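{- Let $\mathbb K$ be a commutative ring and $B$ a finite set with an involution $b\mapsto b^*$. The $\mathbb K$-linear map $\Theta_B:\mathscr Q(B)\to\Lambda(B)$ defined by $\Theta_B(t_{\mathbf T})=\mathbf s_{\mathrm{sh}(\mathbf T)}$ for every standard $B$-tableau $\mathbf T$ is a surjective morphism of graded bialgebras with kernel $\mathscr Q(B)\cap\mathscr Q(B)^\circ$, and it satisfies $\varpi_{\mathrm{tot}}(x,y)=\langle\Theta_B(x),\Theta_B(y)\rangle$ for all $x,y\in\mathscr Q(B)$. The restriction of $\Theta_B$ to $\mathscr D(B)$ is the unique algebra homomorphism $\mathscr D(B)\to\Lambda(B)$ mapping $y_{n,b}$ to $h_n(b)$ for all $n\geq1$, $b\in B$; this restriction is surjective, with kernel $\mathscr D(B)\cap\mathscr D(B)^\circ$.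
   Context: $B\wr\mathfrak S_n=B^n\times\mathfrak S_n$ with elements $(b_1,\dots,b_n;\sigma)$, $\pi\cdot(b_1,\dots,b_n;\sigma)=(b_{\pi^{ -1}(1)},\dots,b_{\pi^{ -1}(n)};\pi\sigma)$, forms a basis of $\mathscr F_n(\mathbb KB)=(\mathbb KB)^{\otimes n}\otimes\mathbb K\mathfrak S_n$. $\mathscr F(\mathbb KB)=\bigoplus_n\mathscr F_n(\mathbb KB)$ is a graded bialgebra with product $(b_1,\dots,b_n;\sigma)*(b'_1,\dots,b'_{n'};\sigma')=x_{(n,n')}\cdot(b_1,\dots,b'_{n'};\sigma\times\sigma')$ ($x_{(n,n')}$ the sum of permutations of $\mathfrak S_{n+n'}$ increasing on $[1,n]$ and on $[n+1,n+n']$, $\sigma\times\sigma'$ juxtaposition) and coproduct $\Delta(b_1,\dots,b_n;\sigma)=\sum_{n'}(b_1,\dots,b_{n'};\pi_{n'})\otimes(b_{n'+1},\dots,b_n;\pi'_{n-n'})$ ($\pi_{n'},\pi'_{n-n'}$ the inverses of the standardizations of $\sigma^{ -1}(1)\cdots\sigma^{ -1}(n')$ and $\sigma^{ -1}(n'+1)\cdots\sigma^{ -1}(n)$). $y_{n,b}=(b,\dots,b;e_n)$ and $\mathscr D(B)$ is the subalgebra generated by the $y_{n,b}$. $\alpha^*=\sigma^{ -1}\cdot(b_1^*,\dots,b_n^*;e_n)$ for $\alpha=(b_1,\dots,b_n;\sigma)$; $\varpi_{\mathrm{tot}}(\alpha,\beta)=1$ if $\beta=\alpha^*$, $0$ otherwise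 (basis elements); $S^\circ=\{x\mid\varpi_{\mathrm{tot}}(x,S)=0\}$. Standard $B$-tableaux, $\mathbf Q(\alpha)$, $t_{\mathbf T}$, $\mathscr Q(B)$: a $B$-tableau is a family $(T_b)_{b\in B}$ of tableaux, standard if its entries are $1,\dots,N$ each once ($N$ its number of boxes); writing $\alpha=\sigma\cdot(b_1,\dots,b_n;e_n)$, for each $b$ let $j_1<\dots<j_r$ be the $j$ with $b_j=b$, RS-insert $\sigma(j_1)\cdots\sigma(j_r)$ and let $Q_b$ record, in the box created at step $s$, the label $j_s$; $\mathbf Q(\alpha)=(Q_b)_b$; $t_{\mathbf T}=\sum_{\mathbf Q(\alpha)=\mathbf T}\alpha$; $\mathscr Q(B)=\mathrm{span}\{t_{\mathbf T}\}$ (a subbialgebra containing $\mathscr D(B)$). $\Lambda$ is the bialgebra of symmetric functions over $\mathbb K$ with complete functions $h_n$ ($\Delta h_n=\sum_{n'}h_{n'}\otimes h_{n-n'}$) and Schur functions $s_\lambda$. $\Lambda(B)=\bigotimes_{b\in B}\Lambda(b)$, $\Lambda(b)$ a copy of $\Lambda$ with $P\mapsto P(b)$; a $B$-partition is a family $\boldsymbol\lambda=(\lambda_b)_{b\in B}$ of partitions, $\boldsymbol\lambda^*=(\lambda_{b^*})_b$, $\mathbf s_{\boldsymbol\lambda}=\prod_bs_{\lambda_b}(b)$; the pairing on $\Lambda(B)$ is $\langle\mathbf s_{\boldsymbol\lambda},\mathbf s_{\boldsymbol\lambda'}\rangle=1$ if $\boldsymbol\lambda'=\boldsymbol\lambda^*$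 and $0$ otherwise. The shape of a standard $B$-tableau is the $B$-partition of the shapes of its tableaux. -}

module Defs where

open import Level using (_⊔_)
open import Algebra.Bundles using (CommutativeRing)
open import Data.Nat as ℕ using (ℕ; zero; suc; _∸_; _<ᵇ_; _≡ᵇ_; _<_; _≥_; _≤_)
open import Data.Bool using (Bool; true; false; if_then_else_; _∧_)
open import Data.Maybe as M using (Maybe; just; nothing)
open import Data.List as L using (List; []; _∷_; _++_; map; concatMap; foldr; foldl; length; replicate; upTo; take; drop; reverse; concat; mapMaybe; allFin)
open import Data.Nat.ListAction using (sum)
open import Data.List.Relation.Unary.All using (All)
open import Data.List.Relation.Unary.Linked using (Linked)
open import Data.List.Relation.Binary.Permutation.Propositional using (_↭_)
open import Data.Vec as V using (Vec)
open import Data.Fin using (Fin)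
import Data.Fin.Properties as FinP
import Data.Nat.Properties as ℕP
import Data.List.Properties as LP
import Data.Vec.Properties as VP
open import Data.Product using (_×_; _,_; proj₁; proj₂; ∃; ∃₂)
open import Relation.Binary.PropositionalEquality using (_≡_)
open import Relation.Binary.Definitions using (DecidableEquality)
open import Relation.Nullary using (yes; no; does)
open import Relation.Nullary.Decidable using (_×-dec_; map′)

-- Generic list combinatorics (permutations in one-line notation,
-- values 0 .. n-1; positions are 0-based)

pairDec : ∀ {a b} {A : Set a} {B : Set b} → DecidableEquality A → DecidableEquality B → DecidableEquality (A × B)
pairDec dA dB (a , b) (a' , b') = map′ (λ { (_≡_.refl , _≡_.refl) → _≡_.refl }) (λ { _≡_.refl → _≡_.refl , _≡_.refl }) (dA a a' ×-dec dB b b')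

at : List ℕ → ℕ → ℕ
at [] _ = 0
at (x ∷ xs) zero = x
at (x ∷ xs) (suc i) = at xs i

lookupM : ∀ {a} {A : Set a} → List A → ℕ → Maybe A
lookupM [] _ = nothing
lookupM (x ∷ xs) zero = just x
lookupM (x ∷ xs) (suc i) = lookupM xs i

pos : ℕ → List ℕ → ℕ
pos v [] = 0
pos v (x ∷ xs) = if x ≡ᵇ v then 0 else suc (pos v xs)

invPerm : List ℕ → List ℕ
invPerm σ = map (λ i → pos i σ) (upTo (length σ))

countLess : ℕ → List ℕ → ℕ
countLess x [] = 0
countLess x (y ∷ ys) = if y <ᵇ x then suc (countLess x ys) else countLess x ys

-- standardization of a word of distinct naturals
std : List ℕ → List ℕ
std w = map (λ x → countLess x w) w

insertAll : ℕ → List ℕ → List (List ℕ)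
insertAll x [] = (x ∷ []) ∷ []
insertAll x (y ∷ ys) = (x ∷ y ∷ ys) ∷ map (y ∷_) (insertAll x ys)

perms : List ℕ → List (List ℕ)
perms [] = [] ∷ []
perms (x ∷ xs) = concatMap (insertAll x) (perms xs)

-- shuffle patterns: false = slot of the first factor, true = of the second
shuffles : ℕ → ℕ → List (List Bool)
shuffles zero n' = replicate n' true ∷ []
shuffles (suc n) zero = replicate (suc n) false ∷ []
shuffles (suc n) (suc n') = map (false ∷_) (shuffles n (suc n')) ++ map (true ∷_) (shuffles (suc n) n')

indicesOf : Bool → List Bool → List ℕ
indicesOf c s = go 0 s
  where
  go : ℕ → List Bool → List ℕ
  go k [] = []
  go k (true ∷ s) = if c then k ∷ go (suc k) s else go (suc k) s
  go k (false ∷ s) = if c then go (suc k) s else k ∷ go (suc k) s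

shufflePerm : List Bool → List ℕ
shufflePerm s = indicesOf false s ++ indicesOf true s

merge : ∀ {a} {A : Set a} → List A → List A → List Bool → List A
merge xs ys [] = []
merge (x ∷ xs) ys (false ∷ s) = x ∷ merge xs ys s
merge [] ys (false ∷ s) = merge [] ys s
merge xs (y ∷ ys) (true ∷ s) = y ∷ merge xs ys s
merge xs [] (true ∷ s) = merge xs [] s

allZero : List ℕ → Bool
allZero = L.foldr (λ x r → (x ≡ᵇ 0) ∧ r) true

-- Robinson–Schensted insertion (rows listed top to bottom)

Tableau : Set
Tableau = List (List ℕ)

rowIns : ℕ → List ℕ → List ℕ × Maybe ℕ
rowIns x [] = (x ∷ [] , nothing)
rowIns x (y ∷ ys) with x <ᵇ y
... | true = (x ∷ ys , just y)
... | false with rowIns x ys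
...   | (r , mb) = (y ∷ r , mb)

tabIns : ℕ → Tableau → Tableau × ℕ
tabIns x [] = ((x ∷ []) ∷ [] , 0)
tabIns x (r ∷ rs) with rowIns x r
... | (r' , nothing) = (r' ∷ rs , 0)
... | (r' , just y) with tabIns y rs
...   | (rs' , i) = (r' ∷ rs' , suc i)

addAt : ℕ → ℕ → Tableau → Tableau
addAt v zero [] = (v ∷ []) ∷ []
addAt v zero (r ∷ rs) = (r ++ v ∷ []) ∷ rs
addAt v (suc i) [] = (v ∷ []) ∷ []
addAt v (suc i) (r ∷ rs) = r ∷ addAt v i rs

rsStep : Tableau × Tableau → ℕ × ℕ → Tableau × Tableau
rsStep (P , Q) (x , j) with tabIns x P
... | (P' , i) = (P' , addAt j i Q)

rsQ : List (ℕ × ℕ) → Tableau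
rsQ ps = proj₂ (foldl rsStep ([] , []) ps)

-- standard Young tableau (entries arbitrary distinct naturals)
ColLess : List ℕ → List ℕ → Set
ColLess r r' = ∀ i → i < length r' → at r i < at r' i

IsTab : Tableau → Set
IsTab t = All (λ r → 1 ≤ length r) t × All (Linked _<_) t
        × Linked _≥_ (map length t) × Linked ColLess t

-- Kostka numbers: number of SSYT of shape λ and content a
-- (a = (a_1,...,a_r), a_i = number of entries equal to i)

head0 : List ℕ → ℕ
head0 [] = 0
head0 (x ∷ _) = x

-- all μ with λ/μ a horizontal strip, together with its size
stripsL : List ℕ → List (List ℕ × ℕ)
stripsL [] = ([] , 0) ∷ []
stripsL (l ∷ rest) =
  concatMap (λ p → map (λ j → ((l ∸ j) ∷ proj₁ p , proj₂ p ℕ.+ j)) (upTo (suc (l ∸ head0 rest))))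
            (stripsL rest)

strips : List ℕ → ℕ → List (List ℕ)
strips λ' k = mapMaybe (λ p → if proj₂ p ≡ᵇ k then just (proj₁ p) else nothing) (stripsL λ')

-- content given from the largest value down
kostkaRev : List ℕ → List ℕ → ℕ
kostkaRev λ' [] = if allZero λ' then 1 else 0
kostkaRev λ' (k ∷ ks) = sum (map (λ μ → kostkaRev μ ks) (strips λ' k))

kostka : List ℕ → List ℕ → ℕ
kostka λ' a = kostkaRev λ' (reverse a)

IsPartition : List ℕ → Set
IsPartition l = Linked _≥_ l × All (1 ≤_) l

PadPerm : List ℕ → List ℕ → Set
PadPerm e e' = ∃₂ λ k k' → (e ++ replicate k 0) ↭ (e' ++ replicate k' 0)

splitsL : List ℕ → List (List ℕ × List ℕ)
splitsL [] = ([] , []) ∷ []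
splitsL (x ∷ xs) = concatMap (λ i → map (λ p → (i ∷ proj₁ p , (x ∸ i) ∷ proj₂ p)) (splitsL xs)) (upTo (suc x))

splitsV : ∀ {n} → Vec (List ℕ) n → List (Vec (List ℕ) n × Vec (List ℕ) n)
splitsV V.[] = (V.[] , V.[]) ∷ []
splitsV (e V.∷ es) = concatMap (λ p → map (λ q → (proj₁ p V.∷ proj₁ q , proj₂ p V.∷ proj₂ q)) (splitsV es)) (splitsL e)

-- The setting: a commutative ring 𝕂, B = Fin m, an involution inv = (_)*

module Setup {c ℓ} (𝕂 : CommutativeRing c ℓ) (m : ℕ) (inv : Fin m → Fin m) where
  open CommutativeRing 𝕂

  sumK : List Carrier → Carrier
  sumK = foldr _+_ 0#

  prodK : List Carrier → Carrier
  prodK = foldr _*_ 1#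

  natK : ℕ → Carrier
  natK zero = 0#
  natK (suc n) = 1# + natK n

  -- 𝓕(𝕂B): basis elements (b_1..b_n ; σ) with σ in one-line notation
  -- (values 0..n-1); elements are finite formal 𝕂-combinations.

  Word : Set
  Word = List (Fin m) × List ℕ

  word≟ : DecidableEquality Word
  word≟ = pairDec (LP.≡-dec FinP._≟_) (LP.≡-dec ℕP._≟_)

  F : Set c
  F = List (Carrier × Word)

  F2 : Set c
  F2 = List (Carrier × Word × Word)

  coefF : F → Word → Carrier
  coefF x w = sumK (map (λ p → if does (word≟ (proj₂ p) w) then proj₁ p else 0#) x)

  coefF2 : F2 → Word × Word → Carrier
  coefF2 x w = sumK (map (λ p → if does (pairDec word≟ word≟ (proj₂ p) w) then proj₁ p else 0#) x)

  _≈F_ : F → F → Set ℓ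
  x ≈F y = ∀ w → coefF x w ≈ coefF y w

  _≈F2_ : F2 → F2 → Set ℓ
  x ≈F2 y = ∀ w → coefF2 x w ≈ coefF2 y w

  _•F_ : Carrier → F → F
  k •F x = map (λ p → (k * proj₁ p , proj₂ p)) x

  oneF : F
  oneF = (1# , ([] , [])) ∷ []

  εF : F → Carrier
  εF x = coefF x ([] , [])

  -- product of basis elements: x_{(n,n')} · (b,b' ; σ × σ')
  mulW : Word → Word → F
  mulW (b , σ) (b' , σ') =
    map (λ s → (1# , (merge b b' s , map (at (shufflePerm s)) (σ ++ map (length b ℕ.+_) σ'))))
        (shuffles (length b) (length b'))

  _*F_ : F → F → F
  x *F y = concatMap (λ p → concatMap (λ q → (proj₁ p * proj₁ q) •F mulW (proj₂ p) (proj₂ q)) y) x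

  ΔW : Word → List (Word × Word)
  ΔW (b , σ) = map (λ n' → ((take n' b , invPerm (std (take n' σi))) , (drop n' b , invPerm (std (drop n' σi)))))
                   (upTo (suc (length b)))
    where σi = invPerm σ

  ΔF : F → F2
  ΔF x = concatMap (λ p → map (λ q → (proj₁ p , q)) (ΔW (proj₂ p))) x

  -- α* = σ⁻¹ · (b_1*,…,b_n* ; e_n)
  starW : Word → Word
  starW (b , σ) = (mapMaybe (λ i → M.map inv (lookupM b i)) σ , invPerm σ)

  ϖ : F → F → Carrier
  ϖ x y = sumK (concatMap (λ p → map (λ q → if does (word≟ (proj₂ q) (starW (proj₂ p))) then proj₁ p * proj₁ q else 0#) y) x)

  BTab : Set
  BTab = Vec Tableau m

  btab≟ : DecidableEquality BTab
  btab≟ = VP.≡-dec (LP.≡-dec (LP.≡-dec ℕP._≟_))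

  entries : BTab → List ℕ
  entries T = concat (concat (V.toList T))

  boxes : BTab → ℕ
  boxes T = length (entries T)

  IsStdBT : BTab → Set
  IsStdBT T = (entries T ↭ upTo (boxes T)) × All IsTab (V.toList T)

  BPart : Set
  BPart = Vec (List ℕ) m

  shape : BTab → BPart
  shape T = V.map (map length) T

  -- colour b_j of α = σ·(b_1..b_n;e_n) = (b∘σ⁻¹ ; σ) is c_{σ(j)}
  Qb : Word → Fin m → Tableau
  Qb (c , σ) b = rsQ (mapMaybe sel (upTo (length σ)))
    where
    sel : ℕ → Maybe (ℕ × ℕ)
    sel j with lookupM c (at σ j)
    ... | nothing = nothing
    ... | just b' = if does (b' FinP.≟ b) then just (at σ j , j) else nothing

  Q : Word → BTab
  Q α = V.tabulate (Qb α)

  allWords : ℕ → List (List (Fin m))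
  allWords zero = [] ∷ []
  allWords (suc n) = concatMap (λ b → map (b ∷_) (allWords n)) (allFin m)

  allBasis : ℕ → List Word
  allBasis n = concatMap (λ c' → map (λ σ → (c' , σ)) (perms (upTo n))) (allWords n)

  tT : BTab → F
  tT T = mapMaybe (λ α → if does (btab≟ (Q α) T) then just (1# , α) else nothing) (allBasis (boxes T))

  -- elements of 𝒬(B): formal combinations of standard B-tableaux
  QRep : Set c
  QRep = List (Carrier × BTab)

  Std : QRep → Set c
  Std u = All (λ p → IsStdBT (proj₂ p)) u

  QRep2 : Set c
  QRep2 = List (Carrier × BTab × BTab)

  Std2 : QRep2 → Set c
  Std2 r = All (λ p → IsStdBT (proj₁ (proj₂ p)) × IsStdBT (proj₂ (proj₂ p))) r

  ι : QRep → F
  ι u = concatMap (λ p → proj₁ p •F tT (proj₂ p)) u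

  ι2 : QRep2 → F2
  ι2 r = concatMap (λ p → concatMap (λ α → map (λ β → (proj₁ p , proj₂ α , proj₂ β)) (tT (proj₂ (proj₂ p)))) (tT (proj₁ (proj₂ p)))) r

  -- Λ(B) = ⊗_b Λ(b): bounded-degree formal power series in variables
  -- x_{b,i} (b ∈ B, i ≥ 1), symmetric in each block; an element is given
  -- by its coefficient function on B-monomials (exponent lists per b).

  BMon : Set
  BMon = Vec (List ℕ) m

  totdeg : BMon → ℕ
  totdeg a = sum (map sum (V.toList a))

  ΛB : Set c
  ΛB = BMon → Carrier

  ΛB2 : Set c
  ΛB2 = BMon × BMon → Carrier

  _≈Λ_ : ΛB → ΛB → Set ℓ
  f ≈Λ g = ∀ a → f a ≈ g a

  _≈Λ2_ : ΛB2 → ΛB2 → Set ℓ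
  f ≈Λ2 g = ∀ a → f a ≈ g a

  IsΛB : ΛB → Set ℓ
  IsΛB f = (∀ a a' → (∀ b → PadPerm (V.lookup a b) (V.lookup a' b)) → f a ≈ f a')
         × ∃ λ (D : ℕ) → ∀ a → D < totdeg a → f a ≈ 0#

  isConst : BMon → Bool
  isConst a = V.foldr (λ _ → Bool) (λ e r → allZero e ∧ r) true a

  0Λ : ΛB
  0Λ a = 0#

  1Λ : ΛB
  1Λ a = if isConst a then 1# else 0#

  _+Λ_ : ΛB → ΛB → ΛB
  (f +Λ g) a = f a + g a

  _•Λ_ : Carrier → ΛB → ΛB
  (k •Λ f) a = k * f a

  _·Λ_ : ΛB → ΛB → ΛB
  (f ·Λ g) a = sumK (map (λ p → f (proj₁ p) * g (proj₂ p)) (splitsV a))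

  -- Δ f = f(x, y) (the y-variables placed after the x-variables)
  ΔΛ : ΛB → ΛB2
  ΔΛ f (a , a') = f (V.zipWith _++_ a a')

  εΛ : ΛB → Carrier
  εΛ f = f (V.replicate m [])

  -- 𝐬_𝛌 = ∏_b s_{λ_b}(b), s_λ = Σ_T x^T over SSYT T of shape λ
  schurB : BPart → ΛB
  schurB λ' a = prodK (V.toList (V.zipWith (λ l e → natK (kostka l e)) λ' a))

  hΛ : ℕ → Fin m → ΛB
  hΛ n b a = if does (sum (V.lookup a b) ℕP.≟ n) ∧ isConst (a V.[ b ]≔ []) then 1# else 0#

  SRep : Set c
  SRep = List (Carrier × BPart)

  AllPart : SRep → Set c
  AllPart p = All (λ q → V.foldr (λ _ → Set) (λ l r → IsPartition l × r) (Data.Unit.⊤) (proj₂ q)) p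
    where import Data.Unit

  evalS : SRep → ΛB
  evalS p a = sumK (map (λ q → proj₁ q * schurB (proj₂ q) a) p)

  starP : BPart → BPart
  starP λ' = V.tabulate (λ b → V.lookup λ' (inv b))

  bpart≟ : DecidableEquality BPart
  bpart≟ = VP.≡-dec (LP.≡-dec ℕP._≟_)

  pairS : SRep → SRep → Carrier
  pairS p q = sumK (concatMap (λ r → map (λ s → if does (bpart≟ (proj₂ s) (starP (proj₂ r))) then proj₁ r * proj₁ s else 0#) q) p)

  Θs : QRep → SRep
  Θs u = map (λ p → (proj₁ p , shape (proj₂ p))) u

  Θ : QRep → ΛB
  Θ u = evalS (Θs u)

  Θ2 : QRep2 → ΛB2
  Θ2 r (a , a') = sumK (map (λ p → proj₁ p * (schurB (shape (proj₁ (proj₂ p))) a * schurB (shape (proj₂ (proj₂ p))) a')) r)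

  -- 𝒟(B): elements are 𝕂-combinations of products of generators;
  -- the generator (n , b) stands for y_{n+1,b}.

  y : ℕ → Fin m → F
  y n b = (1# , (replicate n b , upTo n)) ∷ []

  DRep : Set c
  DRep = List (Carrier × List (ℕ × Fin m))

  evalWord : List (ℕ × Fin m) → F
  evalWord = foldr (λ g acc → y (suc (proj₁ g)) (proj₂ g) *F acc) oneF

  evalD : DRep → F
  evalD p = concatMap (λ q → proj₁ q •F evalWord (proj₂ q)) p

  _•D_ : Carrier → DRep → DRep
  k •D p = map (λ q → (k * proj₁ q , proj₂ q)) p

  _·D_ : DRep → DRep → DRep
  p ·D q = concatMap (λ r → map (λ s → (proj₁ r * proj₁ s , proj₂ r ++ proj₂ s)) q) p

  gen : ℕ → Fin m → DRep
  gen n b = (1# , (n , b) ∷ []) ∷ []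

  IsAlgHomD : (DRep → ΛB) → Set (c ⊔ ℓ)
  IsAlgHomD ψ = (∀ p q → evalD p ≈F evalD q → ψ p ≈Λ ψ q)
              × (∀ p q → ψ (p ++ q) ≈Λ (ψ p +Λ ψ q))
              × (∀ k p → ψ (k •D p) ≈Λ (k •Λ ψ p))
              × (∀ p q → ψ (p ·D q) ≈Λ (ψ p ·Λ ψ q))
              × (ψ ((1# , []) ∷ []) ≈Λ 1Λ)
              × (∀ n b → ψ (gen n b) ≈Λ hΛ (suc n) b)

  hWord : List (ℕ × Fin m) → ΛB
  hWord = foldr (λ g acc → hΛ (suc (proj₁ g)) (proj₂ g) ·Λ acc) 1Λ

  φ : DRep → ΛB
  φ p a = sumK (map (λ q → proj₁ q * hWord (proj₂ q) a) p)

-- A standard B-tableau is encoded by the sequence of boxes it grows by, a lattice path. Insertion obeys a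
-- local growth rule that is self-dual, so Q(α) is the insertion tableau of the inverse biword, and words
-- correspond to pairs of paths of the same shape. By the row bumping lemma, whether the inverse biword of α
-- is a concatenation of increasing monochromatic blocks of given type depends only on Q(α): the new boxes
-- of a block form a horizontal strip. Hence the number of such α in x ∈ 𝒬(B), counted with coefficients,
-- which is the pairing of x with a product of the y_{n,b}, is given on t_T by the number of chains of
-- horizontal strips in sh(T), a product of Kostka numbers, that is, by a coefficient of s_{sh(T)}. So Θ_B is
-- this pairing, for which multiplicativity (a block of a shuffle is split between the factors) and
-- comultiplicativity (cut the word) are seen directly. For the same reason the coefficients of a product of
-- generators depend on Q(α) only, so 𝒟(B) ⊆ 𝒬(B). The Kostka matrix is unitriangular for n(λ) = Σ i λ_i;
-- this makes the Schur functions independent, puts them in the span of the products of the h_n(b), and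
-- gives surjectivity. The kernels follow from ϖ_tot(t_T, t_T') = [sh(T') = sh(T)*].

module Submission where

open import Defs
open import Level using (Level; Lift; lift; _⊔_)
open import Algebra.Bundles using (CommutativeRing)
import Algebra.Properties.CommutativeSemigroup as CSProps
open import Data.Bool as Bool using (Bool; true; false; if_then_else_; T; _∧_)
open import Data.Bool.Properties using (∧-assoc; ∧-zeroʳ)
open import Data.Empty using (⊥; ⊥-elim)
open import Data.Fin as F using (Fin)
open import Data.Fin.Properties using () renaming (_≟_ to _≟ᶠ_; suc-injective to Fsuc-injective)
open import Data.List using (List; []; _∷_; _++_; _∷ʳ_; _∷ʳ′_; allFin; applyUpTo; concat; concatMap; deduplicate; downFrom; drop; filter; foldl; foldr; initLast; length; map; mapMaybe; replicate; reverse; take; upTo; zip)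
open import Data.List.Membership.Propositional using (_∈_; _∉_)
import Data.List.Membership.DecPropositional as DecMem
open import Data.List.Membership.Propositional.Properties using (∈-++⁺ʳ; ∈-++⁺ˡ; ∈-++⁻; ∈-allFin; ∈-deduplicate⁺; ∈-deduplicate⁻; ∈-downFrom⁻; ∈-filter⁺; ∈-filter⁻; ∈-map⁺; ∈-map⁻; ∈-upTo⁺; ∈-upTo⁻; ∈-∃++)
open import Data.List.Membership.Propositional.Properties.WithK using (unique∧set⇒bag)
open import Data.List.Properties using (++-assoc; ++-cancelˡ; ++-identityʳ; concat-++; filter-++; filter-accept; filter-all; filter-none; filter-reject; foldl-++; length-++; length-downFrom; length-map; length-replicate; length-reverse; length-take; length-upTo; length-zipWith; map-++; map-cong; map-id; map-upTo; map-cong-local; map-∘; mapMaybe-++; reverse-++; reverse-injective; reverse-involutive; reverse-map; reverse-upTo; unfold-reverse; ∷-injective; ∷-injectiveʳ; ∷-injectiveˡ; ∷ʳ-injectiveˡ; ≡-dec)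
open import Data.List.Relation.Binary.BagAndSetEquality using (∼bag⇒↭)
open import Data.List.Relation.Binary.Permutation.Propositional using (_↭_; refl; prep; swap; ↭-refl; ↭-reflexive; ↭-sym; ↭-trans) renaming (trans to ↭-tr)
open import Data.List.Relation.Binary.Permutation.Propositional.Properties as Perm using (++⁺ʳ; All-resp-↭; drop-mid; drop-∷; filter-↭; mapMaybe-↭; shift; ↭-length; ↭-reverse; ∈-resp-↭)
open import Data.List.Relation.Unary.All as All using (All; []; _∷_)
import Data.List.Relation.Unary.All.Properties as AllP
open import Data.List.Relation.Unary.AllPairs using (AllPairs; []; _∷_)
import Data.List.Relation.Unary.AllPairs.Properties as APP
open import Data.List.Relation.Unary.Any using (here; there)
open import Data.List.Relation.Unary.Linked as Linked using (Linked; []; [-]; _∷_)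
open import Data.List.Relation.Unary.Linked.Properties using (AllPairs⇒Linked; Linked⇒AllPairs)
open import Data.List.Relation.Unary.Unique.Propositional using (Unique)
import Data.List.Relation.Unary.Unique.Propositional.Properties as Uniq
import Data.List.Relation.Unary.Unique.DecPropositional.Properties as UniqD
open import Data.Maybe as Maybe using (Maybe; just; nothing; _>>=_)
open import Data.Maybe.Properties using (just-injective)
open import Data.Nat as ℕ using (ℕ; zero; suc; _≤_; _<_; _≥_; z≤n; s≤s; _∸_; _≤ᵇ_; _<ᵇ_; _≡ᵇ_; _<?_; _≤?_)
import Data.Nat.Properties as ℕP
open import Data.Nat.ListAction using (sum)
open import Data.Nat.ListAction.Properties using (sum-++; sum-↭)
open import Data.Product using (_×_; _,_; proj₁; proj₂; ∃; ∃₂; map₁; map₂)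
open import Data.Sum using (inj₁; inj₂)
open import Data.Unit using (⊤; tt)
open import Data.Vec as V using (Vec; lookup; _[_]≔_)
import Data.Vec.Properties as VP
open import Function using (_∘_; id; case_of_; flip; mk⇔)
open import Relation.Nullary
open import Relation.Nullary.Decidable using (dec-true; dec-false; does-⇔)
open import Relation.Binary.Definitions using (DecidableEquality; Tri; tri<; tri≈; tri>)
import Relation.Binary.Reasoning.Setoid as SetoidReasoning
open import Relation.Binary.PropositionalEquality using (_≡_; _≢_; refl; sym; trans; cong; cong₂; subst; subst₂; module ≡-Reasoning)

-- Row insertion treats its two outputs differently, whereas the duality exchanges them. Both are
-- therefore kept in one format, labelled boxes by decreasing label, and insertion recurses on the
-- largest entry instead of on the rows: inversion exchanges removal of the largest value with
-- removal of the last letter. All colours share one list, because positions and values are ordered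
-- across colours; boxes of different colours do not interact. Every word has two readings, by value
-- and by position. Block decompositions of the value reading are the functionals that compute Θ,
-- those of the position reading are the coefficients of products of generators. An element of Λ(B)
-- is its family of coefficients, so identities in Λ(B) become identities between functionals, one
-- for each exponent vector. These functionals live on all combinations of words; hence a product or
-- a coproduct is evaluated without being expanded in the `tT`. The pairing on Λ(B) refers to Schur
-- expansions, so it makes sense only with their independence; over an arbitrary 𝕂 this rests on
-- diagonal entries equal to 1 and involves no division.

at-++ˡ : ∀ r s i → i < length r → at (r ++ s) i ≡ at r i
at-++ˡ (x ∷ r) s zero _ = refl
at-++ˡ (x ∷ r) s (suc i) (s≤s lt) = at-++ˡ r s i lt

at-++ʳ : ∀ r s i → at (r ++ s) (length r ℕ.+ i) ≡ at s i
at-++ʳ [] s i = refl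
at-++ʳ (x ∷ r) s i = at-++ʳ r s i

at-last : ∀ r v → at (r ∷ʳ v) (length r) ≡ v
at-last r v = trans (cong (at (r ∷ʳ v)) (sym (ℕP.+-identityʳ _))) (at-++ʳ r (v ∷ []) 0)

at-∈ : ∀ r i → i < length r → at r i ∈ r
at-∈ (x ∷ r) zero _ = here refl
at-∈ (x ∷ r) (suc i) (s≤s lt) = there (at-∈ r i lt)

length-∷ʳ : ∀ {a} {A : Set a} (r : List A) v → length (r ∷ʳ v) ≡ suc (length r)
length-∷ʳ r v = trans (length-++ r) (ℕP.+-comm _ 1)

++-inj : ∀ {a} {A : Set a} (P P' : List A) {Z Z'} → length P ≡ length P' → P ++ Z ≡ P' ++ Z' → P ≡ P' × Z ≡ Z'
++-inj [] [] _ e = refl , e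
++-inj (x ∷ P) (x' ∷ P') el e with ++-inj P P' (ℕP.suc-injective el) (∷-injectiveʳ e)
... | (refl , eZ) = cong (_∷ P) (∷-injectiveˡ e) , eZ

map-cong-∈ : ∀ {a b} {A : Set a} {B : Set b} {f g : A → B} xs → (∀ {x} → x ∈ xs → f x ≡ g x) → map f xs ≡ map g xs
map-cong-∈ xs h = map-cong-local (All.tabulate h)

map-unique : ∀ {a b} {A : Set a} {B : Set b} (f : A → B) {xs} → Unique xs → (∀ {x y} → x ∈ xs → y ∈ xs → f x ≡ f y → x ≡ y) → Unique (map f xs)
map-unique f [] _ = []
map-unique f {x ∷ xs} (a ∷ u) inj =
  AllP.map⁺ (All.tabulate λ i e → All.lookup a i (inj (here refl) (there i) e)) ∷ map-unique f u (λ i j → inj (there i) (there j))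

∈-perm : ∀ {a} {A : Set a} {d : A} {p} → d ∈ p → ∃ λ q → p ↭ d ∷ q
∈-perm i with ∈-∃++ i
... | (ys , zs , refl) = ys ++ zs , shift _ ys zs

-- Insertion by growth rules: inverse, row bumping, symmetry.

module GrowthInsertion (m : ℕ) where
  open import Data.Nat
  open import Data.Nat.Properties

  Letter Cell : Set
  Letter = Fin m × ℕ
  Cell = Fin m × ℕ

  -- A family of tableaux is encoded by its boxes (entry , (b , i)), i the row in T_b, by decreasing entry;
  -- the columns are implied.
  Enc : Set
  Enc = List (ℕ × Cell)

  infix 4 _≟c_
  _≟c_ : DecidableEquality Cell
  (b , i) ≟c (b' , i') with b ≟ᶠ b' | i ≟ i'
  ... | yes refl | yes refl = yes refl
  ... | no ne | _ = no (ne ∘ cong proj₁)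
  ... | yes _ | no ne = no (ne ∘ cong proj₂)

  up : Cell → Cell
  up (b , i) = b , suc i

  -- If the insertion into the entries below t creates the box of t, then t is bumped into the next row.
  push : ℕ → Cell → Enc × Cell → Enc × Cell
  push t c (E , d) with c ≟c d
  ... | yes _ = (t , up c) ∷ E , up c
  ... | no _ = (t , c) ∷ E , d

  -- Fomin's local rule, applied from the smallest entries up. The second component is the box by
  -- which the shape grows. It always has colour `b`, so entries of the other colours keep their
  -- places.
  ins : Letter → Enc → Enc × Cell
  ins (b , x) [] = (x , b , 0) ∷ [] , (b , 0)
  ins (b , x) ((t , c) ∷ E) with t <? x
  ... | yes _ = (x , b , 0) ∷ (t , c) ∷ E , (b , 0)
  ... | no _ = push t c (ins (b , x) E)

  push-≡ : ∀ t {c d} E → c ≡ d → push t c (E , d) ≡ ((t , up c) ∷ E , up c)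
  push-≡ t {c} {d} E e with c ≟c d
  ... | yes _ = refl
  ... | no ne = ⊥-elim (ne e)

  push-≢ : ∀ t {c d} E → c ≢ d → push t c (E , d) ≡ ((t , c) ∷ E , d)
  push-≢ t {c} {d} E e with c ≟c d
  ... | yes q = ⊥-elim (e q)
  ... | no ne = refl

  ins-top : ∀ {b x t} c E → t < x → ins (b , x) ((t , c) ∷ E) ≡ ((x , b , 0) ∷ (t , c) ∷ E , (b , 0))
  ins-top {b} {x} {t} c E lt with t <? x
  ... | yes _ = refl
  ... | no nlt = ⊥-elim (nlt lt)

  ins-push : ∀ {b x t} c E → ¬ t < x → ins (b , x) ((t , c) ∷ E) ≡ push t c (ins (b , x) E)
  ins-push {b} {x} {t} c E nlt with t <? x
  ... | yes lt = ⊥-elim (nlt lt)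
  ... | no _ = refl

  ins-max : ∀ {b x} E → All ((_< x) ∘ proj₁) E → ins (b , x) E ≡ ((x , b , 0) ∷ E , (b , 0))
  ins-max [] _ = refl
  ins-max ((t , c) ∷ E) (lt ∷ _) = ins-top c E lt

  labels : Enc → List ℕ
  labels = map proj₁

  cells : Enc → List Cell
  cells = map proj₂

  ins-colour : ∀ b x E → proj₁ (proj₂ (ins (b , x) E)) ≡ b
  ins-colour b x [] = refl
  ins-colour b x ((t , c) ∷ E) with t <? x
  ... | yes _ = refl
  ... | no _ with c ≟c proj₂ (ins (b , x) E)
  ...   | yes e = trans (cong proj₁ e) (ins-colour b x E)
  ...   | no _ = ins-colour b x E

  ins-labels : ∀ b x E → labels (proj₁ (ins (b , x) E)) ↭ x ∷ labels E
  ins-labels b x [] = ↭-refl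
  ins-labels b x ((t , c) ∷ E) with t <? x
  ... | yes _ = ↭-refl
  ... | no _ with c ≟c proj₂ (ins (b , x) E)
  ...   | yes e = ↭-trans (prep t (ins-labels b x E)) (swap t x ↭-refl)
  ...   | no _ = ↭-trans (prep t (ins-labels b x E)) (swap t x ↭-refl)

  ins-cells : ∀ b x E → cells (proj₁ (ins (b , x) E)) ↭ proj₂ (ins (b , x) E) ∷ cells E
  ins-cells b x [] = ↭-refl
  ins-cells b x ((t , c) ∷ E) with t <? x
  ... | yes _ = ↭-refl
  ... | no _ with c ≟c proj₂ (ins (b , x) E)
  ...   | yes e = prep (up c) (subst (λ z → cells (proj₁ (ins (b , x) E)) ↭ z ∷ cells E) (sym e) (ins-cells b x E))
  ...   | no _ = ↭-trans (prep c (ins-cells b x E)) (swap c _ ↭-refl)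

  DescBy : ∀ {a} {A : Set a} → (A → ℕ) → List A → Set a
  DescBy f [] = Lift _ ⊤
  DescBy f (x ∷ xs) = All (λ y → f y < f x) xs × DescBy f xs

  Desc : Enc → Set
  Desc = DescBy proj₁

  All-labels : ∀ {P : ℕ → Set} {E} → All P (labels E) → All (P ∘ proj₁) E
  All-labels = AllP.map⁻

  ins-desc : ∀ b x E → Desc E → x ∉ labels E → Desc (proj₁ (ins (b , x) E))
  ins-desc b x [] _ _ = [] , lift tt
  ins-desc b x ((t , c) ∷ E) (a , D) nin with t <? x
  ... | yes lt = (lt ∷ All.map (λ q → <-trans q lt) a) , a , D
  ... | no nlt with c ≟c proj₂ (ins (b , x) E)
  ...   | yes e = All-labels (All-resp-↭ (↭-sym (ins-labels b x E)) (≤∧≢⇒< (≮⇒≥ nlt) (nin ∘ here) ∷ AllP.map⁺ a)) , ins-desc b x E D (nin ∘ there)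
  ...   | no _ = All-labels (All-resp-↭ (↭-sym (ins-labels b x E)) (≤∧≢⇒< (≮⇒≥ nlt) (nin ∘ here) ∷ AllP.map⁺ a)) , ins-desc b x E D (nin ∘ there)

  abstract
    δ : Cell → Cell → ℕ
    δ c d = if does (c ≟c d) then 1 else 0

    δ-≡ : ∀ c → δ c c ≡ 1
    δ-≡ c with c ≟c c
    ... | yes _ = refl
    ... | no ne = ⊥-elim (ne refl)

    δ-≢ : ∀ {c d} → c ≢ d → δ c d ≡ 0
    δ-≢ {c} {d} ne with c ≟c d
    ... | yes e = ⊥-elim (ne e)
    ... | no _ = refl

  δ+≡ : ∀ c n → δ c c + n ≡ suc n
  δ+≡ c n = cong (_+ n) (δ-≡ c)

  δ+≢ : ∀ {c d} n → c ≢ d → δ c d + n ≡ n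
  δ+≢ n ne = cong (_+ n) (δ-≢ ne)

  up≢ : ∀ {b : Fin m} {i} → (b , suc i) ≢ (b , i)
  up≢ ()

  ≢up : ∀ {b : Fin m} {i} → (b , i) ≢ (b , suc i)
  ≢up ()

  cnt : List Cell → Cell → ℕ
  cnt [] d = 0
  cnt (c ∷ p) d = δ c d + cnt p d

  cnt-++ : ∀ p q d → cnt (p ++ q) d ≡ cnt p d + cnt q d
  cnt-++ [] q d = refl
  cnt-++ (c ∷ p) q d = trans (cong (δ c d +_) (cnt-++ p q d)) (sym (+-assoc (δ c d) _ _))

  cnt-↭ : ∀ {p q} → p ↭ q → ∀ d → cnt p d ≡ cnt q d
  cnt-↭ refl d = refl
  cnt-↭ (prep x s) d = cong (δ x d +_) (cnt-↭ s d)
  cnt-↭ (swap {ys = ys} x y s) d = trans (cong (λ z → δ x d + (δ y d + z)) (cnt-↭ s d))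
    (trans (sym (+-assoc (δ x d) (δ y d) _)) (trans (cong (_+ cnt ys d) (+-comm (δ x d) (δ y d))) (+-assoc (δ y d) (δ x d) _)))
  cnt-↭ (↭-tr s s') d = trans (cnt-↭ s d) (cnt-↭ s' d)

  cnt-∈ : ∀ p {d} → 0 < cnt p d → d ∈ p
  cnt-∈ (c ∷ p) {d} lt with c ≟c d
  ... | yes e = here (sym e)
  ... | no ne = there (cnt-∈ p (subst (λ z → 0 < z + cnt p d) (δ-≢ ne) lt))

  cnt⇒↭ : ∀ p q → (∀ d → cnt p d ≡ cnt q d) → p ↭ q
  cnt⇒↭ [] [] h = ↭-refl
  cnt⇒↭ [] (c ∷ q) h with subst (λ z → 0 ≡ z + cnt q c) (δ-≡ c) (h c)
  ... | ()
  cnt⇒↭ (c ∷ p) q h with ∈-perm (cnt-∈ q (subst (0 <_) (trans (cong (_+ cnt p c) (sym (δ-≡ c))) (h c)) z<s))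
  ... | (q' , s) = ↭-trans (prep c (cnt⇒↭ p q' (λ d → +-cancelˡ-≡ (δ c d) _ _ (trans (h d) (cnt-↭ s d))))) (↭-sym s)

  Part : List Cell → Set
  Part p = ∀ b i → cnt p (b , suc i) ≤ cnt p (b , i)

  Part-resp : ∀ {p q} → p ↭ q → Part p → Part q
  Part-resp s P b i = subst₂ _≤_ (cnt-↭ s _) (cnt-↭ s _) (P b i)

  -- Every suffix is a shape. With the newest box first, this is a chain in Young's lattice for each
  -- colour, or a Yamanouchi word read from its end.
  Lat : List Cell → Set
  Lat [] = ⊤
  Lat (c ∷ p) = Part (c ∷ p) × Lat p

  Lat⇒Part : ∀ p → Lat p → Part p
  Lat⇒Part [] _ b i = z≤n
  Lat⇒Part (c ∷ p) (P , _) = P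

  Part-0 : ∀ b p → Part p → Part ((b , 0) ∷ p)
  Part-0 b p P b' i = ≤-trans (≤-reflexive (cong (_+ cnt p (b' , suc i)) (δ-≢ {b , 0} {b' , suc i} λ ())))
    (≤-trans (P b' i) (m≤n+m _ (δ (b , 0) (b' , i))))

  -- The local configurations of a growth diagram. Going up, two extensions of `p` by the same box
  -- leave room in the next row (`Part-up`), two by distinct boxes leave room for both
  -- (`Part-both`). `Part-down` and `Part-meet` recover the lower shape from the upper ones, as
  -- deletion requires.
  Part-up : ∀ c p → Part p → Part (c ∷ p) → Part (up c ∷ c ∷ p)
  Part-up c p P Pc b i with c ≟c (b , i)
  ... | yes refl = subst₂ _≤_ (sym (trans (δ+≡ _ _) (cong suc (δ+≢ _ ≢up)))) (sym (trans (δ+≢ _ up≢) (δ+≡ _ _))) (s≤s (P b i))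
  ... | no ne = ≤-trans (≤-reflexive (δ+≢ {up c} {b , suc i} _ (λ { refl → ne refl }))) (≤-trans (Pc b i) (m≤n+m _ (δ (up c) (b , i))))

  Part-both : ∀ {c d} p → c ≢ d → Part (c ∷ p) → Part (d ∷ p) → Part (c ∷ d ∷ p)
  Part-both {c} {d} p ne Pc Pd b i with c ≟c (b , suc i)
  ... | no ne' = ≤-trans (≤-reflexive (δ+≢ _ ne')) (≤-trans (Pd b i) (m≤n+m _ (δ c (b , i))))
  ... | yes refl = subst₂ _≤_ (sym (trans (δ+≡ _ _) (cong suc (δ+≢ _ (ne ∘ sym))))) (sym (δ+≢ _ up≢))
                     (≤-trans (subst₂ _≤_ (δ+≡ _ _) (δ+≢ _ up≢) (Pc b i)) (m≤n+m _ (δ d (b , i))))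

  Part-down : ∀ d p → Part (d ∷ p) → Part (up d ∷ d ∷ p) → Part p
  Part-down d p Pd Pu b i with d ≟c (b , i)
  ... | yes refl = ≤-pred (subst₂ _≤_ (trans (δ+≡ _ _) (cong suc (δ+≢ _ ≢up))) (trans (δ+≢ _ up≢) (δ+≡ _ _)) (Pu b i))
  ... | no ne = ≤-trans (m≤n+m _ (δ d (b , suc i))) (≤-trans (Pd b i) (≤-reflexive (δ+≢ _ ne)))

  Part-meet : ∀ {c d} p → c ≢ d → Part (c ∷ p) → Part (d ∷ p) → Part p
  Part-meet {c} {d} p ne Pc Pd b i with c ≟c (b , i)
  ... | no ne' = ≤-trans (m≤n+m _ (δ c (b , suc i))) (≤-trans (Pc b i) (≤-reflexive (δ+≢ _ ne')))
  ... | yes refl = ≤-trans (m≤n+m _ (δ d (b , suc i))) (≤-trans (Pd b i) (≤-reflexive (δ+≢ {d} _ (ne ∘ sym))))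

  ins-lat : ∀ b x E → Lat (cells E) → Lat (cells (proj₁ (ins (b , x) E)))
  ins-lat b x [] _ = Part-0 b [] (λ _ _ → z≤n) , tt
  ins-lat b x ((t , c) ∷ E) (P , L) with t <? x
  ... | yes _ = Part-0 b (c ∷ cells E) P , P , L
  ... | no _ with c ≟c proj₂ (ins (b , x) E)
  ...   | yes refl = Part-resp (prep _ (↭-sym (ins-cells b x E))) (Part-up _ (cells E) (Lat⇒Part _ L) P) , ins-lat b x E L
  ...   | no ne = Part-resp (prep _ (↭-sym (ins-cells b x E)))
                    (Part-both (cells E) ne P (Part-resp (ins-cells b x E) (Lat⇒Part _ (ins-lat b x E L)))) , ins-lat b x E L

  -- The local rule read backwards: an entry occupying the box to be removed was bumped there from
  -- the row above, unless the box lies in row 0, where the entry is the inserted letter itself.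
  del : Cell → Enc → Maybe (Enc × ℕ)
  delTop : ℕ → Cell → Enc → Maybe (Enc × ℕ)
  del d [] = nothing
  del d ((t , c) ∷ E) with c ≟c d
  ... | yes _ = delTop t d E
  ... | no _ = Maybe.map (map₁ ((t , c) ∷_)) (del d E)
  delTop t (b , zero) E = just (E , t)
  delTop t (b , suc i) E = Maybe.map (map₁ ((t , b , i) ∷_)) (del (b , i) E)

  del-eq0 : ∀ b t E → del (b , 0) ((t , b , 0) ∷ E) ≡ just (E , t)
  del-eq0 b t E with (b , 0) ≟c (b , 0)
  ... | yes _ = refl
  ... | no ne = ⊥-elim (ne refl)

  del-eqs : ∀ c t E → del (up c) ((t , up c) ∷ E) ≡ Maybe.map (map₁ ((t , c) ∷_)) (del c E)
  del-eqs c t E with up c ≟c up c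
  ... | yes _ = refl
  ... | no ne = ⊥-elim (ne refl)

  del-neq : ∀ {c d} t E → c ≢ d → del d ((t , c) ∷ E) ≡ Maybe.map (map₁ ((t , c) ∷_)) (del d E)
  del-neq {c} {d} t E n with c ≟c d
  ... | yes e = ⊥-elim (n e)
  ... | no ne = refl

  del-ins : ∀ b x E → del (proj₂ (ins (b , x) E)) (proj₁ (ins (b , x) E)) ≡ just (E , x)
  del-ins b x [] = del-eq0 b x []
  del-ins b x ((t , c) ∷ E) with t <? x
  ... | yes _ = del-eq0 b x _
  ... | no _ with c ≟c proj₂ (ins (b , x) E)
  ...   | yes refl = trans (del-eqs c t _) (cong (Maybe.map (map₁ ((t , c) ∷_))) (del-ins b x E))
  ...   | no ne = trans (del-neq t _ ne) (cong (Maybe.map (map₁ ((t , c) ∷_))) (del-ins b x E))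

  -- `Part q` says that `d` is a removable corner. This condition passes to the recursive call: by
  -- `Part-down` when the largest entry sits in the row of `d`, by `Part-meet` otherwise.
  unins : ∀ E d q → Desc E → Lat (cells E) → cells E ↭ d ∷ q → Part q →
    ∃₂ λ E₀ x → ins (proj₁ d , x) E₀ ≡ (E , d) × labels E ↭ x ∷ labels E₀ × Desc E₀ × Lat (cells E₀) × cells E₀ ↭ q
  unins [] d q _ _ s _ = ⊥-elim (Perm.¬x∷xs↭[] (↭-sym s))
  unins ((t , c) ∷ E) d q (a , D) (P , L) s Pq with c ≟c d
  unins ((t , c) ∷ E) (b , zero) q (a , D) (P , L) s Pq | yes refl =
    E , t , ins-max E a , ↭-refl , D , L , drop-∷ s
  -- The largest entry came from row `i`, so a box of that row has to be removed next; there is one,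
  -- since row `i` is at least as long as row `suc i`.
  unins ((t , c) ∷ E) (b , suc i) q (a , D) (P , L) s Pq | yes refl
    with ∈-perm (cnt-∈ (cells E) {b , i} (≤-trans (subst (λ z → 0 < z + cnt (cells E) (b , suc i)) (sym (δ-≡ (b , suc i))) z<s)
            (≤-trans (P b i) (≤-reflexive (cong (_+ cnt (cells E) (b , i)) (δ-≢ {b , suc i} {b , i} λ ()))))))
  ... | (q' , s') with unins E (b , i) q' D L s' (Part-down (b , i) q' (Part-resp s' (Lat⇒Part _ L)) (Part-resp (prep _ s') P))
  ...   | (E₀ , x , e , sl , D₀ , L₀ , sc) =
          (t , b , i) ∷ E₀ , x ,
          trans (ins-push (b , i) E₀ (<-asym (All.lookup (AllP.map⁺ a) (∈-resp-↭ (↭-sym sl) (here refl)))))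
            (trans (cong (push t (b , i)) e) (push-≡ t E refl)) ,
          ↭-trans (prep t sl) (swap t x ↭-refl) ,
          (All-labels (All.tail (All-resp-↭ sl (AllP.map⁺ a))) , D₀) ,
          (Part-resp (↭-trans s' (prep _ (↭-sym sc))) (Lat⇒Part _ L) , L₀) ,
          ↭-trans (prep _ sc) (↭-trans (↭-sym s') (drop-∷ s))
  unins ((t , c) ∷ E) d q (a , D) (P , L) s Pq | no ne
    with ∈-perm (d∈ (∈-resp-↭ (↭-sym s) (here refl)))
    where
    d∈ : d ∈ c ∷ cells E → d ∈ cells E
    d∈ (here e) = ⊥-elim (ne (sym e))
    d∈ (there i) = i
  ... | (q' , s') with drop-∷ (↭-trans (swap d c ↭-refl) (↭-trans (prep c (↭-sym s')) s))
  ...   | sq with unins E d q' D L s' (Part-meet q' ne (Part-resp (↭-sym sq) Pq) (Part-resp s' (Lat⇒Part _ L)))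
  ...     | (E₀ , x , e , sl , D₀ , L₀ , sc) =
          (t , c) ∷ E₀ , x ,
          trans (ins-push c E₀ (<-asym (All.lookup (AllP.map⁺ a) (∈-resp-↭ (↭-sym sl) (here refl)))))
            (trans (cong (push t c) e) (push-≢ t E ne)) ,
          ↭-trans (prep t sl) (swap t x ↭-refl) ,
          (All-labels (All.tail (All-resp-↭ sl (AllP.map⁺ a))) , D₀) ,
          (Part-resp (↭-trans (↭-sym sq) (prep c (↭-sym sc))) Pq , L₀) ,
          ↭-trans (prep c sc) sq

  ins-inj : ∀ b x E b' x' E' → ins (b , x) E ≡ ins (b' , x') E' → (b , x) ≡ (b' , x') × E ≡ E'
  ins-inj b x E b' x' E' e =
    cong₂ _,_ (trans (sym (ins-colour b x E)) (trans (cong (proj₁ ∘ proj₂) e) (ins-colour b' x' E'))) (cong proj₂ q) , cong proj₁ q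
    where
    q : (E , x) ≡ (E' , x')
    q = just-injective (trans (sym (del-ins b x E)) (trans (cong (λ z → del (proj₂ z) (proj₁ z)) e) (del-ins b' x' E')))

  -- Words are inserted from their last letter on.
  run : List Letter → Enc × List Cell
  run [] = [] , []
  run (l ∷ R) = proj₁ (ins l (proj₁ (run R))) , proj₂ (ins l (proj₁ (run R))) ∷ proj₂ (run R)

  vals : List Letter → List ℕ
  vals = map proj₂

  run-cells : ∀ R → cells (proj₁ (run R)) ↭ proj₂ (run R)
  run-cells [] = ↭-refl
  run-cells ((b , x) ∷ R) = ↭-trans (ins-cells b x _) (prep _ (run-cells R))

  run-length : ∀ R → length (proj₂ (run R)) ≡ length R
  run-length [] = refl
  run-length (_ ∷ R) = cong suc (run-length R)

  run-latE : ∀ R → Lat (cells (proj₁ (run R)))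
  run-latE [] = tt
  run-latE ((b , x) ∷ R) = ins-lat b x _ (run-latE R)

  run-lat : ∀ R → Lat (proj₂ (run R))
  run-lat [] = tt
  run-lat (l ∷ R) = Part-resp (run-cells (l ∷ R)) (Lat⇒Part _ (run-latE (l ∷ R))) , run-lat R

  Distinct : List ℕ → Set
  Distinct [] = ⊤
  Distinct (x ∷ xs) = x ∉ xs × Distinct xs

  run-inj : ∀ R R' → run R ≡ run R' → R ≡ R'
  run-inj [] [] _ = refl
  run-inj [] (_ ∷ _) e = case cong proj₂ e of λ ()
  run-inj (_ ∷ _) [] e = case cong proj₂ e of λ ()
  run-inj ((b , x) ∷ R) ((b' , x') ∷ R') e
    with ins-inj b x _ b' x' _ (cong₂ _,_ (cong proj₁ e) (∷-injectiveˡ (cong proj₂ e)))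
  ... | (refl , e') = cong (_ ∷_) (run-inj R R' (cong₂ _,_ e' (∷-injectiveʳ (cong proj₂ e))))

  -- With `run-inj` this is the Robinson-Schensted bijection. The path `p` tells which box is to be
  -- deleted next, and `Lat p` that it is a corner at that moment.
  run-surj : ∀ p E → Desc E → Lat (cells E) → Lat p → cells E ↭ p → ∃ λ R → run R ≡ (E , p) × vals R ↭ labels E
  run-surj [] [] _ _ _ _ = [] , refl , ↭-refl
  run-surj [] (_ ∷ _) _ _ _ s = ⊥-elim (Perm.¬x∷xs↭[] s)
  run-surj (d ∷ p) E D L (_ , Lp) s with unins E d p D L s (Lat⇒Part p Lp)
  ... | (E₀ , x , e , sl , D₀ , L₀ , sc) with run-surj p E₀ D₀ L₀ Lp sc
  ...   | (R , eR , sR) = (proj₁ d , x) ∷ R ,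
          cong₂ _,_ (trans (cong (λ z → proj₁ (ins _ (proj₁ z))) eR) (cong proj₁ e))
             (cong₂ _∷_ (trans (cong (λ z → proj₂ (ins _ (proj₁ z))) eR) (cong proj₂ e)) (cong proj₂ eR)) ,
          ↭-trans (prep x sR) (↭-sym sl)

  -- Both new boxes pass the largest entry `t`, and each is pushed one row down exactly when it
  -- meets `t`. If the first is pushed, `t` moves below the second box, which then stays. If only
  -- the second is pushed, it was strictly above the first. Either way the order of the rows
  -- survives.
  bump-≤ : ∀ b x x' E → x < x' → proj₂ (proj₂ (ins (b , x') (proj₁ (ins (b , x) E)))) ≤ proj₂ (proj₂ (ins (b , x) E))
  bump-≤ b x x' [] lt = ≤-reflexive (cong (proj₂ ∘ proj₂) (ins-top (b , 0) [] lt))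
  bump-≤ b x x' ((t , c) ∷ E) lt with t <? x
  ... | yes _ = ≤-reflexive (cong (proj₂ ∘ proj₂) (ins-top (b , 0) ((t , c) ∷ E) lt))
  ... | no nlt with ins (b , x) E | bump-≤ b x x' E lt | ins-colour b x E
  ...   | (E₁ , d) | ih | cd with c ≟c d
  bump-≤ b x x' ((t , c) ∷ E) lt | no nlt | (E₁ , d) | ih | cd | yes refl with t <? x'
  ... | yes _ = z≤n
  ... | no _ with up c ≟c proj₂ (ins (b , x') E₁)
  ...   | yes e = ⊥-elim (<-irrefl (sym (cong proj₂ e)) (s≤s ih))
  ...   | no _ = ≤-trans ih (n≤1+n _)
  bump-≤ b x x' ((t , c) ∷ E) lt | no nlt | (E₁ , d) | ih | cd | no ne with t <? x'
  ... | yes _ = z≤n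
  ... | no _ with c ≟c proj₂ (ins (b , x') E₁)
  ...   | no _ = ih
  ...   | yes refl = ≤∧≢⇒< ih (λ e → ne (cong₂ _,_ (trans (ins-colour b x' E₁) (sym cd)) e))

  -- When the first box is pushed, the second either meets `t` in its new row and is pushed as well,
  -- or lies below that row already.
  bump-< : ∀ b x x' E → x' < x → proj₂ (proj₂ (ins (b , x) E)) < proj₂ (proj₂ (ins (b , x') (proj₁ (ins (b , x) E))))
  bump-< b x x' [] lt = subst (λ z → 0 < proj₂ (proj₂ z)) (sym (trans (ins-push (b , 0) [] (<-asym lt)) (push-≡ x _ refl))) z<s
  bump-< b x x' ((t , c) ∷ E) lt with t <? x
  ... | yes _ = subst (λ z → 0 < proj₂ (proj₂ z)) (sym (ins-push (b , 0) ((t , c) ∷ E) (<-asym lt))) positive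
    where
    positive : 0 < proj₂ (proj₂ (push x (b , 0) (ins (b , x') ((t , c) ∷ E))))
    positive with (b , 0) ≟c proj₂ (ins (b , x') ((t , c) ∷ E))
    ... | yes _ = z<s
    ... | no ne = n≢0⇒n>0 (λ e → ne (cong₂ _,_ (sym (ins-colour b x' ((t , c) ∷ E))) (sym e)))
  ... | no nlt with ins (b , x) E | bump-< b x x' E lt | ins-colour b x E
  ...   | (E₁ , d) | ih | cd with c ≟c d
  bump-< b x x' ((t , c) ∷ E) lt | no nlt | (E₁ , d) | ih | cd | yes refl with t <? x'
  ... | yes lt' = ⊥-elim (nlt (<-trans lt' lt))
  ... | no _ with up c ≟c proj₂ (ins (b , x') E₁)
  ...   | yes e = ≤-refl
  ...   | no ne = ≤∧≢⇒< ih (λ e → ne (cong₂ _,_ (trans cd (sym (ins-colour b x' E₁))) e))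
  bump-< b x x' ((t , c) ∷ E) lt | no nlt | (E₁ , d) | ih | cd | no ne with t <? x'
  ... | yes lt' = ⊥-elim (nlt (<-trans lt' lt))
  ... | no _ with c ≟c proj₂ (ins (b , x') E₁)
  ...   | no _ = ih
  ...   | yes refl = ≤-trans ih (n≤1+n _)

  DescBy-mid : ∀ {a} {A : Set a} (f : A → ℕ) xs {x ys} → DescBy f (xs ++ x ∷ ys) →
    All (λ y → f x < f y) xs × All (λ y → f y < f x) ys × DescBy f (xs ++ ys)
  DescBy-mid f [] (a , D) = [] , a , D
  DescBy-mid f (z ∷ xs) (a , D) with DescBy-mid f xs D | AllP.++⁻ xs a
  ... | (p , q , D') | (a₁ , (az ∷ a₂)) = az ∷ p , q , AllP.++⁺ a₁ a₂ , D'

  BiLetter : Set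
  BiLetter = ℕ × Letter

  bi : List BiLetter → Enc × Enc
  bi [] = [] , []
  bi ((j , l) ∷ L) = proj₁ (ins l (proj₁ (bi L))) , (j , proj₂ (ins l (proj₁ (bi L)))) ∷ proj₂ (bi L)

  value : BiLetter → ℕ
  value = proj₂ ∘ proj₂

  inverse : BiLetter → BiLetter
  inverse (j , b , x) = x , b , j

  bi-run₁ : ∀ L → proj₁ (bi L) ≡ proj₁ (run (map proj₂ L))
  bi-run₁ [] = refl
  bi-run₁ ((j , l) ∷ L) = cong (proj₁ ∘ ins l) (bi-run₁ L)

  bi-run₂ : ∀ L → proj₂ (bi L) ≡ zip (map proj₁ L) (proj₂ (run (map proj₂ L)))
  bi-run₂ [] = refl
  bi-run₂ ((j , l) ∷ L) = cong₂ (λ E Q → (j , proj₂ (ins l E)) ∷ Q) (bi-run₁ L) (bi-run₂ L)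

  bi-values : ∀ L → labels (proj₁ (bi L)) ↭ map value L
  bi-values [] = ↭-refl
  bi-values ((j , b , x) ∷ L) = ↭-trans (ins-labels b x _) (prep x (bi-values L))

  bi-labels : ∀ L → labels (proj₂ (bi L)) ≡ map proj₁ L
  bi-labels [] = refl
  bi-labels (_ ∷ L) = cong (_ ∷_) (bi-labels L)

  -- The local rule for ins is self-dual: a letter of maximal value in the middle of a biword adds one
  -- box to the P-symbol and is inserted into the Q-symbol. Induction on the maximum gives the symmetry.
  bi-max : ∀ L₁ j b n L₂ → All ((_< n) ∘ value) (L₁ ++ L₂) → All ((j <_) ∘ proj₁) L₁ → All ((_< j) ∘ proj₁) L₂ →
    let r = ins (b , j) (proj₂ (bi (L₁ ++ L₂))) in
    bi (L₁ ++ (j , b , n) ∷ L₂) ≡ ((n , proj₂ r) ∷ proj₁ (bi (L₁ ++ L₂)) , proj₁ r)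
  bi-max [] j b n L₂ av _ aj
    rewrite ins-max {b} {n} (proj₁ (bi L₂)) (All-labels (All-resp-↭ (↭-sym (bi-values L₂)) (AllP.map⁺ av)))
          | ins-max {b} {j} (proj₂ (bi L₂)) (All-labels (subst (All (_< j)) (sym (bi-labels L₂)) (AllP.map⁺ aj))) = refl
  bi-max ((t , b' , x) ∷ L₁) j b n L₂ (vx ∷ av) (jt ∷ ai) aj
    with bi (L₁ ++ (j , b , n) ∷ L₂) | bi (L₁ ++ L₂) | bi-max L₁ j b n L₂ av ai aj
  ... | _ | (P , Q) | refl
    rewrite ins-push {b'} {x} {n} (proj₂ (ins (b , j) Q)) P (<-asym vx)
          | ins-push {b} {j} {t} (proj₂ (ins (b' , x) P)) Q (<-asym jt)
    with ins (b' , x) P | ins (b , j) Q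
  ... | (P' , d) | (Q' , c) with c ≟c d
  ...   | yes refl rewrite push-≡ t {c} Q' refl = refl
  ...   | no ne rewrite push-≢ t Q' (ne ∘ sym) = refl

  -- Schützenberger's theorem on inverse permutations, for coloured biwords. The head of `L'` is the
  -- letter of maximal value: on the inverse side it is inserted last, while in `L` it sits
  -- somewhere in the middle, which is the situation of `bi-max`.
  symmetry : ∀ L L' → L ↭ L' → DescBy proj₁ L → DescBy value L' →
    bi (map inverse L') ≡ (proj₂ (bi L) , proj₁ (bi L))
  symmetry L [] s _ _ rewrite Perm.↭-empty-inv s = refl
  symmetry L ((j , b , n) ∷ L') s D (a , D') with ∈-∃++ (∈-resp-↭ (↭-sym s) (here refl))
  ... | (L₁ , L₂ , refl) with DescBy-mid proj₁ L₁ D | drop-mid L₁ [] s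
  ...   | (a₁ , a₂ , D₁₂) | s' rewrite symmetry (L₁ ++ L₂) L' s' D₁₂ D'
          | bi-max L₁ j b n L₂ (All-resp-↭ (↭-sym s') a) a₁ a₂ = refl

-- Schensted's row insertion seen from the largest entry.

module RowInsertion where
  open import Data.Nat
  open import Data.Nat.Properties

  AllRows : (ℕ → Set) → Tableau → Set
  AllRows P = All (All P)

  <ᵇ-true : ∀ {x y} → x < y → (x <ᵇ y) ≡ true
  <ᵇ-true {x} {y} lt with x <ᵇ y | <⇒<ᵇ lt
  ... | true | _ = refl

  <ᵇ-false : ∀ {x y} → ¬ x < y → (x <ᵇ y) ≡ false
  <ᵇ-false {x} {y} nlt with x <ᵇ y in e
  ... | false = refl
  ... | true = ⊥-elim (nlt (<ᵇ⇒< x y (subst T (sym e) tt)))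

  bumpLast : ℕ → List ℕ × Maybe ℕ → List ℕ × Maybe ℕ
  bumpLast t (r' , nothing) = r' , just t
  bumpLast t (r' , just y) = r' ∷ʳ t , just y

  rowIns-∷ʳ : ∀ x t r → x < t → rowIns x (r ∷ʳ t) ≡ bumpLast t (rowIns x r)
  rowIns-∷ʳ x t [] lt rewrite <ᵇ-true lt = refl
  rowIns-∷ʳ x t (y ∷ r) lt with x <ᵇ y
  ... | true = refl
  ... | false rewrite rowIns-∷ʳ x t r lt with rowIns x r
  ...   | (r' , nothing) = refl
  ...   | (r' , just _) = refl

  rowIns-max : ∀ t r → All (_< t) r → rowIns t r ≡ (r ∷ʳ t , nothing)
  rowIns-max t [] _ = refl
  rowIns-max t (y ∷ r) (lt ∷ a) rewrite <ᵇ-false (<-asym lt) | rowIns-max t r a = refl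

  rowIns-bumped : ∀ x r r' y → rowIns x r ≡ (r' , just y) → y ∈ r
  rowIns-bumped x (z ∷ r) r' y e with x <ᵇ z
  rowIns-bumped x (z ∷ r) r' y refl | true = here refl
  ... | false with rowIns x r in q
  rowIns-bumped x (z ∷ r) _ y refl | false | (r'' , just .y) = there (rowIns-bumped x r r'' y q)

  pushT : ℕ → ℕ → Tableau × ℕ → Tableau × ℕ
  pushT t k (X , i) with k ≟ i
  ... | yes _ = addAt t (suc k) X , suc k
  ... | no _ = addAt t k X , i

  tabIns-max : ∀ t X → AllRows (_< t) X → tabIns t X ≡ (addAt t 0 X , 0)
  tabIns-max t [] _ = refl
  tabIns-max t (r ∷ X) (a ∷ _) rewrite rowIns-max t r a = refl

  -- The largest entry ends its row. It is bumped exactly when the insertion would otherwise have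
  -- stopped in that row, and then it settles at the end of the next row, where all entries are
  -- smaller. This derives the growth rule from row insertion.
  tabIns-addAt : ∀ t k X x → AllRows (_< t) X → x < t → k ≤ length X →
    tabIns x (addAt t k X) ≡ pushT t k (tabIns x X)
  tabIns-addAt t zero [] x _ lt _ rewrite <ᵇ-true lt = refl
  tabIns-addAt t zero (r ∷ X) x (a ∷ aX) lt _ rewrite rowIns-∷ʳ x t r lt with rowIns x r
  ... | (r' , nothing) rewrite tabIns-max t X aX = refl
  ... | (r' , just y) with tabIns y X
  ...   | (X' , i) = refl
  tabIns-addAt t (suc k) (r ∷ X) x (a ∷ aX) lt (s≤s le) with rowIns x r in q
  ... | (r' , nothing) = refl
  ... | (r' , just y) rewrite tabIns-addAt t k X y aX (All.lookup a (rowIns-bumped x r r' y q)) le with tabIns y X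
  ...   | (X' , i) = pushed (k ≟ i)
    where
    pushed : (d : Dec (k ≡ i)) → (r' ∷ proj₁ (pushT t k (X' , i)) , suc (proj₂ (pushT t k (X' , i)))) ≡ pushT t (suc k) (r' ∷ X' , suc i)
    pushed _ with k ≟ i | suc k ≟ suc i
    ... | yes _ | yes _ = refl
    ... | no _ | no _ = refl
    ... | yes e | no ne = ⊥-elim (ne (cong suc e))
    ... | no ne | yes e = ⊥-elim (ne (suc-injective e))

  Above : List ℕ → Tableau → Set
  Above r [] = ⊤
  Above r (r' ∷ _) = length r' ≤ length r × ColLess r r'

  -- `IsTab` rearranged so that a tableau is a row placed on top of a tableau, for recursion on
  -- rows.
  RT : Tableau → Set
  RT [] = ⊤
  RT (r ∷ X) = 1 ≤ length r × Linked _<_ r × Above r X × RT X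

  RT⇒IsTab : ∀ X → RT X → IsTab X
  RT⇒IsTab [] _ = [] , [] , [] , []
  RT⇒IsTab (r ∷ []) (n , l , _ , _) = n ∷ [] , l ∷ [] , [-] , [-]
  RT⇒IsTab (r ∷ r' ∷ X) (n , l , (le , cl) , R) with RT⇒IsTab (r' ∷ X) R
  ... | (a , b , c , d) = n ∷ a , l ∷ b , le ∷ c , cl ∷ d

  IsTab⇒RT : ∀ X → IsTab X → RT X
  IsTab⇒RT [] _ = tt
  IsTab⇒RT (r ∷ []) (n ∷ _ , l ∷ _ , _ , _) = n , l , tt , tt
  IsTab⇒RT (r ∷ r' ∷ X) (n ∷ a , l ∷ b , le ∷ c , cl ∷ d) = n , l , (le , cl) , IsTab⇒RT (r' ∷ X) (a , b , c , d)

  lens : Tableau → List ℕ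
  lens = map length

  Linked-∷ʳ : ∀ {r v} → Linked _<_ r → All (_< v) r → Linked _<_ (r ∷ʳ v)
  Linked-∷ʳ [] _ = [-]
  Linked-∷ʳ [-] (lt ∷ []) = lt ∷ [-]
  Linked-∷ʳ (p ∷ l) (_ ∷ a) = p ∷ Linked-∷ʳ l a

  -- Row `k` can be lengthened by a box. For positive `k` this compares it with the row above; row
  -- `k` may be empty, in which case it is missing from the list.
  Corner : ℕ → Tableau → Set
  Corner zero X = ⊤
  Corner (suc k) [] = ⊥
  Corner (suc zero) (r ∷ []) = 1 ≤ length r
  Corner (suc zero) (r ∷ r' ∷ X) = length r' < length r
  Corner (suc (suc k)) (r ∷ X) = Corner (suc k) X

  addAt-RT : ∀ v k X → AllRows (_< v) X → Corner k X → RT X → RT (addAt v k X)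
  addAt-RT v zero [] _ _ _ = s≤s z≤n , [-] , tt , tt
  addAt-RT v zero (r ∷ X) (a ∷ _) _ (n , l , ab , R) =
    subst (1 ≤_) (sym (length-∷ʳ r v)) (s≤s z≤n) , Linked-∷ʳ l a , above X ab , R
    where
    above : ∀ X → Above r X → Above (r ∷ʳ v) X
    above [] _ = tt
    above (r' ∷ X) (le , cl) = ≤-trans le (≤-trans (n≤1+n _) (≤-reflexive (sym (length-∷ʳ r v)))) ,
      λ i lt → subst (_< at r' i) (sym (at-++ˡ r (v ∷ []) i (<-≤-trans lt le))) (cl i lt)
  addAt-RT v (suc zero) (r ∷ []) (a ∷ _) c (n , l , ab , R) = n , l , (c , col) , s≤s z≤n , [-] , tt , tt
    where
    col : ColLess r (v ∷ [])
    col zero _ = All.lookup a (at-∈ r 0 n)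
    col (suc i) (s≤s ())
  addAt-RT v (suc zero) (r ∷ r' ∷ X) (a ∷ aX) c (n , l , (le , cl) , R) =
    n , l , (subst (_≤ length r) (sym (length-∷ʳ r' v)) c , col) , addAt-RT v zero (r' ∷ X) aX tt R
    where
    col : ColLess r (r' ∷ʳ v)
    col i lt with i <? length r'
    ... | yes q = subst (at r i <_) (sym (at-++ˡ r' (v ∷ []) i q)) (cl i q)
    ... | no q with ≤-antisym (≤-pred (subst (i <_) (length-∷ʳ r' v) lt)) (≮⇒≥ q)
    ...   | refl = subst (at r i <_) (sym (at-last r' v)) (All.lookup a (at-∈ r i c))
  addAt-RT v (suc (suc k)) (r ∷ []) _ () _
  addAt-RT v (suc (suc k)) (r ∷ r' ∷ X) (a ∷ aX) c (n , l , ab , R) = n , l , ab , addAt-RT v (suc k) (r' ∷ X) aX c R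

  addAt-concat : ∀ v k X → k ≤ length X → concat (addAt v k X) ↭ v ∷ concat X
  addAt-concat v zero [] _ = ↭-refl
  addAt-concat v zero (r ∷ X) _ = subst (_↭ v ∷ r ++ concat X) (sym (++-assoc r (v ∷ []) (concat X))) (shift v r (concat X))
  addAt-concat v (suc k) (r ∷ X) (s≤s le) = ↭-trans (Perm.++⁺ˡ r (addAt-concat v k X le)) (shift v r (concat X))

  All⇒AllRows : ∀ {P : ℕ → Set} X → All P (concat X) → AllRows P X
  All⇒AllRows X = AllP.concat⁻

  init< : ∀ r {z} → Linked _<_ (r ∷ʳ z) → All (_< z) r
  init< [] _ = []
  init< (x ∷ []) (lt ∷ _) = lt ∷ []
  init< (x ∷ y ∷ r) (lt ∷ l) with init< (y ∷ r) l
  ... | (q ∷ a) = <-trans lt q ∷ q ∷ a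

  Linked-init : ∀ r {z} → Linked _<_ (r ∷ʳ z) → Linked _<_ r
  Linked-init [] _ = []
  Linked-init (x ∷ []) _ = [-]
  Linked-init (x ∷ y ∷ r) (lt ∷ l) = lt ∷ Linked-init (y ∷ r) l

  max-last : ∀ v r → Linked _<_ r → All (_≤ v) r → v ∈ r → ∃ λ r₀ → r ≡ r₀ ∷ʳ v
  max-last v r l a i with initLast r
  max-last v .(r₀ ∷ʳ z) l a i | r₀ ∷ʳ′ z with ∈-++⁻ r₀ i
  ... | inj₁ i₀ = ⊥-elim (<-irrefl refl (<-≤-trans (All.lookup (init< r₀ l) i₀) (All.lookup a (∈-++⁺ʳ r₀ (here refl)))))
  ... | inj₂ (here refl) = r₀ , refl

  Above-shrink : ∀ r r₀ v X → Above r ((r₀ ∷ʳ v) ∷ X) → Above r (r₀ ∷ X)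
  Above-shrink r r₀ v X (le , cl) = ≤-trans (≤-trans (n≤1+n _) (≤-reflexive (sym (length-∷ʳ r₀ v)))) le ,
    λ i lt → subst (at r i <_) (at-++ˡ r₀ (v ∷ []) i lt) (cl i (<-trans lt (≤-reflexive (sym (length-∷ʳ r₀ v)))))

  -- The last component strengthens the induction: if the maximum lies further down, the row on top
  -- must still fit onto the changed remainder.
  removeMax : ∀ v X → RT X → AllRows (_≤ v) X → v ∈ concat X →
    ∃₂ λ k X' → X ≡ addAt v k X' × RT X' × k ≤ length X' × (∀ r → Above r X → Above r X')
  removeMax v (r ∷ X) (n , l , ab , R) (a ∷ aX) i with ∈-++⁻ r i
  ... | inj₂ j with removeMax v X R aX j
  ...   | (k , X' , refl , R' , le , A') = suc k , r ∷ X' , refl , (n , l , A' r ab , R') , s≤s le , λ _ z → z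
  removeMax v (r ∷ X) (n , l , ab , R) (a ∷ aX) i | inj₁ j with max-last v r l a j
  ... | (r₀ , refl) = last r₀ X n l ab R aX
    where
    last : ∀ r₀ X → 1 ≤ length (r₀ ∷ʳ v) → Linked _<_ (r₀ ∷ʳ v) → Above (r₀ ∷ʳ v) X → RT X → AllRows (_≤ v) X →
      ∃₂ λ k X' → (r₀ ∷ʳ v) ∷ X ≡ addAt v k X' × RT X' × k ≤ length X' × (∀ r → Above r ((r₀ ∷ʳ v) ∷ X) → Above r X')
    last [] [] _ _ _ _ _ = 0 , [] , refl , tt , z≤n , λ _ _ → tt
    -- If the maximum is alone in its row, there is no row beneath, since the first entry of such a
    -- row would exceed it.
    last [] ((y ∷ r₁) ∷ X) _ _ (_ , cl) _ ((le ∷ _) ∷ _) = ⊥-elim (<-irrefl refl (<-≤-trans (cl 0 (s≤s z≤n)) le))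
    last (x ∷ r₀) X n l ab R aX = 0 , (x ∷ r₀) ∷ X , refl , (s≤s z≤n , Linked-init (x ∷ r₀) l , above X ab aX , R) , z≤n ,
        λ r A → Above-shrink r (x ∷ r₀) v X A
      where
      above : ∀ X → Above (x ∷ r₀ ∷ʳ v) X → AllRows (_≤ v) X → Above (x ∷ r₀) X
      above [] _ _ = tt
      above (r' ∷ X) (le , cl) (a' ∷ _) = short , λ i lt → subst (_< at r' i) (at-++ˡ (x ∷ r₀) (v ∷ []) i (<-≤-trans lt short)) (cl i lt)
        where
        -- The row beneath does not reach the column of `v`, where its entry would exceed the
        -- maximum.
        short : length r' ≤ suc (length r₀)
        short with length r' ≤? suc (length r₀)
        ... | yes q = q
        ... | no q = ⊥-elim (<-irrefl refl (<-≤-trans (subst (_< at r' (suc (length r₀))) (at-last (x ∷ r₀) v) (cl _ (≰⇒> q)))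
                       (All.lookup a' (at-∈ r' _ (≰⇒> q)))))

  NonEmpty : Tableau → Set
  NonEmpty = All (λ r → 1 ≤ length r)

  RT⇒NonEmpty : ∀ X → RT X → NonEmpty X
  RT⇒NonEmpty X R = proj₁ (RT⇒IsTab X R)

  ∉-∷ʳ : ∀ {t : ℕ} (r r' : List ℕ) → r ∷ʳ t ≡ r' → t ∉ r' → ⊥
  ∉-∷ʳ r _ refl n = n (∈-++⁺ʳ r (here refl))

  -- Freshness of `t` locates the altered row. `NonEmpty` separates a new row from an empty one:
  -- `addAt t 0 []` and `addAt t 0 ([] ∷ [])` coincide.
  addAt-inj : ∀ t k X k' X' → t ∉ concat X → t ∉ concat X' → NonEmpty X → NonEmpty X' → k ≤ length X → k' ≤ length X' →
    addAt t k X ≡ addAt t k' X' → k ≡ k' × X ≡ X'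
  addAt-inj t zero [] zero [] _ _ _ _ _ _ _ = refl , refl
  addAt-inj t zero [] zero (r ∷ X') _ _ _ (n ∷ _) _ _ e with ∷ʳ-injectiveˡ [] r (∷-injectiveˡ e)
  addAt-inj t zero [] zero (r ∷ X') _ _ _ (() ∷ _) _ _ e | refl
  addAt-inj t zero (r ∷ X) zero [] _ _ (n ∷ _) _ _ _ e with ∷ʳ-injectiveˡ [] r (sym (∷-injectiveˡ e))
  addAt-inj t zero (r ∷ X) zero [] _ _ (() ∷ _) _ _ _ e | refl
  addAt-inj t zero (r ∷ X) zero (r' ∷ X') _ _ _ _ _ _ e =
    refl , cong₂ _∷_ (∷ʳ-injectiveˡ r r' (∷-injectiveˡ e)) (∷-injectiveʳ e)
  addAt-inj t zero [] (suc k') (r' ∷ X') _ n _ _ _ _ e = ⊥-elim (∉-∷ʳ [] r' (∷-injectiveˡ e) (n ∘ ∈-++⁺ˡ))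
  addAt-inj t zero (r ∷ X) (suc k') (r' ∷ X') _ n _ _ _ _ e = ⊥-elim (∉-∷ʳ r r' (∷-injectiveˡ e) (n ∘ ∈-++⁺ˡ))
  addAt-inj t (suc k) (r ∷ X) zero [] n _ _ _ _ _ e = ⊥-elim (∉-∷ʳ [] r (sym (∷-injectiveˡ e)) (n ∘ ∈-++⁺ˡ))
  addAt-inj t (suc k) (r ∷ X) zero (r' ∷ X') n _ _ _ _ _ e = ⊥-elim (∉-∷ʳ r' r (sym (∷-injectiveˡ e)) (n ∘ ∈-++⁺ˡ))
  addAt-inj t (suc k) (r ∷ X) (suc k') (r' ∷ X') n n' (_ ∷ ne) (_ ∷ ne') (s≤s le) (s≤s le') e
    with addAt-inj t k X k' X' (n ∘ ∈-++⁺ʳ r) (n' ∘ ∈-++⁺ʳ r') ne ne' le le' (∷-injectiveʳ e)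
  ... | (refl , refl) = refl , cong (_∷ X) (∷-injectiveˡ e)

  at-lens-addAt : ∀ v k X i → k ≤ length X → at (lens (addAt v k X)) i ≡ (if does (k ≟ i) then 1 else 0) + at (lens X) i
  at-lens-addAt v zero [] zero _ = refl
  at-lens-addAt v zero [] (suc i) _ = refl
  at-lens-addAt v zero (r ∷ X) zero _ = length-∷ʳ r v
  at-lens-addAt v zero (r ∷ X) (suc i) _ = refl
  at-lens-addAt v (suc k) (r ∷ X) zero _ = refl
  at-lens-addAt v (suc k) (r ∷ X) (suc i) (s≤s le) = at-lens-addAt v k X i le

  RT-lens : ∀ X i → RT X → at (lens X) (suc i) ≤ at (lens X) i
  RT-lens [] i _ = z≤n
  RT-lens (r ∷ []) i _ = z≤n
  RT-lens (r ∷ r' ∷ X) zero (_ , _ , (le , _) , _) = le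
  RT-lens (r ∷ r' ∷ X) (suc i) (_ , _ , _ , R) = RT-lens (r' ∷ X) i R

  corner : ∀ k X → NonEmpty X → (∀ i → k ≡ suc i → at (lens X) k < at (lens X) i) → Corner k X
  corner zero X _ _ = tt
  corner (suc k) [] _ h = case h k refl of λ ()
  corner (suc zero) (r ∷ []) (n ∷ _) h = n
  corner (suc zero) (r ∷ r' ∷ X) _ h = h 0 refl
  corner (suc (suc k)) (r ∷ X) (_ ∷ ne) h = corner (suc k) X ne (λ { i refl → h (suc i) refl })

  corner⇒≤ : ∀ k X → Corner k X → k ≤ length X
  corner⇒≤ zero X _ = z≤n
  corner⇒≤ (suc zero) (r ∷ []) _ = s≤s z≤n
  corner⇒≤ (suc zero) (r ∷ r' ∷ X) _ = s≤s z≤n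
  corner⇒≤ (suc (suc k)) (r ∷ X) c = s≤s (corner⇒≤ (suc k) X c)

-- Growth encodings as families of tableaux.

module Realisation (m : ℕ) where
  open import Data.Nat
  open import Data.Nat.Properties
  open F using (zero; suc)
  open V using ([]; _∷_)
  open GrowthInsertion m
  open RowInsertion

  addTo : Fin m → ℕ → Cell → Tableau → Tableau
  addTo b t (b' , k) X with b' ≟ᶠ b
  ... | yes _ = addAt t k X
  ... | no _ = X

  addTo-≡ : ∀ b t k X → addTo b t (b , k) X ≡ addAt t k X
  addTo-≡ b t k X with b ≟ᶠ b
  ... | yes _ = refl
  ... | no ne = ⊥-elim (ne refl)

  addTo-≢ : ∀ {b b'} t k X → b' ≢ b → addTo b t (b' , k) X ≡ X
  addTo-≢ {b} {b'} t k X ne with b' ≟ᶠ b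
  ... | yes e = ⊥-elim (ne e)
  ... | no _ = refl

  real : Fin m → Enc → Tableau
  real b [] = []
  real b ((t , c) ∷ E) = addTo b t c (real b E)

  private
    δ-row : ∀ b k i → δ (b , k) (b , i) ≡ (if does (k ≟ i) then 1 else 0)
    δ-row b k i with k ≟ i
    ... | yes e = trans (trans (cong (λ z → δ (b , k) (b , z)) (sym e)) (δ-≡ _)) (cong (if_then 1 else 0) (sym (dec-true (k ≟ i) e)))
    ... | no ne = trans (δ-≢ (λ { refl → ne refl })) (cong (if_then 1 else 0) (sym (dec-false (k ≟ i) ne)))

  record RealOf (b : Fin m) (X : Tableau) (E : Enc) : Set where
    field
      rt : RT X
      row-lengths : ∀ i → at (lens X) i ≡ cnt (cells E) (b , i)
      entry : ∀ {v} → v ∈ concat X → v ∈ labels E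

  open RealOf public

  Real : Fin m → Enc → Set
  Real b E = RealOf b (real b E) E

  below : ∀ {b t} E → Real b E → All ((_< t) ∘ proj₁) E → AllRows (_< t) (real b E)
  below {b} E R a = All⇒AllRows (real b E) (All.tabulate λ i → All.lookup (AllP.map⁺ a) (entry R i))

  corner-real : ∀ {b k} E → Real b E → Part ((b , k) ∷ cells E) → Corner k (real b E)
  corner-real {b} {k} E R P = corner k (real b E) (RT⇒NonEmpty _ (rt R)) λ { i refl →
    subst₂ _<_ (sym (row-lengths R (suc i))) (sym (row-lengths R i)) (subst₂ _≤_ (δ+≡ _ _) (δ+≢ _ up≢) (P b i)) }

  real-Lat : ∀ b E → Desc E → Lat (cells E) → Real b E
  real-Lat b [] _ _ = record { rt = tt ; row-lengths = λ i → refl ; entry = λ () }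
  real-Lat b ((t , b' , k) ∷ E) (a , D) (P , L) with b' ≟ᶠ b | real-Lat b E D L
  ... | no ne | R = record { rt = rt R ; row-lengths = λ i → trans (row-lengths R i) (sym (δ+≢ _ (ne ∘ cong proj₁))) ; entry = there ∘ entry R }
  ... | yes refl | R = record
    { rt = addAt-RT t k _ (below E R a) (corner-real E R P) (rt R)
    ; row-lengths = λ i → trans (at-lens-addAt t k _ i k≤) (cong₂ _+_ (sym (δ-row b k i)) (row-lengths R i))
    ; entry = λ i → ent (∈-resp-↭ (addAt-concat t k _ k≤) i) }
    where
    k≤ = corner⇒≤ k _ (corner-real E R P)
    ent : ∀ {v} → v ∈ t ∷ concat (real b E) → v ∈ t ∷ labels E
    ent (here e) = here e
    ent (there i) = there (entry R i)

  -- Both insertions obey the same rule for the largest entry, by `tabIns-addAt` and by the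
  -- definition of `ins`. An entry of another colour is invisible in `real b`, and is never pushed
  -- since the new box has colour `b`.
  tabIns-real : ∀ b x E → Desc E → Lat (cells E) → x ∉ labels E →
    tabIns x (real b E) ≡ (real b (proj₁ (ins (b , x) E)) , proj₂ (proj₂ (ins (b , x) E)))
  tabIns-real b x [] _ _ _ = cong (_, 0) (sym (addTo-≡ b x 0 []))
  tabIns-real b x ((t , b' , k) ∷ E) (a , D) (P , L) nin with t <? x
  ... | yes lt = trans (tabIns-max x (real b ((t , b' , k) ∷ E)) (below _ (real-Lat b _ (a , D) (P , L)) (lt ∷ All.map (λ q → <-trans q lt) a)))
                       (cong (_, 0) (sym (addTo-≡ b x 0 _)))
  ... | no nlt with b' ≟ᶠ b
  ...   | no ne = trans (tabIns-real b x E D L (nin ∘ there)) (cong₂ _,_ (sym (trans (cong (real b ∘ proj₁) other) (addTo-≢ t k _ ne))) (cong (proj₂ ∘ proj₂) (sym other)))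
    where
    other : push t (b' , k) (ins (b , x) E) ≡ ((t , b' , k) ∷ proj₁ (ins (b , x) E) , proj₂ (ins (b , x) E))
    other = push-≢ t _ (λ e → ne (trans (cong proj₁ e) (ins-colour b x E)))
  ...   | yes refl rewrite tabIns-addAt t k (real b E) x (below E (real-Lat b E D L) a) (≤∧≢⇒< (≮⇒≥ nlt) (nin ∘ here)) (corner⇒≤ k _ (corner-real E (real-Lat b E D L) P))
                         | tabIns-real b x E D L (nin ∘ there) = pushed (ins-colour b x E)
    where
    pushed : proj₁ (proj₂ (ins (b , x) E)) ≡ b →
      pushT t k (real b (proj₁ (ins (b , x) E)) , proj₂ (proj₂ (ins (b , x) E)))
      ≡ (real b (proj₁ (push t (b , k) (ins (b , x) E))) , proj₂ (proj₂ (push t (b , k) (ins (b , x) E))))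
    pushed e with ins (b , x) E
    pushed refl | (E' , d) with k ≟ proj₂ d | (b , k) ≟c d
    ... | yes refl | yes _ = cong (_, suc k) (sym (addTo-≡ b t (suc k) _))
    ... | no _ | no _ = cong (_, proj₂ d) (sym (addTo-≡ b t k _))
    ... | yes refl | no ne = ⊥-elim (ne refl)
    ... | no ne | yes refl = ⊥-elim (ne refl)

  real-ins-≢ : ∀ {b b'} x E → b' ≢ b → real b (proj₁ (ins (b' , x) E)) ≡ real b E
  real-ins-≢ x [] ne = addTo-≢ x 0 [] ne
  real-ins-≢ {b} {b'} x ((t , c) ∷ E) ne with t <? x
  ... | yes _ = addTo-≢ x 0 _ ne
  ... | no _ with c ≟c proj₂ (ins (b' , x) E)
  ...   | no _ = cong (addTo b t c) (real-ins-≢ x E ne)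
  ...   | yes refl = trans (addTo-≢ t _ _ (ne ∘ trans (sym (ins-colour b' x E))))
                       (trans (real-ins-≢ x E ne) (sym (addTo-≢ t _ _ (ne ∘ trans (sym (ins-colour b' x E))))))

  select : Fin m → BiLetter → Maybe (ℕ × ℕ)
  select b (j , b' , x) = if does (b' ≟ᶠ b) then just (x , j) else nothing

  rs : List (ℕ × ℕ) → Tableau × Tableau
  rs [] = [] , []
  rs (p ∷ L) = rsStep (rs L) p

  rs-reverse : ∀ L → foldl rsStep ([] , []) (reverse L) ≡ rs L
  rs-reverse [] = refl
  rs-reverse (p ∷ L) rewrite unfold-reverse p L | foldl-++ rsStep ([] , []) (reverse L) (p ∷ []) = cong (λ z → rsStep z p) (rs-reverse L)

  bi-desc₁ : ∀ L → Distinct (map value L) → Desc (proj₁ (bi L))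
  bi-desc₁ [] _ = lift tt
  bi-desc₁ ((j , b , x) ∷ L) (n , D) = ins-desc b x _ (bi-desc₁ L D) (n ∘ ∈-resp-↭ (bi-values L))

  bi-lat₁ : ∀ L → Lat (cells (proj₁ (bi L)))
  bi-lat₁ L = subst (Lat ∘ cells) (sym (bi-run₁ L)) (run-latE (map proj₂ L))

  -- A letter of another colour changes neither tableau of colour `b`, so inserting all letters
  -- jointly and selecting those of colour `b` beforehand give the same pair.
  rs-real : ∀ b L → Distinct (map value L) → rs (mapMaybe (select b) L) ≡ (real b (proj₁ (bi L)) , real b (proj₂ (bi L)))
  rs-real b [] _ = refl
  rs-real b ((j , b' , x) ∷ L) (n , D) with b' ≟ᶠ b in eq
  ... | no ne = trans (rs-real b L D) (cong₂ _,_ (sym (real-ins-≢ x (proj₁ (bi L)) ne)) (sym (addTo-≢ j (proj₂ (proj₂ (ins (b' , x) (proj₁ (bi L))))) _ (ne ∘ trans (sym (ins-colour b' x (proj₁ (bi L))))))))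
  ... | yes refl rewrite rs-real b L D
                       | tabIns-real b x (proj₁ (bi L)) (bi-desc₁ L D) (bi-lat₁ L) (n ∘ ∈-resp-↭ (bi-values L)) =
        cong (real b (proj₁ (ins (b , x) (proj₁ (bi L)))) ,_) (coloured (proj₂ (ins (b , x) (proj₁ (bi L)))) (ins-colour b x (proj₁ (bi L))))
    where
    coloured : ∀ d → proj₁ d ≡ b → addAt j (proj₂ d) (real b (proj₂ (bi L))) ≡ addTo b j d (real b (proj₂ (bi L)))
    coloured d refl = sym (addTo-≡ b j (proj₂ d) _)

  entriesV : ∀ {n} → Vec Tableau n → List ℕ
  entriesV T = concat (concat (V.toList T))

  entriesV-∷ : ∀ {n} X (T : Vec Tableau n) → entriesV (X ∷ T) ≡ concat X ++ entriesV T
  entriesV-∷ X T = sym (concat-++ X (concat (V.toList T)))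

  entriesV-update : ∀ {n} (T : Vec Tableau n) b {X' v} → concat (lookup T b) ↭ v ∷ concat X' →
    entriesV T ↭ v ∷ entriesV (T [ b ]≔ X')
  entriesV-update (X ∷ T) zero {X'} s = subst₂ _↭_ (sym (entriesV-∷ X T)) (cong (_ ∷_) (sym (entriesV-∷ X' T))) (Perm.++⁺ʳ (entriesV T) s)
  entriesV-update (X ∷ T) (suc b) {X'} {v} s = subst₂ _↭_ (sym (entriesV-∷ X T)) (cong (v ∷_) (sym (entriesV-∷ X (T [ b ]≔ X'))))
    (↭-trans (Perm.++⁺ˡ (concat X) (entriesV-update T b {X'} s)) (shift v (concat X) _))

  entriesV-∈ : ∀ {n} (T : Vec Tableau n) {v} → v ∈ entriesV T → ∃ λ b → v ∈ concat (lookup T b)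
  entriesV-∈ (X ∷ T) i with ∈-++⁻ (concat X) (subst (_ ∈_) (entriesV-∷ X T) i)
  ... | inj₁ j = zero , j
  ... | inj₂ j with entriesV-∈ T j
  ...   | (b , k) = suc b , k

  ∈-entriesV : ∀ {n} (T : Vec Tableau n) b {v} → v ∈ concat (lookup T b) → v ∈ entriesV T
  ∈-entriesV (X ∷ T) zero i = subst (_ ∈_) (sym (entriesV-∷ X T)) (∈-++⁺ˡ i)
  ∈-entriesV (X ∷ T) (suc b) i = subst (_ ∈_) (sym (entriesV-∷ X T)) (∈-++⁺ʳ (concat X) (∈-entriesV T b i))

  entriesV-[] : ∀ {n} (T : Vec Tableau n) b → RT (lookup T b) → entriesV T ↭ [] → lookup T b ≡ []
  entriesV-[] T b R s with lookup T b in eq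
  ... | [] = refl
  entriesV-[] T b R s | (x ∷ r) ∷ X with ∈-resp-↭ s (∈-entriesV T b (subst (λ z → x ∈ concat z) (sym eq) (here refl)))
  ... | ()
  entriesV-[] T b (() , _) s | [] ∷ X

  Desc-downFrom : ∀ N E → labels E ≡ downFrom N → Desc E
  Desc-downFrom zero [] _ = lift tt
  Desc-downFrom (suc N) ((t , c) ∷ E) e with ∷-injective e
  ... | (refl , e') = All-labels (subst (All (_< N)) (sym e') (lt N)) , Desc-downFrom N E e'
    where
    lt : ∀ N → All (_< N) (downFrom N)
    lt zero = []
    lt (suc N) = ≤-refl ∷ All.map m<n⇒m<1+n (lt N)

  -- Stripping off the largest entry again and again lists the boxes from the newest to the oldest.
  -- What is left at each stage is a family of tableaux, and its weakly decreasing row lengths are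
  -- the lattice condition.
  encode : ∀ N (T : Vec Tableau m) → entriesV T ↭ downFrom N → (∀ b → RT (lookup T b)) →
    ∃ λ E → labels E ≡ downFrom N × Lat (cells E) × (∀ b → real b E ≡ lookup T b)
  encode zero T s R = [] , refl , tt , λ b → sym (entriesV-[] T b (R b) s)
  encode (suc N) T s R with entriesV-∈ T (∈-resp-↭ (↭-sym s) (here refl))
  ... | (b , i) with removeMax N (lookup T b) (R b)
                       (All⇒AllRows (lookup T b) (All.tabulate λ j → ≤-pred (∈-downFrom⁻ (∈-resp-↭ s (∈-entriesV T b j))))) i
  ...   | (k , X' , eX , R' , k≤ , _)
      with encode N (T [ b ]≔ X')
             (drop-∷ (↭-trans (↭-sym (entriesV-update T b {X'} (subst (λ z → concat z ↭ N ∷ concat X') (sym eX) (addAt-concat N k X' k≤)))) s))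
             RT'
    where
    RT' : ∀ b' → RT (lookup (T [ b ]≔ X') b')
    RT' b' with b' ≟ᶠ b
    ... | yes refl = subst RT (sym (VP.lookup∘updateAt b T)) R'
    ... | no ne = subst RT (sym (VP.lookup∘updateAt′ b' b ne T)) (R b')
  ...     | (E , eE , L , re) = (N , b , k) ∷ E , cong (N ∷_) eE , (part , L) , reals
    where
    D = Desc-downFrom N E eE
    reals : ∀ b' → real b' ((N , b , k) ∷ E) ≡ lookup T b'
    reals b' with b ≟ᶠ b'
    ... | yes refl = trans (cong (addAt N k) (trans (re b) (VP.lookup∘updateAt b T))) (sym eX)
    ... | no ne = trans (re b') (VP.lookup∘updateAt′ b' b (ne ∘ sym) T)
    sh : ∀ b' i → at (lens (lookup T b')) i ≡ cnt ((b , k) ∷ cells E) (b' , i)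
    sh b' i with b ≟ᶠ b'
    ... | no ne = trans (cong (λ z → at (lens z) i) (sym (trans (re b') (VP.lookup∘updateAt′ b' b (ne ∘ sym) T))))
                    (trans (row-lengths (real-Lat b' E D L) i) (sym (δ+≢ _ (ne ∘ cong proj₁))))
    ... | yes refl = trans (cong (λ z → at (lens z) i) eX) (trans (at-lens-addAt N k X' i k≤)
                       (cong₂ _+_ (sym (δ-row b k i)) (trans (cong (λ z → at (lens z) i) (sym (trans (re b) (VP.lookup∘updateAt b T)))) (row-lengths (real-Lat b E D L) i))))
    part : Part ((b , k) ∷ cells E)
    part b' i = subst₂ _≤_ (sh b' (suc i)) (sh b' i) (RT-lens (lookup T b') i (R b'))

  real-entries : ∀ {b t} E → Real b E → All ((_< t) ∘ proj₁) E → t ∉ concat (real b E)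
  real-entries E R a i = <-irrefl refl (All.lookup (AllP.map⁺ a) (entry R i))

  -- The largest label occurs in just one tableau of each family, which fixes its colour.
  -- `addAt-inj` then fixes its row, and it can be deleted on both sides.
  real-inj : ∀ E E' → labels E ≡ labels E' → Desc E → Desc E' → Lat (cells E) → Lat (cells E') →
    (∀ b → real b E ≡ real b E') → E ≡ E'
  real-inj [] [] _ _ _ _ _ _ = refl
  real-inj ((t , b , k) ∷ E) ((t' , b' , k') ∷ E') el (a , D) (a' , D') (P , L) (P' , L') h with ∷-injective el
  ... | (refl , el') = go (b ≟ᶠ b')
    where
    R = λ c → real-Lat c E D L
    R' = λ c → real-Lat c E' D' L'
    go : Dec (b ≡ b') → (t , b , k) ∷ E ≡ (t , b' , k') ∷ E'
    go (no ne) = ⊥-elim (real-entries E' (R' b) a' (subst (λ z → t ∈ concat z)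
        (trans (trans (sym (addTo-≡ b t k _)) (h b)) (addTo-≢ t k' _ (ne ∘ sym)))
        (∈-resp-↭ (↭-sym (addAt-concat t k _ (corner⇒≤ k _ (corner-real E (R b) P)))) (here refl))))
    go (yes refl) with addAt-inj t k (real b E) k' (real b E') (real-entries E (R b) a) (real-entries E' (R' b) a')
                         (RT⇒NonEmpty _ (rt (R b))) (RT⇒NonEmpty _ (rt (R' b)))
                         (corner⇒≤ k _ (corner-real E (R b) P)) (corner⇒≤ k' _ (corner-real E' (R' b) P'))
                         (trans (sym (addTo-≡ b t k _)) (trans (h b) (addTo-≡ b t k' _)))
    ... | (refl , eX) = cong ((t , b , k) ∷_) (real-inj E E' el' D D' L L' h')
      where
      h' : ∀ c → real c E ≡ real c E'
      h' c with b ≟ᶠ c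
      ... | yes refl = eX
      ... | no ne = trans (sym (addTo-≢ t k _ ne)) (trans (h c) (addTo-≢ t k _ ne))

  realV : Enc → Vec Tableau m
  realV E = V.tabulate (λ b → real b E)

  realV-entries : ∀ E → Desc E → Lat (cells E) → entriesV (realV E) ↭ labels E
  realV-entries [] _ _ = subst (_↭ []) (sym (none m)) ↭-refl
    where
    none : ∀ n → entriesV (V.tabulate {n = n} (λ b → [])) ≡ []
    none zero = refl
    none (suc n) = none n
  realV-entries ((t , b , k) ∷ E) (a , D) (P , L) =
    ↭-trans (entriesV-update (realV ((t , b , k) ∷ E)) b {real b E} step)
      (prep t (subst (λ z → entriesV z ↭ labels E) (sym same) (realV-entries E D L)))
    where
    step : concat (lookup (realV ((t , b , k) ∷ E)) b) ↭ t ∷ concat (real b E)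
    step = subst (λ z → concat z ↭ t ∷ concat (real b E)) (sym (trans (VP.lookup∘tabulate _ b) (addTo-≡ b t k _)))
             (addAt-concat t k _ (corner⇒≤ k _ (corner-real E (real-Lat b E D L) P)))
    same : realV ((t , b , k) ∷ E) [ b ]≔ real b E ≡ realV E
    same = trans (sym (VP.tabulate∘lookup _)) (VP.tabulate-cong λ c → ptwise c (c ≟ᶠ b))
      where
      ptwise : ∀ c → Dec (c ≡ b) → lookup (realV ((t , b , k) ∷ E) [ b ]≔ real b E) c ≡ real c E
      ptwise c (yes refl) = VP.lookup∘updateAt b (realV ((t , b , k) ∷ E))
      ptwise c (no ne) = trans (VP.lookup∘updateAt′ c b ne (realV ((t , b , k) ∷ E)))
                           (trans (VP.lookup∘tabulate _ c) (addTo-≢ t k _ (ne ∘ sym)))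

-- Permutations in one-line notation; enumerations without repetition.

module Permutations where
  open import Data.Nat
  open import Data.Nat.Properties
  open F using (zero; suc)
  open GrowthInsertion 0 using (Distinct) public

  private variable
    a b : Level
    A : Set a
    B : Set b

  unique⇒↭ : {xs ys : List A} → Unique xs → Unique ys → (∀ {z} → z ∈ xs → z ∈ ys) → (∀ {z} → z ∈ ys → z ∈ xs) → xs ↭ ys
  unique⇒↭ u v f g = ∼bag⇒↭ (unique∧set⇒bag u v (mk⇔ f g))

  Unique⇒Distinct : {xs : List ℕ} → Unique xs → Distinct xs
  Unique⇒Distinct [] = tt
  Unique⇒Distinct (a ∷ u) = (λ i → All.lookup a i refl) , Unique⇒Distinct u

  Unique-resp : {xs ys : List A} → xs ↭ ys → Unique xs → Unique ys
  Unique-resp refl u = u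
  Unique-resp (prep x s) (a ∷ u) = All-resp-↭ s a ∷ Unique-resp s u
  Unique-resp (swap x y s) ((ne ∷ a) ∷ a' ∷ u) = ((λ e → ne (sym e)) ∷ All-resp-↭ s a') ∷ All-resp-↭ s a ∷ Unique-resp s u
  Unique-resp (↭-tr s t) u = Unique-resp t (Unique-resp s u)

  ∈-concatMap-split : (f : A → List B) (xs : List A) {z : B} → z ∈ concatMap f xs → ∃ λ x → x ∈ xs × z ∈ f x
  ∈-concatMap-split f (x ∷ xs) i with ∈-++⁻ (f x) i
  ... | inj₁ j = x , here refl , j
  ... | inj₂ j with ∈-concatMap-split f xs j
  ...   | (y , k , q) = y , there k , q

  ∈-concatMap-join : (f : A → List B) {xs : List A} {x : A} {z : B} → x ∈ xs → z ∈ f x → z ∈ concatMap f xs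
  ∈-concatMap-join f (here refl) j = ∈-++⁺ˡ j
  ∈-concatMap-join f {y ∷ xs} (there i) j = ∈-++⁺ʳ (f y) (∈-concatMap-join f i j)

  concatMap-unique : (f : A → List B) {xs : List A} → Unique xs → (∀ {x} → x ∈ xs → Unique (f x)) →
    (∀ {x y z} → x ∈ xs → y ∈ xs → z ∈ f x → z ∈ f y → x ≡ y) → Unique (concatMap f xs)
  concatMap-unique f [] _ _ = []
  concatMap-unique f {x ∷ xs} (a ∷ u) uf dj = Uniq.++⁺ (uf (here refl)) (concatMap-unique f u (uf ∘ there) (λ i j → dj (there i) (there j)))
    λ { (i , j) → let (y , k , q) = ∈-concatMap-split f xs j in All.lookup a k (dj (here refl) (there k) i q) }

  ≡ᵇ-refl : ∀ n → (n ≡ᵇ n) ≡ true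
  ≡ᵇ-refl zero = refl
  ≡ᵇ-refl (suc n) = ≡ᵇ-refl n

  ≡ᵇ-≢ : ∀ {x y} → x ≢ y → (x ≡ᵇ y) ≡ false
  ≡ᵇ-≢ {x} {y} ne with x ≡ᵇ y in e
  ... | false = refl
  ... | true = ⊥-elim (ne (≡ᵇ⇒≡ x y (subst T (sym e) tt)))

  at-pos : ∀ {v} σ → v ∈ σ → at σ (pos v σ) ≡ v
  at-pos {v} (x ∷ σ) i with x ≟ v
  ... | yes refl rewrite ≡ᵇ-refl x = refl
  ... | no ne rewrite ≡ᵇ-≢ ne with i
  ...   | here e = ⊥-elim (ne (sym e))
  ...   | there j = at-pos σ j

  pos< : ∀ {v} σ → v ∈ σ → pos v σ < length σ
  pos< {v} (x ∷ σ) i with x ≟ v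
  ... | yes refl rewrite ≡ᵇ-refl x = s≤s z≤n
  ... | no ne rewrite ≡ᵇ-≢ ne with i
  ...   | here e = ⊥-elim (ne (sym e))
  ...   | there j = s≤s (pos< σ j)

  pos-at : ∀ σ j → Distinct σ → j < length σ → pos (at σ j) σ ≡ j
  pos-at (x ∷ σ) zero _ _ rewrite ≡ᵇ-refl x = refl
  pos-at (x ∷ σ) (suc j) (n , D) (s≤s lt) rewrite ≡ᵇ-≢ {x} {at σ j} (λ { refl → n (at-∈ σ j lt) }) = cong suc (pos-at σ j D lt)

  map-at-upTo : ∀ σ → map (at σ) (upTo (length σ)) ≡ σ
  map-at-upTo σ = trans (map-upTo (at σ) (length σ)) (go σ)
    where
    go : ∀ σ → applyUpTo (at σ) (length σ) ≡ σ
    go [] = refl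
    go (x ∷ σ) = cong (x ∷_) (go σ)

  IsPerm : ℕ → List ℕ → Set
  IsPerm n σ = σ ↭ upTo n

  module _ {n σ} (p : IsPerm n σ) where
    perm-length : length σ ≡ n
    perm-length = trans (↭-length p) (length-upTo n)

    perm-unique : Unique σ
    perm-unique = Unique-resp (↭-sym p) (Uniq.upTo⁺ n)

    perm-distinct : Distinct σ
    perm-distinct = Unique⇒Distinct perm-unique

    perm-∈⁺ : ∀ {v} → v < n → v ∈ σ
    perm-∈⁺ lt = ∈-resp-↭ (↭-sym p) (∈-upTo⁺ lt)

    perm-∈⁻ : ∀ {v} → v ∈ σ → v < n
    perm-∈⁻ i = ∈-upTo⁻ (∈-resp-↭ p i)

    map-at-inv : map (at σ) (invPerm σ) ≡ upTo n
    map-at-inv = trans (sym (map-∘ (upTo (length σ)))) (trans (map-id-local′ (upTo (length σ)) λ i → at-pos σ (perm-∈⁺ (subst (_ <_) perm-length (∈-upTo⁻ i)))) (cong upTo perm-length))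
      where
      map-id-local′ : ∀ {f : ℕ → ℕ} xs → (∀ {x} → x ∈ xs → f x ≡ x) → map f xs ≡ xs
      map-id-local′ [] _ = refl
      map-id-local′ (x ∷ xs) h = cong₂ _∷_ (h (here refl)) (map-id-local′ xs (h ∘ there))

    at-inv : ∀ {v} → v < n → at (invPerm σ) v ≡ pos v σ
    at-inv {v} lt = go (λ i → pos i σ) (length σ) v (subst (v <_) (sym perm-length) lt)
      where
      go : ∀ (f : ℕ → ℕ) N v → v < N → at (map f (upTo N)) v ≡ f v
      go f N v lt = trans (cong (λ z → at z v) (map-upTo f N)) (go' f N v lt)
        where
        go' : ∀ (f : ℕ → ℕ) N v → v < N → at (applyUpTo f N) v ≡ f v
        go' f (suc N) zero _ = refl
        go' f (suc N) (suc v) (s≤s lt) = go' (f ∘ suc) N v lt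

    inv-length : length (invPerm σ) ≡ n
    inv-length = trans (length-map _ (upTo (length σ))) (trans (length-upTo _) perm-length)

    inv-perm : IsPerm n (invPerm σ)
    inv-perm = unique⇒↭ (Uniq.map⁻ {f = at σ} (subst Unique (sym map-at-inv) (Uniq.upTo⁺ n))) (Uniq.upTo⁺ n)
      (λ i → let (v , j , e) = ∈-map⁻ _ i in ∈-upTo⁺ (subst₂ _<_ (sym e) perm-length (pos< σ (perm-∈⁺ (subst (v <_) perm-length (∈-upTo⁻ j))))))
      (λ {j} i → let lt = subst (j <_) (sym perm-length) (∈-upTo⁻ i) in
         subst (_∈ invPerm σ) (pos-at σ j perm-distinct lt)
           (∈-map⁺ (λ i → pos i σ) (∈-upTo⁺ (subst (at σ j <_) (sym perm-length) (perm-∈⁻ (at-∈ σ j lt))))))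

    -- For finite permutations a right inverse is the inverse. Inverses of composite words are
    -- identified through this criterion.
    inv-unique : ∀ ρ → All (_< n) ρ → map (at σ) ρ ≡ upTo n → ρ ≡ invPerm σ
    inv-unique ρ a e = trans (sym (go ρ a)) (trans (map-∘ ρ) (trans (cong (map (λ i → pos i σ)) e) (cong (map (λ i → pos i σ) ∘ upTo) (sym perm-length))))
      where
      go : ∀ ρ → All (_< n) ρ → map (λ r → pos (at σ r) σ) ρ ≡ ρ
      go [] _ = refl
      go (r ∷ ρ) (lt ∷ a) = cong₂ _∷_ (pos-at σ r perm-distinct (subst (r <_) (sym perm-length) lt)) (go ρ a)

  invPerm-involutive : ∀ {n σ} → IsPerm n σ → invPerm (invPerm σ) ≡ σ
  invPerm-involutive {n} {σ} p = sym (inv-unique (inv-perm p) σ (All.tabulate (perm-∈⁻ p)) (begin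
      map (at (invPerm σ)) σ ≡⟨ cong (map (at (invPerm σ))) (sym (map-at-upTo σ)) ⟩
      map (at (invPerm σ)) (map (at σ) (upTo (length σ))) ≡⟨ sym (map-∘ (upTo (length σ))) ⟩
      map (at (invPerm σ) ∘ at σ) (upTo (length σ)) ≡⟨ go (upTo (length σ)) (λ i → ∈-upTo⁻ i) ⟩
      upTo (length σ) ≡⟨ cong upTo (perm-length p) ⟩
      upTo n ∎))
    where
    open ≡-Reasoning
    go : ∀ xs → (∀ {j} → j ∈ xs → j < length σ) → map (at (invPerm σ) ∘ at σ) xs ≡ xs
    go [] _ = refl
    go (x ∷ xs) h = cong₂ _∷_ (trans (at-inv p (perm-∈⁻ p (at-∈ σ x (h (here refl))))) (pos-at σ x (perm-distinct p) (h (here refl)))) (go xs (h ∘ there))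

  ∈-insertAll⁺ : ∀ x l r → l ++ x ∷ r ∈ insertAll x (l ++ r)
  ∈-insertAll⁺ x [] [] = here refl
  ∈-insertAll⁺ x [] (_ ∷ _) = here refl
  ∈-insertAll⁺ x (y ∷ l) r = there (∈-map⁺ (y ∷_) (∈-insertAll⁺ x l r))

  ∈-insertAll⁻ : ∀ x ys {zs} → zs ∈ insertAll x ys → ∃₂ λ l r → ys ≡ l ++ r × zs ≡ l ++ x ∷ r
  ∈-insertAll⁻ x [] (here refl) = [] , [] , refl , refl
  ∈-insertAll⁻ x (y ∷ ys) (here refl) = [] , y ∷ ys , refl , refl
  ∈-insertAll⁻ x (y ∷ ys) (there i) with ∈-map⁻ (y ∷_) i
  ... | (zs , j , refl) with ∈-insertAll⁻ x ys j
  ...   | (l , r , refl , refl) = y ∷ l , r , refl , refl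

  ∈-perms⁺ : ∀ xs {zs} → zs ↭ xs → zs ∈ perms xs
  ∈-perms⁺ [] s rewrite Perm.↭-empty-inv s = here refl
  ∈-perms⁺ (x ∷ xs) s with ∈-∃++ (∈-resp-↭ (↭-sym s) (here refl))
  ... | (l , r , refl) = ∈-concatMap-join (insertAll x) (∈-perms⁺ xs (drop-mid l [] s)) (∈-insertAll⁺ x l r)

  ∈-perms⁻ : ∀ xs {zs} → zs ∈ perms xs → zs ↭ xs
  ∈-perms⁻ [] (here refl) = ↭-refl
  ∈-perms⁻ (x ∷ xs) i with ∈-concatMap-split (insertAll x) (perms xs) i
  ... | (ys , j , k) with ∈-insertAll⁻ x ys k
  ...   | (l , r , refl , refl) = ↭-trans (shift x l r) (prep x (∈-perms⁻ xs j))

  insertAll-unique : ∀ x ys → x ∉ ys → Unique (insertAll x ys)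
  insertAll-unique x [] _ = [] ∷ []
  insertAll-unique x (y ∷ ys) n = All.tabulate (λ i e → case ∈-map⁻ (y ∷_) i of λ { (_ , _ , e') → n (here (∷-injectiveˡ (trans e e'))) })
    ∷ Uniq.map⁺ ∷-injectiveʳ (insertAll-unique x ys (n ∘ there))

  mid-inj : ∀ {x : ℕ} l r l' r' → x ∉ l ++ r → x ∉ l' ++ r' → l ++ x ∷ r ≡ l' ++ x ∷ r' → l ++ r ≡ l' ++ r'
  mid-inj [] r [] r' _ _ e = ∷-injectiveʳ e
  mid-inj [] r (y ∷ l') r' _ n e = ⊥-elim (n (here (∷-injectiveˡ e)))
  mid-inj (y ∷ l) r [] r' n _ e = ⊥-elim (n (here (sym (∷-injectiveˡ e))))
  mid-inj (y ∷ l) r (y' ∷ l') r' n n' e = cong₂ _∷_ (∷-injectiveˡ e) (mid-inj l r l' r' (n ∘ there) (n' ∘ there) (∷-injectiveʳ e))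

  perms-unique : ∀ xs → Distinct xs → Unique (perms xs)
  perms-unique [] _ = [] ∷ []
  perms-unique (x ∷ xs) (n , D) = concatMap-unique (insertAll x) (perms-unique xs D)
    (λ {ys} i → insertAll-unique x ys (x∉ i)) dj
    where
    x∉ : ∀ {ys} → ys ∈ perms xs → x ∉ ys
    x∉ i = n ∘ ∈-resp-↭ (∈-perms⁻ xs i)
    dj : ∀ {ys ys' z} → ys ∈ perms xs → ys' ∈ perms xs → z ∈ insertAll x ys → z ∈ insertAll x ys' → ys ≡ ys'
    dj {ys} {ys'} i i' j j' with ∈-insertAll⁻ x ys j | ∈-insertAll⁻ x ys' j'
    ... | (l , r , refl , refl) | (l' , r' , refl , e) = mid-inj l r l' r' (x∉ i) (x∉ i') e

  iota : ℕ → ℕ → List ℕ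
  iota k zero = []
  iota k (suc n) = k ∷ iota (suc k) n

  applyUpTo-iota : ∀ (f : ℕ → ℕ) k n → (∀ i → f i ≡ k + i) → applyUpTo f n ≡ iota k n
  applyUpTo-iota f k zero h = refl
  applyUpTo-iota f k (suc n) h = cong₂ _∷_ (trans (h 0) (+-identityʳ k)) (applyUpTo-iota (f ∘ suc) (suc k) n (λ i → trans (h (suc i)) (+-suc k i)))

  upTo-iota : ∀ n → upTo n ≡ iota 0 n
  upTo-iota n = applyUpTo-iota id 0 n (λ _ → refl)

  reverse-mapMaybe : (f : A → Maybe B) (xs : List A) → reverse (mapMaybe f xs) ≡ mapMaybe f (reverse xs)
  reverse-mapMaybe f [] = refl
  reverse-mapMaybe f (x ∷ xs) rewrite unfold-reverse x xs | mapMaybe-++ f (reverse xs) (x ∷ []) | sym (reverse-mapMaybe f xs) with f x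
  ... | just y = unfold-reverse y (mapMaybe f xs)
  ... | nothing = sym (++-identityʳ _)

-- Block decompositions of words and of paths.

module RunDecompositions (m : ℕ) where
  open import Data.Nat
  open import Data.Nat.Properties
  open F using (zero; suc)
  open GrowthInsertion m

  -- (n , b) stands for a block of n letters of colour b.
  Run : Set
  Run = ℕ × Fin m

  -- X is a concatenation of increasing monochromatic blocks of type w, the first letter being at least p.
  comp : ℕ → List Run → List Letter → Bool
  comp p [] [] = true
  comp p [] (_ ∷ _) = false
  comp p ((zero , b) ∷ w) X = comp 0 w X
  comp p ((suc n , b) ∷ w) [] = false
  comp p ((suc n , b) ∷ w) ((b' , x) ∷ X) = does (b' ≟ᶠ b) ∧ ((p ≤ᵇ x) ∧ comp (suc x) ((n , b) ∷ w) X)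

  -- The relational form of `comp`, with the order inside a block as a parameter, so that the same
  -- notion serves words (strict order of values) and paths (weak order of rows).
  Blocks : (Cell → Cell → Set) → List Run → List Cell → Set
  Blocks L [] X = X ≡ []
  Blocks L ((n , b) ∷ w) X = ∃₂ λ Y Z → X ≡ Y ++ Z × length Y ≡ n × All (λ a → proj₁ a ≡ b) Y × Linked L Y × Blocks L w Z

  _<ₗ_ _>ₗ_ _≤ₗ_ : Cell → Cell → Set
  a <ₗ a' = proj₂ a < proj₂ a'
  a >ₗ a' = proj₂ a' < proj₂ a
  a ≤ₗ a' = proj₂ a ≤ proj₂ a'

  ∧-true : ∀ {a b} → a ∧ b ≡ true → a ≡ true × b ≡ true
  ∧-true {true} {true} _ = refl , refl

  ≤ᵇ-true : ∀ {p x} → p ≤ x → (p ≤ᵇ x) ≡ true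
  ≤ᵇ-true {p} {x} le with p ≤ᵇ x | ≤⇒≤ᵇ le
  ... | true | _ = refl

  comp⇒Blocks : ∀ p w X → comp p w X ≡ true → Blocks _<ₗ_ w X
  comp⇒Blocks′ : ∀ p n b w X → comp p ((n , b) ∷ w) X ≡ true →
    ∃₂ λ Y Z → X ≡ Y ++ Z × length Y ≡ n × All (λ a → proj₁ a ≡ b) Y × Linked _<ₗ_ Y × All ((p ≤_) ∘ proj₂) Y × Blocks _<ₗ_ w Z
  comp⇒Blocks p [] [] _ = refl
  comp⇒Blocks p ((n , b) ∷ w) X e with comp⇒Blocks′ p n b w X e
  ... | (Y , Z , e₁ , e₂ , a , l , _ , B) = Y , Z , e₁ , e₂ , a , l , B
  comp⇒Blocks′ p zero b w X e = [] , X , refl , refl , [] , [] , [] , comp⇒Blocks 0 w X e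
  comp⇒Blocks′ p (suc n) b w ((b' , x) ∷ X) e with b' ≟ᶠ b | ∧-true {does (b' ≟ᶠ b)} e
  ... | no _ | (() , _)
  ... | yes eb | (_ , e') with ∧-true {p ≤ᵇ x} e'
  ...   | (le , e'') with comp⇒Blocks′ (suc x) n b w X e''
  ...     | (Y , Z , refl , refl , a , l , bd , B) = (b' , x) ∷ Y , Z , refl , refl , eb ∷ a , link Y bd l ,
              (p≤ ∷ All.map (λ q → ≤-trans p≤ (≤-trans (n≤1+n x) q)) bd) , B
    where
    p≤ : p ≤ x
    p≤ = ≤ᵇ⇒≤ p x (subst T (sym le) tt)
    link : ∀ Y → All ((suc x ≤_) ∘ proj₂) Y → Linked _<ₗ_ Y → Linked _<ₗ_ ((b' , x) ∷ Y)
    link [] _ _ = [-]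
    link (y ∷ Y) (q ∷ _) l = q ∷ l

  Blocks⇒comp : ∀ w X → Blocks _<ₗ_ w X → comp 0 w X ≡ true
  Blocks⇒comp′ : ∀ p b w Y Z → All (λ a → proj₁ a ≡ b) Y → Linked _<ₗ_ Y → All ((p ≤_) ∘ proj₂) Y → Blocks _<ₗ_ w Z →
    comp p ((length Y , b) ∷ w) (Y ++ Z) ≡ true
  Blocks⇒comp [] .[] refl = refl
  Blocks⇒comp ((n , b) ∷ w) X (Y , Z , refl , refl , a , l , B) = Blocks⇒comp′ 0 b w Y Z a l (All.tabulate (λ _ → z≤n)) B
  Blocks⇒comp′ p b w [] Z _ _ _ B = Blocks⇒comp w Z B
  Blocks⇒comp′ p b w ((b' , x) ∷ Y) Z (eb ∷ a) l (q ∷ bd) B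
    rewrite dec-true (b' ≟ᶠ b) eb | ≤ᵇ-true q = Blocks⇒comp′ (suc x) b w Y Z a (Linked.tail l) (above Y l) B
    where
    above : ∀ {x} Y → Linked _<ₗ_ (x ∷ Y) → All ((suc (proj₂ x) ≤_) ∘ proj₂) Y
    above [] _ = []
    above (y ∷ Y) (q ∷ l) = q ∷ All.map (<-trans q) (above Y l)

  Linked-snoc : ∀ {L : Cell → Cell → Set} Y {y z} → Linked L (Y ++ y ∷ []) → L y z → Linked L (Y ++ y ∷ z ∷ [])
  Linked-snoc [] _ q = q ∷ [-]
  Linked-snoc (x ∷ []) (r ∷ l) q = r ∷ Linked-snoc [] l q
  Linked-snoc (x ∷ x' ∷ Y) (r ∷ l) q = r ∷ Linked-snoc (x' ∷ Y) l q

  Linked-reverse : ∀ {L : Cell → Cell → Set} Y → Linked L Y → Linked (flip L) (reverse Y)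
  Linked-reverse [] _ = []
  Linked-reverse (y ∷ []) _ = [-]
  Linked-reverse {L} (x ∷ y ∷ Y) (q ∷ l) = subst (Linked (flip L)) (sym (trans (unfold-reverse x (y ∷ Y)) (trans (cong (_++ x ∷ []) (unfold-reverse y Y)) (++-assoc (reverse Y) (y ∷ []) (x ∷ [])))))
    (Linked-snoc (reverse Y) (subst (Linked (flip L)) (unfold-reverse y Y) (Linked-reverse (y ∷ Y) l)) q)

  Blocks-++ : ∀ {L} w w' X X' → Blocks L w X → Blocks L w' X' → Blocks L (w ++ w') (X ++ X')
  Blocks-++ [] w' .[] X' refl B = B
  Blocks-++ ((n , b) ∷ w) w' X X' (Y , Z , refl , e , a , l , B) B' = Y , Z ++ X' , ++-assoc Y Z X' , e , a , l , Blocks-++ w w' Z X' B B'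

  Blocks-reverse : ∀ {L} w X → Blocks L w X → Blocks (flip L) (reverse w) (reverse X)
  Blocks-reverse [] .[] refl = refl
  Blocks-reverse {L} ((n , b) ∷ w) .(Y ++ Z) (Y , Z , refl , e , a , l , B) =
    subst₂ (Blocks (flip L)) (sym (unfold-reverse (n , b) w)) (sym (reverse-++ Y Z))
      (Blocks-++ (reverse w) ((n , b) ∷ []) (reverse Z) (reverse Y) (Blocks-reverse w Z B)
        (reverse Y , [] , sym (++-identityʳ _) , trans (length-reverse Y) e , All-resp-↭ (↭-sym (↭-reverse Y)) a , Linked-reverse Y l , refl))

  -- Insertion begins at the end of a list, so a word is reversed before it is inserted: its blocks
  -- then come in the opposite order and decrease.
  comp⇔reverse : ∀ w X → (comp 0 w X ≡ true → Blocks _>ₗ_ (reverse w) (reverse X)) × (Blocks _>ₗ_ (reverse w) (reverse X) → comp 0 w X ≡ true)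
  comp⇔reverse w X = (λ e → Blocks-reverse w X (comp⇒Blocks 0 w X e)) ,
    λ B → Blocks⇒comp w X (subst₂ (Blocks _<ₗ_) (reverse-involutive w) (reverse-involutive X) (Blocks-reverse (reverse w) (reverse X) B))

  path : List Letter → List Cell
  path R = proj₂ (run R)

  -- A cut of the word is a cut of the path at the same place, so blocks can be transported one by
  -- one. As `Y` is inserted from its end, `_>ₗ_` means increasing insertion; the new boxes then
  -- move weakly upwards in time, and `P` has the newest first. Conversely, distinctness excludes
  -- equal neighbours, which row bumping does not cover.
  path-++ : ∀ Y Z → ∃ λ P → path (Y ++ Z) ≡ P ++ path Z × length P ≡ length Y × map proj₁ P ≡ map proj₁ Y ×
    (∀ b → All (λ a → proj₁ a ≡ b) Y → (Linked _>ₗ_ Y → Linked _≤ₗ_ P) × (Distinct (vals (Y ++ Z)) → Linked _≤ₗ_ P → Linked _>ₗ_ Y))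
  path-++ [] Z = [] , refl , refl , refl , λ _ _ → (λ _ → []) , λ _ _ → []
  path-++ ((b , x) ∷ []) Z = proj₂ (ins (b , x) (proj₁ (run Z))) ∷ [] , refl , refl , cong (_∷ []) (ins-colour b x (proj₁ (run Z))) , λ _ _ → (λ _ → [-]) , λ _ _ → [-]
  path-++ ((b , x) ∷ (b' , x') ∷ Y) Z with path-++ ((b' , x') ∷ Y) Z
  ... | (d ∷ P , e , el , ec , lk) = proj₂ (ins (b , x) (proj₁ (run ((b' , x') ∷ Y ++ Z)))) ∷ d ∷ P ,
        cong (proj₂ (ins (b , x) (proj₁ (run ((b' , x') ∷ Y ++ Z)))) ∷_) e , cong suc el , cong₂ _∷_ (ins-colour b x (proj₁ (run ((b' , x') ∷ Y ++ Z)))) ec , λ c a → fw c a , bw c a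
    where
    d≡ : d ≡ proj₂ (ins (b' , x') (proj₁ (run (Y ++ Z))))
    d≡ = sym (∷-injectiveˡ e)
    E = proj₁ (run (Y ++ Z))
    fw : ∀ c → All (λ a → proj₁ a ≡ c) ((b , x) ∷ (b' , x') ∷ Y) → Linked _>ₗ_ ((b , x) ∷ (b' , x') ∷ Y) → Linked _≤ₗ_ (_ ∷ d ∷ P)
    fw c (refl ∷ refl ∷ a) (q ∷ l) = subst (λ z → _ ≤ proj₂ z) (sym d≡) (bump-≤ b x' x E q) ∷ proj₁ (lk c (refl ∷ a)) l
    bw : ∀ c → All (λ a → proj₁ a ≡ c) ((b , x) ∷ (b' , x') ∷ Y) → Distinct (vals ((b , x) ∷ (b' , x') ∷ Y ++ Z)) → Linked _≤ₗ_ (_ ∷ d ∷ P) → Linked _>ₗ_ ((b , x) ∷ (b' , x') ∷ Y)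
    bw c (refl ∷ refl ∷ a) (n , D) (q ∷ l) with <-cmp x' x
    ... | tri< lt _ _ = lt ∷ proj₂ (lk c (refl ∷ a)) D l
    ... | tri≈ _ e _ = ⊥-elim (n (here (sym e)))
    ... | tri> _ _ gt = ⊥-elim (<-irrefl refl (<-≤-trans (bump-< b x' x E gt) (subst (λ z → _ ≤ proj₂ z) d≡ q)))

  colours-All : ∀ {b} (P Y : List Cell) → map proj₁ P ≡ map proj₁ Y → All (λ a → proj₁ a ≡ b) Y → All (λ a → proj₁ a ≡ b) P
  colours-All {b} P Y e a = AllP.map⁻ (subst (All (_≡ b)) (sym e) (AllP.map⁺ a))

  Blocks⇒path : ∀ w R → Blocks _>ₗ_ w R → Blocks _≤ₗ_ w (path R)
  Blocks⇒path [] .[] refl = refl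
  Blocks⇒path ((n , b) ∷ w) .(Y ++ Z) (Y , Z , refl , e , a , l , B) with path-++ Y Z
  ... | (P , eP , el , ec , lk) = P , path Z , eP , trans el e , colours-All P Y ec a , proj₁ (lk b a) l , Blocks⇒path w Z B

  Distinct-++ʳ : ∀ Y {Z} → Distinct (vals (Y ++ Z)) → Distinct (vals Z)
  Distinct-++ʳ [] D = D
  Distinct-++ʳ (_ ∷ Y) (_ , D) = Distinct-++ʳ Y D

  split-length : ∀ {A B : Set} (R : List A) (P Q : List B) → length R ≡ length (P ++ Q) → ∃₂ λ Y Z → R ≡ Y ++ Z × length Y ≡ length P
  split-length R [] Q _ = [] , R , refl , refl
  split-length (x ∷ R) (_ ∷ P) Q e with split-length R P Q (suc-injective e)
  ... | (Y , Z , refl , el) = x ∷ Y , Z , refl , cong suc el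

  path⇒Blocks : ∀ w R → Distinct (vals R) → Blocks _≤ₗ_ w (path R) → Blocks _>ₗ_ w R
  path⇒Blocks [] [] _ _ = refl
  path⇒Blocks ((n , b) ∷ w) R D (P , Q , e , eP , a , l , B) with split-length R P Q (trans (sym (run-length R)) (cong length e))
  ... | (Y , Z , refl , eY) with path-++ Y Z
  ...   | (P' , eP' , el , ec , lk) with ++-inj P' P (trans el eY) (trans (sym eP') e)
  ...     | (refl , refl) = let aY = colours-All Y P' (sym ec) a in
            Y , Z , refl , trans eY eP , aY , proj₂ (lk b aY) D l , path⇒Blocks w Z (Distinct-++ʳ Y D) B

  -- By the row bumping lemma (bump-≤, bump-<), block decompositions depend only on the path of new cells.
  comp⇔path : ∀ w X → Distinct (vals (reverse X)) →
    (comp 0 w X ≡ true → Blocks _≤ₗ_ (reverse w) (path (reverse X))) × (Blocks _≤ₗ_ (reverse w) (path (reverse X)) → comp 0 w X ≡ true)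
  comp⇔path w X D = (λ e → Blocks⇒path (reverse w) (reverse X) (proj₁ (comp⇔reverse w X) e)) ,
    λ B → proj₂ (comp⇔reverse w X) (path⇒Blocks (reverse w) (reverse X) D B)

-- Horizontal strips and their enumeration.

module Strips where
  open import Data.Nat
  open import Data.Nat.Properties
  open F using (zero; suc)
  open Permutations

  Wk : List ℕ → Set
  Wk [] = ⊤
  Wk (l ∷ λ') = head0 λ' ≤ l × Wk λ'

  -- Horizontal strip condition for lists of the same length: a row that is emptied remains as a
  -- zero, so `μ` is determined by its row lengths (`Strip-ext`).
  Strip : List ℕ → List ℕ → Set
  Strip [] [] = ⊤
  Strip (l ∷ λ') (u ∷ μ) = u ≤ l × head0 λ' ≤ u × Strip λ' μ
  Strip [] (_ ∷ _) = ⊥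
  Strip (_ ∷ _) [] = ⊥

  Strip-head : ∀ λ' μ → Strip λ' μ → head0 μ ≤ head0 λ'
  Strip-head [] [] _ = z≤n
  Strip-head (l ∷ λ') (u ∷ μ) (le , _) = le

  Strip-Wk : ∀ λ' μ → Strip λ' μ → Wk μ
  Strip-Wk [] [] _ = tt
  Strip-Wk (l ∷ λ') (u ∷ μ) (_ , h , s) = ≤-trans (Strip-head λ' μ s) h , Strip-Wk λ' μ s

  private
    row : ℕ → List ℕ → List ℕ × ℕ → List (List ℕ × ℕ)
    row l rest p = map (λ j → ((l ∸ j) ∷ proj₁ p , proj₂ p + j)) (upTo (suc (l ∸ head0 rest)))

  stripsL⁻ : ∀ λ' {p} → Wk λ' → p ∈ stripsL λ' → Strip λ' (proj₁ p) × proj₂ p + sum (proj₁ p) ≡ sum λ'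
  stripsL⁻ [] _ (here refl) = tt , refl
  stripsL⁻ (l ∷ λ') (h , W) i with ∈-concatMap-split (row l λ') (stripsL λ') i
  ... | ((μ , s) , j , k) with ∈-map⁻ _ k | stripsL⁻ λ' W j
  ...   | (t , q , refl) | (S , e) = (m∸n≤m l t , ≤-trans (≤-reflexive (sym (m∸[m∸n]≡n h))) (∸-monoʳ-≤ l (≤-pred (∈-upTo⁻ q))) , S) , (begin
            s + t + (l ∸ t + sum μ) ≡⟨ +-assoc s t _ ⟩
            s + (t + (l ∸ t + sum μ)) ≡⟨ cong (s +_) (sym (+-assoc t (l ∸ t) (sum μ))) ⟩
            s + (t + (l ∸ t) + sum μ) ≡⟨ cong (λ z → s + (z + sum μ)) (m+[n∸m]≡n (≤-trans (≤-pred (∈-upTo⁻ q)) (m∸n≤m l (head0 λ')))) ⟩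
            s + (l + sum μ) ≡⟨ sym (+-assoc s l _) ⟩
            s + l + sum μ ≡⟨ cong (_+ sum μ) (+-comm s l) ⟩
            l + s + sum μ ≡⟨ +-assoc l s _ ⟩
            l + (s + sum μ) ≡⟨ cong (l +_) e ⟩
            l + sum λ' ∎)
    where open ≡-Reasoning

  stripsL⁺ : ∀ λ' μ → Strip λ' μ → ∃ λ s → (μ , s) ∈ stripsL λ'
  stripsL⁺ [] [] _ = 0 , here refl
  stripsL⁺ (l ∷ λ') (u ∷ μ) (le , h , S) with stripsL⁺ λ' μ S
  ... | (s , i) = s + (l ∸ u) , ∈-concatMap-join (row l λ') i
        (subst (λ z → (z ∷ μ , s + (l ∸ u)) ∈ row l λ' (μ , s)) (m∸[m∸n]≡n le) (∈-map⁺ (λ j → ((l ∸ j) ∷ μ , s + j)) (∈-upTo⁺ (s≤s (∸-monoʳ-≤ l h)))))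

  stripsL-unique : ∀ λ' → Unique (stripsL λ')
  stripsL-unique [] = [] ∷ []
  stripsL-unique (l ∷ λ') = concatMap-unique (row l λ') (stripsL-unique λ')
    (λ {p} _ → Uniq.map⁺ (λ {j} {j'} e → +-cancelˡ-≡ (proj₂ p) j j' (cong proj₂ e)) (Uniq.upTo⁺ _))
    dj
    where
    dj : ∀ {p p' z} → p ∈ stripsL λ' → p' ∈ stripsL λ' → z ∈ row l λ' p → z ∈ row l λ' p' → p ≡ p'
    dj {p} {p'} _ _ i i' with ∈-map⁻ _ i | ∈-map⁻ _ i'
    ... | (j , q , refl) | (j' , q' , e) = cong₂ _,_ (∷-injectiveʳ (cong proj₁ e))
          (+-cancelʳ-≡ j _ _ (trans (cong proj₂ e) (cong (proj₂ p' +_) (sym (∸-cancelˡ-≡ (bd q) (bd q') (∷-injectiveˡ (cong proj₁ e)))))))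
      where
      bd : ∀ {j} → j ∈ upTo (suc (l ∸ head0 λ')) → j ≤ l
      bd q = ≤-trans (≤-pred (∈-upTo⁻ q)) (m∸n≤m l (head0 λ'))

  mapMaybe-∈⁻ : ∀ {A B : Set} (f : A → Maybe B) xs {z} → z ∈ mapMaybe f xs → ∃ λ x → x ∈ xs × f x ≡ just z
  mapMaybe-∈⁻ f (x ∷ xs) i with f x in e
  ... | nothing = let (y , j , q) = mapMaybe-∈⁻ f xs i in y , there j , q
  mapMaybe-∈⁻ f (x ∷ xs) (here refl) | just _ = x , here refl , e
  mapMaybe-∈⁻ f (x ∷ xs) (there i) | just _ = let (y , j , q) = mapMaybe-∈⁻ f xs i in y , there j , q

  mapMaybe-∈⁺ : ∀ {A B : Set} (f : A → Maybe B) {xs x z} → x ∈ xs → f x ≡ just z → z ∈ mapMaybe f xs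
  mapMaybe-∈⁺ f {x ∷ xs} (here refl) e rewrite e = here refl
  mapMaybe-∈⁺ f {y ∷ xs} (there i) e with f y
  ... | nothing = mapMaybe-∈⁺ f i e
  ... | just _ = there (mapMaybe-∈⁺ f i e)

  mapMaybe-unique : ∀ {A B : Set} (f : A → Maybe B) {xs} → Unique xs → (∀ {x y z} → x ∈ xs → y ∈ xs → f x ≡ just z → f y ≡ just z → x ≡ y) → Unique (mapMaybe f xs)
  mapMaybe-unique f [] _ = []
  mapMaybe-unique f {x ∷ xs} (a ∷ u) inj with f x in e
  ... | nothing = mapMaybe-unique f u (λ i j → inj (there i) (there j))
  ... | just z = All.tabulate (λ i e' → let (y , j , q) = mapMaybe-∈⁻ f xs i in All.lookup a j (inj (here refl) (there j) e (trans q (cong just (sym e')))))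
                 ∷ mapMaybe-unique f u (λ i j → inj (there i) (there j))

  private
    sel : ℕ → List ℕ × ℕ → Maybe (List ℕ)
    sel k p = if proj₂ p ≡ᵇ k then just (proj₁ p) else nothing

    sel-just : ∀ k p {μ} → sel k p ≡ just μ → proj₂ p ≡ k × proj₁ p ≡ μ
    sel-just k p e with proj₂ p ≡ᵇ k in q
    sel-just k p refl | true = ≡ᵇ⇒≡ _ _ (subst T (sym q) tt) , refl

  strips⁻ : ∀ λ' k {μ} → Wk λ' → μ ∈ strips λ' k → Strip λ' μ × k + sum μ ≡ sum λ'
  strips⁻ λ' k W i with mapMaybe-∈⁻ (sel k) (stripsL λ') i
  ... | (p , j , e) with sel-just k p e
  ...   | (refl , refl) = stripsL⁻ λ' W j

  strips⁺ : ∀ λ' k μ → Wk λ' → Strip λ' μ → k + sum μ ≡ sum λ' → μ ∈ strips λ' k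
  strips⁺ λ' k μ W S e with stripsL⁺ λ' μ S
  ... | (s , i) with +-cancelʳ-≡ (sum μ) s k (trans (proj₂ (stripsL⁻ λ' W i)) (sym e))
  ...   | refl = mapMaybe-∈⁺ (sel s) i (cong (if_then just μ else nothing) (≡ᵇ-refl s))

  strips-unique : ∀ λ' k → Unique (strips λ' k)
  strips-unique λ' k = mapMaybe-unique (sel k) (stripsL-unique λ') λ {x} {y} _ _ e e' →
    let (a , b) = sel-just k x e ; (a' , b') = sel-just k y e' in cong₂ _,_ (trans b (sym b')) (trans a (sym a'))

-- Kostka numbers as numbers of lattice paths.

module KostkaPaths (m : ℕ) where
  open import Data.Nat
  open import Data.Nat.Properties
  open F using (zero; suc)
  open GrowthInsertion m
  open RunDecompositions m
  open Permutations using (∈-concatMap-split; ∈-concatMap-join; concatMap-unique)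
  open Strips public

  BP : Set
  BP = Vec (List ℕ) m

  restr : Fin m → List Run → List ℕ
  restr b [] = []
  restr b ((n , b') ∷ ws) with b' ≟ᶠ b
  ... | yes _ = n ∷ restr b ws
  ... | no _ = restr b ws

  restr-≡ : ∀ b n ws → restr b ((n , b) ∷ ws) ≡ n ∷ restr b ws
  restr-≡ b n ws with b ≟ᶠ b
  ... | yes _ = refl
  ... | no ne = ⊥-elim (ne refl)

  restr-≢ : ∀ {b b'} n ws → b' ≢ b → restr b ((n , b') ∷ ws) ≡ restr b ws
  restr-≢ {b} {b'} n ws ne with b' ≟ᶠ b
  ... | yes e = ⊥-elim (ne e)
  ... | no _ = refl

  -- The cells of the skew shape λ/μ in colour b, topmost row first; the rows are numbered from k.
  strip : Fin m → ℕ → List ℕ → List ℕ → List Cell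
  strip b k (l ∷ λ') (u ∷ μ) = replicate (l ∸ u) (b , k) ++ strip b (suc k) λ' μ
  strip b k _ _ = []

  allZeroB : BP → Bool
  allZeroB V = V.foldr (λ _ → Bool) (λ e r → allZero e ∧ r) true V

  -- The lattice paths of given content and block type, produced by the recursion of `kostkaRev`.
  -- The head of the block type is the newest block, hence the outermost strip.
  paths : BP → List Run → List (List Cell)
  paths λ' [] = if allZeroB λ' then [] ∷ [] else []
  paths λ' ((n , b) ∷ ws) = concatMap (λ μ → map (strip b 0 (lookup λ' b) μ ++_) (paths (λ' [ b ]≔ μ) ws)) (strips (lookup λ' b) n)

  Content : BP → List Cell → Set
  Content λ' q = ∀ b i → cnt q (b , i) ≡ at (lookup λ' b) i

  cnt-replicate-≡ : ∀ j c → cnt (replicate j c) c ≡ j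
  cnt-replicate-≡ zero c = refl
  cnt-replicate-≡ (suc j) c = trans (δ+≡ c _) (cong suc (cnt-replicate-≡ j c))

  cnt-∉ : ∀ p d → All (_≢ d) p → cnt p d ≡ 0
  cnt-∉ [] d _ = refl
  cnt-∉ (c ∷ p) d (ne ∷ a) = trans (δ+≢ _ ne) (cnt-∉ p d a)

  strip-rows : ∀ b k λ' μ → All (λ c → proj₁ c ≡ b × k ≤ proj₂ c) (strip b k λ' μ)
  strip-rows b k [] _ = []
  strip-rows b k (l ∷ λ') [] = []
  strip-rows b k (l ∷ λ') (u ∷ μ) = AllP.++⁺ (AllP.replicate⁺ (l ∸ u) (refl , ≤-refl)) (All.map (λ (e , le) → e , ≤-trans (n≤1+n k) le) (strip-rows b (suc k) λ' μ))

  cnt-strip-< : ∀ b k i λ' μ → i < k → cnt (strip b k λ' μ) (b , i) ≡ 0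
  cnt-strip-< b k i λ' μ lt = cnt-∉ _ _ (All.map (λ { (_ , le) refl → <-irrefl refl (<-≤-trans lt le) }) (strip-rows b k λ' μ))

  cnt-strip-≢ : ∀ b b' k i λ' μ → b ≢ b' → cnt (strip b k λ' μ) (b' , i) ≡ 0
  cnt-strip-≢ b b' k i λ' μ ne = cnt-∉ _ _ (All.map (λ { (e , _) refl → ne (sym e) }) (strip-rows b k λ' μ))

  cnt-strip : ∀ b k λ' μ i → Strip λ' μ → cnt (strip b k λ' μ) (b , k + i) + at μ i ≡ at λ' i
  cnt-strip b k [] [] i _ = refl
  cnt-strip b k (l ∷ λ') (u ∷ μ) zero (le , _ , S) = begin
      cnt (replicate (l ∸ u) (b , k) ++ strip b (suc k) λ' μ) (b , k + 0) + u ≡⟨ cong (λ z → cnt (replicate (l ∸ u) (b , k) ++ strip b (suc k) λ' μ) (b , z) + u) (+-identityʳ k) ⟩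
      cnt (replicate (l ∸ u) (b , k) ++ strip b (suc k) λ' μ) (b , k) + u ≡⟨ cong (_+ u) (cnt-++ (replicate (l ∸ u) (b , k)) _ _) ⟩
      cnt (replicate (l ∸ u) (b , k)) (b , k) + cnt (strip b (suc k) λ' μ) (b , k) + u ≡⟨ cong₂ (λ y z → y + z + u) (cnt-replicate-≡ (l ∸ u) (b , k)) (cnt-strip-< b (suc k) k λ' μ ≤-refl) ⟩
      l ∸ u + 0 + u ≡⟨ cong (_+ u) (+-identityʳ _) ⟩
      l ∸ u + u ≡⟨ m∸n+n≡m le ⟩
      l ∎
    where open ≡-Reasoning
  cnt-strip b k (l ∷ λ') (u ∷ μ) (suc i) (le , _ , S) = trans (cong (_+ at μ i) (trans (cnt-++ (replicate (l ∸ u) (b , k)) _ _)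
      (cong₂ _+_ (cnt-∉ (replicate (l ∸ u) (b , k)) _ (AllP.replicate⁺ (l ∸ u) (λ e → <-irrefl (cong proj₂ e) (m<m+n k z<s)))) (cong (λ z → cnt (strip b (suc k) λ' μ) (b , z)) (+-suc k i)))))
    (cnt-strip b (suc k) λ' μ i S)

  length-strip : ∀ b k λ' μ → Strip λ' μ → length (strip b k λ' μ) + sum μ ≡ sum λ'
  length-strip b k [] [] _ = refl
  length-strip b k (l ∷ λ') (u ∷ μ) (le , _ , S) = begin
    length (replicate (l ∸ u) (b , k) ++ strip b (suc k) λ' μ) + (u + sum μ) ≡⟨ cong (_+ (u + sum μ)) (trans (length-++ (replicate (l ∸ u) (b , k))) (cong (_+ _) (length-replicate (l ∸ u)))) ⟩
    l ∸ u + length (strip b (suc k) λ' μ) + (u + sum μ) ≡⟨ interchange (l ∸ u) _ u (sum μ) ⟩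
    l ∸ u + u + (length (strip b (suc k) λ' μ) + sum μ) ≡⟨ cong₂ _+_ (m∸n+n≡m le) (length-strip b (suc k) λ' μ S) ⟩
    l + sum λ' ∎
    where
    open ≡-Reasoning
    open import Algebra.Properties.CommutativeSemigroup +-commutativeSemigroup using (interchange)

  Linked-replicate-++ : ∀ j {b k} Y → All (λ c → k ≤ proj₂ c) Y → Linked _≤ₗ_ Y → Linked _≤ₗ_ (replicate j (b , k) ++ Y)
  Linked-replicate-++ zero Y _ l = l
  Linked-replicate-++ (suc zero) [] _ _ = [-]
  Linked-replicate-++ (suc zero) (y ∷ Y) (le ∷ _) l = le ∷ l
  Linked-replicate-++ (suc (suc j)) Y a l = ≤-refl ∷ Linked-replicate-++ (suc j) Y a l

  strip-sorted : ∀ b k λ' μ → Linked _≤ₗ_ (strip b k λ' μ)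
  strip-sorted b k [] _ = []
  strip-sorted b k (l ∷ λ') [] = []
  strip-sorted b k (l ∷ λ') (u ∷ μ) = Linked-replicate-++ (l ∸ u) _ (All.map (λ (_ , le) → ≤-trans (n≤1+n k) le) (strip-rows b (suc k) λ' μ)) (strip-sorted b (suc k) λ' μ)

  Part-add : ∀ b k Y → Part Y → (∀ k' → k ≡ suc k' → cnt Y (b , k) < cnt Y (b , k')) → Part ((b , k) ∷ Y)
  Part-add b k Y P h b' i with (b , k) ≟c (b' , suc i)
  ... | yes refl = ≤-trans (≤-reflexive (δ+≡ _ _)) (≤-trans (h i refl) (m≤n+m _ (δ (b , suc i) (b , i))))
  ... | no ne = ≤-trans (≤-reflexive (δ+≢ _ ne)) (≤-trans (P b' i) (m≤n+m _ (δ (b , k) (b' , i))))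

  Lat-replicate : ∀ j b k Y → Lat Y → (∀ k' → k ≡ suc k' → cnt Y (b , k) + j ≤ cnt Y (b , k')) → Lat (replicate j (b , k) ++ Y)
  Lat-replicate zero b k Y L _ = L
  Lat-replicate (suc j) b k Y L h with Lat-replicate j b k Y L (λ k' e → ≤-trans (+-monoʳ-≤ (cnt Y (b , k)) (n≤1+n j)) (h k' e))
  ... | L' = Part-add b k (replicate j (b , k) ++ Y) (Lat⇒Part _ L') (λ { k' refl → ≤-trans (≤-reflexive (trans (cong suc
        (trans (cnt-++ (replicate j (b , suc k')) Y _) (trans (cong (_+ _) (cnt-replicate-≡ j _)) (+-comm j _)))) (sym (+-suc (cnt Y (b , suc k')) j))))
        (≤-trans (h k' refl) (≤-trans (m≤n+m (cnt Y (b , k')) (cnt (replicate j (b , suc k')) (b , k'))) (≤-reflexive (sym (cnt-++ (replicate j (b , suc k')) Y (b , k')))))) }) , L'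

  -- In time the lower rows of a strip are filled before the upper ones. A row may grow to its final
  -- length because the old row above is already that long; the last premise carries this condition
  -- across the recursion and is vacuous in row 0.
  Lat-strip : ∀ b k λ' μ Z → Strip λ' μ → Lat Z → (∀ i → cnt Z (b , k + i) ≡ at μ i) → (∀ k' → k ≡ suc k' → head0 λ' ≤ cnt Z (b , k')) →
    Lat (strip b k λ' μ ++ Z)
  Lat-strip b k [] [] Z _ L _ _ = L
  Lat-strip b k (l ∷ λ') (u ∷ μ) Z (le , h , S) L c hd = subst Lat (sym (++-assoc (replicate (l ∸ u) (b , k)) _ Z))
    (Lat-replicate (l ∸ u) b k (strip b (suc k) λ' μ ++ Z)
      (Lat-strip b (suc k) λ' μ Z S L (λ i → trans (cong (λ z → cnt Z (b , z)) (sym (+-suc k i))) (c (suc i)))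
        (λ { k' refl → ≤-trans h (≤-reflexive (sym u≡)) }))
      λ { k' refl → ≤-trans (≤-reflexive (trans (cong (_+ (l ∸ u)) (trans (cnt-++ (strip b (suc k) λ' μ) Z _) (cong₂ _+_ (cnt-strip-< b (suc k) k λ' μ ≤-refl) u≡))) (m+[n∸m]≡n le)))
            (≤-trans (hd k' refl) (≤-trans (m≤n+m _ _) (≤-reflexive (sym (cnt-++ (strip b (suc k) λ' μ) Z (b , k')))))) })
    where
    u≡ : cnt Z (b , k) ≡ u
    u≡ = trans (cong (λ z → cnt Z (b , z)) (sym (+-identityʳ k))) (c 0)

  Lat-++ʳ : ∀ P {Z} → Lat (P ++ Z) → Lat Z
  Lat-++ʳ [] L = L
  Lat-++ʳ (_ ∷ P) (_ , L) = Lat-++ʳ P L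

  peel-row : ∀ b k P → All (λ c → proj₁ c ≡ b × k ≤ proj₂ c) P → Linked _≤ₗ_ P →
    ∃₂ λ j P' → P ≡ replicate j (b , k) ++ P' × All (λ c → proj₁ c ≡ b × suc k ≤ proj₂ c) P' × Linked _≤ₗ_ P'
  peel-row b k [] _ _ = 0 , [] , refl , [] , []
  peel-row b k ((b' , i) ∷ P) ((refl , le) ∷ a) l with k ≟ i
  ... | yes refl = let (j , P' , e , a' , l') = peel-row b k P a (Linked.tail l) in suc j , P' , cong (_ ∷_) e , a' , l'
  ... | no ne = 0 , (b , i) ∷ P , refl , up∀ P (≤∧≢⇒< le ne) (All.map proj₁ a) l , l
    where
    up∀ : ∀ {i} P → k < i → All (λ c → proj₁ c ≡ b) P → Linked _≤ₗ_ ((b , i) ∷ P) → All (λ c → proj₁ c ≡ b × suc k ≤ proj₂ c) ((b , i) ∷ P)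
    up∀ [] lt _ _ = (refl , lt) ∷ []
    up∀ (p ∷ P) lt (refl ∷ a) (q ∷ l) = (refl , lt) ∷ up∀ P (<-≤-trans lt q) a l

  strip-surj : ∀ b k λ' P Z → All (λ c → proj₁ c ≡ b × k ≤ proj₂ c) P → Linked _≤ₗ_ P → Lat (P ++ Z) → (∀ i → cnt (P ++ Z) (b , k + i) ≡ at λ' i) →
    ∃ λ μ → Strip λ' μ × (∀ i → cnt Z (b , k + i) ≡ at μ i) × P ≡ strip b k λ' μ
  strip-surj b k [] [] Z _ _ _ c = [] , tt , c , refl
  strip-surj b k [] ((b' , i) ∷ P) Z ((refl , le) ∷ _) _ _ c =
    ⊥-elim (1+n≢0 (trans (sym (δ+≡ (b , i) _)) (trans (cong (λ z → cnt ((b , i) ∷ P ++ Z) (b , z)) (sym (m+[n∸m]≡n le))) (c (i ∸ k)))))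
  strip-surj b k (l ∷ λ') P Z a s L c with peel-row b k P a s
  ... | (j , P' , refl , a' , s')
      with strip-surj b (suc k) λ' P' Z a' s' (Lat-++ʳ (replicate j (b , k)) (subst Lat (++-assoc (replicate j (b , k)) P' Z) L))
             (λ i → trans (trans (sym (trans (cong (cnt' i) (++-assoc (replicate j (b , k)) P' Z)) (trans (cnt-++ (replicate j (b , k)) (P' ++ Z) _)
                (cong (_+ _) (cnt-∉ (replicate j (b , k)) _ (AllP.replicate⁺ j (λ e → <-irrefl (cong proj₂ e) (s≤s (m≤m+n k i))))))))) (cong (λ z → cnt ((replicate j (b , k) ++ P') ++ Z) (b , z)) (sym (+-suc k i)))) (c (suc i)))
    where
    cnt' : ℕ → List Cell → ℕ
    cnt' i X = cnt X (b , suc k + i)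
  ...   | (μ , S , cμ , e) = cnt Z (b , k) ∷ μ , (m+n≤o⇒n≤o j (≤-reflexive l≡) , hd , S) , cs , cong₂ _++_ (cong (λ z → replicate z (b , k)) (trans (sym (m+n∸n≡m j (cnt Z (b , k)))) (cong (_∸ cnt Z (b , k)) l≡))) e
    where
    P'0 : cnt P' (b , k) ≡ 0
    P'0 = cnt-∉ P' _ (All.map (λ { (_ , le) refl → <-irrefl refl le }) a')
    l≡ : j + cnt Z (b , k) ≡ l
    l≡ = trans (sym (trans (cnt-++ (replicate j (b , k) ++ P') Z (b , k)) (cong (_+ cnt Z (b , k)) (trans (cnt-++ (replicate j (b , k)) P' (b , k)) (trans (cong₂ _+_ (cnt-replicate-≡ j (b , k)) P'0) (+-identityʳ j))))))
           (trans (cong (λ z → cnt ((replicate j (b , k) ++ P') ++ Z) (b , z)) (sym (+-identityʳ k))) (c 0))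
    L' : Lat (P' ++ Z)
    L' = Lat-++ʳ (replicate j (b , k)) (subst Lat (++-assoc (replicate j (b , k)) P' Z) L)
    head0≡ : ∀ λ' → head0 λ' ≡ at λ' 0
    head0≡ [] = refl
    head0≡ (x ∷ _) = refl
    -- Consider the moment when the rows below `k` have received their boxes and row `k` none yet:
    -- the lattice condition then compares the final length of row `k + 1` with the initial length
    -- of row `k`, which is the horizontal strip condition.
    hd : head0 λ' ≤ cnt Z (b , k)
    hd = ≤-trans (≤-reflexive (trans (head0≡ λ') (trans (sym (c 1)) (trans (cong (λ z → cnt ((replicate j (b , k) ++ P') ++ Z) (b , z)) (+-comm k 1))
           (trans (cong (λ X → cnt X (b , suc k)) (++-assoc (replicate j (b , k)) P' Z)) (trans (cnt-++ (replicate j (b , k)) (P' ++ Z) _)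
             (cong (_+ _) (cnt-∉ (replicate j (b , k)) _ (AllP.replicate⁺ j λ e → <-irrefl (cong proj₂ e) (n<1+n k))))))))))
         (≤-trans (Lat⇒Part _ L' b k) (≤-reflexive (trans (cnt-++ P' Z _) (cong (_+ _) P'0))))
    cs : ∀ i → cnt Z (b , k + i) ≡ at (cnt Z (b , k) ∷ μ) i
    cs zero = cong (λ z → cnt Z (b , z)) (+-identityʳ k)
    cs (suc i) = trans (cong (λ z → cnt Z (b , z)) (+-suc k i)) (cμ i)

  Wks : BP → Set
  Wks λ' = ∀ b → Wk (lookup λ' b)

  update-Wks : ∀ λ' b μ → Wks λ' → Strip (lookup λ' b) μ → Wks (λ' [ b ]≔ μ)
  update-Wks λ' b μ W S b' with b' ≟ᶠ b
  ... | yes refl = subst Wk (sym (VP.lookup∘updateAt b λ')) (Strip-Wk _ μ S)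
  ... | no ne = subst Wk (sym (VP.lookup∘updateAt′ b' b ne λ')) (W b')

  allZero⁻ : ∀ l → allZero l ≡ true → ∀ i → at l i ≡ 0
  allZero⁻ [] _ i = refl
  allZero⁻ (zero ∷ l) e zero = refl
  allZero⁻ (zero ∷ l) e (suc i) = allZero⁻ l e i

  allZero⁺ : ∀ l → (∀ i → at l i ≡ 0) → allZero l ≡ true
  allZero⁺ [] _ = refl
  allZero⁺ (x ∷ l) h with h 0
  ... | refl = allZero⁺ l (h ∘ suc)

  allZeroV : ∀ {n} → Vec (List ℕ) n → Bool
  allZeroV V = V.foldr (λ _ → Bool) (λ e r → allZero e ∧ r) true V

  allZeroV⁻ : ∀ {n} (V : Vec (List ℕ) n) → allZeroV V ≡ true → ∀ b i → at (lookup V b) i ≡ 0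
  allZeroV⁻ (l V.∷ V) e zero i = allZero⁻ l (proj₁ (∧-true e)) i
  allZeroV⁻ (l V.∷ V) e (suc b) i = allZeroV⁻ V (proj₂ (∧-true {allZero l} e)) b i

  allZeroV⁺ : ∀ {n} (V : Vec (List ℕ) n) → (∀ b i → at (lookup V b) i ≡ 0) → allZeroV V ≡ true
  allZeroV⁺ V.[] _ = refl
  allZeroV⁺ (l V.∷ V) h rewrite allZero⁺ l (h zero) = allZeroV⁺ V (h ∘ suc)

  content-update : ∀ λ' b μ Z → Strip (lookup λ' b) μ → Content (λ' [ b ]≔ μ) Z → Content λ' (strip b 0 (lookup λ' b) μ ++ Z)
  content-update λ' b μ Z S c b' i with b' ≟ᶠ b
  ... | yes refl = trans (cnt-++ (strip b 0 (lookup λ' b) μ) Z _) (trans (cong (cnt (strip b 0 (lookup λ' b) μ) (b , i) +_) (trans (c b i) (cong (λ z → at z i) (VP.lookup∘updateAt b λ')))) (cnt-strip b 0 (lookup λ' b) μ i S))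
  ... | no ne = trans (cnt-++ (strip b 0 (lookup λ' b) μ) Z _) (cong₂ _+_ (cnt-strip-≢ b b' 0 i (lookup λ' b) μ (ne ∘ sym)) (trans (c b' i) (cong (λ z → at z i) (VP.lookup∘updateAt′ b' b ne λ'))))

  paths⁻ : ∀ λ' ws {q} → Wks λ' → q ∈ paths λ' ws → Lat q × Content λ' q × Blocks _≤ₗ_ ws q
  paths⁻ λ' [] W i with allZeroB λ' in e
  paths⁻ λ' [] W (here refl) | true = tt , (λ b i → sym (allZeroV⁻ λ' e b i)) , refl
  paths⁻ λ' ((n , b) ∷ ws) W i with ∈-concatMap-split (λ μ → map (strip b 0 (lookup λ' b) μ ++_) (paths (λ' [ b ]≔ μ) ws)) (strips (lookup λ' b) n) i
  ... | (μ , j , k) with ∈-map⁻ (strip b 0 (lookup λ' b) μ ++_) k | strips⁻ (lookup λ' b) n (W b) j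
  ...   | (Z , iZ , refl) | (S , e) with paths⁻ (λ' [ b ]≔ μ) ws (update-Wks λ' b μ W S) iZ
  ...     | (L , c , B) = Lat-strip b 0 (lookup λ' b) μ Z S L (λ i → trans (c b i) (cong (λ z → at z i) (VP.lookup∘updateAt b λ'))) (λ _ ()) ,
              content-update λ' b μ Z S c ,
              _ , Z , refl , +-cancelʳ-≡ (sum μ) _ _ (trans (length-strip b 0 (lookup λ' b) μ S) (sym e)) , All.map proj₁ (strip-rows b 0 (lookup λ' b) μ) , strip-sorted b 0 (lookup λ' b) μ , B

  paths⁺ : ∀ λ' ws {q} → Wks λ' → Lat q → Content λ' q → Blocks _≤ₗ_ ws q → q ∈ paths λ' ws
  paths⁺ λ' [] W L c refl rewrite allZeroV⁺ λ' (λ b i → sym (c b i)) = here refl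
  paths⁺ λ' ((n , b) ∷ ws) W L c (P , Z , refl , e , a , l , B)
    with strip-surj b 0 (lookup λ' b) P Z (All.map (λ e → e , z≤n) a) l L (c b)
  ... | (μ , S , cμ , refl) = ∈-concatMap-join (λ μ → map (strip b 0 (lookup λ' b) μ ++_) (paths (λ' [ b ]≔ μ) ws))
        (strips⁺ (lookup λ' b) n μ (W b) S (trans (cong (_+ sum μ) (sym e)) (length-strip b 0 (lookup λ' b) μ S)))
        (∈-map⁺ (strip b 0 (lookup λ' b) μ ++_) (paths⁺ (λ' [ b ]≔ μ) ws (update-Wks λ' b μ W S) (Lat-++ʳ (strip b 0 (lookup λ' b) μ) L) c' B))
    where
    c' : Content (λ' [ b ]≔ μ) Z
    c' b' i with b' ≟ᶠ b
    ... | yes refl = trans (cμ i) (cong (λ z → at z i) (sym (VP.lookup∘updateAt b λ')))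
    ... | no ne = trans (sym (trans (cnt-++ (strip b 0 (lookup λ' b) μ) Z (b' , i)) (cong (_+ cnt Z (b' , i)) (cnt-strip-≢ b b' 0 i (lookup λ' b) μ (ne ∘ sym)))))
                    (trans (c b' i) (cong (λ z → at z i) (sym (VP.lookup∘updateAt′ b' b ne λ'))))

  Strip-ext : ∀ λ' μ μ' → Strip λ' μ → Strip λ' μ' → (∀ i → at μ i ≡ at μ' i) → μ ≡ μ'
  Strip-ext [] [] [] _ _ _ = refl
  Strip-ext (_ ∷ λ') (u ∷ μ) (u' ∷ μ') (_ , _ , S) (_ , _ , S') h = cong₂ _∷_ (h 0) (Strip-ext λ' μ μ' S S' (h ∘ suc))

  paths-unique : ∀ λ' ws → Wks λ' → Unique (paths λ' ws)
  paths-unique λ' [] W with allZeroB λ'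
  ... | true = [] ∷ []
  ... | false = []
  paths-unique λ' ((n , b) ∷ ws) W = concatMap-unique _ (strips-unique (lookup λ' b) n)
    (λ {μ} i → Uniq.map⁺ (++-cancelˡ (strip b 0 (lookup λ' b) μ) _ _) (paths-unique (λ' [ b ]≔ μ) ws (update-Wks λ' b μ W (proj₁ (strips⁻ (lookup λ' b) n (W b) i)))))
    dj
    where
    l = lookup λ' b
    dj : ∀ {μ μ' z} → μ ∈ strips l n → μ' ∈ strips l n → z ∈ map (strip b 0 l μ ++_) (paths (λ' [ b ]≔ μ) ws) → z ∈ map (strip b 0 l μ' ++_) (paths (λ' [ b ]≔ μ') ws) → μ ≡ μ'
    dj {μ} {μ'} i i' j j' with strips⁻ l n (W b) i | strips⁻ l n (W b) i' | ∈-map⁻ (strip b 0 l μ ++_) j | ∈-map⁻ (strip b 0 l μ' ++_) j'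
    ... | (S , e) | (S' , e') | (q , _ , refl) | (q' , _ , eq)
        with ++-inj (strip b 0 l μ) (strip b 0 l μ') (trans (+-cancelʳ-≡ (sum μ) _ _ (trans (length-strip b 0 l μ S) (sym e))) (sym (+-cancelʳ-≡ (sum μ') _ _ (trans (length-strip b 0 l μ' S') (sym e'))))) eq
    ...   | (es , _) = Strip-ext l μ μ' S S' (λ i → +-cancelˡ-≡ (cnt (strip b 0 l μ) (b , i)) _ _ (trans (cnt-strip b 0 l μ i S) (sym (trans (cong (λ z → cnt z (b , i) + at μ' i) es) (cnt-strip b 0 l μ' i S')))))

  ∏ : ∀ {n} → (Fin n → ℕ) → ℕ
  ∏ {zero} f = 1
  ∏ {suc n} f = f zero * ∏ (f ∘ suc)

  ∏-cong : ∀ {n} {f g : Fin n → ℕ} → (∀ b → f b ≡ g b) → ∏ f ≡ ∏ g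
  ∏-cong {zero} h = refl
  ∏-cong {suc n} h = cong₂ _*_ (h zero) (∏-cong (h ∘ suc))

  sum-*ʳ : ∀ {A : Set} (xs : List A) (f : A → ℕ) k → sum (map (λ x → f x * k) xs) ≡ sum (map f xs) * k
  sum-*ʳ [] f k = refl
  sum-*ʳ (x ∷ xs) f k = trans (cong (f x * k +_) (sum-*ʳ xs f k)) (sym (*-distribʳ-+ k (f x) _))

  sum-*ˡ : ∀ {A : Set} (xs : List A) (f : A → ℕ) k → sum (map (λ x → k * f x) xs) ≡ k * sum (map f xs)
  sum-*ˡ [] f k = sym (*-zeroʳ k)
  sum-*ˡ (x ∷ xs) f k = trans (cong (k * f x +_) (sum-*ˡ xs f k)) (sym (*-distribˡ-+ k (f x) _))

  sum-cong : ∀ {A : Set} (xs : List A) {f g : A → ℕ} → (∀ x → f x ≡ g x) → sum (map f xs) ≡ sum (map g xs)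
  sum-cong [] h = refl
  sum-cong (x ∷ xs) h = cong₂ _+_ (h x) (sum-cong xs h)

  -- Removing a strip of colour `b` alters only the factor of that colour, so the sum over strips
  -- can be moved into this factor.
  ∏-linear : ∀ {A : Set} {n} (xs : List A) (g : A → Fin n → ℕ) (h : Fin n → ℕ) b → (∀ x b' → b' ≢ b → g x b' ≡ h b') →
    sum (map (λ x → g x b) xs) ≡ h b → sum (map (∏ ∘ g) xs) ≡ ∏ h
  ∏-linear xs g h zero eq e = trans (sum-cong xs (λ x → cong (g x zero *_) (∏-cong (λ b → eq x (suc b) λ ())))) (trans (sum-*ʳ xs _ _) (cong (_* ∏ (h ∘ suc)) e))
  ∏-linear xs g h (suc b) eq e = trans (sum-cong xs (λ x → cong (_* ∏ (g x ∘ suc)) (eq x zero λ ()))) (trans (sum-*ˡ xs (λ x → ∏ (g x ∘ suc)) (h zero))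
    (cong (h zero *_) (∏-linear xs (λ x → g x ∘ suc) (h ∘ suc) b (λ x b' ne → eq x (suc b') (λ { refl → ne refl })) e)))

  length-concatMap : ∀ {A B : Set} (f : A → List B) xs → length (concatMap f xs) ≡ sum (map (length ∘ f) xs)
  length-concatMap f [] = refl
  length-concatMap f (x ∷ xs) = trans (length-++ (f x)) (cong (length (f x) +_) (length-concatMap f xs))

  ∏-indicator : ∀ {n} (V : Vec (List ℕ) n) → ∏ (λ b → kostkaRev (lookup V b) []) ≡ (if allZeroV V then 1 else 0)
  ∏-indicator V.[] = refl
  ∏-indicator (l V.∷ V) with allZero l
  ... | true = trans (+-identityʳ _) (∏-indicator V)
  ... | false = refl

  length-paths : ∀ λ' ws → length (paths λ' ws) ≡ ∏ (λ b → kostkaRev (lookup λ' b) (restr b ws))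
  length-paths λ' [] = trans len (sym (∏-indicator λ'))
    where
    len : length (paths λ' []) ≡ (if allZeroV λ' then 1 else 0)
    len with allZeroB λ'
    ... | true = refl
    ... | false = refl
  length-paths λ' ((n , b) ∷ ws) = trans (length-concatMap _ (strips (lookup λ' b) n)) (trans
    (sum-cong (strips (lookup λ' b) n) (λ μ → trans (length-map (strip b 0 (lookup λ' b) μ ++_) (paths (λ' [ b ]≔ μ) ws)) (length-paths (λ' [ b ]≔ μ) ws)))
    (∏-linear (strips (lookup λ' b) n) (λ μ b' → kostkaRev (lookup (λ' [ b ]≔ μ) b') (restr b' ws)) _ b
      (λ μ b' ne → trans (cong (λ z → kostkaRev z (restr b' ws)) (VP.lookup∘updateAt′ b' b ne λ')) (cong (kostkaRev (lookup λ' b')) (sym (restr-≢ n ws (ne ∘ sym)))))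
      (trans (sum-cong (strips (lookup λ' b) n) (λ μ → cong (λ z → kostkaRev z (restr b ws)) (VP.lookup∘updateAt b λ'))) (cong (kostkaRev (lookup λ' b)) (sym (restr-≡ b n ws))))))

  -- Unitriangularity by row sums.

  rowsum : List Cell → ℕ
  rowsum q = sum (map proj₂ q)

  wt : List Run → ℕ
  wt [] = 0
  wt ((n , b) ∷ ws) = n * length (restr b ws) + wt ws

  -- The superstandard path: the r-th block of colour b lies in row r.
  can : List Run → List Cell
  can [] = []
  can ((n , b) ∷ ws) = replicate n (b , length (restr b ws)) ++ can ws

  rowsum-++ : ∀ P Z → rowsum (P ++ Z) ≡ rowsum P + rowsum Z
  rowsum-++ [] Z = refl
  rowsum-++ (c ∷ P) Z = trans (cong (proj₂ c +_) (rowsum-++ P Z)) (sym (+-assoc (proj₂ c) _ _))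

  -- The oldest box of the block is also its lowest, and it needs a box of `Z` in the row above. So
  -- a block reaches at most one row further down than its predecessors.
  maxrow : ∀ b r P Z → All (λ c → proj₁ c ≡ b) P → Linked _≤ₗ_ P → Lat (P ++ Z) → (∀ i → r ≤ i → cnt Z (b , i) ≡ 0) → All (λ c → proj₂ c ≤ r) P
  maxrow b r [] Z _ _ _ _ = []
  maxrow b r ((.b , i) ∷ []) Z (refl ∷ []) _ (P , _) h with i ≤? r
  ... | yes le = le ∷ []
  maxrow b r ((.b , zero) ∷ []) Z (refl ∷ []) _ (P , _) h | no nle = ⊥-elim (nle z≤n)
  maxrow b r ((.b , suc i) ∷ []) Z (refl ∷ []) _ (P , _) h | no nle =
    ⊥-elim (1+n≰n (≤-trans (s≤s z≤n) (≤-trans (≤-reflexive (sym (δ+≡ (b , suc i) (cnt Z (b , suc i))))) (≤-trans (P b i) (≤-reflexive (trans (δ+≢ _ up≢) (h i (≤-pred (≰⇒> nle)))))))))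
  maxrow b r (d ∷ d' ∷ P) Z (_ ∷ a) (q ∷ l) (_ , L) h with maxrow b r (d' ∷ P) Z a l L h
  ... | (le ∷ les) = ≤-trans q le ∷ le ∷ les

  sum-max : ∀ b r P → All (λ c → proj₁ c ≡ b) P → All (λ c → proj₂ c ≤ r) P →
    rowsum P ≤ length P * r × (rowsum P ≡ length P * r → P ≡ replicate (length P) (b , r))
  sum-max b r [] _ _ = z≤n , λ _ → refl
  sum-max b r ((.b , i) ∷ P) (refl ∷ a) (le ∷ les) with sum-max b r P a les
  ... | (s , h) = +-mono-≤ le s , λ e → cong₂ _∷_ (cong (b ,_) (≤-antisym le (+-cancelʳ-≤ _ r i (≤-trans (≤-reflexive (sym e)) (+-monoʳ-≤ i s)))))
          (h (≤-antisym s (+-cancelˡ-≤ r _ _ (≤-trans (≤-reflexive (sym e)) (+-monoˡ-≤ _ le)))))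

  -- By `maxrow` a block preceded in time by `r` blocks of its colour stays within rows 0 to `r`;
  -- hence the bound `wt`, and equality puts every box into its lowest admissible row. As the row
  -- sum depends on the content only, this takes the place of dominance order by a comparison of
  -- natural numbers.
  path-bound : ∀ ws q → Blocks _≤ₗ_ ws q → Lat q →
    (∀ b i → length (restr b ws) ≤ i → cnt q (b , i) ≡ 0) × rowsum q ≤ wt ws × (rowsum q ≡ wt ws → q ≡ can ws)
  path-bound [] .[] refl _ = (λ _ _ _ → refl) , z≤n , λ _ → refl
  path-bound ((n , b) ∷ ws) .(P ++ Z) (P , Z , refl , refl , a , l , B) L with path-bound ws Z B (Lat-++ʳ P L)
  ... | (z , s , h) = z' , ≤-trans (≤-reflexive (rowsum-++ P Z)) (+-mono-≤ (proj₁ sm) s) , eq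
    where
    r = length (restr b ws)
    mr = maxrow b r P Z a l L (z b)
    sm = sum-max b r P a mr
    z' : ∀ b' i → length (restr b' ((length P , b) ∷ ws)) ≤ i → cnt (P ++ Z) (b' , i) ≡ 0
    z' b' i le with b ≟ᶠ b'
    ... | yes refl = trans (cnt-++ P Z _) (cong₂ _+_ (cnt-∉ P _ (All.map (λ { q refl → <-irrefl refl (<-≤-trans le q) }) mr)) (z b i (≤-trans (n≤1+n r) le)))
    ... | no ne = trans (cnt-++ P Z _) (cong₂ _+_ (cnt-∉ P _ (All.map (λ { refl refl → ne refl }) a)) (z b' i le))
    eq : rowsum (P ++ Z) ≡ length P * r + wt ws → P ++ Z ≡ replicate (length P) (b , r) ++ can ws
    eq e = cong₂ _++_ (proj₂ sm (≤-antisym (proj₁ sm) (+-cancelʳ-≤ (wt ws) _ _ (≤-trans (≤-reflexive (trans (sym e) (rowsum-++ P Z))) (+-monoʳ-≤ (rowsum P) s)))))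
                      (h (≤-antisym s (+-cancelˡ-≤ (length P * r) _ _ (≤-trans (≤-reflexive (trans (sym e) (rowsum-++ P Z))) (+-monoˡ-≤ (rowsum Z) (proj₁ sm))))))

  rowsum-replicate : ∀ n b r → rowsum (replicate n (b , r)) ≡ n * r
  rowsum-replicate zero b r = refl
  rowsum-replicate (suc n) b r = cong (r +_) (rowsum-replicate n b r)

  rowsum-can : ∀ ws → rowsum (can ws) ≡ wt ws
  rowsum-can [] = refl
  rowsum-can ((n , b) ∷ ws) = trans (rowsum-++ (replicate n (b , length (restr b ws))) (can ws)) (cong₂ _+_ (rowsum-replicate n b _) (rowsum-can ws))

  can-blocks : ∀ ws → Blocks _≤ₗ_ ws (can ws)
  can-blocks [] = refl
  can-blocks ((n , b) ∷ ws) = replicate n (b , length (restr b ws)) , can ws , refl , length-replicate n , AllP.replicate⁺ n refl ,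
    subst (Linked _≤ₗ_) (++-identityʳ _) (Linked-replicate-++ n [] [] []) , can-blocks ws

  at-≥ : ∀ X i → length X ≤ i → at X i ≡ 0
  at-≥ [] i _ = refl
  at-≥ (x ∷ X) (suc i) (s≤s le) = at-≥ X i le

  at-snoc-> : ∀ X n i → length X < i → at (X ++ n ∷ []) i ≡ 0
  at-snoc-> X n i lt = at-≥ (X ++ n ∷ []) i (≤-trans (≤-reflexive (trans (length-++ X) (+-comm _ 1))) lt)

  cnt-can : ∀ ws b i → cnt (can ws) (b , i) ≡ at (reverse (restr b ws)) i
  cnt-can [] b i = refl
  cnt-can ((n , b') ∷ ws) b i with b' ≟ᶠ b
  ... | no ne = trans (cnt-++ (replicate n _) (can ws) _) (cong₂ _+_ (cnt-∉ (replicate n _) _ (AllP.replicate⁺ n (ne ∘ cong proj₁))) (cnt-can ws b i))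
  ... | yes refl = trans (cnt-++ (replicate n (b , r)) (can ws) _) (trans (cong (cnt (replicate n (b , r)) (b , i) +_) (cnt-can ws b i))
                     (trans (cases (<-cmp i r)) (cong (λ z → at z i) (sym (unfold-reverse n rs)))))
    where
    rs = restr b ws
    r = length rs
    X = reverse rs
    eX : length X ≡ r
    eX = length-reverse rs
    cases : Tri (i < r) (i ≡ r) (r < i) → cnt (replicate n (b , r)) (b , i) + at X i ≡ at (X ++ n ∷ []) i
    cases (tri< lt ne _) = trans (cong (_+ at X i) (cnt-∉ (replicate n (b , r)) _ (AllP.replicate⁺ n (λ e → ne (sym (cong proj₂ e)))))) (sym (at-++ˡ X (n ∷ []) i (subst (i <_) (sym eX) lt)))
    cases (tri≈ _ refl _) = trans (cong₂ _+_ (cnt-replicate-≡ n (b , r)) (at-≥ X r (≤-reflexive eX))) (trans (+-identityʳ n) (sym (trans (cong (at (X ++ n ∷ [])) (sym eX)) (at-last X n))))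
    cases (tri> _ ne gt) = trans (cong₂ _+_ (cnt-∉ (replicate n (b , r)) _ (AllP.replicate⁺ n (λ e → ne (sym (cong proj₂ e))))) (at-≥ X i (≤-trans (≤-reflexive eX) (<⇒≤ gt)))) (sym (at-snoc-> X n i (subst (_< i) (sym eX) gt)))

  Wk-snoc : ∀ X n → Wk (X ++ n ∷ []) → Wk X × (∀ k → length X ≡ suc k → n ≤ at X k)
  Wk-snoc [] n _ = tt , λ _ ()
  Wk-snoc (x ∷ []) n (h , _) = (z≤n , tt) , λ { zero refl → h }
  Wk-snoc (x ∷ y ∷ X) n (h , W) with Wk-snoc (y ∷ X) n W
  ... | (W' , last) = (h , W') , λ { (suc k) e → last k (suc-injective e) }

  Lat-can : ∀ ws → (∀ b → Wk (reverse (restr b ws))) → Lat (can ws)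
  Lat-can [] _ = tt
  Lat-can ((n , b) ∷ ws) W = Lat-replicate n b (length (restr b ws)) (can ws) (Lat-can ws W') λ k' e →
      ≤-trans (≤-reflexive (cong (_+ n) (trans (cnt-can ws b _) (at-≥ (reverse (restr b ws)) _ (≤-reflexive (length-reverse (restr b ws)))))))
        (≤-trans (proj₂ snoc k' (trans (length-reverse (restr b ws)) e)) (≤-reflexive (sym (cnt-can ws b k'))))
    where
    snoc : Wk (reverse (restr b ws)) × (∀ k → length (reverse (restr b ws)) ≡ suc k → n ≤ at (reverse (restr b ws)) k)
    snoc = Wk-snoc (reverse (restr b ws)) n (subst Wk (trans (cong reverse (restr-≡ b n ws)) (unfold-reverse n (restr b ws))) (W b))
    W' : ∀ b' → Wk (reverse (restr b' ws))
    W' b' with b ≟ᶠ b'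
    ... | yes refl = proj₁ snoc
    ... | no ne = subst (Wk ∘ reverse) (restr-≢ n ws ne) (W b')

-- Shuffles and the inverses of shuffled permutations.

module Shuffles where
  open F using (zero; suc)
  open Permutations

  idx : Bool → ℕ → List Bool → List ℕ
  idx c k [] = []
  idx c k (true ∷ s) = if c then k ∷ idx c (suc k) s else idx c (suc k) s
  idx c k (false ∷ s) = if c then idx c (suc k) s else k ∷ idx c (suc k) s

  mutual
    -- `idx` copies the local recursion of `indicesOf`. That recursion cannot be named, so the hole
    -- in `go-idx` stands for it; it is found by unification once the counter and the pattern are
    -- abstracted.
    indicesOf-idx : ∀ c s → indicesOf c s ≡ idx c 0 s
    indicesOf-idx c [] = refl
    indicesOf-idx c (true ∷ s) with 1 | true ∷ s
    ... | z | t = cong (λ l → if c then 0 ∷ l else l) (go-idx c t z s)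
    indicesOf-idx c (false ∷ s) with 1 | false ∷ s
    ... | z | t = cong (λ l → if c then l else 0 ∷ l) (go-idx c t z s)

    go-idx : ∀ c t z s → _ ≡ idx c z s
    go-idx c t z [] = refl
    go-idx c t z (true ∷ s) = cong (λ l → if c then z ∷ l else l) (go-idx c t (suc z) s)
    go-idx c t z (false ∷ s) = cong (λ l → if c then l else z ∷ l) (go-idx c t (suc z) s)

  merge-true : ∀ {A : Set} (X : List A) y Y s → merge X (y ∷ Y) (true ∷ s) ≡ y ∷ merge X Y s
  merge-true [] y Y s = refl
  merge-true (_ ∷ _) y Y s = refl

  merge-idx : ∀ k s → merge (idx false k s) (idx true k s) s ≡ iota k (length s)
  merge-idx k [] = refl
  merge-idx k (true ∷ s) = trans (merge-true (idx false (suc k) s) k _ s) (cong (k ∷_) (merge-idx (suc k) s))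
  merge-idx k (false ∷ s) = cong (k ∷_) (merge-idx (suc k) s)

  -- false slots are filled from X, true slots from Y.
  data Fits {A B : Set} : List A → List B → List Bool → Set where
    [] : Fits [] [] []
    left : ∀ {x X Y s} → Fits X Y s → Fits (x ∷ X) Y (false ∷ s)
    right : ∀ {X y Y s} → Fits X Y s → Fits X (y ∷ Y) (true ∷ s)

  fits-[] : ∀ {A B : Set} (Y : List B) → Fits {A} [] Y (replicate (length Y) true)
  fits-[] [] = []
  fits-[] (y ∷ Y) = right (fits-[] Y)

  fits-[]ʳ : ∀ {A B : Set} (X : List A) → Fits {A} {B} X [] (replicate (length X) false)
  fits-[]ʳ [] = []
  fits-[]ʳ (x ∷ X) = left (fits-[]ʳ X)

  shuffles-fit : ∀ {A B : Set} (X : List A) (Y : List B) {s} → s ∈ shuffles (length X) (length Y) → Fits X Y s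
  shuffles-fit [] Y (here refl) = fits-[] Y
  shuffles-fit (x ∷ X) [] (here refl) = fits-[]ʳ (x ∷ X)
  shuffles-fit (x ∷ X) (y ∷ Y) i with ∈-++⁻ (map (false ∷_) (shuffles (length X) (suc (length Y)))) i
  ... | inj₁ j with ∈-map⁻ (false ∷_) j
  ...   | (s , k , refl) = left (shuffles-fit X (y ∷ Y) k)
  shuffles-fit (x ∷ X) (y ∷ Y) i | inj₂ j with ∈-map⁻ (true ∷_) j
  ...   | (s , k , refl) = right (shuffles-fit (x ∷ X) Y k)

  fits-length : ∀ {A B C D : Set} {X : List A} {Y : List B} {s} (X' : List C) (Y' : List D) → length X ≡ length X' → length Y ≡ length Y' → Fits X Y s → Fits X' Y' s
  fits-length [] [] _ _ [] = []
  fits-length (x ∷ X') Y' e e' (left f) = left (fits-length X' Y' (ℕP.suc-injective e) e' f)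
  fits-length X' (y ∷ Y') e e' (right f) = right (fits-length X' Y' e (ℕP.suc-injective e') f)

  fits-idx : ∀ {A B : Set} {X : List A} {Y : List B} {s} k → Fits X Y s → length X ≡ length (idx false k s) × length Y ≡ length (idx true k s)
  fits-idx k [] = refl , refl
  fits-idx k (left f) = cong suc (proj₁ (fits-idx (suc k) f)) , proj₂ (fits-idx (suc k) f)
  fits-idx k (right f) = proj₁ (fits-idx (suc k) f) , cong suc (proj₂ (fits-idx (suc k) f))

  fits-size : ∀ {A B : Set} {X : List A} {Y : List B} {s} → Fits X Y s → length s ≡ length X ℕ.+ length Y
  fits-size [] = refl
  fits-size (left f) = cong suc (fits-size f)
  fits-size {X = X} (right f) = trans (cong suc (fits-size f)) (sym (ℕP.+-suc (length X) _))

  merge-map : ∀ {A B : Set} (f : A → B) {X Y s} → Fits X Y s → map f (merge X Y s) ≡ merge (map f X) (map f Y) s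
  merge-map f [] = refl
  merge-map f (left r) = cong (_ ∷_) (merge-map f r)
  merge-map f {X} {y ∷ Y} {true ∷ s} (right r) = trans (cong (map f) (merge-true X y Y s)) (trans (cong (f y ∷_) (merge-map f r)) (sym (merge-true (map f X) (f y) (map f Y) s)))

  merge-↭ : ∀ {A : Set} {X Y : List A} {s} → Fits X Y s → merge X Y s ↭ X ++ Y
  merge-↭ [] = ↭-refl
  merge-↭ (left r) = prep _ (merge-↭ r)
  merge-↭ {X = X} {y ∷ Y} {true ∷ s} (right r) = ↭-trans (↭-reflexive (merge-true X y Y s)) (↭-trans (prep y (merge-↭ r)) (↭-sym (shift y X Y)))

  merge-zip : ∀ {A B : Set} {X X' : List A} {s} (Z Z' : List B) → length X ≡ length Z → length X' ≡ length Z' → Fits X X' s →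
    zip (merge X X' s) (merge Z Z' s) ≡ merge (zip X Z) (zip X' Z') s
  merge-zip [] [] _ _ [] = refl
  merge-zip (z ∷ Z) Z' e e' (left r) = cong (_ ∷_) (merge-zip Z Z' (ℕP.suc-injective e) e' r)
  merge-zip {X = X} {x' ∷ X'} {true ∷ s} Z (z' ∷ Z') e e' (right r) =
    trans (cong₂ zip (merge-true X x' X' s) (merge-true Z z' Z' s)) (trans (cong (_ ∷_) (merge-zip Z Z' e (ℕP.suc-injective e') r)) (sym (merge-true (zip X Z) _ (zip X' Z') s)))

  iota-++ : ∀ k n n' → iota k (n ℕ.+ n') ≡ iota k n ++ iota (k ℕ.+ n) n'
  iota-++ k zero n' = cong (λ z → iota z n') (sym (ℕP.+-identityʳ k))
  iota-++ k (suc n) n' = cong (k ∷_) (trans (iota-++ (suc k) n n') (cong (λ z → iota (suc k) n ++ iota z n') (sym (ℕP.+-suc k n))))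

  map-+-iota : ∀ k j n → map (k ℕ.+_) (iota j n) ≡ iota (k ℕ.+ j) n
  map-+-iota k j zero = refl
  map-+-iota k j (suc n) = cong (_ ∷_) (trans (map-+-iota k (suc j) n) (cong (λ z → iota z n) (ℕP.+-suc k j)))

  upTo-++ : ∀ n n' → upTo n ++ map (n ℕ.+_) (upTo n') ≡ upTo (n ℕ.+ n')
  upTo-++ n n' = trans (cong₂ (λ x y → x ++ map (n ℕ.+_) y) (upTo-iota n) (upTo-iota n')) (trans (cong (iota 0 n ++_) (trans (map-+-iota n 0 n') (cong (λ z → iota z n') (ℕP.+-identityʳ n))))
    (trans (sym (iota-++ 0 n n')) (sym (upTo-iota (n ℕ.+ n')))))

  at-map : ∀ (f : ℕ → ℕ) xs i → i < length xs → at (map f xs) i ≡ f (at xs i)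
  at-map f (x ∷ xs) zero _ = refl
  at-map f (x ∷ xs) (suc i) (s≤s lt) = at-map f xs i lt

  module _ {n n' σ σ'} (p : IsPerm n σ) (p' : IsPerm n' σ') {s} (f : Fits σ σ' s) where
    private
      I₀ I₁ I : List ℕ
      I₀ = idx false 0 s
      I₁ = idx true 0 s
      I = shufflePerm s

      I≡ : I ≡ I₀ ++ I₁
      I≡ = cong₂ _++_ (indicesOf-idx false s) (indicesOf-idx true s)

      l₀ : length I₀ ≡ n
      l₀ = trans (sym (proj₁ (fits-idx 0 f))) (perm-length p)

      l₁ : length I₁ ≡ n'
      l₁ = trans (sym (proj₂ (fits-idx 0 f))) (perm-length p')

      fI : Fits I₀ I₁ s
      fI = fits-length I₀ I₁ (proj₁ (fits-idx 0 f)) (proj₂ (fits-idx 0 f)) f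

      merged : merge I₀ I₁ s ≡ upTo (n ℕ.+ n')
      merged = trans (merge-idx 0 s) (trans (cong (iota 0) (trans (fits-size f) (cong₂ ℕ._+_ (perm-length p) (perm-length p')))) (sym (upTo-iota (n ℕ.+ n'))))

      permI : IsPerm (n ℕ.+ n') I
      permI = ↭-trans (↭-reflexive I≡) (↭-trans (↭-sym (merge-↭ fI)) (↭-reflexive merged))

      γ : List ℕ
      γ = map (at I) (σ ++ map (n ℕ.+_) σ')

    shuffled-perm : IsPerm (n ℕ.+ n') γ
    shuffled-perm = ↭-trans (Perm.map⁺ (at I) (↭-trans (Perm.++⁺ p (Perm.map⁺ (n ℕ.+_) p')) (↭-reflexive (trans (upTo-++ n n') (cong upTo (sym (perm-length permI)))))))
      (↭-trans (↭-reflexive (map-at-upTo I)) permI)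

    private
      first : ∀ {t} → t < n → at γ t ≡ at I₀ (at σ t)
      first {t} lt = trans (at-map (at I) (σ ++ map (n ℕ.+_) σ') t (ℕP.<-≤-trans lt' (ℕP.≤-trans (ℕP.m≤m+n _ _) (ℕP.≤-reflexive (sym (length-++ σ))))))
        (trans (cong (at I) (at-++ˡ σ _ t lt')) (trans (cong (λ z → at z (at σ t)) I≡) (at-++ˡ I₀ I₁ (at σ t) (subst (at σ t <_) (sym l₀) (perm-∈⁻ p (at-∈ σ t lt'))))))
        where
        lt' : t < length σ
        lt' = subst (t <_) (sym (perm-length p)) lt

      second : ∀ {t} → t < n' → at γ (n ℕ.+ t) ≡ at I₁ (at σ' t)
      second {t} lt = trans (at-map (at I) (σ ++ map (n ℕ.+_) σ') (n ℕ.+ t) (subst (n ℕ.+ t <_) (sym (trans (length-++ σ) (cong₂ ℕ._+_ (perm-length p) (trans (length-map _ σ') (perm-length p'))))) (ℕP.+-monoʳ-< n lt)))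
        (trans (cong (at I) (trans (cong (λ z → at (σ ++ map (n ℕ.+_) σ') (z ℕ.+ t)) (sym (perm-length p))) (trans (at-++ʳ σ _ t) (at-map (n ℕ.+_) σ' t (subst (t <_) (sym (perm-length p')) lt)))))
        (trans (cong (λ z → at z (n ℕ.+ at σ' t)) I≡) (trans (cong (λ z → at (I₀ ++ I₁) (z ℕ.+ at σ' t)) (sym l₀)) (at-++ʳ I₀ I₁ (at σ' t)))))

    -- Left multiplication by a shuffle acts on values, so in the inverse word the two factors
    -- interleave. To verify it, apply `γ`: the two words go to the two lists of slots, and merging
    -- these gives the identity.
    shuffled-inv : invPerm γ ≡ merge (invPerm σ) (map (n ℕ.+_) (invPerm σ')) s
    shuffled-inv = sym (inv-unique shuffled-perm _ bounded (trans (merge-map (at γ) fτ) (trans (cong₂ (λ x y → merge x y s) e₀ e₁) merged)))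
      where
      τ = invPerm σ
      τ' = invPerm σ'
      fτ : Fits τ (map (n ℕ.+_) τ') s
      fτ = fits-length τ _ (trans (perm-length p) (sym (inv-length p))) (trans (perm-length p') (sym (trans (length-map _ τ') (inv-length p')))) f
      bounded : All (_< n ℕ.+ n') (merge τ (map (n ℕ.+_) τ') s)
      bounded = Perm.All-resp-↭ (↭-sym (merge-↭ fτ)) (AllP.++⁺ (All.tabulate (λ i → ℕP.<-≤-trans (perm-∈⁻ (inv-perm p) i) (ℕP.m≤m+n n n')))
                  (AllP.map⁺ (All.tabulate (λ i → ℕP.+-monoʳ-< n (perm-∈⁻ (inv-perm p') i)))))
      e₀ : map (at γ) τ ≡ I₀
      e₀ = trans (map-cong-∈ τ (λ i → first (perm-∈⁻ (inv-perm p) i))) (trans (map-∘ τ) (trans (cong (map (at I₀)) (map-at-inv p)) (trans (cong (map (at I₀) ∘ upTo) (sym l₀)) (map-at-upTo I₀))))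
      e₁ : map (at γ) (map (n ℕ.+_) τ') ≡ I₁
      e₁ = trans (sym (map-∘ τ')) (trans (map-cong-∈ τ' (λ i → second (perm-∈⁻ (inv-perm p') i))) (trans (map-∘ τ') (trans (cong (map (at I₁)) (map-at-inv p')) (trans (cong (map (at I₁) ∘ upTo) (sym l₁)) (map-at-upTo I₁)))))

-- Standardization preserves order.

module Standardisation where
  open F using (zero; suc)
  open Permutations

  ⊆-unique⇒↭ : ∀ {A : Set} {xs ys : List A} → Unique xs → (∀ {z} → z ∈ xs → z ∈ ys) → length ys ≡ length xs → xs ↭ ys
  ⊆-unique⇒↭ {ys = []} [] _ _ = ↭-refl
  ⊆-unique⇒↭ {xs = x ∷ xs} {ys} (a ∷ u) sub e with ∈-perm (sub (here refl))
  ... | (ys' , s) = ↭-trans (prep x (⊆-unique⇒↭ u sub' (ℕP.suc-injective (trans (sym (↭-length s)) e)))) (↭-sym s)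
    where
    sub' : ∀ {z} → z ∈ xs → z ∈ ys'
    sub' i with ∈-resp-↭ s (sub (there i))
    ... | here refl = ⊥-elim (All.lookup a i refl)
    ... | there j = j

  <ᵇ-cong : ∀ {x y x' y'} → (x < y → x' < y') → (x' < y' → x < y) → (x <ᵇ y) ≡ (x' <ᵇ y')
  <ᵇ-cong {x} {y} {x'} {y'} f g with x <ᵇ y in e | x' <ᵇ y' in e'
  ... | true | true = refl
  ... | false | false = refl
  ... | true | false = ⊥-elim (subst T e' (ℕP.<⇒<ᵇ (f (ℕP.<ᵇ⇒< x y (subst T (sym e) tt)))))
  ... | false | true = ⊥-elim (subst T e (ℕP.<⇒<ᵇ (g (ℕP.<ᵇ⇒< x' y' (subst T (sym e') tt)))))

  countLess-mono : ∀ {x y} w → x ≤ y → countLess x w ≤ countLess y w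
  countLess-mono [] _ = z≤n
  countLess-mono {x} {y} (z ∷ w) le with z <ᵇ x in e | z <ᵇ y in e'
  ... | true | true = s≤s (countLess-mono w le)
  ... | false | true = ℕP.m≤n⇒m≤1+n (countLess-mono w le)
  ... | false | false = countLess-mono w le
  ... | true | false = ⊥-elim (subst T e' (ℕP.<⇒<ᵇ (ℕP.<-≤-trans (ℕP.<ᵇ⇒< z x (subst T (sym e) tt)) le)))

  countLess-< : ∀ {x y} w → x < y → x ∈ w → countLess x w < countLess y w
  countLess-< {x} {y} (z ∷ w) lt (here refl) with x <ᵇ x in e | x <ᵇ y | ℕP.<⇒<ᵇ lt
  ... | true | _ | _ = ⊥-elim (ℕP.<-irrefl refl (ℕP.<ᵇ⇒< x x (subst T (sym e) tt)))
  ... | false | true | _ = s≤s (countLess-mono w (ℕP.<⇒≤ lt))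
  countLess-< {x} {y} (z ∷ w) lt (there i) with z <ᵇ x in e | z <ᵇ y in e'
  ... | true | true = s≤s (countLess-< w lt i)
  ... | false | true = ℕP.m<n⇒m<1+n (countLess-< w lt i)
  ... | false | false = countLess-< w lt i
  ... | true | false = ⊥-elim (subst T e' (ℕP.<⇒<ᵇ (ℕP.<-trans (ℕP.<ᵇ⇒< z x (subst T (sym e) tt)) lt)))

  countLess-bound : ∀ x w → countLess x w ≤ length w
  countLess-bound x [] = z≤n
  countLess-bound x (y ∷ w) with y <ᵇ x
  ... | true = s≤s (countLess-bound x w)
  ... | false = ℕP.m≤n⇒m≤1+n (countLess-bound x w)

  countLess-∈ : ∀ {x} w → x ∈ w → countLess x w < length w
  countLess-∈ {x} w i = ℕP.<-≤-trans (countLess-< w (ℕP.n<1+n x) i) (countLess-bound (suc x) w)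

  countLess-order : ∀ {x y} w → x ∈ w → y ∈ w → (suc x ≤ᵇ y) ≡ (suc (countLess x w) ≤ᵇ countLess y w)
  countLess-order {x} {y} w i j = <ᵇ-cong (λ lt → countLess-< w lt i) back
    where
    back : countLess x w < countLess y w → x < y
    back lt with ℕP.<-cmp x y
    ... | tri< lt' _ _ = lt'
    ... | tri≈ _ refl _ = ⊥-elim (ℕP.<-irrefl refl lt)
    ... | tri> _ _ gt = ⊥-elim (ℕP.<-asym lt (countLess-< w gt j))

  std-perm : ∀ w → Unique w → IsPerm (length w) (std w)
  std-perm w u = ⊆-unique⇒↭ (map-unique _ u (λ i j e → inj i j e))
      (λ i → let (x , j , e) = ∈-map⁻ _ i in ∈-upTo⁺ (subst (_< length w) (sym e) (countLess-∈ w j)))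
      (trans (length-upTo (length w)) (sym (length-map _ w)))
    where
    inj : ∀ {x y} → x ∈ w → y ∈ w → countLess x w ≡ countLess y w → x ≡ y
    inj {x} {y} i j e with ℕP.<-cmp x y
    ... | tri< lt _ _ = ⊥-elim (ℕP.<-irrefl e (countLess-< w lt i))
    ... | tri≈ _ e' _ = e'
    ... | tri> _ _ gt = ⊥-elim (ℕP.<-irrefl (sym e) (countLess-< w gt j))

-- Words and pairs of lattice paths.

module Correspondence {c ℓ} (𝕂 : CommutativeRing c ℓ) (m : ℕ) (inv : Fin m → Fin m) (inv-inv : ∀ b → inv (inv b) ≡ b) where
  open import Data.Nat
  open import Data.Nat.Properties
  open F using (zero; suc)
  open Setup 𝕂 m inv using (Word; word≟; starW; BTab; entries; IsStdBT; shape; Qb; Q; allWords; allBasis; boxes; btab≟) public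
  open GrowthInsertion m public hiding (Distinct)
  open Realisation m public
  open Permutations public

  record Valid (n : ℕ) (α : Word) : Set where
    constructor _▹_
    field
      valid-length : length (proj₁ α) ≡ n
      valid-perm : IsPerm n (proj₂ α)
  open Valid public

  allWords⁺ : ∀ c → c ∈ allWords (length c)
  allWords⁺ [] = here refl
  allWords⁺ (b ∷ c) = ∈-concatMap-join (λ b → map (b ∷_) (allWords (length c))) (∈-allFin b) (∈-map⁺ (b ∷_) (allWords⁺ c))

  allWords⁻ : ∀ n {c} → c ∈ allWords n → length c ≡ n
  allWords⁻ zero (here refl) = refl
  allWords⁻ (suc n) i with ∈-concatMap-split (λ b → map (b ∷_) (allWords n)) (allFin m) i
  ... | (b , _ , j) with ∈-map⁻ (b ∷_) j
  ...   | (c , k , refl) = cong suc (allWords⁻ n k)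

  allWords-unique : ∀ n → Unique (allWords n)
  allWords-unique zero = [] ∷ []
  allWords-unique (suc n) = concatMap-unique _ (Uniq.allFin⁺ m) (λ _ → Uniq.map⁺ ∷-injectiveʳ (allWords-unique n))
    λ _ _ i j → case ∈-map⁻ _ i , ∈-map⁻ _ j of λ { ((_ , _ , refl) , (_ , _ , e)) → ∷-injectiveˡ e }

  allBasis⁺ : ∀ {n α} → Valid n α → α ∈ allBasis n
  allBasis⁺ {n} {c , σ} (refl ▹ p) = ∈-concatMap-join (λ c' → map (λ σ → (c' , σ)) (perms (upTo n))) (allWords⁺ c) (∈-map⁺ (c ,_) (∈-perms⁺ (upTo n) p))

  allBasis⁻ : ∀ n {α} → α ∈ allBasis n → Valid n α
  allBasis⁻ n i with ∈-concatMap-split (λ c' → map (λ σ → (c' , σ)) (perms (upTo n))) (allWords n) i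
  ... | (c , j , k) with ∈-map⁻ (c ,_) k
  ...   | (σ , q , refl) = allWords⁻ n j ▹ ∈-perms⁻ (upTo n) q

  allBasis-unique : ∀ n → Unique (allBasis n)
  allBasis-unique n = concatMap-unique _ (allWords-unique n)
    (λ _ → Uniq.map⁺ (cong proj₂) (perms-unique (upTo n) (Unique⇒Distinct (Uniq.upTo⁺ n))))
    λ _ _ i j → case ∈-map⁻ _ i , ∈-map⁻ _ j of λ { ((_ , _ , refl) , (_ , _ , e)) → cong proj₁ e }

  -- α = (c ; σ) read by increasing value: the letter of rank v is (c_v , σ⁻¹(v)).
  valueWord : Word → List Letter
  valueWord (c , σ) = zip c (invPerm σ)

  letterAt : List (Fin m) → List ℕ → ℕ → Maybe BiLetter
  letterAt c σ j = Maybe.map (λ b → j , b , at σ j) (lookupM c (at σ j))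

  -- α read by increasing position: the letter at position j is (c_{σ(j)} , σ(j)), with label j.
  positionBiword : Word → List BiLetter
  positionBiword (c , σ) = mapMaybe (letterAt c σ) (upTo (length σ))

  positionWord : Word → List Letter
  positionWord α = map proj₂ (positionBiword α)

  valueBiword : Word → List BiLetter
  valueBiword α = zip (iota 0 (length (proj₁ α))) (valueWord α)

  lookupM-drop : ∀ (c : List (Fin m)) v → v < length c → ∃ λ b → lookupM c v ≡ just b
  lookupM-drop (b ∷ c) zero _ = b , refl
  lookupM-drop (b ∷ c) (suc v) (s≤s lt) = lookupM-drop c v lt

  mapMaybe-just : ∀ {A B : Set} (f : A → Maybe B) x {y} xs → f x ≡ just y → mapMaybe f (x ∷ xs) ≡ y ∷ mapMaybe f xs
  mapMaybe-just f x xs e rewrite e = refl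

  inverse-valueBiword : ∀ {n α} → Valid n α → map inverse (valueBiword α) ≡ mapMaybe (letterAt (proj₁ α) (proj₂ α)) (invPerm (proj₂ α))
  inverse-valueBiword {n} {c , σ} (refl ▹ p) =
    go 0 c (invPerm σ) (sym (inv-length p)) (λ _ → refl) (trans (map-at-inv p) (trans (upTo-iota n) (cong (iota 0) (sym (inv-length p)))))
    where
    go : ∀ k c' τ → length c' ≡ length τ → (∀ i → lookupM c (k + i) ≡ lookupM c' i) → map (at σ) τ ≡ iota k (length τ) →
      map inverse (zip (iota k (length c')) (zip c' τ)) ≡ mapMaybe (letterAt c σ) τ
    go k [] [] _ _ _ = refl
    go k (b ∷ c') (t ∷ τ) el h e = sym (trans (mapMaybe-just (letterAt c σ) t τ
         (trans (cong (λ z → Maybe.map (λ b → t , b , z) (lookupM c z)) (∷-injectiveˡ e))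
                (cong (Maybe.map (λ b → t , b , k)) (trans (cong (lookupM c) (sym (+-identityʳ k))) (h 0)))))
       (cong (_ ∷_) (sym (go (suc k) c' τ (suc-injective el) (λ i → trans (cong (lookupM c) (sym (+-suc k i))) (h (suc i))) (∷-injectiveʳ e)))))

  -- Both lists consist of the triples of position, colour and value, one ordered by value and one
  -- by position.
  biwords-↭ : ∀ {n α} → Valid n α → map inverse (valueBiword α) ↭ positionBiword α
  biwords-↭ {n} {c , σ} v@(_ ▹ p) = ↭-trans (↭-reflexive (inverse-valueBiword v))
    (mapMaybe-↭ (letterAt c σ) (↭-trans (inv-perm p) (↭-reflexive (cong upTo (sym (perm-length p))))))

  labels-position : ∀ {n α} → Valid n α → map proj₁ (positionBiword α) ≡ upTo n × vals (positionWord α) ≡ proj₂ α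
  labels-position {n} {c , σ} (refl ▹ p) = subst (λ z → map proj₁ (positionBiword (c , σ)) ≡ upTo z) (perm-length p) (proj₁ (go (upTo (length σ)) ∈-upTo⁻)) ,
    trans (sym (map-∘ _)) (trans (proj₂ (go (upTo (length σ)) ∈-upTo⁻)) (map-at-upTo σ))
    where
    go : ∀ xs → (∀ {j} → j ∈ xs → j < length σ) → map proj₁ (mapMaybe (letterAt c σ) xs) ≡ xs × map value (mapMaybe (letterAt c σ) xs) ≡ map (at σ) xs
    go [] _ = refl , refl
    go (j ∷ xs) h with lookupM-drop c (at σ j) (perm-∈⁻ p (at-∈ σ j (h (here refl)))) | go xs (h ∘ there)
    ... | (b , e) | (e₁ , e₂) rewrite mapMaybe-just (letterAt c σ) j xs (cong (Maybe.map (λ b → j , b , at σ j)) e) = cong (j ∷_) e₁ , cong (at σ j ∷_) e₂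

  map-zip₁ : ∀ {A B : Set} (xs : List A) (ys : List B) → length xs ≡ length ys → map proj₁ (zip xs ys) ≡ xs
  map-zip₁ [] [] _ = refl
  map-zip₁ (x ∷ xs) (y ∷ ys) e = cong (x ∷_) (map-zip₁ xs ys (suc-injective e))

  map-zip₂ : ∀ {A B : Set} (xs : List A) (ys : List B) → length xs ≡ length ys → map proj₂ (zip xs ys) ≡ ys
  map-zip₂ [] [] _ = refl
  map-zip₂ (x ∷ xs) (y ∷ ys) e = cong (y ∷_) (map-zip₂ xs ys (suc-injective e))

  length-iota : ∀ k n → length (iota k n) ≡ n
  length-iota k zero = refl
  length-iota k (suc n) = cong suc (length-iota (suc k) n)

  module _ {n α} (v : Valid n α) where
    private p = valid-perm v

    length-valueWord : length (valueWord α) ≡ n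
    length-valueWord = trans (length-zipWith _,_ (proj₁ α) (invPerm (proj₂ α))) (trans (cong₂ _⊓_ (valid-length v) (inv-length p)) (⊓-idem n))

    vals-valueWord : vals (valueWord α) ≡ invPerm (proj₂ α)
    vals-valueWord = map-zip₂ _ _ (trans (valid-length v) (sym (inv-length p)))

    colours-valueWord : map proj₁ (valueWord α) ≡ proj₁ α
    colours-valueWord = map-zip₁ _ _ (trans (valid-length v) (sym (inv-length p)))

    labels-value : map proj₁ (valueBiword α) ≡ upTo n
    labels-value = trans (map-zip₁ _ _ (trans (length-iota 0 _) (trans (valid-length v) (sym length-valueWord)))) (trans (cong (iota 0) (valid-length v)) (sym (upTo-iota n)))

    word-value : map proj₂ (valueBiword α) ≡ valueWord α
    word-value = map-zip₂ _ _ (trans (length-iota 0 _) (trans (valid-length v) (sym length-valueWord)))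

    length-positionWord : length (positionWord α) ≡ n
    length-positionWord = trans (sym (length-map proj₂ (positionWord α))) (trans (cong length (proj₂ (labels-position v))) (perm-length p))

  downFrom-desc : ∀ {a} {A : Set a} (f : A → ℕ) n xs → map f xs ≡ downFrom n → DescBy f xs
  downFrom-desc f zero [] _ = lift tt
  downFrom-desc f (suc n) (x ∷ xs) e with ∷-injective e
  ... | (refl , e') = AllP.map⁻ (subst (All (_< n)) (sym e') (All.tabulate ∈-downFrom⁻)) , downFrom-desc f n xs e'

  -- Paths list their last step first, hence the decreasing labels.
  lab : List Cell → Enc
  lab p = zip (downFrom (length p)) p

  labels-lab : ∀ p → labels (lab p) ≡ downFrom (length p)
  labels-lab p = map-zip₁ _ p (length-downFrom _)

  cells-lab : ∀ p → cells (lab p) ≡ p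
  cells-lab p = map-zip₂ _ p (length-downFrom _)

  lab-desc : ∀ p → Desc (lab p)
  lab-desc p = Desc-downFrom (length p) (lab p) (labels-lab p)

  lab-cells : ∀ n E → labels E ≡ downFrom n → E ≡ lab (cells E)
  lab-cells zero [] _ = refl
  lab-cells (suc n) ((t , c) ∷ E) e with ∷-injective e
  ... | (refl , e') with lab-cells n E e'
  ...   | eq = cong₂ (λ k E' → (k , c) ∷ E') (trans (sym (trans (cong length e') (length-downFrom n))) (trans (length-map proj₁ E) (sym (length-map proj₂ E)))) eq

  valuePath positionPath : Word → List Cell
  valuePath α = proj₂ (run (reverse (valueWord α)))
  positionPath α = proj₂ (run (reverse (positionWord α)))

  module _ {n α} (v : Valid n α) where
    private
      LW LV : List BiLetter
      LW = valueBiword α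
      LV = positionBiword α

      labelled : ∀ (L : List BiLetter) → map proj₁ L ≡ upTo n → proj₂ (bi (reverse L)) ≡ lab (proj₂ (run (reverse (map proj₂ L))))
      labelled L e = trans (bi-run₂ (reverse L)) (cong₂ zip
        (trans (reverse-map proj₁ L) (trans (cong reverse e) (trans (reverse-upTo n) (cong downFrom (sym len)))))
        (cong (proj₂ ∘ run) (reverse-map proj₂ L)))
        where
        len : length (proj₂ (run (reverse (map proj₂ L)))) ≡ n
        len = trans (run-length (reverse (map proj₂ L))) (trans (length-reverse (map proj₂ L)) (trans (length-map proj₂ L) (trans (sym (length-map proj₁ L)) (trans (cong length e) (length-upTo n)))))

      sorted : ∀ (L : List BiLetter) → map proj₁ L ≡ upTo n → DescBy proj₁ (reverse L)
      sorted L e = downFrom-desc proj₁ n (reverse L) (trans (reverse-map proj₁ L) (trans (cong reverse e) (reverse-upTo n)))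

      sym′ : bi (reverse LW) ≡ (proj₂ (bi (reverse LV)) , proj₁ (bi (reverse LV)))
      sym′ = trans (cong bi (sym (trans (cong (map inverse) (sym (reverse-map inverse LW)))
                      (trans (sym (map-∘ (reverse LW))) (map-id (reverse LW))))))
        (symmetry (reverse LV) (reverse (map inverse LW))
          (↭-trans (↭-reverse LV) (↭-trans (↭-sym (biwords-↭ v)) (↭-sym (↭-reverse (map inverse LW)))))
          (sorted LV (proj₁ (labels-position v)))
          (downFrom-desc value n (reverse (map inverse LW)) (trans (reverse-map value (map inverse LW))
             (trans (cong reverse (trans (sym (map-∘ LW)) (labels-value v))) (reverse-upTo n)))))

    -- By `symmetry` the insertion symbol of one reading is the recording symbol of the other. The
    -- recording labels are consecutive, so the path alone determines that symbol.
    insertion-value : proj₁ (run (reverse (valueWord α))) ≡ lab (positionPath α)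
    insertion-value = trans (cong (proj₁ ∘ run ∘ reverse) (sym (word-value v)))
      (trans (cong (proj₁ ∘ run) (sym (reverse-map proj₂ LW)))
      (trans (sym (bi-run₁ (reverse LW))) (trans (cong proj₁ sym′) (labelled LV (proj₁ (labels-position v))))))

    insertion-position : proj₁ (run (reverse (positionWord α))) ≡ lab (valuePath α)
    insertion-position = trans (cong (proj₁ ∘ run) (sym (reverse-map proj₂ LV)))
      (trans (sym (bi-run₁ (reverse LV))) (trans (sym (cong proj₂ sym′))
        (trans (labelled LW (labels-value v)) (cong (lab ∘ proj₂ ∘ run ∘ reverse) (word-value v)))))

    positionPath-lat : Lat (positionPath α)
    positionPath-lat = run-lat (reverse (positionWord α))

    length-positionPath : length (positionPath α) ≡ n
    length-positionPath = trans (run-length (reverse (positionWord α))) (trans (length-reverse (positionWord α)) (length-positionWord v))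

    paths-↭ : positionPath α ↭ valuePath α
    paths-↭ = subst (_↭ valuePath α) (trans (cong cells insertion-value) (cells-lab (positionPath α))) (run-cells (reverse (valueWord α)))

    Q-real : Q α ≡ realV (lab (positionPath α))
    Q-real = VP.tabulate-cong λ b → trans (qb b) (trans (cong proj₂ (trans (cong rs (reverse-mapMaybe (select b) LV)) (rs-real b (reverse LV) dist)))
               (cong (real b) (labelled LV (proj₁ (labels-position v)))))
      where
      dist : Distinct (map value (reverse LV))
      dist = Unique⇒Distinct (Unique-resp (↭-sym (↭-trans (Perm.map⁺ value (↭-reverse LV)) (↭-reflexive (trans (map-∘ LV) (proj₂ (labels-position v))))))
               (perm-unique (valid-perm v)))
      c' = proj₁ α
      σ = proj₂ α
      mapMaybe-fusion : ∀ {A B C : Set} (s : A → Maybe C) (g : B → Maybe C) (f : A → Maybe B) → (∀ x → s x ≡ (f x >>= g)) → ∀ xs → mapMaybe s xs ≡ mapMaybe g (mapMaybe f xs)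
      mapMaybe-fusion s g f h [] = refl
      mapMaybe-fusion s g f h (x ∷ xs) rewrite h x with f x
      ... | nothing = mapMaybe-fusion s g f h xs
      ... | just y with g y
      ...   | nothing = mapMaybe-fusion s g f h xs
      ...   | just z = cong (z ∷_) (mapMaybe-fusion s g f h xs)
      mutual
        sel≡ : ∀ b → Qb α b ≡ rsQ (mapMaybe (select b) LV)
        sel≡ b = cong rsQ (mapMaybe-fusion _ (select b) (letterAt c' σ) (pw b) (upTo (length σ)))
        -- The hole is the local selector of `Qb`, determined by the use in `sel≡`.
        pw : ∀ b j → _ ≡ (letterAt c' σ j >>= select b)
        pw b j with lookupM c' (at σ j)
        ... | nothing = refl
        ... | just _ = refl
      qb : ∀ b → Qb α b ≡ proj₂ (rs (reverse (mapMaybe (select b) LV)))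
      qb b = trans (sel≡ b) (cong proj₂ (trans (cong (foldl rsStep ([] , [])) (sym (reverse-involutive (mapMaybe (select b) LV)))) (rs-reverse (reverse (mapMaybe (select b) LV)))))

  zip-unzip : ∀ (X : List Letter) → zip (map proj₁ X) (map proj₂ X) ≡ X
  zip-unzip [] = refl
  zip-unzip (x ∷ X) = cong (x ∷_) (zip-unzip X)

  wordOf : List Letter → Word
  wordOf X = map proj₁ X , invPerm (vals X)

  wordOf-valid : ∀ {n} X → IsPerm n (vals X) → Valid n (wordOf X)
  wordOf-valid X p = trans (length-map proj₁ X) (trans (sym (length-map proj₂ X)) (perm-length p)) ▹ inv-perm p

  valueWord-wordOf : ∀ {n} X → IsPerm n (vals X) → valueWord (wordOf X) ≡ X
  valueWord-wordOf X p = trans (cong (zip (map proj₁ X)) (invPerm-involutive p)) (zip-unzip X)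

  wordOf-valueWord : ∀ {n α} → Valid n α → wordOf (valueWord α) ≡ α
  wordOf-valueWord v = cong₂ _,_ (colours-valueWord v) (trans (cong invPerm (vals-valueWord v)) (invPerm-involutive (valid-perm v)))

  distinct-value : ∀ {n α} → Valid n α → Distinct (vals (reverse (valueWord α)))
  distinct-value {n} {α} v = Unique⇒Distinct (Unique-resp (↭-trans (↭-reflexive (sym (vals-valueWord v))) (↭-sym (Perm.map⁺ proj₂ (↭-reverse (valueWord α))))) (perm-unique (inv-perm (valid-perm v))))

  distinct-position : ∀ {n α} → Valid n α → Distinct (vals (reverse (positionWord α)))
  distinct-position {n} {α} v = Unique⇒Distinct (Unique-resp (↭-trans (↭-reflexive (sym (proj₂ (labels-position v)))) (↭-sym (Perm.map⁺ proj₂ (↭-reverse (positionWord α))))) (perm-unique (valid-perm v)))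

  Path : ℕ → List Cell → Set
  Path n p = length p ≡ n × Lat p

  tab : List Cell → BTab
  tab p = realV (lab p)

  lab-lat : ∀ p → Lat p → Lat (cells (lab p))
  lab-lat p = subst Lat (sym (cells-lab p))

  tab-inj : ∀ p p' → length p ≡ length p' → Lat p → Lat p' → tab p ≡ tab p' → p ≡ p'
  tab-inj p p' el L L' e = trans (sym (cells-lab p)) (trans (cong cells (real-inj (lab p) (lab p')
      (trans (labels-lab p) (trans (cong downFrom el) (sym (labels-lab p')))) (lab-desc p) (lab-desc p') (lab-lat p L) (lab-lat p' L')
      λ b → trans (sym (VP.lookup∘tabulate _ b)) (trans (cong (λ z → V.lookup z b) e) (VP.lookup∘tabulate _ b)))) (cells-lab p'))

  tab-entries : ∀ p → Lat p → entries (tab p) ↭ downFrom (length p)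
  tab-entries p L = ↭-trans (realV-entries (lab p) (lab-desc p) (lab-lat p L)) (↭-reflexive (labels-lab p))

  tab-boxes : ∀ p → Lat p → boxes (tab p) ≡ length p
  tab-boxes p L = trans (↭-length (tab-entries p L)) (length-downFrom (length p))

  downFrom-↭ : ∀ n → downFrom n ↭ upTo n
  downFrom-↭ n = subst (_↭ upTo n) (reverse-upTo n) (↭-reverse (upTo n))

  All-tabulate : ∀ {n} {P : Tableau → Set} {f : Fin n → Tableau} → (∀ b → P (f b)) → All P (V.toList (V.tabulate f))
  All-tabulate {zero} h = []
  All-tabulate {suc n} h = h zero ∷ All-tabulate (h ∘ suc)

  All-lookup : ∀ {n} {P : Tableau → Set} (T : V.Vec Tableau n) → All P (V.toList T) → ∀ b → P (V.lookup T b)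
  All-lookup (X V.∷ T) (p ∷ _) zero = p
  All-lookup (X V.∷ T) (_ ∷ a) (suc b) = All-lookup T a b

  tab-std : ∀ p → Lat p → IsStdBT (tab p)
  tab-std p L = subst (λ n → entries (tab p) ↭ upTo n) (sym (tab-boxes p L)) (↭-trans (tab-entries p L) (downFrom-↭ (length p))) ,
    All-tabulate λ b → RowInsertion.RT⇒IsTab _ (rt (real-Lat b (lab p) (lab-desc p) (lab-lat p L)))

  std-path : ∀ T → IsStdBT T → ∃ λ p → Path (boxes T) p × tab p ≡ T
  std-path T (s , a) with encode (boxes T) T (↭-trans s (↭-sym (downFrom-↭ (boxes T)))) (λ b → RowInsertion.IsTab⇒RT _ (All-lookup T a b))
  ... | (E , el , L , r) = cells E ,
    (trans (length-map proj₂ E) (trans (sym (length-map proj₁ E)) (trans (cong length el) (length-downFrom (boxes T)))) , L) ,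
    trans (cong realV (sym (lab-cells (boxes T) E el))) (trans (VP.tabulate-cong r) (VP.tabulate∘lookup T))

  Q-tab : ∀ {n α} → Valid n α → Q α ≡ tab (positionPath α)
  Q-tab = Q-real

  Q-position : ∀ {n α p} → Valid n α → Path n p → Q α ≡ tab p → positionPath α ≡ p
  Q-position v (el , L) e = tab-inj _ _ (trans (length-positionPath v) (sym el)) (positionPath-lat v) L (trans (sym (Q-tab v)) e)

  fibre : ℕ → BTab → List Word
  fibre n T = filter (λ α → btab≟ (Q α) T) (allBasis n)

  fibre-unique : ∀ n T → Unique (fibre n T)
  fibre-unique n T = Uniq.filter⁺ _ (allBasis-unique n)

  fibre⁻ : ∀ {n p α} → Path n p → α ∈ fibre n (tab p) → Valid n α × positionPath α ≡ p
  fibre⁻ {n} {p} P i with ∈-filter⁻ (λ α → btab≟ (Q α) (tab p)) i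
  ... | (j , e) = allBasis⁻ n j , Q-position (allBasis⁻ n j) P e

  fibre⁺ : ∀ {n p α} → Valid n α → positionPath α ≡ p → α ∈ fibre n (tab p)
  fibre⁺ {n} {p} {α} v e = ∈-filter⁺ (λ α → btab≟ (Q α) (tab p)) (allBasis⁺ v) (trans (Q-tab v) (cong tab e))

  -- The position path is the insertion symbol of the value word and the value path records its
  -- insertion, so together they are its Robinson-Schensted image.
  paths-determine : ∀ {n n' α β} → Valid n α → Valid n' β → positionPath α ≡ positionPath β → valuePath α ≡ valuePath β → α ≡ β
  paths-determine {α = α} {β} v v' e e' = trans (sym (wordOf-valueWord v)) (trans (cong wordOf (reverse-injective
      (run-inj (reverse (valueWord α)) (reverse (valueWord β)) (cong₂ _,_ (trans (insertion-value v) (trans (cong lab e) (sym (insertion-value v')))) e')))) (wordOf-valueWord v'))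

  paths-exist : ∀ {n p q} → Path n p → Lat q → p ↭ q → ∃ λ α → Valid n α × positionPath α ≡ p × valuePath α ≡ q
  paths-exist {n} {p} {q} (el , L) Lq s with run-surj q (lab p) (lab-desc p) (lab-lat p L) Lq (↭-trans (↭-reflexive (cells-lab p)) s)
  ... | (R , eR , sR) = α , v , trans (sym (cells-lab _)) (trans (cong cells (trans (sym (insertion-value v)) (trans (cong proj₁ runα) (cong proj₁ eR)))) (cells-lab p)) ,
        trans (cong proj₂ runα) (cong proj₂ eR)
    where
    X = reverse R
    pX : IsPerm n (vals X)
    pX = ↭-trans (Perm.map⁺ proj₂ (↭-reverse R)) (↭-trans sR (↭-trans (↭-reflexive (trans (labels-lab p) (cong downFrom el))) (downFrom-↭ n)))
    α = wordOf X
    v = wordOf-valid X pX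
    runα : run (reverse (valueWord α)) ≡ run R
    runα = cong run (trans (cong reverse (valueWord-wordOf X pX)) (reverse-involutive R))

  invL : Letter → Letter
  invL (b , x) = inv b , x

  invE : Enc → Enc
  invE = map (map₂ invL)

  invL-invol : ∀ l → invL (invL l) ≡ l
  invL-invol (b , x) = cong (_, x) (inv-inv b)

  -- The growth rule only tests boxes for equality, hence commutes with an injective recolouring.
  ins-inv : ∀ b x E → ins (inv b , x) (invE E) ≡ (invE (proj₁ (ins (b , x) E)) , invL (proj₂ (ins (b , x) E)))
  ins-inv b x [] = refl
  ins-inv b x ((t , k) ∷ E) with t <? x
  ... | yes _ = refl
  ... | no _ rewrite ins-inv b x E with k ≟c proj₂ (ins (b , x) E)
  ...   | yes refl = push-≡ t _ refl
  ...   | no ne = push-≢ t _ (λ e → ne (trans (sym (invL-invol k)) (trans (cong invL e) (invL-invol _))))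

  run-inv : ∀ R → run (map invL R) ≡ (invE (proj₁ (run R)) , map invL (proj₂ (run R)))
  run-inv [] = refl
  run-inv ((b , x) ∷ R) rewrite run-inv R | ins-inv b x (proj₁ (run R)) = refl

  invE-lab : ∀ p → invE (lab p) ≡ lab (map invL p)
  invE-lab p = trans (go (downFrom (length p)) p) (cong (λ n → zip (downFrom n) (map invL p)) (sym (length-map invL p)))
    where
    go : ∀ ls p → invE (zip ls p) ≡ zip ls (map invL p)
    go [] p = refl
    go (l ∷ ls) [] = refl
    go (l ∷ ls) (x ∷ p) = cong (_ ∷_) (go ls p)

  letterOf : List (Fin m) → ℕ → Maybe Letter
  letterOf c v = Maybe.map (_, v) (lookupM c v)

  positionWord-letters : ∀ c σ → positionWord (c , σ) ≡ mapMaybe (letterOf c) σ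
  positionWord-letters c σ = trans (go (upTo (length σ))) (cong (mapMaybe (letterOf c)) (map-at-upTo σ))
    where
    go : ∀ xs → map proj₂ (mapMaybe (letterAt c σ) xs) ≡ mapMaybe (letterOf c) (map (at σ) xs)
    go [] = refl
    go (x ∷ xs) with lookupM c (at σ x)
    ... | nothing = go xs
    ... | just _ = cong (_ ∷_) (go xs)

  star-word : ∀ {n α} → Valid n α → valueWord (starW α) ≡ map invL (positionWord α)
  star-word {n} {c , σ} (refl ▹ p) = trans (cong (zip _) (invPerm-involutive p)) (sym (trans (cong (map invL) (positionWord-letters c σ)) (go σ (perm-∈⁻ p))))
    where
    go : ∀ τ → (∀ {v} → v ∈ τ → v < length c) → map invL (mapMaybe (letterOf c) τ) ≡ zip (mapMaybe (λ i → Maybe.map inv (lookupM c i)) τ) τ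
    go [] _ = refl
    go (v ∷ τ) h with lookupM c v | lookupM-drop c v (h (here refl))
    ... | just b | _ = cong (_ ∷_) (go τ (h ∘ there))
    ... | nothing | (_ , ())

  star-valid : ∀ {n α} → Valid n α → Valid n (starW α)
  star-valid {n} {c , σ} (refl ▹ p) = trans (go σ (perm-∈⁻ p)) (perm-length p) ▹ inv-perm p
    where
    go : ∀ τ → (∀ {v} → v ∈ τ → v < length c) → length (mapMaybe (λ i → Maybe.map inv (lookupM c i)) τ) ≡ length τ
    go [] _ = refl
    go (v ∷ τ) h with lookupM c v | lookupM-drop c v (h (here refl))
    ... | just b | _ = cong suc (go τ (h ∘ there))
    ... | nothing | (_ , ())

  -- Passing to α* turns the position reading into the value reading and stars the colours, so by
  -- `symmetry` it exchanges the two paths.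
  star-position : ∀ {n α} → Valid n α → positionPath (starW α) ≡ map invL (valuePath α)
  star-position {n} {α} v = trans (sym (cells-lab _)) (trans (cong cells (trans (sym (insertion-value (star-valid v))) (trans (cong (proj₁ ∘ run)
      (trans (cong reverse (star-word v)) (sym (reverse-map invL (positionWord α))))) (trans (cong proj₁ (run-inv (reverse (positionWord α))))
      (trans (cong invE (insertion-position v)) (invE-lab (valuePath α))))))) (cells-lab _))

-- Finite sums and formal combinations over 𝕂.

module RingSums {c ℓ} (𝕂 : CommutativeRing c ℓ) (m : ℕ) (inv : Fin m → Fin m) where
  open F using (zero; suc)
  open CommutativeRing 𝕂 public using (Carrier; _≈_; _+_; _*_; -_; 0#; 1#; setoid; +-cong; *-cong; +-identityˡ; +-identityʳ; *-identityˡ; *-identityʳ; +-assoc; +-comm; *-assoc; *-comm; distribˡ; distribʳ; zeroˡ; zeroʳ; -‿inverseʳ; -‿inverseˡ; reflexive; +-commutativeSemigroup; *-commutativeSemigroup; +-congˡ; +-congʳ; *-congˡ; *-congʳ) renaming (refl to ≈-refl; sym to ≈-sym; trans to ≈-trans)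
  open Setup 𝕂 m inv using (natK; sumK; prodK)
  module ≈R = SetoidReasoning setoid
  open CSProps +-commutativeSemigroup public using () renaming (interchange to +-interchange; x∙yz≈y∙xz to +-swap)
  open CSProps *-commutativeSemigroup public using () renaming (interchange to *-interchange; x∙yz≈y∙xz to *-swap)

  private variable
    a b : Level
    A : Set a
    B : Set b

  ∑ : List A → (A → Carrier) → Carrier
  ∑ xs f = sumK (map f xs)

  ∑-cong : (xs : List A) {f g : A → Carrier} → (∀ {x} → x ∈ xs → f x ≈ g x) → ∑ xs f ≈ ∑ xs g
  ∑-cong [] h = ≈-refl
  ∑-cong (x ∷ xs) h = +-cong (h (here refl)) (∑-cong xs (h ∘ there))

  ∑-zero : (xs : List A) {f : A → Carrier} → (∀ {x} → x ∈ xs → f x ≈ 0#) → ∑ xs f ≈ 0#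
  ∑-zero [] h = ≈-refl
  ∑-zero (x ∷ xs) h = ≈-trans (+-cong (h (here refl)) (∑-zero xs (h ∘ there))) (+-identityˡ 0#)

  ∑-++ : (xs ys : List A) (f : A → Carrier) → ∑ (xs ++ ys) f ≈ ∑ xs f + ∑ ys f
  ∑-++ [] ys f = ≈-sym (+-identityˡ _)
  ∑-++ (x ∷ xs) ys f = ≈-trans (+-congˡ (∑-++ xs ys f)) (≈-sym (+-assoc _ _ _))

  ∑-concatMap : (g : A → List B) (xs : List A) (f : B → Carrier) → ∑ (concatMap g xs) f ≈ ∑ xs (λ x → ∑ (g x) f)
  ∑-concatMap g [] f = ≈-refl
  ∑-concatMap g (x ∷ xs) f = ≈-trans (∑-++ (g x) (concatMap g xs) f) (+-congˡ (∑-concatMap g xs f))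

  ∑-map : (g : A → B) (xs : List A) (f : B → Carrier) → ∑ (map g xs) f ≈ ∑ xs (f ∘ g)
  ∑-map g xs f = reflexive (cong sumK (sym (map-∘ xs)))

  ∑-+ : (xs : List A) (f g : A → Carrier) → ∑ xs (λ x → f x + g x) ≈ ∑ xs f + ∑ xs g
  ∑-+ [] f g = ≈-sym (+-identityˡ 0#)
  ∑-+ (x ∷ xs) f g = ≈-trans (+-congˡ (∑-+ xs f g)) (+-interchange _ _ _ _)

  ∑-*ˡ : (xs : List A) (k : Carrier) (f : A → Carrier) → k * ∑ xs f ≈ ∑ xs (λ x → k * f x)
  ∑-*ˡ [] k f = zeroʳ k
  ∑-*ˡ (x ∷ xs) k f = ≈-trans (distribˡ k _ _) (+-congˡ (∑-*ˡ xs k f))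

  ∑-*ʳ : (xs : List A) (k : Carrier) (f : A → Carrier) → ∑ xs f * k ≈ ∑ xs (λ x → f x * k)
  ∑-*ʳ xs k f = ≈-trans (*-comm _ k) (≈-trans (∑-*ˡ xs k f) (∑-cong xs (λ _ → *-comm k _)))

  ∑-swap : (xs : List A) (ys : List B) (f : A → B → Carrier) → ∑ xs (λ x → ∑ ys (f x)) ≈ ∑ ys (λ y → ∑ xs (λ x → f x y))
  ∑-swap [] ys f = ≈-sym (∑-zero ys (λ _ → ≈-refl))
  ∑-swap (x ∷ xs) ys f = ≈-trans (+-congˡ (∑-swap xs ys f)) (≈-sym (∑-+ ys (f x) (λ y → ∑ xs (λ x → f x y))))

  ∑-* : (xs : List A) (ys : List B) (f : A → Carrier) (g : B → Carrier) → ∑ xs f * ∑ ys g ≈ ∑ xs (λ x → ∑ ys (λ y → f x * g y))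
  ∑-* xs ys f g = ≈-trans (∑-*ʳ xs (∑ ys g) f) (∑-cong xs (λ {x} _ → ∑-*ˡ ys (f x) g))

  ∑-single : {xs : List A} {x : A} (f : A → Carrier) → Unique xs → x ∈ xs → (∀ {y} → y ∈ xs → y ≢ x → f y ≈ 0#) → ∑ xs f ≈ f x
  ∑-single {xs = x ∷ xs} f (a ∷ u) (here refl) h =
    ≈-trans (+-congˡ (∑-zero xs (λ i → h (there i) (λ e → All.lookup a i (sym e))))) (+-identityʳ _)
  ∑-single {xs = z ∷ xs} f (a ∷ u) (there i) h =
    ≈-trans (+-cong (h (here refl) (All.lookup a i)) (∑-single f u i (h ∘ there))) (+-identityˡ _)

  χ : Bool → Carrier
  χ true = 1#
  χ false = 0#

  χ-∧ : ∀ a b → χ (a ∧ b) ≈ χ a * χ b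
  χ-∧ true b = ≈-sym (*-identityˡ _)
  χ-∧ false b = ≈-sym (zeroˡ _)

  if-χ : ∀ t k → (if t then k else 0#) ≈ χ t * k
  if-χ true k = ≈-sym (*-identityˡ k)
  if-χ false k = ≈-sym (zeroˡ k)

  ∑-filter : ∀ {p} {P : A → Set p} (P? : ∀ x → Dec (P x)) (xs : List A) (f : A → Carrier) → ∑ (filter P? xs) f ≈ ∑ xs (λ x → χ (does (P? x)) * f x)
  ∑-filter P? [] f = ≈-refl
  ∑-filter P? (x ∷ xs) f with does (P? x)
  ... | true = +-cong (≈-sym (*-identityˡ _)) (∑-filter P? xs f)
  ... | false = ≈-trans (∑-filter P? xs f) (≈-sym (≈-trans (+-congʳ (zeroˡ _)) (+-identityˡ _)))

  ∑-length : (xs : List A) → ∑ xs (λ _ → 1#) ≈ natK (length xs)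
  ∑-length [] = ≈-refl
  ∑-length (x ∷ xs) = +-congˡ (∑-length xs)

  natK-+ : ∀ a b → natK (a ℕ.+ b) ≈ natK a + natK b
  natK-+ zero b = ≈-sym (+-identityˡ _)
  natK-+ (suc a) b = ≈-trans (+-congˡ (natK-+ a b)) (≈-sym (+-assoc _ _ _))

  natK-* : ∀ a b → natK (a ℕ.* b) ≈ natK a * natK b
  natK-* zero b = ≈-sym (zeroˡ _)
  natK-* (suc a) b = ≈-trans (natK-+ b (a ℕ.* b)) (≈-trans (+-cong (≈-sym (*-identityˡ _)) (natK-* a b)) (≈-sym (distribʳ _ _ _)))

  Comb : Set → Set c
  Comb A = List (Carrier × A)

  ext : {A : Set} → (A → Carrier) → Comb A → Carrier
  ext g x = ∑ x (λ p → proj₁ p * g (proj₂ p))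

  ext-cong : {A : Set} {g h : A → Carrier} (x : Comb A) → All (λ p → g (proj₂ p) ≈ h (proj₂ p)) x → ext g x ≈ ext h x
  ext-cong x a = ∑-cong x (λ i → *-congˡ (All.lookup a i))

  module Coefficients {A : Set} (_≟_ : DecidableEquality A) where

    coef : Comb A → A → Carrier
    coef x w = ∑ x (λ p → if does (proj₂ p ≟ w) then proj₁ p else 0#)

    coef-ext : ∀ x w → coef x w ≈ ext (λ a → χ (does (a ≟ w))) x
    coef-ext x w = ∑-cong x (λ {p} _ → ≈-trans (if-χ (does (proj₂ p ≟ w)) (proj₁ p)) (*-comm _ _))

    χ-yes : ∀ a → χ (does (a ≟ a)) ≈ 1#
    χ-yes a = reflexive (cong χ (dec-true (a ≟ a) refl))

    χ-no : ∀ {a b} → a ≢ b → χ (does (a ≟ b)) ≈ 0#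
    χ-no {a} {b} ne = reflexive (cong χ (dec-false (a ≟ b) ne))

    ∑-δˡ : ∀ {D a} (g : A → Carrier) → Unique D → a ∈ D → ∑ D (λ d → χ (does (a ≟ d)) * g d) ≈ g a
    ∑-δˡ {D} {a} g u i = ≈-trans (∑-single _ u i (λ {y} _ ne → ≈-trans (*-congʳ (χ-no (ne ∘ sym))) (zeroˡ _))) (≈-trans (*-congʳ (χ-yes a)) (*-identityˡ _))

    ext-support : ∀ D g x → Unique D → All (λ p → proj₂ p ∈ D) x → ext g x ≈ ∑ D (λ d → coef x d * g d)
    ext-support D g [] u _ = ≈-sym (∑-zero D (λ _ → zeroˡ _))
    ext-support D g ((k , a) ∷ x) u (i ∷ s) = begin
      k * g a + ext g x ≈⟨ +-cong (*-congˡ (≈-sym (∑-δˡ g u i))) (ext-support D g x u s) ⟩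
      k * ∑ D (λ d → χ (does (a ≟ d)) * g d) + ∑ D (λ d → coef x d * g d) ≈⟨ +-congʳ (∑-*ˡ D k _) ⟩
      ∑ D (λ d → k * (χ (does (a ≟ d)) * g d)) + ∑ D (λ d → coef x d * g d) ≈⟨ ≈-sym (∑-+ D _ _) ⟩
      ∑ D (λ d → k * (χ (does (a ≟ d)) * g d) + coef x d * g d) ≈⟨ ∑-cong D (λ {d} _ → ≈-trans (+-congʳ (≈-trans (≈-sym (*-assoc _ _ _)) (*-congʳ (≈-trans (*-comm k _) (≈-sym (if-χ (does (a ≟ d)) k)))))) (≈-sym (distribʳ _ _ _))) ⟩
      ∑ D (λ d → coef ((k , a) ∷ x) d * g d) ∎
      where open ≈R

    -- Combinations are lists in which a basis element may recur. Both are rewritten as sums over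
    -- one repetition-free list of all basis elements that occur, where only coefficients enter.
    ext-resp : ∀ g x y → (∀ a → coef x a ≈ coef y a) → ext g x ≈ ext g y
    ext-resp g x y h = ≈-trans (ext-support D g x u (sup x (λ i → ∈-++⁺ˡ i)))
      (≈-trans (∑-cong D (λ {d} _ → *-congʳ (h d))) (≈-sym (ext-support D g y u (sup y (λ i → ∈-++⁺ʳ (map proj₂ x) i)))))
      where
      L = map proj₂ x ++ map proj₂ y
      D = deduplicate _≟_ L
      u = UniqD.deduplicate-! _≟_ L
      sup : ∀ z → (∀ {a} → a ∈ map proj₂ z → a ∈ L) → All (λ p → proj₂ p ∈ D) z
      sup z f = All.tabulate (λ i → ∈-deduplicate⁺ _≟_ (f (∈-map⁺ proj₂ i)))

    coef-∉ : ∀ x a → All (λ p → proj₂ p ≢ a) x → coef x a ≈ 0#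
    coef-∉ x a h = ∑-zero x (λ {p} i → reflexive (cong (λ t → if t then proj₁ p else 0#) (dec-false (proj₂ p ≟ a) (All.lookup h i))))

-- Counting functionals and their values on the `tT`.

module CharacterMap {c ℓ} (𝕂 : CommutativeRing c ℓ) (m : ℕ) (inv : Fin m → Fin m) (inv-inv : ∀ b → inv (inv b) ≡ b) where
  open F using (zero; suc)
  open Correspondence 𝕂 m inv inv-inv public
  open RunDecompositions m public hiding (split-length)
  open KostkaPaths m public
  open RingSums 𝕂 m inv public
  open Setup 𝕂 m inv hiding (Word; word≟; starW; BTab; entries; IsStdBT; shape; Qb; Q; allWords; allBasis; boxes; btab≟) public
  module CW = Coefficients word≟

  -- Blocks of size 0 may occur in `w`, so that every exponent vector gives a block type; the
  -- coefficients of Θ will be values of these functionals.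
  Φ : List Run → F → Carrier
  Φ w = ext (λ α → χ (comp 0 w (valueWord α)))

  tT-fibre : ∀ T → tT T ≡ map (1# ,_) (fibre (boxes T) T)
  tT-fibre T = go (allBasis (boxes T))
    where
    go : ∀ xs → mapMaybe (λ α → if does (btab≟ (Q α) T) then just (1# , α) else nothing) xs ≡ map (1# ,_) (filter (λ α → btab≟ (Q α) T) xs)
    go [] = refl
    go (α ∷ xs) with does (btab≟ (Q α) T)
    ... | true = cong (_ ∷_) (go xs)
    ... | false = go xs

  ext-tT : ∀ g T → ext g (tT T) ≈ ∑ (fibre (boxes T) T) g
  ext-tT g T = ≈-trans (reflexive (cong (ext g) (tT-fibre T))) (≈-trans (∑-map (1# ,_) (fibre (boxes T) T) _) (∑-cong (fibre (boxes T) T) (λ _ → *-identityˡ _)))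

  χ-≟ : ∀ b → χ b ≈ χ (does (b Bool.≟ true)) * 1#
  χ-≟ true = ≈-sym (*-identityʳ 1#)
  χ-≟ false = ≈-sym (zeroˡ 1#)

  Wk-lens : ∀ X → RowInsertion.RT X → Wk (map length X)
  Wk-lens [] _ = tt
  Wk-lens (r ∷ []) _ = z≤n , tt
  Wk-lens (r ∷ r' ∷ X) (_ , _ , (le , _) , R) = le , Wk-lens (r' ∷ X) R

  shape-lookup : ∀ p b → lookup (shape (tab p)) b ≡ map length (real b (lab p))
  shape-lookup p b = trans (VP.lookup-map b (map length) (tab p)) (cong (map length) (VP.lookup∘tabulate _ b))

  shape-Wks : ∀ p → Lat p → Wks (shape (tab p))
  shape-Wks p L b = subst Wk (sym (shape-lookup p b)) (Wk-lens (real b (lab p)) (rt (real-Lat b (lab p) (lab-desc p) (lab-lat p L))))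

  shape-content : ∀ p → Lat p → Content (shape (tab p)) p
  shape-content p L b i = sym (trans (cong (λ z → at z i) (shape-lookup p b)) (trans (row-lengths (real-Lat b (lab p) (lab-desc p) (lab-lat p L)) i) (cong (λ z → cnt z (b , i)) (cells-lab p))))

  content-↭ : ∀ λ' p q → Content λ' p → Content λ' q → p ↭ q
  content-↭ λ' p q c c' = cnt⇒↭ p q (λ { (b , i) → trans (c b i) (sym (c' b i)) })

  kostkaB : BPart → List Run → ℕ
  kostkaB λ' w = ∏ (λ b → kostkaRev (lookup λ' b) (restr b (reverse w)))

  comp? : ∀ w α → Dec (comp 0 w (valueWord α) ≡ true)
  comp? w α = comp 0 w (valueWord α) Bool.≟ true

  -- `valuePath` identifies this set with the paths counted by the Kostka numbers: it is injective
  -- since the position path is fixed, it hits every path of the same content by `paths-exist`, and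
  -- `comp⇔path` translates the block condition.
  compFibre : List Run → ℕ → List Cell → List Word
  compFibre w n p = filter (comp? w) (fibre n (tab p))

  module _ {n p} (P : Path n p) (w : List Run) where
    private
      λ' : BPart
      λ' = shape (tab p)

      W : Wks λ'
      W = shape-Wks p (proj₂ P)

    compFibre⁻ : ∀ {α} → α ∈ compFibre w n p → Valid n α × positionPath α ≡ p × comp 0 w (valueWord α) ≡ true
    compFibre⁻ {α} i with ∈-filter⁻ (comp? w) {v = α} {xs = fibre n (tab p)} i
    ... | (j , e) with fibre⁻ {n} {p} {α} P j
    ...   | (v , q) = v , q , e

    compFibre-unique : Unique (map valuePath (compFibre w n p))
    compFibre-unique = map-unique valuePath (Uniq.filter⁺ (comp? w) (fibre-unique n (tab p))) inj
      where
      inj : ∀ {α β} → α ∈ compFibre w n p → β ∈ compFibre w n p → valuePath α ≡ valuePath β → α ≡ β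
      inj {α} {β} i j e with compFibre⁻ {α} i | compFibre⁻ {β} j
      ... | (v , q , _) | (v' , q' , _) = paths-determine {α = α} {β = β} v v' (trans q (sym q')) e

    compFibre-paths : ∀ {α} → α ∈ compFibre w n p → valuePath α ∈ paths λ' (reverse w)
    compFibre-paths {α} i with compFibre⁻ {α} i
    ... | (v , q , e) = paths⁺ λ' (reverse w) W (run-lat (reverse (valueWord α)))
            (λ b i → trans (sym (cnt-↭ (subst (_↭ valuePath α) q (paths-↭ v)) (b , i))) (shape-content p (proj₂ P) b i))
            (proj₁ (comp⇔path w (valueWord α) (distinct-value v)) e)

    paths-compFibre : ∀ {q} → q ∈ paths λ' (reverse w) → q ∈ map valuePath (compFibre w n p)
    paths-compFibre {q} i = found (paths-exist {n} {p} {q} P (proj₁ r) (content-↭ λ' p q (shape-content p (proj₂ P)) (proj₁ (proj₂ r))))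
      where
      r : Lat q × Content λ' q × Blocks _≤ₗ_ (reverse w) q
      r = paths⁻ λ' (reverse w) W i
      found : (∃ λ α → Valid n α × positionPath α ≡ p × valuePath α ≡ q) → q ∈ map valuePath (compFibre w n p)
      found (α , v , eq , eq') = subst (_∈ map valuePath (compFibre w n p)) eq' (∈-map⁺ valuePath {x = α} (∈-filter⁺ (comp? w) {x = α} (fibre⁺ {n} {p} {α} v eq)
        (proj₂ (comp⇔path w (valueWord α) (distinct-value {n} {α} v)) (subst (Blocks _≤ₗ_ (reverse w)) (sym eq') (proj₂ (proj₂ r))))))

    length-compFibre : length (compFibre w n p) ≡ kostkaB λ' w
    length-compFibre = trans (sym (length-map valuePath (compFibre w n p))) (trans (↭-length (unique⇒↭ compFibre-unique (paths-unique λ' (reverse w) W) to paths-compFibre)) (length-paths λ' (reverse w)))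
      where
      to : ∀ {q} → q ∈ map valuePath (compFibre w n p) → q ∈ paths λ' (reverse w)
      to i with ∈-map⁻ valuePath i
      ... | (α , j , refl) = compFibre-paths {α} j

    Φ-fibre : ∑ (fibre n (tab p)) (λ α → χ (comp 0 w (valueWord α))) ≈ natK (length (compFibre w n p))
    Φ-fibre = ≈-trans (∑-cong (fibre n (tab p)) (λ {α} _ → χ-≟ (comp 0 w (valueWord α))))
      (≈-trans (≈-sym (∑-filter (comp? w) (fibre n (tab p)) (λ _ → 1#))) (∑-length (compFibre w n p)))

  Φ-tab : ∀ {n p} → Path n p → ∀ w → Φ w (tT (tab p)) ≈ natK (kostkaB (shape (tab p)) w)
  Φ-tab {n} {p} P w = ≈-trans (ext-tT (λ α → χ (comp 0 w (valueWord α))) (tab p))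
    (≈-trans (reflexive (cong (λ k → ∑ (fibre k (tab p)) (λ α → χ (comp 0 w (valueWord α)))) (trans (tab-boxes p (proj₂ P)) (proj₁ P))))
    (≈-trans (Φ-fibre P w) (reflexive (cong natK (length-compFibre P w)))))

  Φ-std : ∀ T → IsStdBT T → ∀ w → Φ w (tT T) ≈ natK (kostkaB (shape T) w)
  Φ-std T s w with std-path T s
  ... | (p , P , refl) = Φ-tab P w

  restr-++ : ∀ b w w' → restr b (w ++ w') ≡ restr b w ++ restr b w'
  restr-++ b [] w' = refl
  restr-++ b ((n , b') ∷ w) w' with b' ≟ᶠ b
  ... | yes _ = cong (n ∷_) (restr-++ b w w')
  ... | no _ = restr-++ b w w'

  restr-reverse : ∀ b w → restr b (reverse w) ≡ reverse (restr b w)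
  restr-reverse b [] = refl
  restr-reverse b ((n , b') ∷ w) = trans (cong (restr b) (unfold-reverse (n , b') w)) (trans (restr-++ b (reverse w) _) (trans (cong (_++ restr b ((n , b') ∷ [])) (restr-reverse b w)) last))
    where
    last : reverse (restr b w) ++ restr b ((n , b') ∷ []) ≡ reverse (restr b ((n , b') ∷ w))
    last with b' ≟ᶠ b
    ... | yes _ = sym (unfold-reverse n (restr b w))
    ... | no _ = ++-identityʳ _

  -- Kostka numbers see only the blocks of each colour separately, so the colours may be interleaved
  -- in any way. The coproduct relies on this freedom.
  Has : List Run → BMon → Set
  Has w a = ∀ b → restr b w ≡ lookup a b

  schurB-kostkaB : ∀ λ' w a → Has w a → schurB λ' a ≈ natK (kostkaB λ' w)
  schurB-kostkaB λ' w a h = go λ' a (λ b → restr b (reverse w)) (λ b → trans (restr-reverse b w) (cong reverse (h b)))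
    where
    go : ∀ {n} (λ' a : Vec (List ℕ) n) (r : Fin n → List ℕ) → (∀ b → r b ≡ reverse (lookup a b)) → prodK (V.toList (V.zipWith (λ l e → natK (kostka l e)) λ' a)) ≈ natK (∏ (λ b → kostkaRev (lookup λ' b) (r b)))
    go V.[] V.[] r _ = ≈-sym (+-identityʳ 1#)
    go (l V.∷ λ') (e V.∷ a) r h = ≈-trans (*-cong (reflexive (cong (natK ∘ kostkaRev l) (sym (h zero)))) (go λ' a (r ∘ suc) (h ∘ suc))) (≈-sym (natK-* (kostkaRev l (r zero)) (∏ (λ b → kostkaRev (lookup λ' b) (r (suc b))))))

  block : Fin m → List ℕ → List Run
  block b e = map (_, b) e

  restr-block : ∀ b e → restr b (block b e) ≡ e
  restr-block b [] = refl
  restr-block b (n ∷ e) = trans (restr-≡ b n (block b e)) (cong (n ∷_) (restr-block b e))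

  restr-block-≢ : ∀ {b b'} e → b' ≢ b → restr b (block b' e) ≡ []
  restr-block-≢ [] ne = refl
  restr-block-≢ {b} {b'} (n ∷ e) ne = trans (restr-≢ n (block b' e) ne) (restr-block-≢ e ne)

  wOf′ : ∀ {k} → (Fin k → Fin m) → Vec (List ℕ) k → List Run
  wOf′ f V.[] = []
  wOf′ f (e V.∷ es) = block (f zero) e ++ wOf′ (f ∘ suc) es

  wOf : BMon → List Run
  wOf = wOf′ id

  wOf-has : ∀ a → Has (wOf a) a
  wOf-has a b = hit id a b id
    where
    miss : ∀ {k} (f : Fin k → Fin m) es b → (∀ c → f c ≢ b) → restr b (wOf′ f es) ≡ []
    miss f V.[] b _ = refl
    miss f (e V.∷ es) b h = trans (restr-++ b (block (f zero) e) _) (cong₂ _++_ (restr-block-≢ e (h zero)) (miss (f ∘ suc) es b (h ∘ suc)))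
    hit : ∀ {k} (f : Fin k → Fin m) es c → (∀ {x y} → f x ≡ f y → x ≡ y) → restr (f c) (wOf′ f es) ≡ lookup es c
    hit f (e V.∷ es) zero inj = trans (restr-++ (f zero) (block (f zero) e) _) (trans (cong₂ _++_ (restr-block (f zero) e) (miss (f ∘ suc) es (f zero) (λ c e → case inj e of λ ()))) (++-identityʳ e))
    hit f (e V.∷ es) (suc c) inj = trans (restr-++ (f (suc c)) (block (f zero) e) _) (cong₂ _++_ (restr-block-≢ e (λ e → case inj e of λ ())) (hit (f ∘ suc) es c (Fsuc-injective ∘ inj)))

  ext-•F : ∀ g k x → ext g (k •F x) ≈ k * ext g x
  ext-•F g k x = ≈-trans (∑-map (λ p → (k * proj₁ p , proj₂ p)) x _) (≈-trans (∑-cong x (λ _ → *-assoc k _ _)) (≈-sym (∑-*ˡ x k _)))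

  ext-ι : ∀ g u → ext g (ι u) ≈ ∑ u (λ p → proj₁ p * ext g (tT (proj₂ p)))
  ext-ι g u = ≈-trans (∑-concatMap (λ p → proj₁ p •F tT (proj₂ p)) u _) (∑-cong u (λ {p} _ → ext-•F g (proj₁ p) (tT (proj₂ p))))

  Θ-∑ : ∀ u a → Θ u a ≈ ∑ u (λ p → proj₁ p * schurB (shape (proj₂ p)) a)
  Θ-∑ u a = ∑-map (λ p → (proj₁ p , shape (proj₂ p))) u (λ q → proj₁ q * schurB (proj₂ q) a)

  -- The right side depends only on the element `ι u` and not on the way it is written.
  -- Well-definedness and the morphism properties all start from here.
  Θ-Φ : ∀ u w a → Std u → Has w a → Θ u a ≈ Φ w (ι u)
  Θ-Φ u w a s h = ≈-trans (Θ-∑ u a) (≈-trans (∑-cong u (λ {p} i → *-congˡ (≈-trans (schurB-kostkaB (shape (proj₂ p)) w a h) (≈-sym (Φ-std (proj₂ p) (All.lookup s i) w))))) (≈-sym (ext-ι _ u)))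

  Φ-resp : ∀ w x y → x ≈F y → Φ w x ≈ Φ w y
  Φ-resp w x y h = CW.ext-resp _ x y h

  Θ-well-defined : ∀ u v → Std u → Std v → ι u ≈F ι v → Θ u ≈Λ Θ v
  Θ-well-defined u v s s' h a = ≈-trans (Θ-Φ u (wOf a) a s (wOf-has a)) (≈-trans (Φ-resp (wOf a) (ι u) (ι v) h) (≈-sym (Θ-Φ v (wOf a) a s' (wOf-has a))))

  wsize : List Run → ℕ
  wsize w = sum (map proj₁ w)

  comp-length : ∀ w X → comp 0 w X ≡ true → length X ≡ wsize w
  comp-length w X e = go w X (comp⇒Blocks 0 w X e)
    where
    go : ∀ {L} w X → Blocks L w X → length X ≡ wsize w
    go [] .[] refl = refl
    go ((n , b) ∷ w) .(Y ++ Z) (Y , Z , refl , e , _ , _ , B) = trans (length-++ Y) (cong₂ ℕ._+_ e (go w Z B))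

  wsize-wOf : ∀ a → wsize (wOf a) ≡ totdeg a
  wsize-wOf a = go id a
    where
    go : ∀ {k} (f : Fin k → Fin m) (es : Vec (List ℕ) k) → wsize (wOf′ f es) ≡ sum (map sum (V.toList es))
    go f V.[] = refl
    go f (e V.∷ es) = trans (cong sum (map-++ proj₁ (block (f zero) e) (wOf′ (f ∘ suc) es))) (trans (sum-++ (map proj₁ (block (f zero) e)) _)
      (cong₂ ℕ._+_ (cong sum (trans (sym (map-∘ e)) (map-id e))) (go (f ∘ suc) es)))

  -- `F` also contains pairs whose second component is not a permutation of the right length; the
  -- combinatorics applies to genuine basis elements only.
  AllValid : F → Set c
  AllValid x = All (λ p → ∃ λ n → Valid n (proj₂ p)) x

  fibre-valid : ∀ n T {α} → α ∈ fibre n T → Valid n α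
  fibre-valid n T i = allBasis⁻ n (proj₁ (∈-filter⁻ (λ α → btab≟ (Q α) T) i))

  ι-valid : ∀ u → AllValid (ι u)
  ι-valid [] = []
  ι-valid ((k , T) ∷ u) = AllP.++⁺ (subst (AllValid ∘ (k •F_)) (sym (tT-fibre T)) (AllP.map⁺ (AllP.map⁺ (All.tabulate (λ i → boxes T , fibre-valid (boxes T) T i))))) (ι-valid u)

  Φ-degree : ∀ T w → wsize w ≢ boxes T → Φ w (tT T) ≈ 0#
  Φ-degree T w ne = ≈-trans (ext-tT _ T) (∑-zero (fibre (boxes T) T) λ {α} i → zero′ α (fibre-valid (boxes T) T i))
    where
    zero′ : ∀ α → Valid (boxes T) α → χ (comp 0 w (valueWord α)) ≈ 0#
    zero′ α v with comp 0 w (valueWord α) in e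
    ... | false = ≈-refl
    ... | true = ⊥-elim (ne (trans (sym (comp-length w (valueWord α) e)) (length-valueWord v)))

  Θ-graded : ∀ u n → Std u → All (λ p → boxes (proj₂ p) ≡ n) u → ∀ a → totdeg a ≢ n → Θ u a ≈ 0#
  Θ-graded u n s d a ne = ≈-trans (Θ-∑ u a) (∑-zero u λ {p} i → ≈-trans (*-congˡ (≈-trans (schurB-kostkaB (shape (proj₂ p)) (wOf a) a (wOf-has a))
      (≈-trans (≈-sym (Φ-std (proj₂ p) (All.lookup s i) (wOf a))) (Φ-degree (proj₂ p) (wOf a) (λ e → ne (trans (sym (wsize-wOf a)) (trans e (All.lookup d i)))))))) (zeroʳ _))

  comp-[] : ∀ a → comp 0 (wOf a) [] ≡ isConst a
  comp-[] a = go id a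
    where
    go' : ∀ b e w → comp 0 (block b e ++ w) [] ≡ allZero e ∧ comp 0 w []
    go' b [] w = refl
    go' b (zero ∷ e) w = go' b e w
    go' b (suc n ∷ e) w = refl
    go : ∀ {k} (f : Fin k → Fin m) (es : Vec (List ℕ) k) → comp 0 (wOf′ f es) [] ≡ V.foldr (λ _ → Bool) (λ e r → allZero e ∧ r) true es
    go f V.[] = refl
    go f (e V.∷ es) = trans (go' (f zero) e _) (cong (allZero e ∧_) (go (f ∘ suc) es))

  Φ-one : ∀ a → Φ (wOf a) oneF ≈ 1Λ a
  Φ-one a = ≈-trans (+-identityʳ _) (≈-trans (*-identityˡ _) (≈-trans (reflexive (cong χ (comp-[] a))) (indicator (isConst a))))
    where
    indicator : ∀ b → χ b ≈ (if b then 1# else 0#)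
    indicator true = ≈-refl
    indicator false = ≈-refl

  Θ-unit : ∀ u → Std u → ι u ≈F oneF → Θ u ≈Λ 1Λ
  Θ-unit u s h a = ≈-trans (Θ-Φ u (wOf a) a s (wOf-has a)) (≈-trans (Φ-resp (wOf a) (ι u) oneF h) (Φ-one a))

  Θ-counit : ∀ u → Std u → εΛ (Θ u) ≈ εF (ι u)
  Θ-counit u s = ≈-trans (Θ-Φ u [] (V.replicate m []) s (λ b → sym (VP.lookup-replicate b []))) (≈-trans (ext-cong (ι u) (All.map (λ (_ , v) → null _ v) (ι-valid u))) (≈-sym (CW.coef-ext (ι u) ([] , []))))
    where
    null : ∀ {n} α → Valid n α → χ (comp 0 [] (valueWord α)) ≈ χ (does (word≟ α ([] , [])))
    null ([] , []) v = ≈-refl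
    null ([] , _ ∷ _) (refl ▹ p) = ⊥-elim (Perm.¬x∷xs↭[] p)
    null (_ ∷ _ , []) (refl ▹ p) = ⊥-elim (Perm.¬x∷xs↭[] (↭-sym p))
    null (_ ∷ _ , x ∷ σ) v = ≈-refl

  -- The product: shuffling value words.

  open Shuffles
  open Standardisation

  shiftW : ℕ → List Letter → List Letter
  shiftW n = map (map₂ (n ℕ.+_))

  prodWord : Word → Word → List Bool → Word
  prodWord (b , σ) (b' , σ') s = merge b b' s , map (at (shufflePerm s)) (σ ++ map (length b ℕ.+_) σ')

  module _ {n n' α β} (v : Valid n α) (v' : Valid n' β) {s} (f : Fits (proj₁ α) (proj₁ β) s) where
    private
      fσ : Fits (proj₂ α) (proj₂ β) s
      fσ = fits-length _ _ (trans (valid-length v) (sym (perm-length (valid-perm v)))) (trans (valid-length v') (sym (perm-length (valid-perm v')))) f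

    prodWord-valid : Valid (n ℕ.+ n') (prodWord α β s)
    prodWord-valid = trans (↭-length (merge-↭ f)) (trans (length-++ (proj₁ α)) (cong₂ ℕ._+_ (valid-length v) (valid-length v')))
      ▹ subst (λ k → IsPerm (n ℕ.+ n') (map (at (shufflePerm s)) (proj₂ α ++ map (k ℕ.+_) (proj₂ β)))) (sym (valid-length v)) (shuffled-perm (valid-perm v) (valid-perm v') fσ)

    valueWord-prodWord : valueWord (prodWord α β s) ≡ merge (valueWord α) (shiftW n (valueWord β)) s
    valueWord-prodWord = trans (cong (zip (merge (proj₁ α) (proj₁ β) s)) (trans (cong (λ k → invPerm (map (at (shufflePerm s)) (proj₂ α ++ map (k ℕ.+_) (proj₂ β)))) (valid-length v)) (shuffled-inv (valid-perm v) (valid-perm v') fσ)))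
      (trans (merge-zip _ _ (trans (valid-length v) (sym (inv-length (valid-perm v)))) (trans (valid-length v') (sym (trans (length-map _ (invPerm (proj₂ β))) (inv-length (valid-perm v'))))) f)
        (cong (λ z → merge (valueWord α) z s) (zip-shift (proj₁ β) (invPerm (proj₂ β)))))
      where
      zip-shift : ∀ c τ → zip c (map (n ℕ.+_) τ) ≡ shiftW n (zip c τ)
      zip-shift [] τ = refl
      zip-shift (_ ∷ _) [] = refl
      zip-shift (b ∷ c) (t ∷ τ) = cong (_ ∷_) (zip-shift c τ)

  -- `comp` uses values only through comparisons, so it is unchanged by any relabelling that
  -- preserves order on the values present: the shift of a second factor, standardization, and the
  -- spreading of values over slots.
  comp-map : ∀ (f : ℕ → ℕ) p p' w X → All (λ l → (p ≤ᵇ proj₂ l) ≡ (p' ≤ᵇ f (proj₂ l))) X →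
    (∀ {x y} → x ∈ vals X → y ∈ vals X → (suc x ≤ᵇ y) ≡ (suc (f x) ≤ᵇ f y)) → comp p' w (map (map₂ f) X) ≡ comp p w X
  comp-map f p p' [] [] _ _ = refl
  comp-map f p p' [] (_ ∷ _) _ _ = refl
  comp-map f p p' ((zero , b) ∷ w) X _ h = comp-map f 0 0 w X (All.tabulate (λ _ → refl)) h
  comp-map f p p' ((suc n , b) ∷ w) [] _ _ = refl
  comp-map f p p' ((suc n , b) ∷ w) ((b' , x) ∷ X) (q ∷ a) h =
    cong₂ (λ y z → does (b' ≟ᶠ b) ∧ (y ∧ z)) (sym q) (comp-map f (suc x) (suc (f x)) ((n , b) ∷ w) X
      (All.tabulate (λ i → h (here refl) (there (∈-map⁺ proj₂ i)))) (λ i j → h (there i) (there j)))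

  comp-shift : ∀ n w X → comp 0 w (shiftW n X) ≡ comp 0 w X
  comp-shift n w X = comp-map (n ℕ.+_) 0 0 w X (All.tabulate (λ _ → refl)) (λ {x} {y} _ _ → sh n x y)
    where
    sh : ∀ n x y → (suc x ≤ᵇ y) ≡ (suc (n ℕ.+ x) ≤ᵇ (n ℕ.+ y))
    sh zero x y = refl
    sh (suc n) x zero rewrite ℕP.+-identityʳ n = sym (<ᵇ-irr n x)
      where
      <ᵇ-irr : ∀ n x → (n ℕ.+ x ℕ.<ᵇ n) ≡ false
      <ᵇ-irr zero x = refl
      <ᵇ-irr (suc n) x = <ᵇ-irr n x
    sh (suc n) x (suc y) = trans (sh n x (suc y)) refl

  mergeSum : List Letter → List Letter → (List Letter → Carrier) → Carrier
  mergeSum A B f = ∑ (shuffles (length A) (length B)) (λ s → f (merge A B s))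

  merge-[]ˡ : ∀ (B : List Letter) → merge [] B (replicate (length B) true) ≡ B
  merge-[]ˡ [] = refl
  merge-[]ˡ (y ∷ B) = cong (y ∷_) (merge-[]ˡ B)

  merge-[]ʳ : ∀ (A : List Letter) → merge A [] (replicate (length A) false) ≡ A
  merge-[]ʳ [] = refl
  merge-[]ʳ (x ∷ A) = cong (x ∷_) (merge-[]ʳ A)

  mergeSum-[]ˡ : ∀ B f → mergeSum [] B f ≈ f B
  mergeSum-[]ˡ B f = ≈-trans (+-identityʳ _) (reflexive (cong f (merge-[]ˡ B)))

  mergeSum-[]ʳ : ∀ A f → mergeSum A [] f ≈ f A
  mergeSum-[]ʳ [] f = +-identityʳ _
  mergeSum-[]ʳ (x ∷ A) f = ≈-trans (+-identityʳ _) (reflexive (cong f (merge-[]ʳ (x ∷ A))))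

  partA partB : List Letter → List Letter → (List Letter → Carrier) → Carrier
  partA [] B f = 0#
  partA (x ∷ A) B f = mergeSum A B (f ∘ (x ∷_))
  partB A [] f = 0#
  partB A (y ∷ B) f = mergeSum A B (f ∘ (y ∷_))

  -- The two parts sort the shuffles by the origin of the first letter. The empty shuffle has none,
  -- whence the condition on `f []`.
  mergeSum-split : ∀ A B f → f [] ≈ 0# → mergeSum A B f ≈ partB A B f + partA A B f
  mergeSum-split [] [] f z = ≈-trans (mergeSum-[]ˡ [] f) (≈-trans z (≈-sym (+-identityʳ 0#)))
  mergeSum-split [] (y ∷ B) f z = ≈-trans (mergeSum-[]ˡ (y ∷ B) f) (≈-sym (≈-trans (+-identityʳ _) (mergeSum-[]ˡ B (f ∘ (y ∷_)))))
  mergeSum-split (x ∷ A) [] f z = ≈-trans (mergeSum-[]ʳ (x ∷ A) f) (≈-sym (≈-trans (+-identityˡ _) (mergeSum-[]ʳ A (f ∘ (x ∷_)))))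
  mergeSum-split (x ∷ A) (y ∷ B) f z = ≈-trans (∑-++ (map (false ∷_) (shuffles (length A) (suc (length B)))) _ _) (≈-trans (+-comm _ _)
    (+-cong (∑-map (true ∷_) (shuffles (suc (length A)) (length B)) _) (∑-map (false ∷_) (shuffles (length A) (suc (length B))) _)))

  mergeSum-cong : ∀ A B {f g} → (∀ X → f X ≈ g X) → mergeSum A B f ≈ mergeSum A B g
  mergeSum-cong A B h = ∑-cong (shuffles (length A) (length B)) (λ _ → h _)

  splitsR : List Run → List (List Run × List Run)
  splitsR [] = ([] , []) ∷ []
  splitsR ((n , b) ∷ w) = concatMap (λ i → map (λ p → ((i , b) ∷ proj₁ p , (n ∸ i , b) ∷ proj₂ p)) (splitsR w)) (upTo (suc n))

  κ : ℕ → Fin m → Letter → Carrier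
  κ p b l = χ (does (proj₁ l ≟ᶠ b)) * χ (p ≤ᵇ proj₂ l)

  χ-comp : ∀ p n b w l X → χ (comp p ((suc n , b) ∷ w) (l ∷ X)) ≈ κ p b l * χ (comp (suc (proj₂ l)) ((n , b) ∷ w) X)
  χ-comp p n b w l X = ≈-trans (χ-∧ (does (proj₁ l ≟ᶠ b)) _) (≈-trans (*-congˡ (χ-∧ (p ≤ᵇ proj₂ l) _)) (≈-sym (*-assoc _ _ _)))

  -- Ways in which `A` and `B` share a block type with first block of colour `b`. In `RA` the word
  -- `A` supplies `i` letters of that block and `B` the others; `RA⁺` is the part for size `n + 1`
  -- in which `A` supplies at least one; in `RB` the block is left to `B`. The first argument bounds
  -- from below the next letter of a block already begun.
  RA RA⁺ RB : ℕ → ℕ → Fin m → List Run → List Letter → List Letter → Carrier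
  RA p n b w A B = ∑ (upTo (suc n)) (λ i → ∑ (splitsR w) (λ r → χ (comp p ((i , b) ∷ proj₁ r) A) * χ (comp 0 ((n ∸ i , b) ∷ proj₂ r) B)))
  RA⁺ p n b w A B = ∑ (upTo (suc n)) (λ i → ∑ (splitsR w) (λ r → χ (comp p ((suc i , b) ∷ proj₁ r) A) * χ (comp 0 ((n ∸ i , b) ∷ proj₂ r) B)))
  RB q n b w A B = ∑ (splitsR w) (λ r → χ (comp 0 (proj₁ r) A) * χ (comp q ((n , b) ∷ proj₂ r) B))

  RR : List Run → List Letter → List Letter → Carrier
  RR w A B = ∑ (splitsR w) (λ r → χ (comp 0 (proj₁ r) A) * χ (comp 0 (proj₂ r) B))

  RR-∷ : ∀ n b w A B → RR ((n , b) ∷ w) A B ≈ RA 0 n b w A B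
  RR-∷ n b w A B = ≈-trans (∑-concatMap (λ i → map (cut i) (splitsR w)) (upTo (suc n)) G) (∑-cong (upTo (suc n)) (λ {i} _ → ∑-map (cut i) (splitsR w) G))
    where
    cut : ℕ → List Run × List Run → List Run × List Run
    cut i p = (i , b) ∷ proj₁ p , (n ∸ i , b) ∷ proj₂ p
    G : List Run × List Run → Carrier
    G r = χ (comp 0 (proj₁ r) A) * χ (comp 0 (proj₂ r) B)

  RA-suc : ∀ p n b w A B → RA p (suc n) b w A B ≈ RB 0 (suc n) b w A B + RA⁺ p n b w A B
  RA-suc p n b w A B = +-congˡ (≈-trans (reflexive (cong (λ z → ∑ z G) (sym (map-upTo suc (suc n))))) (∑-map suc (upTo (suc n)) G))
    where
    G : ℕ → Carrier
    G i = ∑ (splitsR w) (λ r → χ (comp p ((i , b) ∷ proj₁ r) A) * χ (comp 0 ((suc n ∸ i , b) ∷ proj₂ r) B))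

  RA⁺-[] : ∀ p n b w B → RA⁺ p n b w [] B ≈ 0#
  RA⁺-[] p n b w B = ∑-zero (upTo (suc n)) (λ _ → ∑-zero (splitsR w) (λ _ → zeroˡ _))

  RA⁺-∷ : ∀ p n b w x A B → RA⁺ p n b w (x ∷ A) B ≈ κ p b x * RA (suc (proj₂ x)) n b w A B
  RA⁺-∷ p n b w x A B = ≈-sym (≈-trans (∑-*ˡ (upTo (suc n)) _ _) (∑-cong (upTo (suc n)) (λ {i} _ → ≈-trans (∑-*ˡ (splitsR w) _ _)
    (∑-cong (splitsR w) (λ {r} _ → ≈-trans (≈-sym (*-assoc _ _ _)) (*-congʳ (≈-sym (χ-comp p i b (proj₁ r) x A))))))))

  RB-[] : ∀ q n b w A → RB q (suc n) b w A [] ≈ 0#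
  RB-[] q n b w A = ∑-zero (splitsR w) (λ _ → zeroʳ _)

  RB-∷ : ∀ q n b w A y B → RB q (suc n) b w A (y ∷ B) ≈ κ q b y * RB (suc (proj₂ y)) n b w A B
  RB-∷ q n b w A y B = ≈-sym (≈-trans (∑-*ˡ (splitsR w) _ _) (∑-cong (splitsR w) (λ {r} _ → ≈-trans (*-swap _ _ _) (*-congˡ (≈-sym (χ-comp q n b (proj₂ r) y B))))))

  module _ (N : ℕ) where
    Low High : List Letter → Set
    Low = All (λ l → proj₂ l < N)
    High = All (λ l → N ≤ proj₂ l)

    -- Within a block the letters of A precede those of B: as long as the bound p is at most N letters of A
    -- may still come, afterwards the block continues in B.
    product-word : ∀ w A B → Low A → High B → mergeSum A B (χ ∘ comp 0 w) ≈ RR w A B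
    product-low : ∀ p n b w A B → p ≤ N → Low A → High B → mergeSum A B (χ ∘ comp p ((n , b) ∷ w)) ≈ RA p n b w A B
    product-high : ∀ q n b w A B → N ≤ q → Low A → High B → mergeSum A B (χ ∘ comp q ((n , b) ∷ w)) ≈ RB q n b w A B

    product-word [] [] [] _ _ = +-congʳ (≈-sym (*-identityˡ _))
    product-word [] [] (y ∷ B) _ _ = ≈-trans (mergeSum-[]ˡ (y ∷ B) (χ ∘ comp 0 [])) (≈-sym (≈-trans (+-identityʳ _) (zeroʳ _)))
    product-word [] (x ∷ A) B lA lB = ≈-trans (null B) (≈-sym (≈-trans (+-identityʳ _) (zeroˡ _)))
      where
      null : ∀ B → mergeSum (x ∷ A) B (χ ∘ comp 0 []) ≈ 0#
      null [] = mergeSum-[]ʳ (x ∷ A) (χ ∘ comp 0 [])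
      null (y ∷ B) = ≈-trans (∑-++ (map (false ∷_) (shuffles (length A) (suc (length B)))) _ _) (≈-trans
        (+-cong (≈-trans (∑-map (false ∷_) (shuffles (length A) (suc (length B))) _) (∑-zero (shuffles (length A) (suc (length B))) (λ _ → ≈-refl)))
                (≈-trans (∑-map (true ∷_) (shuffles (suc (length A)) (length B)) _) (∑-zero (shuffles (suc (length A)) (length B)) (λ _ → ≈-refl)))) (+-identityʳ 0#))
    product-word ((n , b) ∷ w) A B lA lB = ≈-trans (product-low 0 n b w A B z≤n lA lB) (≈-sym (RR-∷ n b w A B))

    product-low p zero b w A B _ lA lB = ≈-trans (product-word w A B lA lB) (≈-sym (+-identityʳ _))
    product-low p (suc n) b w A B p≤ lA lB = ≈-trans (mergeSum-split A B _ ≈-refl) (≈-trans (+-cong (fromB B lB) (fromA A lA)) (≈-sym (RA-suc p n b w A B)))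
      where
      fromA : ∀ A → Low A → partA A B (χ ∘ comp p ((suc n , b) ∷ w)) ≈ RA⁺ p n b w A B
      fromA [] _ = ≈-sym (RA⁺-[] p n b w B)
      fromA (x ∷ A) (lt ∷ lA) = ≈-trans (mergeSum-cong A B (λ X → χ-comp p n b w x X)) (≈-trans (≈-sym (∑-*ˡ (shuffles (length A) (length B)) _ _))
        (≈-trans (*-congˡ (product-low (suc (proj₂ x)) n b w A B lt lA lB)) (≈-sym (RA⁺-∷ p n b w x A B))))
      fromB : ∀ B → High B → partB A B (χ ∘ comp p ((suc n , b) ∷ w)) ≈ RB 0 (suc n) b w A B
      fromB [] _ = ≈-sym (RB-[] 0 n b w A)
      fromB (y ∷ B) (le ∷ lB) = ≈-trans (mergeSum-cong A B (λ X → χ-comp p n b w y X)) (≈-trans (≈-sym (∑-*ˡ (shuffles (length A) (length B)) _ _))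
        (≈-trans (*-cong (*-congˡ (reflexive (cong χ (≤ᵇ-true (ℕP.≤-trans p≤ le))))) (product-high (suc (proj₂ y)) n b w A B (ℕP.m≤n⇒m≤1+n le) lA lB)) (≈-sym (RB-∷ 0 n b w A y B))))

    product-high q zero b w A B _ lA lB = product-word w A B lA lB
    product-high q (suc n) b w A B N≤ lA lB = ≈-trans (mergeSum-split A B _ ≈-refl) (≈-trans (+-cong (fromB B lB) (fromA A lA)) (+-identityʳ _))
      where
      fromA : ∀ A → Low A → partA A B (χ ∘ comp q ((suc n , b) ∷ w)) ≈ 0#
      fromA [] _ = ≈-refl
      fromA (x ∷ A) (lt ∷ _) = ∑-zero (shuffles (length A) (length B)) (λ _ → ≈-trans (χ-comp q n b w x _) (≈-trans (*-congʳ (≈-trans (*-congˡ (reflexive (cong χ (≤ᵇ-false (ℕP.<-≤-trans lt N≤))))) (zeroʳ _))) (zeroˡ _)))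
        where
        ≤ᵇ-false : ∀ {q x} → x < q → (q ≤ᵇ x) ≡ false
        ≤ᵇ-false {q} {x} lt with q ≤ᵇ x in e
        ... | false = refl
        ... | true = ⊥-elim (ℕP.<-irrefl refl (ℕP.<-≤-trans lt (ℕP.≤ᵇ⇒≤ q x (subst T (sym e) tt))))
      fromB : ∀ B → High B → partB A B (χ ∘ comp q ((suc n , b) ∷ w)) ≈ RB q (suc n) b w A B
      fromB [] _ = ≈-sym (RB-[] q n b w A)
      fromB (y ∷ B) (le ∷ lB) = ≈-trans (mergeSum-cong A B (λ X → χ-comp q n b w y X)) (≈-trans (≈-sym (∑-*ˡ (shuffles (length A) (length B)) _ _))
        (≈-trans (*-congˡ (product-high (suc (proj₂ y)) n b w A B (ℕP.m≤n⇒m≤1+n le) lA lB)) (≈-sym (RB-∷ q n b w A y B))))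

  low-valueWord : ∀ {n α} → Valid n α → Low n (valueWord α)
  low-valueWord v = AllP.map⁻ (subst (All (_< _)) (sym (vals-valueWord v)) (All.tabulate (perm-∈⁻ (inv-perm (valid-perm v)))))

  high-shift : ∀ n X → High n (shiftW n X)
  high-shift n X = AllP.map⁺ (All.tabulate (λ {l} _ → ℕP.m≤m+n n (proj₂ l)))

  RR-shift : ∀ n w A B → RR w A (shiftW n B) ≈ RR w A B
  RR-shift n w A B = ∑-cong (splitsR w) (λ {r} _ → *-congˡ (reflexive (cong χ (comp-shift n (proj₂ r) B))))

  product-basis : ∀ {n n' α β} → Valid n α → Valid n' β → ∀ w →
    ∑ (shuffles (length (proj₁ α)) (length (proj₁ β))) (λ s → χ (comp 0 w (valueWord (prodWord α β s)))) ≈ RR w (valueWord α) (valueWord β)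
  product-basis {n} {n'} {α} {β} v v' w = ≈-trans (∑-cong (shuffles (length (proj₁ α)) (length (proj₁ β)))
      (λ i → reflexive (cong (χ ∘ comp 0 w) (valueWord-prodWord v v' (shuffles-fit (proj₁ α) (proj₁ β) i)))))
    (≈-trans (reflexive (cong₂ (λ k k' → ∑ (shuffles k k') (λ s → χ (comp 0 w (merge (valueWord α) (shiftW n (valueWord β)) s))))
        (trans (valid-length v) (sym (length-valueWord v))) (trans (valid-length v') (sym (trans (length-map _ (valueWord β)) (length-valueWord v'))))))
      (≈-trans (product-word n w (valueWord α) (shiftW n (valueWord β)) (low-valueWord v) (high-shift n (valueWord β))) (RR-shift n w (valueWord α) (valueWord β))))

  ext-*F : ∀ g x y → ext g (x *F y) ≈ ∑ x (λ p → ∑ y (λ q → (proj₁ p * proj₁ q) * ∑ (shuffles (length (proj₁ (proj₂ p))) (length (proj₁ (proj₂ q)))) (λ s → g (prodWord (proj₂ p) (proj₂ q) s))))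
  ext-*F g x y = ≈-trans (∑-concatMap _ x _) (∑-cong x (λ {p} _ → ≈-trans (∑-concatMap _ y _) (∑-cong y (λ {q} _ → ≈-trans (ext-•F g (proj₁ p * proj₁ q) (mulW (proj₂ p) (proj₂ q)))
    (*-congˡ (≈-trans (∑-map (λ s → (1# , prodWord (proj₂ p) (proj₂ q) s)) (shuffles (length (proj₁ (proj₂ p))) (length (proj₁ (proj₂ q)))) _)
      (∑-cong (shuffles (length (proj₁ (proj₂ p))) (length (proj₁ (proj₂ q)))) (λ _ → *-identityˡ _))))))))

  Φ-*F : ∀ w x y → AllValid x → AllValid y → Φ w (x *F y) ≈ ∑ (splitsR w) (λ r → Φ (proj₁ r) x * Φ (proj₂ r) y)
  Φ-*F w x y vx vy = begin
    Φ w (x *F y) ≈⟨ ext-*F _ x y ⟩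
    ∑ x (λ p → ∑ y (λ q → (proj₁ p * proj₁ q) * _)) ≈⟨ ∑-cong x (λ {p} i → ∑-cong y (λ {q} j → ≈-trans (*-congˡ (product-basis (proj₂ (All.lookup vx i)) (proj₂ (All.lookup vy j)) w)) (≈-trans (∑-*ˡ (splitsR w) _ _) (∑-cong (splitsR w) (λ _ → *-interchange _ _ _ _))))) ⟩
    ∑ x (λ p → ∑ y (λ q → ∑ (splitsR w) (λ r → term r p * term′ r q))) ≈⟨ ∑-cong x (λ {p} _ → ∑-swap y (splitsR w) _) ⟩
    ∑ x (λ p → ∑ (splitsR w) (λ r → ∑ y (λ q → term r p * term′ r q))) ≈⟨ ∑-swap x (splitsR w) _ ⟩
    ∑ (splitsR w) (λ r → ∑ x (λ p → ∑ y (λ q → term r p * term′ r q))) ≈⟨ ∑-cong (splitsR w) (λ {r} _ → ≈-sym (∑-* x y (term r) (term′ r))) ⟩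
    ∑ (splitsR w) (λ r → Φ (proj₁ r) x * Φ (proj₂ r) y) ∎
    where
    open ≈R
    term term′ : List Run × List Run → Carrier × Word → Carrier
    term r p = proj₁ p * χ (comp 0 (proj₁ r) (valueWord (proj₂ p)))
    term′ r q = proj₁ q * χ (comp 0 (proj₂ r) (valueWord (proj₂ q)))

  splits-block : ∀ b e w (G : List Run × List Run → Carrier) →
    ∑ (splitsR (block b e ++ w)) G ≈ ∑ (splitsL e) (λ p → ∑ (splitsR w) (λ r → G (block b (proj₁ p) ++ proj₁ r , block b (proj₂ p) ++ proj₂ r)))
  splits-block b [] w G = ≈-sym (+-identityʳ _)
  splits-block b (n ∷ e) w G = ≈-trans (∑-concatMap (λ i → map (cutR i) (splitsR (block b e ++ w))) (upTo (suc n)) G)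
    (≈-trans (∑-cong (upTo (suc n)) (λ {i} _ → ≈-trans (∑-map (cutR i) (splitsR (block b e ++ w)) G)
      (≈-trans (splits-block b e w (G ∘ cutR i)) (≈-sym (∑-map (cutL i) (splitsL e) H)))))
    (≈-sym (∑-concatMap (λ i → map (cutL i) (splitsL e)) (upTo (suc n)) H)))
    where
    cutR : ℕ → List Run × List Run → List Run × List Run
    cutR i p = (i , b) ∷ proj₁ p , (n ∸ i , b) ∷ proj₂ p
    cutL : ℕ → List ℕ × List ℕ → List ℕ × List ℕ
    cutL i p = i ∷ proj₁ p , (n ∸ i) ∷ proj₂ p
    H : List ℕ × List ℕ → Carrier
    H p = ∑ (splitsR w) (λ r → G (block b (proj₁ p) ++ proj₁ r , block b (proj₂ p) ++ proj₂ r))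

  splits-wOf : ∀ {k} (f : Fin k → Fin m) (es : Vec (List ℕ) k) (G : List Run × List Run → Carrier) →
    ∑ (splitsR (wOf′ f es)) G ≈ ∑ (splitsV es) (λ p → G (wOf′ f (proj₁ p) , wOf′ f (proj₂ p)))
  splits-wOf f V.[] G = ≈-refl
  splits-wOf f (e V.∷ es) G = ≈-trans (splits-block (f zero) e (wOf′ (f ∘ suc) es) G) (≈-sym (≈-trans (∑-concatMap (λ p → map (cut p) (splitsV es)) (splitsL e) H)
    (∑-cong (splitsL e) (λ {p} _ → ≈-trans (∑-map (cut p) (splitsV es) H) (≈-sym (splits-wOf (f ∘ suc) es (λ r → G (block (f zero) (proj₁ p) ++ proj₁ r , block (f zero) (proj₂ p) ++ proj₂ r))))))))
    where
    cut : List ℕ × List ℕ → Vec (List ℕ) _ × Vec (List ℕ) _ → Vec (List ℕ) _ × Vec (List ℕ) _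
    cut p q = proj₁ p V.∷ proj₁ q , proj₂ p V.∷ proj₂ q
    H : Vec (List ℕ) _ × Vec (List ℕ) _ → Carrier
    H p = G (wOf′ f (proj₁ p) , wOf′ f (proj₂ p))

  -- An extension of Θ to all combinations of words (`Θ-Ψ`). It is multiplicative there, so it can
  -- be applied to products that are not presented as combinations of the `tT`.
  Ψ : F → ΛB
  Ψ x a = Φ (wOf a) x

  Ψ-*F : ∀ x y → AllValid x → AllValid y → Ψ (x *F y) ≈Λ (Ψ x ·Λ Ψ y)
  Ψ-*F x y vx vy a = ≈-trans (Φ-*F (wOf a) x y vx vy) (splits-wOf id a (λ r → Φ (proj₁ r) x * Φ (proj₂ r) y))

  Θ-Ψ : ∀ u → Std u → Θ u ≈Λ Ψ (ι u)
  Θ-Ψ u s a = Θ-Φ u (wOf a) a s (wOf-has a)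

  ·Λ-cong : ∀ {f f' g g'} → f ≈Λ f' → g ≈Λ g' → (f ·Λ g) ≈Λ (f' ·Λ g')
  ·Λ-cong h h' a = ∑-cong (splitsV a) (λ {p} _ → *-cong (h (proj₁ p)) (h' (proj₂ p)))

  Θ-multiplicative : ∀ u v w → Std u → Std v → Std w → ι w ≈F (ι u *F ι v) → Θ w ≈Λ (Θ u ·Λ Θ v)
  Θ-multiplicative u v w su sv sw h a = ≈-trans (Θ-Ψ w sw a) (≈-trans (Φ-resp (wOf a) (ι w) (ι u *F ι v) h)
    (≈-trans (Ψ-*F (ι u) (ι v) (ι-valid u) (ι-valid v) a) (·Λ-cong (λ a → ≈-sym (Θ-Ψ u su a)) (λ a → ≈-sym (Θ-Ψ v sv a)) a)))

  -- The coproduct: cutting value words.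

  comp-++ : ∀ w w' X → comp 0 (w ++ w') X ≡ comp 0 w (take (wsize w) X) ∧ comp 0 w' (drop (wsize w) X)
  comp-++′ : ∀ p n b w w' X → comp p ((n , b) ∷ w ++ w') X ≡ comp p ((n , b) ∷ w) (take (n ℕ.+ wsize w) X) ∧ comp 0 w' (drop (n ℕ.+ wsize w) X)
  comp-++ [] w' X = refl
  comp-++ ((n , b) ∷ w) w' X = comp-++′ 0 n b w w' X
  comp-++′ p zero b w w' X = comp-++ w w' X
  comp-++′ p (suc n) b w w' [] = refl
  comp-++′ p (suc n) b w w' ((b' , x) ∷ X) rewrite comp-++′ (suc x) n b w w' X =
    sym (trans (∧-assoc (does (b' ≟ᶠ b)) _ _) (cong (does (b' ≟ᶠ b) ∧_) (∧-assoc (p ≤ᵇ x) _ _)))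

  factor : List (Fin m) → List ℕ → Word
  factor b τ = b , invPerm (std τ)

  factor-valueWord : ∀ b τ → Unique τ → valueWord (factor b τ) ≡ zip b (std τ)
  factor-valueWord b τ u = cong (zip b) (invPerm-involutive (std-perm τ u))

  -- The inverse in the definition of the coproduct cancels in the value reading. What remains is a
  -- piece of the value word, standardized, and this preserves the order of its values.
  comp-factor : ∀ w b τ → Unique τ → comp 0 w (valueWord (factor b τ)) ≡ comp 0 w (zip b τ)
  comp-factor w b τ u = trans (cong (comp 0 w) (trans (factor-valueWord b τ u) (zip-map b τ)))
      (comp-map (λ x → countLess x τ) 0 0 w (zip b τ) (All.tabulate (λ _ → refl)) (λ i j → countLess-order τ (zip-∈ b τ i) (zip-∈ b τ j)))
    where
    zip-map : ∀ {f : ℕ → ℕ} (b : List (Fin m)) τ → zip b (map f τ) ≡ map (map₂ f) (zip b τ)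
    zip-map [] τ = refl
    zip-map (_ ∷ _) [] = refl
    zip-map (_ ∷ b) (_ ∷ τ) = cong (_ ∷_) (zip-map b τ)
    zip-∈ : ∀ (b : List (Fin m)) τ {x} → x ∈ vals (zip b τ) → x ∈ τ
    zip-∈ (_ ∷ b) (t ∷ τ) (here e) = here e
    zip-∈ (_ ∷ b) (t ∷ τ) (there i) = there (zip-∈ b τ i)

  take-zip : ∀ {A B : Set} k (b : List A) (τ : List B) → zip (take k b) (take k τ) ≡ take k (zip b τ)
  take-zip zero b τ = refl
  take-zip (suc k) [] τ = refl
  take-zip (suc k) (_ ∷ _) [] = refl
  take-zip (suc k) (x ∷ b) (t ∷ τ) = cong (_ ∷_) (take-zip k b τ)

  drop-zip : ∀ {A B : Set} k (b : List A) (τ : List B) → zip (drop k b) (drop k τ) ≡ drop k (zip b τ)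
  drop-zip zero b τ = refl
  drop-zip (suc k) [] τ = refl
  drop-zip {A} {B} (suc k) (_ ∷ b) [] = zip-[] (drop k b)
    where
    zip-[] : ∀ (b : List A) → zip {B = B} b [] ≡ []
    zip-[] [] = refl
    zip-[] (_ ∷ _) = refl
  drop-zip (suc k) (x ∷ b) (t ∷ τ) = drop-zip k b τ

  module CW₂ = Coefficients (pairDec word≟ word≟)

  Φ₂ : List Run → List Run → F2 → Carrier
  Φ₂ w w' = ext (λ z → χ (comp 0 w (valueWord (proj₁ z))) * χ (comp 0 w' (valueWord (proj₂ z))))

  -- A block type fixes the length of the word, so at most the cut after `wsize w` letters
  -- contributes; if the word is shorter, both sides vanish.
  coproduct-word : ∀ w w' X → ∑ (upTo (suc (length X))) (λ k → χ (comp 0 w (take k X)) * χ (comp 0 w' (drop k X))) ≈ χ (comp 0 (w ++ w') X)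
  coproduct-word w w' X with wsize w ℕ.≤? length X
  ... | yes le = ≈-trans (∑-single _ (Uniq.upTo⁺ (suc (length X))) (∈-upTo⁺ (s≤s le)) (λ {k} i ne → other k (ℕP.≤-pred (∈-upTo⁻ i)) ne))
                   (≈-trans (≈-sym (χ-∧ (comp 0 w (take (wsize w) X)) _)) (reflexive (cong χ (sym (comp-++ w w' X)))))
    where
    other : ∀ k → k ≤ length X → k ≢ wsize w → χ (comp 0 w (take k X)) * χ (comp 0 w' (drop k X)) ≈ 0#
    other k le ne with comp 0 w (take k X) in e
    ... | false = zeroˡ _
    ... | true = ⊥-elim (ne (trans (sym (trans (length-take k X) (ℕP.m≤n⇒m⊓n≡m le))) (comp-length w (take k X) e)))
  ... | no nle = ≈-trans (∑-zero (upTo (suc (length X))) (λ {k} i → other k (ℕP.≤-pred (∈-upTo⁻ i)))) (reflexive (cong χ (sym whole)))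
    where
    other : ∀ k → k ≤ length X → χ (comp 0 w (take k X)) * χ (comp 0 w' (drop k X)) ≈ 0#
    other k le with comp 0 w (take k X) in e
    ... | false = zeroˡ _
    ... | true = ⊥-elim (nle (ℕP.≤-trans (ℕP.≤-reflexive (trans (sym (comp-length w (take k X) e)) (trans (length-take k X) (ℕP.m≤n⇒m⊓n≡m le)))) le))
    whole : comp 0 (w ++ w') X ≡ false
    whole with comp 0 (w ++ w') X in e
    ... | false = refl
    ... | true = ⊥-elim (nle (ℕP.≤-trans (ℕP.m≤m+n (wsize w) (wsize w')) (ℕP.≤-reflexive (sym (trans (comp-length (w ++ w') X e) (trans (cong sum (map-++ proj₁ w w')) (sum-++ (map proj₁ w) _)))))))

  coproduct-basis : ∀ {n α} → Valid n α → ∀ w w' →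
    ∑ (ΔW α) (λ z → χ (comp 0 w (valueWord (proj₁ z))) * χ (comp 0 w' (valueWord (proj₂ z)))) ≈ χ (comp 0 (w ++ w') (valueWord α))
  coproduct-basis {n} {α@(b , σ)} v w w' = ≈-trans (∑-map _ (upTo (suc (length b))) _) (≈-trans (∑-cong (upTo (suc (length b)))
      (λ {k} _ → reflexive (cong₂ (λ x y → χ x * χ y)
        (trans (comp-factor w (take k b) (take k τ) (Uniq.take⁺ k u)) (cong (comp 0 w) (take-zip k b τ)))
        (trans (comp-factor w' (drop k b) (drop k τ) (Uniq.drop⁺ k u)) (cong (comp 0 w') (drop-zip k b τ))))))
      (≈-trans (reflexive (cong (λ l → ∑ (upTo (suc l)) (λ k → χ (comp 0 w (take k (valueWord α))) * χ (comp 0 w' (drop k (valueWord α))))) (trans (valid-length v) (sym (length-valueWord v)))))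
        (coproduct-word w w' (valueWord α))))
    where
    τ = invPerm σ
    u : Unique τ
    u = perm-unique (inv-perm (valid-perm v))

  Φ₂-ΔF : ∀ w w' x → AllValid x → Φ₂ w w' (ΔF x) ≈ Φ (w ++ w') x
  Φ₂-ΔF w w' x vx = ≈-trans (∑-concatMap (λ p → map (λ q → (proj₁ p , q)) (ΔW (proj₂ p))) x _) (∑-cong x (λ {p} i → ≈-trans (∑-map (λ q → (proj₁ p , q)) (ΔW (proj₂ p)) _)
    (≈-trans (≈-sym (∑-*ˡ (ΔW (proj₂ p)) (proj₁ p) _)) (*-congˡ (coproduct-basis (proj₂ (All.lookup vx i)) w w')))))

  ext-ι2 : ∀ (g h : Word → Carrier) r → ext (λ z → g (proj₁ z) * h (proj₂ z)) (ι2 r) ≈ ∑ r (λ p → proj₁ p * (ext g (tT (proj₁ (proj₂ p))) * ext h (tT (proj₂ (proj₂ p)))))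
  ext-ι2 g h r = ≈-trans (∑-concatMap _ r _) (∑-cong r (λ {p} _ → ≈-trans (∑-concatMap _ (tT (proj₁ (proj₂ p))) _)
    (≈-trans (∑-cong (tT (proj₁ (proj₂ p))) (λ {α} i → ≈-trans (∑-map _ (tT (proj₂ (proj₂ p))) _) (∑-cong (tT (proj₂ (proj₂ p))) (λ {β} j →
        *-congˡ (≈-trans (*-cong (≈-sym (one (proj₁ (proj₂ p)) {g = g} i)) (≈-sym (one (proj₂ (proj₂ p)) {g = h} j))) ≈-refl)))))
      (≈-sym (≈-trans (*-congˡ (∑-* (tT (proj₁ (proj₂ p))) (tT (proj₂ (proj₂ p))) _ _)) (≈-trans (∑-*ˡ (tT (proj₁ (proj₂ p))) _ _) (∑-cong (tT (proj₁ (proj₂ p))) (λ _ → ∑-*ˡ (tT (proj₂ (proj₂ p))) _ _))))))))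
    where
    one : ∀ T {k α} {g : Word → Carrier} → (k , α) ∈ tT T → k * g α ≈ g α
    one T {k} {α} i with ∈-map⁻ (1# ,_) (subst ((k , α) ∈_) (tT-fibre T) i)
    ... | (_ , _ , refl) = *-identityˡ _

  Θ-comultiplicative : ∀ u r → Std u → Std2 r → ΔF (ι u) ≈F2 ι2 r → ΔΛ (Θ u) ≈Λ2 Θ2 r
  Θ-comultiplicative u r su sr h (a , a') = begin
    -- `wOf a ++ wOf a'` need not be the standard type of the concatenated exponents, but it has
    -- these exponents in every colour.
    Θ u (V.zipWith _++_ a a') ≈⟨ Θ-Φ u (wOf a ++ wOf a') (V.zipWith _++_ a a') su (λ b → trans (restr-++ b (wOf a) (wOf a')) (trans (cong₂ _++_ (wOf-has a b) (wOf-has a' b)) (sym (VP.lookup-zipWith _++_ b a a')))) ⟩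
    Φ (wOf a ++ wOf a') (ι u) ≈⟨ ≈-sym (Φ₂-ΔF (wOf a) (wOf a') (ι u) (ι-valid u)) ⟩
    Φ₂ (wOf a) (wOf a') (ΔF (ι u)) ≈⟨ CW₂.ext-resp _ (ΔF (ι u)) (ι2 r) h ⟩
    Φ₂ (wOf a) (wOf a') (ι2 r) ≈⟨ ext-ι2 _ _ r ⟩
    ∑ r (λ p → proj₁ p * (Φ (wOf a) (tT (proj₁ (proj₂ p))) * Φ (wOf a') (tT (proj₂ (proj₂ p))))) ≈⟨ ∑-cong r (λ {p} i → *-congˡ (*-cong (schur (proj₁ (proj₂ p)) a (proj₁ (All.lookup sr i))) (schur (proj₂ (proj₂ p)) a' (proj₂ (All.lookup sr i))))) ⟩
    Θ2 r (a , a') ∎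
    where
    open ≈R
    schur : ∀ T a → IsStdBT T → Φ (wOf a) (tT T) ≈ schurB (shape T) a
    schur T a s = ≈-trans (Φ-std T s (wOf a)) (≈-sym (schurB-kostkaB (shape T) (wOf a) a (wOf-has a)))

  -- Coefficients of products of generators.

  _≟l_ : DecidableEquality (List Letter)
  _≟l_ = ≡-dec _≟c_

  low high : ℕ → List Letter → List Letter
  low n = filter (λ l → proj₂ l <? n)
  high n = filter (λ l → n ≤? proj₂ l)

  χ-∷ : ∀ x l X W → χ (does ((x ∷ X) ≟l (l ∷ W))) ≈ χ (does (x ≟c l)) * χ (does (X ≟l W))
  χ-∷ x l X W = χ-∧ (does (x ≟c l)) (does (X ≟l W))

  χ-≢ : ∀ {x l : Letter} → x ≢ l → χ (does (x ≟c l)) ≈ 0#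
  χ-≢ {x} {l} ne = reflexive (cong χ (dec-false (x ≟c l) ne))

  mergeSum-0ˡ : ∀ x A B f → (∀ l X → f (l ∷ X) ≈ 0#) → mergeSum (x ∷ A) B f ≈ 0#
  mergeSum-0ˡ x A [] f h = ≈-trans (mergeSum-[]ʳ (x ∷ A) f) (h x A)
  mergeSum-0ˡ x A (y ∷ B) f h = ≈-trans (∑-++ (map (false ∷_) S₀) (map (true ∷_) S₁) g) (≈-trans (+-cong
      (≈-trans (∑-map (false ∷_) S₀ g) (∑-zero S₀ (λ _ → h _ _))) (≈-trans (∑-map (true ∷_) S₁ g) (∑-zero S₁ (λ _ → h _ _)))) (+-identityʳ 0#))
    where
    S₀ = shuffles (length A) (suc (length B))
    S₁ = shuffles (suc (length A)) (length B)
    g : List Bool → Carrier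
    g s = f (merge (x ∷ A) (y ∷ B) s)

  -- A shuffle of a low word A and a high word B is determined by its result, and A, B are recovered by filtering.
  merge-count : ∀ N A B W → Low N A → High N B →
    mergeSum A B (λ X → χ (does (X ≟l W))) ≈ χ (does (A ≟l low N W)) * χ (does (B ≟l high N W))
  merge-count N [] [] [] _ _ = ≈-trans (+-identityʳ _) (≈-sym (*-identityˡ _))
  merge-count N [] (y ∷ B) [] _ _ = ≈-trans (mergeSum-[]ˡ (y ∷ B) (λ X → χ (does (X ≟l [])))) (≈-sym (zeroʳ _))
  merge-count N (x ∷ A) B [] _ _ = ≈-trans (mergeSum-0ˡ x A B (λ X → χ (does (X ≟l []))) (λ _ _ → ≈-refl)) (≈-sym (zeroˡ _))
  merge-count N A B (l ∷ W) lA lB = ≈-trans (mergeSum-split A B (λ X → χ (does (X ≟l (l ∷ W)))) ≈-refl) (cases (proj₂ l <? N))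
    where
    f : List Letter → Carrier
    f X = χ (does (X ≟l (l ∷ W)))
    g : List Letter → Carrier
    g X = χ (does (X ≟l W))
    factor-out : ∀ x A B → mergeSum A B (f ∘ (x ∷_)) ≈ χ (does (x ≟c l)) * mergeSum A B g
    factor-out x A B = ≈-trans (mergeSum-cong A B (λ X → χ-∷ x l X W)) (≈-sym (∑-*ˡ (shuffles (length A) (length B)) (χ (does (x ≟c l))) (λ s → g (merge A B s))))
    cases : Dec (proj₂ l < N) → partB A B f + partA A B f ≈ χ (does (A ≟l low N (l ∷ W))) * χ (does (B ≟l high N (l ∷ W)))
    cases (yes lt) = ≈-trans (+-cong (b0 B lB) (a+ A lA)) (≈-trans (+-identityˡ _) (reflexive (cong₂ (λ y z → χ (does (A ≟l y)) * χ (does (B ≟l z)))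
        (sym (filter-accept (λ l → proj₂ l <? N) {x = l} {xs = W} lt)) (sym (filter-reject (λ l → N ≤? proj₂ l) {x = l} {xs = W} (ℕP.<⇒≱ lt))))))
      where
      b0 : ∀ B → High N B → partB A B f ≈ 0#
      b0 [] _ = ≈-refl
      b0 (y ∷ B) (le ∷ _) = ≈-trans (factor-out y A B) (≈-trans (*-congʳ (χ-≢ {y} {l} (λ { refl → ℕP.<⇒≱ lt le }))) (zeroˡ _))
      a+ : ∀ A → Low N A → partA A B f ≈ χ (does (A ≟l (l ∷ low N W))) * χ (does (B ≟l high N W))
      a+ [] _ = ≈-sym (zeroˡ _)
      a+ (x ∷ A) (_ ∷ lA) = ≈-trans (factor-out x A B) (≈-trans (*-congˡ (merge-count N A B W lA lB)) (≈-trans (≈-sym (*-assoc _ _ _)) (*-congʳ (≈-sym (χ-∷ x l A (low N W))))))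
    cases (no nlt) = ≈-trans (+-cong (b+ B lB) (a0 A lA)) (≈-trans (+-identityʳ _) (reflexive (cong₂ (λ y z → χ (does (A ≟l y)) * χ (does (B ≟l z)))
        (sym (filter-reject (λ l → proj₂ l <? N) {x = l} {xs = W} nlt)) (sym (filter-accept (λ l → N ≤? proj₂ l) {x = l} {xs = W} (ℕP.≮⇒≥ nlt))))))
      where
      a0 : ∀ A → Low N A → partA A B f ≈ 0#
      a0 [] _ = ≈-refl
      a0 (x ∷ A) (lt ∷ _) = ≈-trans (factor-out x A B) (≈-trans (*-congʳ (χ-≢ {x} {l} (λ { refl → nlt lt }))) (zeroˡ _))
      b+ : ∀ B → High N B → partB A B f ≈ χ (does (A ≟l low N W)) * χ (does (B ≟l (l ∷ high N W)))
      b+ [] _ = ≈-sym (zeroʳ _)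
      b+ (y ∷ B) (_ ∷ lB) = ≈-trans (factor-out y A B) (≈-trans (*-congˡ (merge-count N A B W lA lB)) (≈-trans (*-swap _ _ _) (*-congˡ (≈-sym (χ-∷ y l B (high N W))))))

  unshift : ℕ → List Letter → List Letter
  unshift n = map (map₂ (_∸ n))

  -- The word without its first `n` positions: the numbers in a value word are positions, and
  -- `unshift` renumbers the remaining ones from 0.
  rest : ℕ → Word → Word
  rest n α = wordOf (unshift n (high n (valueWord α)))

  vals-high : ∀ n X → vals (unshift n (high n X)) ≡ map (_∸ n) (filter (n ≤?_) (vals X))
  vals-high n X = trans (sym (map-∘ (high n X))) (trans (map-∘ (high n X)) (cong (map (_∸ n)) (go X)))
    where
    go : ∀ X → map proj₂ (high n X) ≡ filter (n ≤?_) (vals X)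
    go [] = refl
    go ((b , x) ∷ X) with n ≤? x
    ... | yes le = trans (cong (map proj₂) (filter-accept (λ l → n ≤? proj₂ l) {x = b , x} {xs = X} le)) (trans (cong (x ∷_) (go X)) (sym (filter-accept (n ≤?_) le)))
    ... | no nle = trans (cong (map proj₂) (filter-reject (λ l → n ≤? proj₂ l) {x = b , x} {xs = X} nle)) (trans (go X) (sym (filter-reject (n ≤?_) nle)))

  high-upTo : ∀ n N → map (_∸ n) (filter (n ≤?_) (upTo N)) ≡ upTo (N ∸ n)
  high-upTo n N with n ≤? N
  ... | no nle = trans (cong (map (_∸ n)) (filter-none (n ≤?_) (All.tabulate (λ i le → nle (ℕP.≤-trans le (ℕP.<⇒≤ (∈-upTo⁻ i))))))) (cong upTo (sym (ℕP.m≤n⇒m∸n≡0 (ℕP.<⇒≤ (ℕP.≰⇒> nle)))))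
  ... | yes le = trans (cong (map (_∸ n) ∘ filter (n ≤?_)) (trans (cong upTo (sym (ℕP.m+[n∸m]≡n le))) (sym (upTo-++ n (N ∸ n)))))
      (trans (cong (map (_∸ n)) (trans (filter-++ (n ≤?_) (upTo n) _) (cong₂ _++_ (filter-none (n ≤?_) (All.tabulate (λ i → ℕP.<⇒≱ (∈-upTo⁻ i)))) (filter-all (n ≤?_) (AllP.map⁺ (All.tabulate (λ {t} _ → ℕP.m≤m+n n t)))))))
      (trans (sym (map-∘ (upTo (N ∸ n)))) (trans (map-cong-∈ (upTo (N ∸ n)) (λ {t} _ → ℕP.m+n∸m≡n n t)) (map-id (upTo (N ∸ n))))))

  rest-perm : ∀ n {N α} → Valid N α → IsPerm (N ∸ n) (vals (unshift n (high n (valueWord α))))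
  rest-perm n {N} {α} v = ↭-trans (↭-reflexive (trans (vals-high n (valueWord α)) (cong (map (_∸ n) ∘ filter (n ≤?_)) (vals-valueWord v))))
    (↭-trans (Perm.map⁺ (_∸ n) (filter-↭ (n ≤?_) (inv-perm (valid-perm v)))) (↭-reflexive (high-upTo n N)))

  rest-valid : ∀ n {N α} → Valid N α → Valid (N ∸ n) (rest n α)
  rest-valid n v = wordOf-valid _ (rest-perm n v)

  unshift-shift : ∀ n X → unshift n (shiftW n X) ≡ X
  unshift-shift n X = trans (sym (map-∘ X)) (trans (map-cong-∈ X (λ {l} _ → cong (proj₁ l ,_) (ℕP.m+n∸m≡n n (proj₂ l)))) (map-id X))

  shift-unshift : ∀ n X → High n X → shiftW n (unshift n X) ≡ X
  shift-unshift n [] _ = refl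
  shift-unshift n (l ∷ X) (le ∷ h) = cong₂ _∷_ (cong (proj₁ l ,_) (ℕP.m+[n∸m]≡n le)) (shift-unshift n X h)

  high-High : ∀ n X → High n (high n X)
  high-High n X = AllP.all-filter (λ l → n ≤? proj₂ l) X

  rest-iff : ∀ n {N N' α β} → Valid N α → Valid N' β → does (shiftW n (valueWord β) ≟l high n (valueWord α)) ≡ does (word≟ β (rest n α))
  rest-iff n {N} {N'} {α} {β} v v' = does-⇔ (mk⇔ to from) (shiftW n (valueWord β) ≟l high n (valueWord α)) (word≟ β (rest n α))
    where
    to : shiftW n (valueWord β) ≡ high n (valueWord α) → β ≡ rest n α
    to e = trans (sym (wordOf-valueWord v')) (cong wordOf (trans (sym (unshift-shift n (valueWord β))) (cong (unshift n) e)))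
    from : β ≡ rest n α → shiftW n (valueWord β) ≡ high n (valueWord α)
    from e = trans (cong (shiftW n) (trans (cong valueWord e) (valueWord-wordOf _ (rest-perm n v)))) (shift-unshift n _ (high-High n (valueWord α)))

  gen-word : ℕ → Fin m → Word
  gen-word n b = replicate n b , upTo n

  gen-valid : ∀ n b → Valid n (gen-word n b)
  gen-valid n b = length-replicate n ▹ ↭-refl

  seg : Fin m → ℕ → List Letter
  seg b n = valueWord (gen-word n b)

  prod-iff : ∀ {n n' N α β γ s} → Valid n α → Valid n' β → Valid N γ → Fits (proj₁ α) (proj₁ β) s →
    does (word≟ (prodWord α β s) γ) ≡ does (merge (valueWord α) (shiftW n (valueWord β)) s ≟l valueWord γ)
  prod-iff {n} {n'} {N} {α} {β} {γ} {s} v v' vγ f = does-⇔ (mk⇔ to from) (word≟ (prodWord α β s) γ) (merge (valueWord α) (shiftW n (valueWord β)) s ≟l valueWord γ)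
    where
    to : prodWord α β s ≡ γ → merge (valueWord α) (shiftW n (valueWord β)) s ≡ valueWord γ
    to e = trans (sym (valueWord-prodWord v v' f)) (cong valueWord e)
    from : merge (valueWord α) (shiftW n (valueWord β)) s ≡ valueWord γ → prodWord α β s ≡ γ
    from e = trans (sym (wordOf-valueWord (prodWord-valid v v' f))) (trans (cong wordOf (trans (valueWord-prodWord v v' f) e)) (wordOf-valueWord vγ))

  prod-count : ∀ {n n' N α β γ} → Valid n α → Valid n' β → Valid N γ →
    ∑ (shuffles (length (proj₁ α)) (length (proj₁ β))) (λ s → χ (does (word≟ (prodWord α β s) γ)))
      ≈ χ (does (valueWord α ≟l low n (valueWord γ))) * χ (does (word≟ β (rest n γ)))
  prod-count {n} {n'} {N} {α} {β} {γ} v v' vγ = ≈-trans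
    (∑-cong (shuffles (length (proj₁ α)) (length (proj₁ β))) (λ i → reflexive (cong χ (prod-iff v v' vγ (shuffles-fit (proj₁ α) (proj₁ β) i)))))
    (≈-trans (reflexive (cong₂ (λ k k' → ∑ (shuffles k k') (λ s → χ (does (merge (valueWord α) (shiftW n (valueWord β)) s ≟l valueWord γ))))
        (trans (valid-length v) (sym (length-valueWord v))) (trans (valid-length v') (sym (trans (length-map _ (valueWord β)) (length-valueWord v'))))))
    (≈-trans (merge-count n (valueWord α) (shiftW n (valueWord β)) (valueWord γ) (low-valueWord v) (high-shift n (valueWord β)))
      (*-congˡ (reflexive (cong χ (rest-iff n vγ v'))))))

  -- The positions below `n` mark the letters of the generator, so α determines the shuffle and both
  -- factors. Only one basis element of the second factor can contribute, namely `rest n α`.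
  coef-y* : ∀ n b x {N α} → AllValid x → Valid N α →
    coefF (y n b *F x) α ≈ χ (does (seg b n ≟l low n (valueWord α))) * coefF x (rest n α)
  coef-y* n b x {N} {α} vx v = begin
    coefF (y n b *F x) α ≈⟨ CW.coef-ext (y n b *F x) α ⟩
    ext (λ γ → χ (does (word≟ γ α))) (y n b *F x) ≈⟨ ext-*F (λ γ → χ (does (word≟ γ α))) (y n b) x ⟩
    ∑ x (λ q → (1# * proj₁ q) * S q) + 0# ≈⟨ +-identityʳ _ ⟩
    ∑ x (λ q → (1# * proj₁ q) * S q) ≈⟨ ∑-cong x (λ {q} i → ≈-trans (*-cong (*-identityˡ _) (prod-count (gen-valid n b) (proj₂ (All.lookup vx i)) v)) (*-swap _ _ _)) ⟩
    ∑ x (λ q → χ (does (seg b n ≟l low n (valueWord α))) * (proj₁ q * χ (does (word≟ (proj₂ q) (rest n α))))) ≈⟨ ≈-sym (∑-*ˡ x _ (λ q → proj₁ q * χ (does (word≟ (proj₂ q) (rest n α))))) ⟩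
    χ (does (seg b n ≟l low n (valueWord α))) * ext (λ γ → χ (does (word≟ γ (rest n α)))) x ≈⟨ *-congˡ (≈-sym (CW.coef-ext x (rest n α))) ⟩
    χ (does (seg b n ≟l low n (valueWord α))) * coefF x (rest n α) ∎
    where
    open ≈R
    S : Carrier × Word → Carrier
    S q = ∑ (shuffles (length (replicate n b)) (length (proj₁ (proj₂ q)))) (λ s → χ (does (word≟ (prodWord (gen-word n b) (proj₂ q) s) α)))

  idx-suc : ∀ c k s → idx c (suc k) s ≡ map suc (idx c k s)
  idx-suc c k [] = refl
  idx-suc true k (true ∷ s) = cong (suc k ∷_) (idx-suc true (suc k) s)
  idx-suc false k (true ∷ s) = idx-suc false (suc k) s
  idx-suc true k (false ∷ s) = idx-suc true (suc k) s
  idx-suc false k (false ∷ s) = cong (suc k ∷_) (idx-suc false (suc k) s)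

  at-idx-suc : ∀ c s v → v < length (idx c 0 s) → at (idx c 1 s) v ≡ suc (at (idx c 0 s) v)
  at-idx-suc c s v lt = trans (cong (λ z → at z v) (idx-suc c 0 s)) (at-map suc (idx c 0 s) v lt)

  lookupM-merge₀ : ∀ {A : Set} {X Y : List A} {s} v → v < length X → Fits X Y s → lookupM (merge X Y s) (at (idx false 0 s) v) ≡ lookupM X v
  lookupM-merge₀ zero _ (left f) = refl
  lookupM-merge₀ {X = x ∷ X} {Y} {s = false ∷ s} (suc v) (s≤s lt) (left f) = trans (cong (lookupM (x ∷ merge X Y s)) (at-idx-suc false s v (subst (v <_) (proj₁ (fits-idx 0 f)) lt))) (lookupM-merge₀ v lt f)
  lookupM-merge₀ {X = X} {y ∷ Y} {true ∷ s} v lt (right f) =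
    trans (cong₂ lookupM (merge-true X y Y s) (at-idx-suc false s v (subst (v <_) (proj₁ (fits-idx 0 f)) lt))) (lookupM-merge₀ v lt f)

  lookupM-merge₁ : ∀ {A : Set} {X Y : List A} {s} v → v < length Y → Fits X Y s → lookupM (merge X Y s) (at (idx true 0 s) v) ≡ lookupM Y v
  lookupM-merge₁ {X = x ∷ X} {Y} {s = false ∷ s} v lt (left f) = trans (cong (lookupM (x ∷ merge X Y s)) (at-idx-suc true s v (subst (v <_) (proj₂ (fits-idx 0 f)) lt))) (lookupM-merge₁ v lt f)
  lookupM-merge₁ {X = X} {y ∷ Y} {true ∷ s} zero lt (right f) = cong (λ z → lookupM z 0) (merge-true X y Y s)
  lookupM-merge₁ {X = X} {y ∷ Y} {true ∷ s} (suc v) (s≤s lt) (right f) =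
    trans (cong₂ lookupM (merge-true X y Y s) (at-idx-suc true s v (subst (v <_) (proj₂ (fits-idx 0 f)) lt))) (lookupM-merge₁ v lt f)

  idx-≥ : ∀ c k s → All (k ≤_) (idx c k s)
  idx-≥ c k [] = []
  idx-≥ true k (true ∷ s) = ℕP.≤-refl ∷ All.map (ℕP.≤-trans (ℕP.n≤1+n k)) (idx-≥ true (suc k) s)
  idx-≥ false k (true ∷ s) = All.map (ℕP.≤-trans (ℕP.n≤1+n k)) (idx-≥ false (suc k) s)
  idx-≥ true k (false ∷ s) = All.map (ℕP.≤-trans (ℕP.n≤1+n k)) (idx-≥ true (suc k) s)
  idx-≥ false k (false ∷ s) = ℕP.≤-refl ∷ All.map (ℕP.≤-trans (ℕP.n≤1+n k)) (idx-≥ false (suc k) s)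

  idx-sorted : ∀ c k s → AllPairs _<_ (idx c k s)
  idx-sorted c k [] = []
  idx-sorted true k (true ∷ s) = idx-≥ true (suc k) s ∷ idx-sorted true (suc k) s
  idx-sorted false k (true ∷ s) = idx-sorted false (suc k) s
  idx-sorted true k (false ∷ s) = idx-sorted true (suc k) s
  idx-sorted false k (false ∷ s) = idx-≥ false (suc k) s ∷ idx-sorted false (suc k) s

  at-sorted : ∀ {xs} i j → AllPairs _<_ xs → i < j → j < length xs → at xs i < at xs j
  at-sorted {x ∷ xs} zero (suc j) (a ∷ _) _ (s≤s lt) = All.lookup a (at-∈ xs j lt)
  at-sorted {x ∷ xs} (suc i) (suc j) (_ ∷ s) (s≤s lt) (s≤s lt') = at-sorted i j s lt lt'

  at-order : ∀ {xs} x y → AllPairs _<_ xs → x < length xs → y < length xs → (suc x ≤ᵇ y) ≡ (suc (at xs x) ≤ᵇ at xs y)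
  at-order {xs} x y s lx ly = <ᵇ-cong (λ lt → at-sorted x y s lt ly) back
    where
    back : at xs x < at xs y → x < y
    back lt with ℕP.<-cmp x y
    ... | tri< lt' _ _ = lt'
    ... | tri≈ _ refl _ = ⊥-elim (ℕP.<-irrefl refl lt)
    ... | tri> _ _ gt = ⊥-elim (ℕP.<-asym lt (at-sorted y x s gt lx))

  mapMaybe-local : ∀ {A B : Set} {f : A → Maybe B} {g : A → B} xs → (∀ {x} → x ∈ xs → f x ≡ just (g x)) → mapMaybe f xs ≡ map g xs
  mapMaybe-local [] _ = refl
  mapMaybe-local {f = f} {g} (x ∷ xs) h = trans (mapMaybe-just f x xs (h (here refl))) (cong (g x ∷_) (mapMaybe-local xs (h ∘ there)))

  lookupM-replicate : ∀ n (b : Fin m) v → v < n → lookupM (replicate n b) v ≡ just b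
  lookupM-replicate (suc n) b zero _ = refl
  lookupM-replicate (suc n) b (suc v) (s≤s lt) = lookupM-replicate n b v lt

  module _ (n : ℕ) (b : Fin m) {n' c' σ'} (v' : Valid n' (c' , σ')) {s} (f : Fits (replicate n b) c' s) where
    private
      I₀ I₁ : List ℕ
      I₀ = idx false 0 s
      I₁ = idx true 0 s

      l₀ : length I₀ ≡ n
      l₀ = trans (sym (proj₁ (fits-idx 0 f))) (length-replicate n)

      l₁ : length I₁ ≡ n'
      l₁ = trans (sym (proj₂ (fits-idx 0 f))) (valid-length v')

      p' : IsPerm n' σ'
      p' = valid-perm v'

      I≡ : shufflePerm s ≡ I₀ ++ I₁
      I≡ = cong₂ _++_ (indicesOf-idx false s) (indicesOf-idx true s)

      colours : List (Fin m)
      colours = merge (replicate n b) c' s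

    -- A shuffle acts on values and leaves positions in place. So the position reading of a product
    -- is a concatenation, with the values of each factor spread increasingly over its slots.
    positionWord-prod : positionWord (prodWord (gen-word n b) (c' , σ') s) ≡ map (b ,_) I₀ ++ map (map₂ (at I₁)) (positionWord (c' , σ'))
    positionWord-prod = trans (positionWord-letters colours (map (at (shufflePerm s)) (upTo n ++ map (length (replicate n b) ℕ.+_) σ'))) (trans (cong (mapMaybe (letterOf colours)) perm≡) (trans (mapMaybe-++ (letterOf colours) I₀ (map (at I₁) σ')) (cong₂ _++_ first second)))
      where
      perm≡ : map (at (shufflePerm s)) (upTo n ++ map (length (replicate n b) ℕ.+_) σ') ≡ I₀ ++ map (at I₁) σ'
      perm≡ = trans (cong₂ (λ z k → map (at z) (upTo n ++ map (k ℕ.+_) σ')) I≡ (length-replicate n)) (trans (map-++ (at (I₀ ++ I₁)) (upTo n) _) (cong₂ _++_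
        (trans (map-cong-∈ (upTo n) (λ i → at-++ˡ I₀ I₁ _ (subst (_ <_) (sym l₀) (∈-upTo⁻ i)))) (trans (cong (map (at I₀) ∘ upTo) (sym l₀)) (map-at-upTo I₀)))
        (trans (sym (map-∘ σ')) (map-cong-∈ σ' (λ {t} _ → trans (cong (λ z → at (I₀ ++ I₁) (z ℕ.+ t)) (sym l₀)) (at-++ʳ I₀ I₁ t))))))
      first : mapMaybe (letterOf colours) I₀ ≡ map (b ,_) I₀
      first = mapMaybe-local I₀ (λ {x} i → cong (Maybe.map (_, x)) (subst (λ z → lookupM colours z ≡ just b) (at-pos I₀ i)
        (trans (lookupM-merge₀ (pos x I₀) (subst (pos x I₀ <_) (sym (proj₁ (fits-idx 0 f))) (pos< I₀ i)) f) (lookupM-replicate n b _ (subst (pos x I₀ <_) l₀ (pos< I₀ i))))))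
      second : mapMaybe (letterOf colours) (map (at I₁) σ') ≡ map (map₂ (at I₁)) (positionWord (c' , σ'))
      second = trans (go σ' (λ i → subst (_ <_) (sym (valid-length v')) (perm-∈⁻ p' i))) (cong (map (map₂ (at I₁))) (sym (positionWord-letters c' σ')))
        where
        go : ∀ τ → (∀ {t} → t ∈ τ → t < length c') → mapMaybe (letterOf colours) (map (at I₁) τ) ≡ map (map₂ (at I₁)) (mapMaybe (letterOf c') τ)
        go [] _ = refl
        go (t ∷ τ) h with lookupM-drop c' t (h (here refl))
        ... | (d , e) = trans (mapMaybe-just (letterOf colours) (at I₁ t) (map (at I₁) τ) (cong (Maybe.map (_, at I₁ t)) (trans (lookupM-merge₁ t (h (here refl)) f) e)))
              (trans (cong ((d , at I₁ t) ∷_) (go τ (h ∘ there))) (cong (map (map₂ (at I₁))) (sym (mapMaybe-just (letterOf c') t τ (cong (Maybe.map (_, t)) e)))))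

    comp-prod : ∀ w → comp 0 ((n , b) ∷ w) (positionWord (prodWord (gen-word n b) (c' , σ') s)) ≡ comp 0 w (positionWord (c' , σ'))
    comp-prod w = trans (cong (comp 0 ((n , b) ∷ w)) positionWord-prod) (trans (comp-++ ((n , b) ∷ []) w X) (trans (cong₂ (λ y z → comp 0 ((n , b) ∷ []) y ∧ comp 0 w z) (proj₁ td) (proj₂ td)) (trans (cong (_∧ comp 0 w Z) block-true)
        (comp-map (at I₁) 0 0 w (positionWord (c' , σ')) (All.tabulate (λ _ → refl)) (λ {x} {y} i j → at-order x y (idx-sorted true 0 s) (bd i) (bd j))))))
      where
      Y = map (b ,_) I₀
      Z = map (map₂ (at I₁)) (positionWord (c' , σ'))
      X = Y ++ Z
      lY : length Y ≡ n ℕ.+ 0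
      lY = trans (length-map (b ,_) I₀) (trans l₀ (sym (ℕP.+-identityʳ n)))
      split : ∀ {A : Set} (Y Z : List A) k → length Y ≡ k → take k (Y ++ Z) ≡ Y × drop k (Y ++ Z) ≡ Z
      split [] Z .0 refl = refl , refl
      split (y ∷ Y) Z .(suc (length Y)) refl = cong (y ∷_) (proj₁ (split Y Z _ refl)) , proj₂ (split Y Z _ refl)
      td : take (n ℕ.+ 0) X ≡ Y × drop (n ℕ.+ 0) X ≡ Z
      td = split Y Z (n ℕ.+ 0) lY
      sorted⇒Linked : ∀ xs → AllPairs _<_ xs → Linked _<ₗ_ (map (b ,_) xs)
      sorted⇒Linked [] _ = []
      sorted⇒Linked (x ∷ []) _ = [-]
      sorted⇒Linked (x ∷ y ∷ xs) ((lt ∷ _) ∷ s) = lt ∷ sorted⇒Linked (y ∷ xs) s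
      block-true : comp 0 ((n , b) ∷ []) Y ≡ true
      block-true = Blocks⇒comp ((n , b) ∷ []) Y (Y , [] , sym (++-identityʳ Y) , trans lY (ℕP.+-identityʳ n) , AllP.map⁺ (All.tabulate (λ _ → refl)) , sorted⇒Linked I₀ (idx-sorted false 0 s) , refl)
      bd : ∀ {x} → x ∈ vals (positionWord (c' , σ')) → x < length I₁
      bd {x} i = subst (x <_) (sym l₁) (perm-∈⁻ p' (subst (x ∈_) (proj₂ (labels-position v')) i))

  sorted-unique : ∀ {A : Set} (f : A → ℕ) {xs ys : List A} → xs ↭ ys → AllPairs (λ x y → f x < f y) xs → AllPairs (λ x y → f x < f y) ys → xs ≡ ys
  sorted-unique f {[]} s _ _ = sym (Perm.↭-empty-inv (↭-sym s))
  sorted-unique f {x ∷ xs} {[]} s _ _ = ⊥-elim (Perm.¬x∷xs↭[] s)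
  sorted-unique f {x ∷ xs} {y ∷ ys} s (a ∷ p) (b ∷ q) with ∈-resp-↭ s (here refl) | ∈-resp-↭ (↭-sym s) (here refl)
  ... | here refl | _ = cong (x ∷_) (sorted-unique f (drop-∷ s) p q)
  ... | there i | here refl = cong (x ∷_) (sorted-unique f (drop-∷ s) p q)
  ... | there i | there j = ⊥-elim (ℕP.<-asym (All.lookup b i) (All.lookup a j))

  map-split : ∀ {A B : Set} (f : A → B) xs Y Z → map f xs ≡ Y ++ Z → ∃₂ λ LY LZ → xs ≡ LY ++ LZ × map f LY ≡ Y × map f LZ ≡ Z
  map-split f xs [] Z e = [] , xs , refl , refl , e
  map-split f (x ∷ xs) (y ∷ Y) Z e with map-split f xs Y Z (∷-injectiveʳ e)
  ... | (LY , LZ , refl , e₁ , e₂) = x ∷ LY , LZ , refl , cong₂ _∷_ (∷-injectiveˡ e) e₁ , e₂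

  seg-letters : ∀ b n → seg b n ≡ map (b ,_) (upTo n)
  seg-letters b n = trans (cong (zip (replicate n b)) (sym (inv-unique ↭-refl (upTo n) (All.tabulate ∈-upTo⁻) (subst (λ k → map (at (upTo n)) (upTo k) ≡ upTo n) (length-upTo n) (map-at-upTo (upTo n)))))) (go n (upTo n) (length-upTo n))
    where
    go : ∀ n xs → length xs ≡ n → zip (replicate n b) xs ≡ map (b ,_) xs
    go .0 [] refl = refl
    go .(suc (length xs)) (x ∷ xs) refl = cong (_ ∷_) (go (length xs) xs refl)

  -- An increasing first block has the same order by position and by value; hence its letters,
  -- picked out of the value word, show their positions 0, ..., n - 1 in order.
  low-seg : ∀ {N α} n b w → Valid N α → comp 0 ((n , b) ∷ w) (positionWord α) ≡ true → seg b n ≡ low n (valueWord α)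
  low-seg {N} {α} n b w v e = fromBlocks (comp⇒Blocks 0 ((n , b) ∷ w) (positionWord α) e)
    where
    LV LI : List BiLetter
    LV = positionBiword α
    LI = map inverse (valueBiword α)
    small : (z : BiLetter) → Dec (proj₁ z < n)
    small z = proj₁ z <? n
    h : BiLetter → Letter
    h z = proj₁ (proj₂ z) , proj₁ z
    low-inverse : ∀ L → map h (filter small (map inverse L)) ≡ low n (map proj₂ L)
    low-inverse [] = refl
    low-inverse ((k , c , t) ∷ L) = go (t <? n)
      where
      go : Dec (t < n) → map h (filter small (map inverse ((k , c , t) ∷ L))) ≡ low n (map proj₂ ((k , c , t) ∷ L))
      go (yes lt) = trans (cong (map h) (filter-accept small {x = t , c , k} {xs = map inverse L} lt)) (trans (cong ((c , t) ∷_) (low-inverse L)) (sym (filter-accept (λ l → proj₂ l <? n) {x = c , t} {xs = map proj₂ L} lt)))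
      go (no nlt) = trans (cong (map h) (filter-reject small {x = t , c , k} {xs = map inverse L} nlt)) (trans (low-inverse L) (sym (filter-reject (λ l → proj₂ l <? n) {x = c , t} {xs = map proj₂ L} nlt)))
    upTo-sorted : ∀ N → AllPairs _<_ (upTo N)
    upTo-sorted N = APP.applyUpTo⁺₁ id N (λ lt _ → lt)
    LI-sorted : AllPairs (λ x y → value x < value y) LI
    LI-sorted = APP.map⁻ (subst (AllPairs _<_) (sym (trans (sym (map-∘ (valueBiword α))) (labels-value v))) (upTo-sorted N))
    fromBlocks : Blocks _<ₗ_ ((n , b) ∷ w) (positionWord α) → seg b n ≡ low n (valueWord α)
    fromBlocks (Y , Z , eYZ , lY , aY , kY , _) = go (map-split proj₂ LV Y Z eYZ)
      where
      go : (∃₂ λ LY LZ → LV ≡ LY ++ LZ × map proj₂ LY ≡ Y × map proj₂ LZ ≡ Z) → seg b n ≡ low n (valueWord α)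
      go (LY , LZ , eLV , eY , eZ) = trans (seg-letters b n) (trans (sym hLY) (trans (cong (map h) (sym X≡LY)) (trans (low-inverse (valueBiword α)) (cong (low n) (word-value v)))))
        where
        lLY : length LY ≡ n
        lLY = trans (sym (length-map proj₂ LY)) (trans (cong length eY) lY)
        lab≡ : map proj₁ LY ++ map proj₁ LZ ≡ upTo n ++ map (n ℕ.+_) (upTo (length LZ))
        lab≡ = trans (sym (map-++ proj₁ LY LZ)) (trans (cong (map proj₁) (sym eLV)) (trans (proj₁ (labels-position v)) (trans (cong upTo (sym N≡)) (sym (upTo-++ n (length LZ))))))
          where
          N≡ : n ℕ.+ length LZ ≡ N
          N≡ = trans (cong (ℕ._+ length LZ) (sym lLY)) (trans (sym (length-++ LY)) (trans (cong length (sym eLV)) (trans (sym (length-map proj₂ LV)) (length-positionWord v))))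
        both : map proj₁ LY ≡ upTo n × map proj₁ LZ ≡ map (n ℕ.+_) (upTo (length LZ))
        both = ++-inj (map proj₁ LY) (upTo n) (trans (length-map proj₁ LY) (trans lLY (sym (length-upTo n)))) lab≡
        filtered : filter small LV ≡ LY
        filtered = trans (cong (filter small) eLV) (trans (filter-++ small LY LZ) (trans (cong₂ _++_
          (filter-all small (AllP.map⁻ (subst (All (_< n)) (sym (proj₁ both)) (All.tabulate ∈-upTo⁻))))
          (filter-none small (AllP.map⁻ (subst (All (λ k → ¬ k < n)) (sym (proj₂ both)) (AllP.map⁺ (All.tabulate (λ {t} _ → ℕP.≤⇒≯ (ℕP.m≤m+n n t)))))))) (++-identityʳ LY)))
        -- Both lists contain the letters in the first `n` positions and are sorted by value: the
        -- left one as part of the value reading, the right one because the block increases.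
        X≡LY : filter small LI ≡ LY
        X≡LY = sorted-unique value (subst (filter small LI ↭_) filtered (filter-↭ small (biwords-↭ v))) (APP.filter⁺ small LI-sorted)
          (APP.map⁻ (subst (AllPairs _<ₗ_) (sym eY) (Linked⇒AllPairs (λ {i} {j} {k} → ℕP.<-trans) kY)))
        hLY : map h LY ≡ map (b ,_) (upTo n)
        hLY = trans (colour LY (AllP.map⁻ (subst (All (λ a → proj₁ a ≡ b)) (sym eY) aY))) (cong (map (b ,_)) (proj₁ both))
          where
          colour : ∀ L → All (λ z → proj₁ (proj₂ z) ≡ b) L → map h L ≡ map (b ,_) (map proj₁ L)
          colour [] _ = refl
          colour (z ∷ L) (e ∷ a) = cong₂ _∷_ (cong (_, proj₁ z) e) (colour L a)

  pattern-of : ℕ → List Letter → List Bool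
  pattern-of n = map (λ l → does (n ≤? proj₂ l))

  pattern-fits : ∀ n W → Fits (low n W) (high n W) (pattern-of n W) × merge (low n W) (high n W) (pattern-of n W) ≡ W
  pattern-fits n [] = [] , refl
  pattern-fits n (l ∷ W) = go (n ≤? proj₂ l)
    where
    go : Dec (n ≤ proj₂ l) → Fits (low n (l ∷ W)) (high n (l ∷ W)) (pattern-of n (l ∷ W)) × merge (low n (l ∷ W)) (high n (l ∷ W)) (pattern-of n (l ∷ W)) ≡ l ∷ W
    go (yes le) rewrite filter-reject (λ l → proj₂ l <? n) {x = l} {xs = W} (ℕP.≤⇒≯ le) | filter-accept (λ l → n ≤? proj₂ l) {x = l} {xs = W} le | dec-true (n ≤? proj₂ l) le =
      right (proj₁ (pattern-fits n W)) , trans (merge-true (low n W) l (high n W) (pattern-of n W)) (cong (l ∷_) (proj₂ (pattern-fits n W)))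
    go (no nle) rewrite filter-accept (λ l → proj₂ l <? n) {x = l} {xs = W} (ℕP.≰⇒> nle) | filter-reject (λ l → n ≤? proj₂ l) {x = l} {xs = W} nle | dec-false (n ≤? proj₂ l) nle =
      left (proj₁ (pattern-fits n W)) , cong (l ∷_) (proj₂ (pattern-fits n W))

  -- Under the hypothesis α is itself a term of the product of the generator with `rest n α`; the
  -- shuffle is read off from which letters of its value word are low. Then `comp-prod` applies.
  comp-rest : ∀ {N α} n b w → Valid N α → seg b n ≡ low n (valueWord α) →
    comp 0 ((n , b) ∷ w) (positionWord α) ≡ comp 0 w (positionWord (rest n α))
  comp-rest {N} {α} n b w v e = trans (cong (comp 0 ((n , b) ∷ w) ∘ positionWord) (sym α≡)) (comp-prod n b vr f w)
    where
    W : List Letter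
    W = valueWord α
    vr : Valid (N ∸ n) (rest n α)
    vr = rest-valid n v
    hw : shiftW n (valueWord (rest n α)) ≡ high n W
    hw = trans (cong (shiftW n) (valueWord-wordOf _ (rest-perm n v))) (shift-unshift n _ (high-High n W))
    f : Fits (replicate n b) (proj₁ (rest n α)) (pattern-of n W)
    f = fits-length _ _ (trans (sym (cong length e)) (trans (length-valueWord (gen-valid n b)) (sym (length-replicate n))))
          (trans (sym (cong length hw)) (trans (length-map _ (valueWord (rest n α))) (trans (length-valueWord vr) (sym (valid-length vr))))) (proj₁ (pattern-fits n W))
    α≡ : prodWord (gen-word n b) (rest n α) (pattern-of n W) ≡ α
    α≡ = trans (sym (wordOf-valueWord (prodWord-valid (gen-valid n b) vr f))) (trans (cong wordOf (trans (valueWord-prodWord (gen-valid n b) vr f)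
           (trans (cong₂ (λ y z → merge y z (pattern-of n W)) e hw) (proj₂ (pattern-fits n W))))) (wordOf-valueWord v))

  AllValid-*F : ∀ x y → AllValid x → AllValid y → AllValid (x *F y)
  AllValid-*F x y vx vy = AllP.concat⁺ (AllP.map⁺ (All.map (λ {p} (n , v) → AllP.concat⁺ (AllP.map⁺ (All.map (λ {q} (n' , v') →
    AllP.map⁺ (AllP.map⁺ (All.tabulate (λ i → n ℕ.+ n' , prodWord-valid v v' (shuffles-fit (proj₁ (proj₂ p)) (proj₁ (proj₂ q)) i))))) vy))) vx))

  gens : List (ℕ × Fin m) → List Run
  gens = map (map₁ suc)

  evalWord-valid : ∀ w → AllValid (evalWord w)
  evalWord-valid [] = (0 , (refl ▹ ↭-refl)) ∷ []
  evalWord-valid ((n , b) ∷ w) = AllValid-*F (y (suc n) b) (evalWord w) ((suc n , gen-valid (suc n) b) ∷ []) (evalWord-valid w)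

  -- The first generator is split off by `coef-y*` on the left and by `comp-rest` on the right. If
  -- the first positions do not form the required block, both sides vanish, the right one by
  -- `low-seg`.
  evalWord-coef : ∀ w {N α} → Valid N α → coefF (evalWord w) α ≈ χ (comp 0 (gens w) (positionWord α))
  evalWord-coef [] {N} {α} v = ≈-trans (+-identityʳ _) (null α v)
    where
    null : ∀ {N} α → Valid N α → (if does (word≟ ([] , []) α) then 1# else 0#) ≈ χ (comp 0 [] (positionWord α))
    null ([] , []) v = ≈-refl
    null ([] , _ ∷ _) (refl ▹ p) = ⊥-elim (Perm.¬x∷xs↭[] p)
    null (b ∷ c , σ) v = nonempty (positionWord (b ∷ c , σ)) (trans (length-positionWord v) (sym (valid-length v)))
      where
      nonempty : ∀ X → length X ≡ suc (length c) → 0# ≈ χ (comp 0 [] X)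
      nonempty (_ ∷ _) _ = ≈-refl
  evalWord-coef ((k , b) ∷ w) {N} {α} v = ≈-trans (coef-y* (suc k) b (evalWord w) (evalWord-valid w) v)
    (≈-trans (*-congˡ (evalWord-coef w (rest-valid (suc k) v))) (cases (seg b (suc k) ≟l low (suc k) (valueWord α))))
    where
    cases : (d : Dec (seg b (suc k) ≡ low (suc k) (valueWord α))) → χ (does d) * χ (comp 0 (gens w) (positionWord (rest (suc k) α))) ≈ χ (comp 0 ((suc k , b) ∷ gens w) (positionWord α))
    cases (yes e) = ≈-trans (*-identityˡ _) (reflexive (cong χ (sym (comp-rest (suc k) b (gens w) v e))))
    cases (no ne) = ≈-trans (zeroˡ _) (reflexive (cong χ (sym (isFalse (comp 0 ((suc k , b) ∷ gens w) (positionWord α)) (λ e → ne (low-seg (suc k) b (gens w) v e))))))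
      where
      isFalse : ∀ t → t ≢ true → t ≡ false
      isFalse true ne = ⊥-elim (ne refl)
      isFalse false _ = refl

  module CT = Coefficients btab≟

  boxes-Q : ∀ {N α} → Valid N α → boxes (Q α) ≡ N
  boxes-Q {N} {α} v = trans (cong boxes (Q-tab v)) (trans (tab-boxes (positionPath α) (positionPath-lat v)) (length-positionPath v))

  Q-std : ∀ {N α} → Valid N α → IsStdBT (Q α)
  Q-std {N} {α} v = subst IsStdBT (sym (Q-tab v)) (tab-std (positionPath α) (positionPath-lat v))

  fibre-Q : ∀ {n T α} → α ∈ fibre n T → Q α ≡ T
  fibre-Q {n} {T} {α} i = proj₂ (∈-filter⁻ (λ α → btab≟ (Q α) T) {v = α} {xs = allBasis n} i)

  fibre-∈ : ∀ {N α} → Valid N α → α ∈ fibre (boxes (Q α)) (Q α)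
  fibre-∈ {N} {α} v = ∈-filter⁺ (λ β → btab≟ (Q β) (Q α)) {x = α} (subst (λ n → α ∈ allBasis n) (sym (boxes-Q v)) (allBasis⁺ v)) refl

  coef-tT : ∀ {N α} → Valid N α → ∀ T → ext (λ β → χ (does (word≟ β α))) (tT T) ≈ χ (does (btab≟ T (Q α)))
  coef-tT {N} {α} v T = ≈-trans (ext-tT (λ β → χ (does (word≟ β α))) T) (cases (btab≟ T (Q α)))
    where
    S : BTab → Carrier
    S T = ∑ (fibre (boxes T) T) (λ β → χ (does (word≟ β α)))
    at-Q : S (Q α) ≈ 1#
    at-Q = ≈-trans (∑-single (λ β → χ (does (word≟ β α))) (fibre-unique (boxes (Q α)) (Q α)) (fibre-∈ v) (λ _ ne → CW.χ-no ne)) (CW.χ-yes α)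
    cases : (d : Dec (T ≡ Q α)) → S T ≈ χ (does d)
    cases (yes e) = subst (λ T → S T ≈ 1#) (sym e) at-Q
    cases (no ne) = ∑-zero (fibre (boxes T) T) (λ {β} i → CW.χ-no (λ e → ne (trans (sym (fibre-Q {boxes T} {T} {β} i)) (cong Q {x = β} {y = α} e))))

  coef-ι : ∀ u {N α} → Valid N α → coefF (ι u) α ≈ CT.coef u (Q α)
  coef-ι u {N} {α} v = ≈-trans (CW.coef-ext (ι u) α) (≈-trans (ext-ι (λ β → χ (does (word≟ β α))) u) (≈-trans (∑-cong u (λ {p} _ → *-congˡ (coef-tT v (proj₂ p)))) (≈-sym (CT.coef-ext u (Q α)))))

  valid-≈F : ∀ x y → AllValid x → AllValid y → (∀ {N α} → Valid N α → coefF x α ≈ coefF y α) → x ≈F y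
  valid-≈F x y vx vy h α = cases (DecMem._∈?_ word≟ α (allBasis (length (proj₁ α))))
    where
    absent : α ∉ allBasis (length (proj₁ α)) → ∀ z → AllValid z → coefF z α ≈ 0#
    absent ni z vz = CW.coef-∉ z α (All.map (λ { (n , v) refl → ni (subst (λ k → α ∈ allBasis k) (sym (valid-length v)) (allBasis⁺ v)) }) vz)
    cases : Dec (α ∈ allBasis (length (proj₁ α))) → coefF x α ≈ coefF y α
    cases (yes i) = h (allBasis⁻ (length (proj₁ α)) i)
    cases (no ni) = ≈-trans (absent ni x vx) (≈-sym (absent ni y vy))

  compPosition? : ∀ w α → Dec (comp 0 w (positionWord α) ≡ true)
  compPosition? w α = comp 0 w (positionWord α) Bool.≟ true

  -- The words in the product of generators are those with this block type in the position reading.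
  -- By `tabs-comp` they fill whole fibres of `Q`, so the product is the sum of the `tT` over this
  -- list, each taken once.
  tabs : List (ℕ × Fin m) → List BTab
  tabs w = deduplicate btab≟ (map Q (filter (compPosition? (gens w)) (allBasis (wsize (gens w)))))

  tabs-unique : ∀ w → Unique (tabs w)
  tabs-unique w = UniqD.deduplicate-! btab≟ (map Q (filter (compPosition? (gens w)) (allBasis (wsize (gens w)))))

  tabs⁻ : ∀ w {T} → T ∈ tabs w → ∃ λ β → Valid (wsize (gens w)) β × comp 0 (gens w) (positionWord β) ≡ true × T ≡ Q β
  tabs⁻ w {T} i = unpack (∈-map⁻ Q (∈-deduplicate⁻ btab≟ (map Q L) i))
    where
    L : List Word
    L = filter (compPosition? (gens w)) (allBasis (wsize (gens w)))
    unpack : (∃ λ β → β ∈ L × T ≡ Q β) → ∃ λ β → Valid (wsize (gens w)) β × comp 0 (gens w) (positionWord β) ≡ true × T ≡ Q β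
    unpack (β , j , e) = β , allBasis⁻ (wsize (gens w)) (proj₁ jj) , proj₂ jj , e
      where
      jj : β ∈ allBasis (wsize (gens w)) × comp 0 (gens w) (positionWord β) ≡ true
      jj = ∈-filter⁻ (compPosition? (gens w)) {v = β} {xs = allBasis (wsize (gens w))} j

  comp-size : ∀ w {N α} → Valid N α → comp 0 w (positionWord α) ≡ true → N ≡ wsize w
  comp-size w {N} {α} v e = trans (sym (length-positionWord v)) (comp-length w (positionWord α) e)

  tabs⁺ : ∀ w {N α} → Valid N α → comp 0 (gens w) (positionWord α) ≡ true → Q α ∈ tabs w
  tabs⁺ w {N} {α} v e = ∈-deduplicate⁺ btab≟ (∈-map⁺ Q {x = α} (∈-filter⁺ (compPosition? (gens w)) {x = α} (subst (λ k → α ∈ allBasis k) (comp-size (gens w) v e) (allBasis⁺ v)) e))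

  Q-injective : ∀ {N N' α β} → Valid N α → Valid N' β → Q α ≡ Q β → positionPath α ≡ positionPath β
  Q-injective {N} {N'} {α} {β} v v' e = tab-inj (positionPath α) (positionPath β)
    (trans (length-positionPath v) (trans (trans (sym (boxes-Q v)) (trans (cong boxes e) (boxes-Q v'))) (sym (length-positionPath v'))))
    (positionPath-lat v) (positionPath-lat v') (trans (sym (Q-tab v)) (trans e (Q-tab v')))

  tabs-comp : ∀ w {N α} → Valid N α → Q α ∈ tabs w → comp 0 (gens w) (positionWord α) ≡ true
  tabs-comp w {N} {α} v i = unpack (tabs⁻ w i)
    where
    unpack : (∃ λ β → Valid (wsize (gens w)) β × comp 0 (gens w) (positionWord β) ≡ true × Q α ≡ Q β) → comp 0 (gens w) (positionWord α) ≡ true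
    unpack (β , v' , e , q) = proj₂ (comp⇔path (gens w) (positionWord α) (distinct-position v)) (subst (Blocks _≤ₗ_ (reverse (gens w))) (sym (Q-injective v v' q))
      (proj₁ (comp⇔path (gens w) (positionWord β) (distinct-position v')) e))

  tabRep : Carrier → List (ℕ × Fin m) → QRep
  tabRep k w = map (k ,_) (tabs w)

  tabRep-std : ∀ k w → Std (tabRep k w)
  tabRep-std k w = AllP.map⁺ (All.tabulate λ {T} i → isStd T (tabs⁻ w i))
    where
    isStd : ∀ T → (∃ λ β → Valid (wsize (gens w)) β × comp 0 (gens w) (positionWord β) ≡ true × T ≡ Q β) → IsStdBT T
    isStd T (β , v , _ , e) = subst IsStdBT (sym e) (Q-std v)

  tabRep-coef : ∀ k w {N α} → Valid N α → CT.coef (tabRep k w) (Q α) ≈ k * χ (comp 0 (gens w) (positionWord α))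
  tabRep-coef k w {N} {α} v = ≈-trans (∑-map (k ,_) (tabs w) (λ p → if does (btab≟ (proj₂ p) (Q α)) then proj₁ p else 0#)) (≈-trans (∑-cong (tabs w) (λ {T} _ → ≈-trans (if-χ (does (btab≟ T (Q α))) k) (*-comm _ _)))
      (≈-trans (≈-sym (∑-*ˡ (tabs w) k (λ T → χ (does (btab≟ T (Q α)))))) (*-congˡ (cases (comp 0 (gens w) (positionWord α)) refl))))
    where
    cases : ∀ t → comp 0 (gens w) (positionWord α) ≡ t → ∑ (tabs w) (λ T → χ (does (btab≟ T (Q α)))) ≈ χ t
    cases true e = ≈-trans (∑-single (λ T → χ (does (btab≟ T (Q α)))) (tabs-unique w) (tabs⁺ w v e) (λ _ ne → CT.χ-no ne)) (CT.χ-yes (Q α))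
    cases false e = ∑-zero (tabs w) (λ {T} i → CT.χ-no (λ q → case trans (sym e) (tabs-comp w v (subst (_∈ tabs w) q i)) of λ ()))

  toQ : DRep → QRep
  toQ = concatMap (λ q → tabRep (proj₁ q) (proj₂ q))

  toQ-std : ∀ p → Std (toQ p)
  toQ-std [] = []
  toQ-std ((k , w) ∷ p) = AllP.++⁺ (tabRep-std k w) (toQ-std p)

  AllValid-• : ∀ k x → AllValid x → AllValid (k •F x)
  AllValid-• k x = AllP.map⁺

  evalD-valid : ∀ p → AllValid (evalD p)
  evalD-valid [] = []
  evalD-valid ((k , w) ∷ p) = AllP.++⁺ (AllValid-• k (evalWord w) (evalWord-valid w)) (evalD-valid p)

  ext-evalD : ∀ g p → ext g (evalD p) ≈ ∑ p (λ q → proj₁ q * ext g (evalWord (proj₂ q)))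
  ext-evalD g p = ≈-trans (∑-concatMap (λ q → proj₁ q •F evalWord (proj₂ q)) p (λ r → proj₁ r * g (proj₂ r))) (∑-cong p (λ {q} _ → ext-•F g (proj₁ q) (evalWord (proj₂ q))))

  coef-evalD : ∀ p α → coefF (evalD p) α ≈ ∑ p (λ q → proj₁ q * coefF (evalWord (proj₂ q)) α)
  coef-evalD p α = ≈-trans (CW.coef-ext (evalD p) α) (≈-trans (ext-evalD (λ β → χ (does (word≟ β α))) p) (∑-cong p (λ {q} _ → *-congˡ (≈-sym (CW.coef-ext (evalWord (proj₂ q)) α)))))

  evalD-toQ : ∀ p → evalD p ≈F ι (toQ p)
  evalD-toQ p = valid-≈F (evalD p) (ι (toQ p)) (evalD-valid p) (ι-valid (toQ p)) λ {N} {α} v →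
    ≈-trans (coef-evalD p α) (≈-sym (≈-trans (coef-ι (toQ p) v) (≈-trans (∑-concatMap (λ q → tabRep (proj₁ q) (proj₂ q)) p (λ r → if does (btab≟ (proj₂ r) (Q α)) then proj₁ r else 0#))
      (∑-cong p (λ {q} _ → ≈-trans (tabRep-coef (proj₁ q) (proj₂ q) v) (*-congˡ (≈-sym (evalWord-coef (proj₂ q) v))))))))

  -- Images of the generators.

  others : Fin m → List Run → Bool
  others b [] = true
  others b ((n , d) ∷ w) = (if does (d ≟ᶠ b) then true else (n ≡ᵇ 0)) ∧ others b w

  -- An increasing word in one colour may be cut anywhere, so only the total size of the blocks of
  -- colour `b` matters, and blocks of other colours must be empty.
  comp-seg : ∀ b p w k n → p ≤ k → comp p w (map (b ,_) (iota k n)) ≡ (sum (restr b w) ≡ᵇ n) ∧ others b w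
  comp-seg b p [] k zero _ = refl
  comp-seg b p [] k (suc n) _ = refl
  comp-seg b p ((zero , d) ∷ w) k n _ = trans (comp-seg b 0 w k n z≤n) (same (d ≟ᶠ b))
    where
    same : Dec (d ≡ b) → (sum (restr b w) ≡ᵇ n) ∧ others b w ≡ (sum (restr b ((zero , d) ∷ w)) ≡ᵇ n) ∧ others b ((zero , d) ∷ w)
    same (yes refl) rewrite restr-≡ d 0 w | dec-true (d ≟ᶠ d) refl = refl
    same (no ne) rewrite restr-≢ 0 w ne | dec-false (d ≟ᶠ b) ne = refl
  comp-seg b p ((suc c , d) ∷ w) k zero _ = same (d ≟ᶠ b)
    where
    same : Dec (d ≡ b) → false ≡ (sum (restr b ((suc c , d) ∷ w)) ≡ᵇ 0) ∧ others b ((suc c , d) ∷ w)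
    same (yes refl) rewrite restr-≡ d (suc c) w = refl
    same (no ne) rewrite dec-false (d ≟ᶠ b) ne = sym (∧-zeroʳ _)
  comp-seg b p ((suc c , d) ∷ w) k (suc n) le = same (d ≟ᶠ b)
    where
    same : Dec (d ≡ b) → comp p ((suc c , d) ∷ w) (map (b ,_) (iota k (suc n))) ≡ (sum (restr b ((suc c , d) ∷ w)) ≡ᵇ suc n) ∧ others b ((suc c , d) ∷ w)
    same (yes refl) = trans (cong₂ _∧_ (dec-true (d ≟ᶠ d) refl) (trans (cong (_∧ _) (≤ᵇ-true le)) (comp-seg d (suc k) ((c , d) ∷ w) (suc k) n ℕP.≤-refl)))
      (trans (cong₂ (λ y z → (sum y ≡ᵇ n) ∧ z) (restr-≡ d c w) refl) (sym (trans (cong (λ y → (sum y ≡ᵇ suc n) ∧ others d ((suc c , d) ∷ w)) (restr-≡ d (suc c) w)) (trans (cong (λ t → ((c ℕ.+ sum (restr d w)) ≡ᵇ n) ∧ ((if t then true else false) ∧ others d w)) (dec-true (d ≟ᶠ d) refl))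
        (sym (cong (λ t → ((c ℕ.+ sum (restr d w)) ≡ᵇ n) ∧ ((if t then true else (c ≡ᵇ 0)) ∧ others d w)) (dec-true (d ≟ᶠ d) refl)))))))
    same (no ne) = trans (cong (_∧ ((p ≤ᵇ k) ∧ comp (suc k) ((c , d) ∷ w) (map (b ,_) (iota (suc k) n)))) (dec-false (b ≟ᶠ d) (ne ∘ sym))) (sym (trans (cong (λ t → (sum (restr b ((suc c , d) ∷ w)) ≡ᵇ suc n) ∧ ((if t then true else false) ∧ others b w)) (dec-false (d ≟ᶠ b) ne)) (∧-zeroʳ _)))

  others-block : ∀ b d e w → others b (block d e ++ w) ≡ (if does (d ≟ᶠ b) then true else allZero e) ∧ others b w
  others-block b d [] w with does (d ≟ᶠ b)
  ... | true = refl
  ... | false = refl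
  others-block b d (x ∷ e) w = trans (cong ((if does (d ≟ᶠ b) then true else (x ≡ᵇ 0)) ∧_) (others-block b d e w)) (go (does (d ≟ᶠ b)))
    where
    go : ∀ t → (if t then true else (x ≡ᵇ 0)) ∧ ((if t then true else allZero e) ∧ others b w) ≡ (if t then true else allZero (x ∷ e)) ∧ others b w
    go true = refl
    go false = sym (∧-assoc (x ≡ᵇ 0) (allZero e) (others b w))

  others-wOf : ∀ b a → others b (wOf a) ≡ isConst (a [ b ]≔ [])
  others-wOf b a = hit id a b id
    where
    miss : ∀ {k} (f : Fin k → Fin m) es b → (∀ c → f c ≢ b) → others b (wOf′ f es) ≡ allZeroV es
    miss f V.[] b _ = refl
    miss f (e V.∷ es) b h = trans (others-block b (f zero) e _) (cong₂ _∧_ (cong (if_then true else allZero e) (dec-false (f zero ≟ᶠ b) (h zero))) (miss (f ∘ suc) es b (h ∘ suc)))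
    hit : ∀ {k} (f : Fin k → Fin m) es c → (∀ {x y} → f x ≡ f y → x ≡ y) → others (f c) (wOf′ f es) ≡ allZeroV (es [ c ]≔ [])
    hit f (e V.∷ es) zero inj = trans (others-block (f zero) (f zero) e _) (trans (cong (λ t → (if t then true else allZero e) ∧ others (f zero) (wOf′ (f ∘ suc) es)) (dec-true (f zero ≟ᶠ f zero) refl))
      (miss (f ∘ suc) es (f zero) (λ c e → case inj e of λ ())))
    hit f (e V.∷ es) (suc c) inj = trans (others-block (f (suc c)) (f zero) e _) (cong₂ _∧_ (cong (if_then true else allZero e) (dec-false (f zero ≟ᶠ f (suc c)) (λ e → case inj e of λ ())))
      (hit (f ∘ suc) es c (Fsuc-injective ∘ inj)))

  Ψ-gen : ∀ n b → Ψ (y n b) ≈Λ hΛ n b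
  Ψ-gen n b a = ≈-trans (+-identityʳ _) (≈-trans (*-identityˡ _) (reflexive (trans (cong χ e) (indicator ((sum (lookup a b) ≡ᵇ n) ∧ isConst (a [ b ]≔ []))))))
    where
    e : comp 0 (wOf a) (seg b n) ≡ (sum (lookup a b) ≡ᵇ n) ∧ isConst (a [ b ]≔ [])
    e = trans (cong (comp 0 (wOf a)) (trans (seg-letters b n) (cong (map (b ,_)) (upTo-iota n)))) (trans (comp-seg b 0 (wOf a) 0 n z≤n)
      (cong₂ (λ y z → (sum y ≡ᵇ n) ∧ z) (wOf-has a b) (others-wOf b a)))
    indicator : ∀ t → χ t ≡ (if t then 1# else 0#)
    indicator true = refl
    indicator false = refl

  Ψ-evalWord : ∀ w → Ψ (evalWord w) ≈Λ hWord w
  Ψ-evalWord [] a = Φ-one a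
  Ψ-evalWord ((n , b) ∷ w) a = ≈-trans (Ψ-*F (y (suc n) b) (evalWord w) ((suc n , gen-valid (suc n) b) ∷ []) (evalWord-valid w) a) (·Λ-cong (Ψ-gen (suc n) b) (Ψ-evalWord w) a)

  φ-Ψ : ∀ p → Ψ (evalD p) ≈Λ φ p
  φ-Ψ p a = ≈-trans (ext-evalD (λ α → χ (comp 0 (wOf a) (valueWord α))) p) (∑-cong p (λ {q} _ → *-congˡ (Ψ-evalWord (proj₂ q) a)))

  Θ-φ : ∀ p u → Std u → evalD p ≈F ι u → Θ u ≈Λ φ p
  Θ-φ p u s h a = ≈-trans (Θ-Ψ u s a) (≈-trans (≈-sym (Φ-resp (wOf a) (evalD p) (ι u) h)) (φ-Ψ p a))

  -- Splittings of block types; φ is the unique homomorphism.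

  S : ℕ → (ℕ → ℕ → Carrier) → Carrier
  S n H = ∑ (upTo (suc n)) (λ i → H i (n ∸ i))

  S-suc : ∀ n H → S (suc n) H ≈ H 0 (suc n) + S n (λ i k → H (suc i) k)
  S-suc n H = +-congˡ (≈-trans (reflexive (cong (λ z → ∑ z (λ i → H i (suc n ∸ i))) (sym (map-upTo suc (suc n))))) (∑-map suc (upTo (suc n)) (λ i → H i (suc n ∸ i))))

  S-cong : ∀ n {H H'} → (∀ i k → H i k ≈ H' i k) → S n H ≈ S n H'
  S-cong n h = ∑-cong (upTo (suc n)) (λ _ → h _ _)

  S-+ : ∀ n H H' → S n (λ i k → H i k + H' i k) ≈ S n H + S n H'
  S-+ n H H' = ∑-+ (upTo (suc n)) (λ i → H i (n ∸ i)) (λ i → H' i (n ∸ i))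

  S-assoc : ∀ n (G : ℕ → ℕ → ℕ → Carrier) → S n (λ i k → S i (λ a b → G a b k)) ≈ S n (λ a r → S r (λ b k → G a b k))
  S-assoc zero G = ≈-refl
  S-assoc (suc n) G = begin
    S (suc n) (λ i k → S i (λ a b → G a b k)) ≈⟨ S-suc n (λ i k → S i (λ a b → G a b k)) ⟩
    S 0 (λ a b → G a b (suc n)) + S n (λ i k → S (suc i) (λ a b → G a b k)) ≈⟨ +-cong (+-identityʳ _) (≈-trans (S-cong n (λ i k → S-suc i (λ a b → G a b k))) (S-+ n (λ i k → G 0 (suc i) k) (λ i k → S i (λ a b → G (suc a) b k)))) ⟩
    G 0 0 (suc n) + (S n (λ i k → G 0 (suc i) k) + S n (λ i k → S i (λ a b → G (suc a) b k))) ≈⟨ ≈-sym (+-assoc _ _ _) ⟩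
    (G 0 0 (suc n) + S n (λ i k → G 0 (suc i) k)) + S n (λ i k → S i (λ a b → G (suc a) b k)) ≈⟨ +-cong (≈-sym (S-suc n (G 0))) (S-assoc n (G ∘ suc)) ⟩
    S (suc n) (G 0) + S n (λ a r → S r (λ b k → G (suc a) b k)) ≈⟨ ≈-sym (S-suc n (λ a r → S r (λ b k → G a b k))) ⟩
    S (suc n) (λ a r → S r (λ b k → G a b k)) ∎
    where open ≈R

  SR : List Run → (List Run → List Run → Carrier) → Carrier
  SR w H = ∑ (splitsR w) (λ r → H (proj₁ r) (proj₂ r))

  SR-∷ : ∀ n b w H → SR ((n , b) ∷ w) H ≈ S n (λ i k → SR w (λ p q → H ((i , b) ∷ p) ((k , b) ∷ q)))
  SR-∷ n b w H = ≈-trans (∑-concatMap (λ i → map (cut i) (splitsR w)) (upTo (suc n)) (λ r → H (proj₁ r) (proj₂ r)))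
    (∑-cong (upTo (suc n)) (λ {i} _ → ∑-map (cut i) (splitsR w) (λ r → H (proj₁ r) (proj₂ r))))
    where
    cut : ℕ → List Run × List Run → List Run × List Run
    cut i p = (i , b) ∷ proj₁ p , (n ∸ i , b) ∷ proj₂ p

  SR-cong : ∀ w {H H'} → (∀ p q → H p q ≈ H' p q) → SR w H ≈ SR w H'
  SR-cong w h = ∑-cong (splitsR w) (λ _ → h _ _)

  SR-S : ∀ w n (G : List Run → List Run → ℕ → ℕ → Carrier) → SR w (λ p q → S n (G p q)) ≈ S n (λ i k → SR w (λ p q → G p q i k))
  SR-S w n G = ∑-swap (splitsR w) (upTo (suc n)) (λ r i → G (proj₁ r) (proj₂ r) i (n ∸ i))

  -- Coassociativity of splitting. It yields the multiplicativity of `hWord` by regrouping the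
  -- values of the functionals, so that the regrouping takes place in 𝕂 instead of in products of
  -- words.
  SR-assoc : ∀ w (G : List Run → List Run → List Run → Carrier) → SR w (λ p q → SR p (λ a b → G a b q)) ≈ SR w (λ a r → SR r (λ b q → G a b q))
  SR-assoc [] G = ≈-refl
  SR-assoc ((n , d) ∷ w) G = begin
    SR ((n , d) ∷ w) (λ p q → SR p (λ a b → G a b q)) ≈⟨ SR-∷ n d w (λ p q → SR p (λ a b → G a b q)) ⟩
    S n (λ i k → SR w (λ p q → SR ((i , d) ∷ p) (λ a b → G a b ((k , d) ∷ q)))) ≈⟨ S-cong n (λ i k → ≈-trans (SR-cong w (λ p q → SR-∷ i d p (λ a b → G a b ((k , d) ∷ q)))) (SR-S w i (λ p q s t → SR p (λ a b → G ((s , d) ∷ a) ((t , d) ∷ b) ((k , d) ∷ q))))) ⟩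
    S n (λ i k → S i (λ s t → SR w (λ p q → SR p (λ a b → G ((s , d) ∷ a) ((t , d) ∷ b) ((k , d) ∷ q))))) ≈⟨ S-assoc n (λ s t k → SR w (λ p q → SR p (λ a b → G ((s , d) ∷ a) ((t , d) ∷ b) ((k , d) ∷ q)))) ⟩
    S n (λ s r → S r (λ t k → SR w (λ p q → SR p (λ a b → G ((s , d) ∷ a) ((t , d) ∷ b) ((k , d) ∷ q))))) ≈⟨ S-cong n (λ s r → S-cong r (λ t k → SR-assoc w (λ a b q → G ((s , d) ∷ a) ((t , d) ∷ b) ((k , d) ∷ q)))) ⟩
    S n (λ s r → S r (λ t k → SR w (λ a q → SR q (λ b e → G ((s , d) ∷ a) ((t , d) ∷ b) ((k , d) ∷ e))))) ≈⟨ S-cong n (λ s r → ≈-sym (≈-trans (SR-cong w (λ a q → SR-∷ r d q (λ b e → G ((s , d) ∷ a) b e))) (SR-S w r (λ a q t k → SR q (λ b e → G ((s , d) ∷ a) ((t , d) ∷ b) ((k , d) ∷ e)))))) ⟩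
    S n (λ s r → SR w (λ a q → SR ((r , d) ∷ q) (λ b e → G ((s , d) ∷ a) b e))) ≈⟨ ≈-sym (SR-∷ n d w (λ a r → SR r (λ b q → G a b q))) ⟩
    SR ((n , d) ∷ w) (λ a r → SR r (λ b q → G a b q)) ∎
    where open ≈R

  SR-unitˡ : ∀ w (f : List Run → Carrier) → SR w (λ p q → χ (comp 0 p []) * f q) ≈ f w
  SR-unitˡ [] f = ≈-trans (+-identityʳ _) (*-identityˡ _)
  SR-unitˡ ((n , d) ∷ w) f = ≈-trans (SR-∷ n d w (λ p q → χ (comp 0 p []) * f q)) (≈-trans (∑-single (λ i → SR w (λ p q → χ (comp 0 ((i , d) ∷ p) []) * f ((n ∸ i , d) ∷ q))) (Uniq.upTo⁺ (suc n)) (∈-upTo⁺ (s≤s z≤n)) other) (SR-unitˡ w (λ q → f ((n , d) ∷ q))))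
    where
    other : ∀ {i} → i ∈ upTo (suc n) → i ≢ 0 → SR w (λ p q → χ (comp 0 ((i , d) ∷ p) []) * f ((n ∸ i , d) ∷ q)) ≈ 0#
    other {zero} _ ne = ⊥-elim (ne refl)
    other {suc i} _ _ = ∑-zero (splitsR w) (λ _ → zeroˡ _)

  SR-unitʳ : ∀ w (f : List Run → Carrier) → SR w (λ p q → f p * χ (comp 0 q [])) ≈ f w
  SR-unitʳ [] f = ≈-trans (+-identityʳ _) (*-identityʳ _)
  SR-unitʳ ((n , d) ∷ w) f = ≈-trans (SR-∷ n d w (λ p q → f p * χ (comp 0 q []))) (≈-trans (∑-single (λ i → SR w (λ p q → f ((i , d) ∷ p) * χ (comp 0 ((n ∸ i , d) ∷ q) []))) (Uniq.upTo⁺ (suc n)) (∈-upTo⁺ ℕP.≤-refl)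
      (λ {i} j ne → other (n ∸ i) (ℕP.m>n⇒m∸n≢0 (ℕP.≤∧≢⇒< (ℕP.≤-pred (∈-upTo⁻ j)) ne))))
      (≈-trans (reflexive (cong (λ k → SR w (λ p q → f ((n , d) ∷ p) * χ (comp 0 ((k , d) ∷ q) []))) (ℕP.n∸n≡0 n))) (SR-unitʳ w (λ p → f ((n , d) ∷ p)))))
    where
    other : ∀ {i} k → k ≢ 0 → SR w (λ p q → f ((i , d) ∷ p) * χ (comp 0 ((k , d) ∷ q) [])) ≈ 0#
    other zero ne = ⊥-elim (ne refl)
    other (suc k) _ = ∑-zero (splitsR w) (λ _ → zeroʳ _)

  Φ-oneF : ∀ v → Φ v oneF ≈ χ (comp 0 v [])
  Φ-oneF v = ≈-trans (+-identityʳ _) (*-identityˡ _)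

  y-valid : ∀ n b → AllValid (y n b)
  y-valid n b = (n , gen-valid n b) ∷ []

  Φ-evalWord-++ : ∀ w w' v → Φ v (evalWord (w ++ w')) ≈ SR v (λ p q → Φ p (evalWord w) * Φ q (evalWord w'))
  Φ-evalWord-++ [] w' v = ≈-sym (≈-trans (SR-cong v (λ p q → *-congʳ (Φ-oneF p))) (SR-unitˡ v (λ q → Φ q (evalWord w'))))
  Φ-evalWord-++ ((n , b) ∷ w) w' v = begin
    Φ v (Y *F evalWord (w ++ w')) ≈⟨ Φ-*F v Y (evalWord (w ++ w')) (y-valid (suc n) b) (evalWord-valid (w ++ w')) ⟩
    SR v (λ p q → Φ p Y * Φ q (evalWord (w ++ w'))) ≈⟨ SR-cong v (λ p q → ≈-trans (*-congˡ (Φ-evalWord-++ w w' q)) (∑-*ˡ (splitsR q) _ _)) ⟩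
    SR v (λ p q → SR q (λ a e → Φ p Y * (Φ a (evalWord w) * Φ e (evalWord w')))) ≈⟨ ≈-sym (SR-assoc v (λ p a e → Φ p Y * (Φ a (evalWord w) * Φ e (evalWord w')))) ⟩
    SR v (λ q e → SR q (λ p a → Φ p Y * (Φ a (evalWord w) * Φ e (evalWord w')))) ≈⟨ SR-cong v (λ q e → ≈-trans (SR-cong q (λ p a → ≈-sym (*-assoc _ _ _))) (≈-sym (∑-*ʳ (splitsR q) _ _))) ⟩
    SR v (λ q e → SR q (λ p a → Φ p Y * Φ a (evalWord w)) * Φ e (evalWord w')) ≈⟨ SR-cong v (λ q e → *-congʳ (≈-sym (Φ-*F q Y (evalWord w) (y-valid (suc n) b) (evalWord-valid w)))) ⟩
    SR v (λ q e → Φ q (Y *F evalWord w) * Φ e (evalWord w')) ∎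
    where
    open ≈R
    Y = y (suc n) b

  hWord-++ : ∀ w w' → hWord (w ++ w') ≈Λ (hWord w ·Λ hWord w')
  hWord-++ w w' a = ≈-trans (≈-sym (Ψ-evalWord (w ++ w') a)) (≈-trans (Φ-evalWord-++ w w' (wOf a)) (≈-trans (splits-wOf id a (λ r → Φ (proj₁ r) (evalWord w) * Φ (proj₂ r) (evalWord w')))
    (·Λ-cong (Ψ-evalWord w) (Ψ-evalWord w') a)))

  hΛ-1Λ : ∀ n b → (hΛ (suc n) b ·Λ 1Λ) ≈Λ hΛ (suc n) b
  hΛ-1Λ n b a = ≈-trans (≈-sym (Ψ-evalWord ((n , b) ∷ []) a)) (≈-trans (Φ-*F (wOf a) (y (suc n) b) oneF (y-valid (suc n) b) (evalWord-valid []))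
    (≈-trans (SR-cong (wOf a) (λ p q → *-congˡ (Φ-oneF q))) (≈-trans (SR-unitʳ (wOf a) (λ p → Φ p (y (suc n) b))) (Ψ-gen (suc n) b a))))

  φ-well-defined : ∀ p q → evalD p ≈F evalD q → φ p ≈Λ φ q
  φ-well-defined p q h a = ≈-trans (≈-sym (φ-Ψ p a)) (≈-trans (Φ-resp (wOf a) (evalD p) (evalD q) h) (φ-Ψ q a))

  φ-• : ∀ k p → φ (k •D p) ≈Λ (k •Λ φ p)
  φ-• k p a = ≈-trans (∑-map (λ q → (k * proj₁ q , proj₂ q)) p (λ q → proj₁ q * hWord (proj₂ q) a)) (≈-trans (∑-cong p (λ _ → *-assoc _ _ _)) (≈-sym (∑-*ˡ p k (λ q → proj₁ q * hWord (proj₂ q) a))))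

  φ-·D : ∀ p q → φ (p ·D q) ≈Λ (φ p ·Λ φ q)
  φ-·D p q a = begin
    φ (p ·D q) a ≈⟨ ∑-concatMap (λ r → map (times r) q) p term ⟩
    ∑ p (λ r → ∑ (map (times r) q) term) ≈⟨ ∑-cong p (λ {r} _ → ≈-trans (∑-map (times r) q term) (∑-cong q (λ {s} _ → ≈-trans (*-congˡ (hWord-++ (proj₂ r) (proj₂ s) a)) (≈-trans (∑-*ˡ (splitsV a) _ _) (∑-cong (splitsV a) (λ _ → *-interchange _ _ _ _)))))) ⟩
    ∑ p (λ r → ∑ q (λ s → ∑ (splitsV a) (λ z → f r z * g s z))) ≈⟨ ∑-cong p (λ {r} _ → ∑-swap q (splitsV a) (λ s z → f r z * g s z)) ⟩
    ∑ p (λ r → ∑ (splitsV a) (λ z → ∑ q (λ s → f r z * g s z))) ≈⟨ ∑-swap p (splitsV a) (λ r z → ∑ q (λ s → f r z * g s z)) ⟩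
    ∑ (splitsV a) (λ z → ∑ p (λ r → ∑ q (λ s → f r z * g s z))) ≈⟨ ∑-cong (splitsV a) (λ {z} _ → ≈-sym (∑-* p q (λ r → f r z) (λ s → g s z))) ⟩
    (φ p ·Λ φ q) a ∎
    where
    open ≈R
    times : Carrier × List (ℕ × Fin m) → Carrier × List (ℕ × Fin m) → Carrier × List (ℕ × Fin m)
    times r s = proj₁ r * proj₁ s , proj₂ r ++ proj₂ s
    term : Carrier × List (ℕ × Fin m) → Carrier
    term q = proj₁ q * hWord (proj₂ q) a
    f g : Carrier × List (ℕ × Fin m) → BMon × BMon → Carrier
    f r z = proj₁ r * hWord (proj₂ r) (proj₁ z)
    g s z = proj₁ s * hWord (proj₂ s) (proj₂ z)

  φ-hom : IsAlgHomD φ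
  φ-hom = φ-well-defined , (λ p q a → ∑-++ p q _) , φ-• , φ-·D , (λ a → ≈-trans (+-identityʳ _) (*-identityˡ _)) ,
    λ n b a → ≈-trans (+-identityʳ _) (≈-trans (*-identityˡ _) (hΛ-1Λ n b a))

  evalD-coef-cong : ∀ k k' w → k ≈ k' → evalD ((k , w) ∷ []) ≈F evalD ((k' , w) ∷ [])
  evalD-coef-cong k k' w e α = ≈-trans (coef-evalD ((k , w) ∷ []) α) (≈-trans (+-congʳ (*-congʳ e)) (≈-sym (coef-evalD ((k' , w) ∷ []) α)))

  module _ (ψ : DRep → ΛB) (hom : IsAlgHomD ψ) where
    private
      ψ-resp = proj₁ hom
      ψ-++ = proj₁ (proj₂ hom)
      ψ-• = proj₁ (proj₂ (proj₂ hom))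
      ψ-· = proj₁ (proj₂ (proj₂ (proj₂ hom)))
      ψ-1 = proj₁ (proj₂ (proj₂ (proj₂ (proj₂ hom))))
      ψ-gen = proj₂ (proj₂ (proj₂ (proj₂ (proj₂ hom))))

    ψ-word : ∀ w → ψ ((1# , w) ∷ []) ≈Λ hWord w
    ψ-word [] = ψ-1
    -- The product `gen n b ·D ((1# , w) ∷ [])` carries the coefficient `1# * 1#`, so the two
    -- representatives are compared through their values in 𝒟(B).
    ψ-word ((n , b) ∷ w) a = ≈-trans (ψ-resp ((1# , (n , b) ∷ w) ∷ []) (gen n b ·D ((1# , w) ∷ [])) (evalD-coef-cong 1# (1# * 1#) ((n , b) ∷ w) (≈-sym (*-identityˡ 1#))) a)
      (≈-trans (ψ-· (gen n b) ((1# , w) ∷ []) a) (·Λ-cong (ψ-gen n b) (ψ-word w) a))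

    φ-unique : ∀ p → ψ p ≈Λ φ p
    -- The empty combination is `0# •D []`, so homogeneity gives its image.
    φ-unique [] a = ≈-trans (ψ-• 0# [] a) (zeroˡ _)
    φ-unique ((k , w) ∷ p) a = ≈-trans (ψ-++ ((k , w) ∷ []) p a) (+-cong (≈-trans (ψ-resp ((k , w) ∷ []) (k •D ((1# , w) ∷ [])) (evalD-coef-cong k (k * 1#) w (≈-sym (*-identityʳ k))) a)
      (≈-trans (ψ-• k ((1# , w) ∷ []) a) (*-congˡ (ψ-word w a)))) (φ-unique p a))

  -- Independence of the Schur functions.

  module CB = Coefficients bpart≟

  record PartV (λ' : BPart) : Set where
    constructor partV
    field part : ∀ b → IsPartition (lookup λ' b)
  open PartV

  PartF : ∀ {n} → Vec (List ℕ) n → Set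
  PartF V = V.foldr (λ _ → Set) (λ l r → IsPartition l × r) ⊤ V

  PartF⁻ : ∀ {n} (V : Vec (List ℕ) n) → PartF V → ∀ b → IsPartition (lookup V b)
  PartF⁻ (l V.∷ V) (p , _) zero = p
  PartF⁻ (l V.∷ V) (_ , ps) (suc b) = PartF⁻ V ps b

  IsPartition⇒Wk : ∀ l → Linked _≥_ l → Wk l
  IsPartition⇒Wk [] _ = tt
  IsPartition⇒Wk (x ∷ []) _ = z≤n , tt
  IsPartition⇒Wk (x ∷ y ∷ l) (le ∷ k) = le , IsPartition⇒Wk (y ∷ l) k

  PartV⇒Wks : ∀ {λ'} → PartV λ' → Wks λ'
  PartV⇒Wks h b = IsPartition⇒Wk _ (proj₁ (part h b))

  parts-ext : ∀ l l' → All (1 ≤_) l → All (1 ≤_) l' → (∀ i → at l i ≡ at l' i) → l ≡ l'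
  parts-ext [] [] _ _ _ = refl
  parts-ext [] (x ∷ l') _ (p ∷ _) h = ⊥-elim (ℕP.<-irrefl (h 0) p)
  parts-ext (x ∷ l) [] (p ∷ _) _ h = ⊥-elim (ℕP.<-irrefl (sym (h 0)) p)
  parts-ext (x ∷ l) (x' ∷ l') (_ ∷ p) (_ ∷ p') h = cong₂ _∷_ (h 0) (parts-ext l l' p p' (h ∘ suc))

  vec-ext : ∀ {n} {A : Set} (V W : Vec A n) → (∀ b → lookup V b ≡ lookup W b) → V ≡ W
  vec-ext V W h = trans (sym (VP.tabulate∘lookup V)) (trans (VP.tabulate-cong h) (VP.tabulate∘lookup W))

  content-ext : ∀ {λ' μ} q → PartV λ' → PartV μ → Content λ' q → Content μ q → λ' ≡ μ
  content-ext {λ'} {μ} q P P' C C' = vec-ext λ' μ (λ b → parts-ext _ _ (proj₂ (part P b)) (proj₂ (part P' b)) (λ i → trans (sym (C b i)) (C' b i)))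

  shape-part : ∀ p → Lat p → PartV (shape (tab p))
  shape-part p L = partV λ b → subst IsPartition (sym (shape-lookup p b)) (proj₁ (proj₂ (proj₂ (isTab b))) , AllP.map⁺ (proj₁ (isTab b)))
    where
    isTab : ∀ b → IsTab (real b (lab p))
    isTab b = RowInsertion.RT⇒IsTab _ (rt (real-Lat b (lab p) (lab-desc p) (lab-lat p L)))

  std-part : ∀ T → IsStdBT T → PartV (shape T)
  std-part T s = go (std-path T s)
    where
    go : (∃ λ p → Path (boxes T) p × tab p ≡ T) → PartV (shape T)
    go (p , (_ , L) , e) = subst (PartV ∘ shape) e (shape-part p L)

  -- n(λ) = Σ i λ_i, summed over the colours.
  stat : BPart → ℕ
  stat λ' = wt (reverse (wOf λ'))

  canP : BPart → List Cell
  canP λ' = can (reverse (wOf λ'))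

  reverse-restr : ∀ λ' b → reverse (restr b (reverse (wOf λ'))) ≡ lookup λ' b
  reverse-restr λ' b = trans (cong reverse (restr-reverse b (wOf λ'))) (trans (reverse-involutive _) (wOf-has λ' b))

  canP-content : ∀ λ' → Content λ' (canP λ')
  canP-content λ' b i = trans (cnt-can (reverse (wOf λ')) b i) (cong (λ l → at l i) (reverse-restr λ' b))

  canP-lat : ∀ {λ'} → PartV λ' → Lat (canP λ')
  canP-lat {λ'} P = Lat-can (reverse (wOf λ')) (λ b → subst Wk (sym (reverse-restr λ' b)) (PartV⇒Wks {λ'} P b))

  rowsum-content : ∀ λ' q → Content λ' q → rowsum q ≡ stat λ'
  rowsum-content λ' q C = trans (sum-↭ (Perm.map⁺ proj₂ (content-↭ λ' q (canP λ') C (canP-content λ')))) (rowsum-can (reverse (wOf λ')))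

  canTab : BPart → BTab
  canTab λ' = tab (canP λ')

  shape-canTab : ∀ {λ'} → PartV λ' → shape (canTab λ') ≡ λ'
  shape-canTab {λ'} P = content-ext (canP λ') (shape-part (canP λ') (canP-lat P)) P (shape-content (canP λ') (canP-lat P)) (canP-content λ')

  canTab-std : ∀ {λ'} → PartV λ' → IsStdBT (canTab λ')
  canTab-std {λ'} P = tab-std (canP λ') (canP-lat {λ'} P)

  schurB-paths : ∀ λ' μ → schurB λ' μ ≈ natK (length (paths λ' (reverse (wOf μ))))
  schurB-paths λ' μ = ≈-trans (schurB-kostkaB λ' (wOf μ) μ (wOf-has μ)) (reflexive (cong natK (sym (length-paths λ' (reverse (wOf μ))))))

  paths-bound : ∀ {λ' μ q} → PartV λ' → q ∈ paths λ' (reverse (wOf μ)) → stat λ' ≤ stat μ × (stat μ ≤ stat λ' → q ≡ canP μ)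
  paths-bound {λ'} {μ} {q} P i = go (paths⁻ λ' (reverse (wOf μ)) (PartV⇒Wks {λ'} P) i)
    where
    go : Lat q × Content λ' q × Blocks _≤ₗ_ (reverse (wOf μ)) q → stat λ' ≤ stat μ × (stat μ ≤ stat λ' → q ≡ canP μ)
    go (L , C , B) = le , λ ge → proj₂ (proj₂ pb) (trans e (ℕP.≤-antisym le ge))
      where
      pb = path-bound (reverse (wOf μ)) q B L
      e : rowsum q ≡ stat λ'
      e = rowsum-content λ' q C
      le : stat λ' ≤ stat μ
      le = subst (_≤ stat μ) e (proj₁ (proj₂ pb))

  -- A path counted here would attain the maximal row sum for `μ`. It would then be the
  -- superstandard path, whose content is `μ` and not `λ'`.
  schurB-≢ : ∀ {λ' μ} → PartV λ' → PartV μ → λ' ≢ μ → stat μ ≤ stat λ' → schurB λ' μ ≈ 0#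
  schurB-≢ {λ'} {μ} P P' ne le = ≈-trans (schurB-paths λ' μ) (reflexive (cong (natK ∘ length) (empty (paths λ' (reverse (wOf μ))) none)))
    where
    empty : ∀ {A : Set} (xs : List A) → (∀ {x} → x ∉ xs) → xs ≡ []
    empty [] _ = refl
    empty (x ∷ xs) h = ⊥-elim (h (here refl))
    none : ∀ {q} → q ∉ paths λ' (reverse (wOf μ))
    none {q} i = ne (content-ext (canP μ) P P' (subst (Content λ') (proj₂ (paths-bound {λ'} {μ} P i) le) (proj₁ (proj₂ (paths⁻ λ' (reverse (wOf μ)) (PartV⇒Wks {λ'} P) i)))) (canP-content μ))

  schurB-≡ : ∀ {μ} → PartV μ → schurB μ μ ≈ 1#
  schurB-≡ {μ} P = ≈-trans (schurB-paths μ μ) (≈-trans (reflexive (cong natK (one (paths μ (reverse (wOf μ))) (paths-unique μ (reverse (wOf μ)) (PartV⇒Wks {μ} P))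
      (λ i → proj₂ (paths-bound {μ} {μ} P i) ℕP.≤-refl) (paths⁺ μ (reverse (wOf μ)) (PartV⇒Wks {μ} P) (canP-lat P) (canP-content μ) (can-blocks (reverse (wOf μ))))))) (+-identityʳ 1#))
    where
    one : ∀ {A : Set} {z : A} (xs : List A) → Unique xs → (∀ {x} → x ∈ xs → x ≡ z) → z ∈ xs → length xs ≡ 1
    one (x ∷ []) _ _ _ = refl
    one (x ∷ y ∷ xs) ((ne ∷ _) ∷ _) h _ = ⊥-elim (ne (trans (h (here refl)) (sym (h (there (here refl))))))

  AllPartV : SRep → Set c
  AllPartV = All (λ q → PartV (proj₂ q))

  support-part : ∀ p → AllPartV p → All PartV (map proj₂ p)
  support-part [] [] = []
  support-part (_ ∷ p) (h ∷ hs) = h ∷ support-part p hs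

  AllPart⇒ : ∀ {p} → AllPart p → AllPartV p
  AllPart⇒ = All.map (λ {q} h → partV (PartF⁻ (proj₂ q) h))

  cancelʳ : ∀ {x y z} → x + z ≈ y + z → x ≈ y
  cancelʳ {x} {y} {z} e = begin
    x ≈⟨ ≈-sym (+-identityʳ x) ⟩
    x + 0# ≈⟨ +-congˡ (≈-sym (-‿inverseʳ z)) ⟩
    x + (z + - z) ≈⟨ ≈-sym (+-assoc _ _ _) ⟩
    x + z + - z ≈⟨ +-congʳ e ⟩
    y + z + - z ≈⟨ +-assoc _ _ _ ⟩
    y + (z + - z) ≈⟨ +-congˡ (-‿inverseʳ z) ⟩
    y + 0# ≈⟨ +-identityʳ y ⟩
    y ∎
    where open ≈R

  -- The coefficient of s_λ at the exponent μ vanishes unless stat λ ≤ stat μ, with equality only for λ = μ.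
  schur-independent : ∀ p q → AllPartV p → AllPartV q → evalS p ≈Λ evalS q → ∀ μ → CB.coef p μ ≈ CB.coef q μ
  schur-independent p q Pp Pq h μ = cases (DecMem._∈?_ bpart≟ μ L)
    where
    L : List BPart
    L = map proj₂ p ++ map proj₂ q
    L-part : ∀ {ν} → ν ∈ L → PartV ν
    L-part i = All.lookup (AllP.++⁺ (support-part p Pp) (support-part q Pq)) i
    absent : ∀ {ν} x → (∀ {λ'} → λ' ∈ map proj₂ x → λ' ∈ L) → ν ∉ L → CB.coef x ν ≈ 0#
    absent {ν} x sub ni = CB.coef-∉ x ν (All.tabulate (λ {r} i e → ni (subst (_∈ L) e (sub (∈-map⁺ proj₂ i)))))
    claim : ∀ s μ → PartV μ → (∀ ν → PartV ν → stat ν < s → CB.coef p ν ≈ CB.coef q ν) → stat μ ≤ s → CB.coef p μ ≈ CB.coef q μ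
    claim s μ P ih le = cancelʳ (≈-trans (≈-sym (expand p (λ i → ∈-++⁺ˡ i))) (≈-trans (h μ) (≈-trans (expand q (λ i → ∈-++⁺ʳ (map proj₂ p) i)) (+-congˡ (≈-sym same)))))
      where
      other? : ∀ ν → Dec (ν ≢ μ)
      other? ν = ¬? (bpart≟ ν μ)
      D' : List BPart
      D' = filter other? (deduplicate bpart≟ L)
      D'⁻ : ∀ {ν} → ν ∈ D' → ν ∈ L × ν ≢ μ
      D'⁻ {ν} i = ∈-deduplicate⁻ bpart≟ L (proj₁ (∈-filter⁻ other? {xs = deduplicate bpart≟ L} i)) , proj₂ (∈-filter⁻ other? {xs = deduplicate bpart≟ L} i)
      uD : Unique (μ ∷ D')
      uD = All.tabulate (λ i e → proj₂ (D'⁻ i) (sym e)) ∷ Uniq.filter⁺ other? (UniqD.deduplicate-! bpart≟ L)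
      inD : ∀ {ν} → ν ∈ L → ν ∈ μ ∷ D'
      inD {ν} i = go (bpart≟ ν μ)
        where
        go : Dec (ν ≡ μ) → ν ∈ μ ∷ D'
        go (yes e) = here e
        go (no ne) = there (∈-filter⁺ other? (∈-deduplicate⁺ bpart≟ i) ne)
      R : SRep → Carrier
      R x = ∑ D' (λ ν → CB.coef x ν * schurB ν μ)
      expand : ∀ x → (∀ {ν} → ν ∈ map proj₂ x → ν ∈ L) → evalS x μ ≈ CB.coef x μ + R x
      expand x sub = ≈-trans (CB.ext-support (μ ∷ D') (λ ν → schurB ν μ) x uD (All.tabulate (λ i → inD (sub (∈-map⁺ proj₂ i))))) (+-congʳ (≈-trans (*-congˡ (schurB-≡ P)) (*-identityʳ _)))
      same : R p ≈ R q
      -- Coefficients at shapes of smaller `stat` agree by induction; the remaining shapes have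
      -- entry 0 at the exponent `μ`.
      same = ∑-cong D' (λ {ν} i → term ν i (stat ν ℕP.<? stat μ))
        where
        term : ∀ ν → ν ∈ D' → Dec (stat ν < stat μ) → CB.coef p ν * schurB ν μ ≈ CB.coef q ν * schurB ν μ
        term ν i (yes lt) = *-congʳ (ih ν (L-part (proj₁ (D'⁻ i))) (ℕP.<-≤-trans lt le))
        term ν i (no nlt) = ≈-trans (*-congˡ z) (≈-trans (zeroʳ _) (≈-sym (≈-trans (*-congˡ z) (zeroʳ _))))
          where
          z : schurB ν μ ≈ 0#
          z = schurB-≢ (L-part (proj₁ (D'⁻ i))) P (proj₂ (D'⁻ i)) (ℕP.≮⇒≥ nlt)
    all : ∀ s μ → PartV μ → stat μ < s → CB.coef p μ ≈ CB.coef q μ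
    all (suc s) μ P (s≤s le) = claim s μ P (λ ν Pν lt → all s ν Pν lt) le
    cases : Dec (μ ∈ L) → CB.coef p μ ≈ CB.coef q μ
    cases (yes i) = all (suc (stat μ)) μ (L-part i) ℕP.≤-refl
    cases (no ni) = ≈-trans (absent p (λ i → ∈-++⁺ˡ i) ni) (≈-sym (absent q (λ i → ∈-++⁺ʳ (map proj₂ p) i) ni))

  -- The pairing of tableau classes and the kernel of Θ.

  cnt-inv : ∀ p b i → cnt (map invL p) (b , i) ≡ cnt p (inv b , i)
  cnt-inv [] b i = refl
  cnt-inv ((d , k) ∷ p) b i = cong₂ ℕ._+_ (go ((d , k) ≟c (inv b , i))) (cnt-inv p b i)
    where
    go : Dec ((d , k) ≡ (inv b , i)) → δ (inv d , k) (b , i) ≡ δ (d , k) (inv b , i)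
    go (yes refl) = trans (cong (λ z → δ (z , i) (b , i)) (inv-inv b)) (trans (δ-≡ (b , i)) (sym (δ-≡ (inv b , i))))
    go (no ne) = trans (δ-≢ (λ e → ne (cong₂ _,_ (trans (sym (inv-inv d)) (cong (inv ∘ proj₁) e)) (cong proj₂ e)))) (sym (δ-≢ ne))

  Lat-inv : ∀ p → Lat p → Lat (map invL p)
  Lat-inv [] _ = tt
  Lat-inv (d ∷ p) (P , L) = (λ b i → subst₂ _≤_ (sym (cnt-inv (d ∷ p) b (suc i))) (sym (cnt-inv (d ∷ p) b i)) (P (inv b) i)) , Lat-inv p L

  invL-invL : ∀ p → map invL (map invL p) ≡ p
  invL-invL p = trans (sym (map-∘ p)) (trans (map-cong invL-invol p) (map-id p))

  starP-lookup : ∀ λ' b → lookup (starP λ') b ≡ lookup λ' (inv b)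
  starP-lookup λ' b = VP.lookup∘tabulate _ b

  starP-part : ∀ {λ'} → PartV λ' → PartV (starP λ')
  starP-part {λ'} P = partV λ b → subst IsPartition (sym (starP-lookup λ' b)) (part P (inv b))

  starP-invol : ∀ λ' → starP (starP λ') ≡ λ'
  starP-invol λ' = vec-ext _ λ' (λ b → trans (starP-lookup (starP λ') b) (trans (starP-lookup λ' (inv b)) (cong (lookup λ') (inv-inv b))))

  Content-star : ∀ λ' q → Content λ' q → Content (starP λ') (map invL q)
  Content-star λ' q C b i = trans (cnt-inv q b i) (trans (C (inv b) i) (cong (λ l → at l i) (sym (starP-lookup λ' b))))

  module _ {p p'} (L : Lat p) (L' : Lat p') where
    private
      n : ℕ
      n = length p

      hit : Word → Carrier
      hit α = χ (does (btab≟ (tab p') (Q (starW α))))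

      Q-star : ∀ {α} → Valid n α → Q (starW α) ≡ tab (map invL (valuePath α))
      Q-star v = trans (Q-tab (star-valid v)) (cong tab (star-position v))

      matches : ∀ {α} → Valid n α → tab p' ≡ Q (starW α) → valuePath α ≡ map invL p'
      matches {α} v e = trans (sym (invL-invL (valuePath α))) (cong (map invL) (sym (tab-inj p' (map invL (valuePath α))
          (trans (sym (tab-boxes p' L')) (trans (cong boxes (trans e (Q-star v))) (tab-boxes _ Li))) L' Li (trans e (Q-star v)))))
        where
        Li : Lat (map invL (valuePath α))
        Li = Lat-inv _ (run-lat (reverse (valueWord α)))

      content-eq : shape (tab p') ≡ starP (shape (tab p)) → p ↭ map invL p'
      content-eq e = content-↭ (shape (tab p)) p (map invL p') (shape-content p L) (subst (λ λ' → Content λ' (map invL p')) (trans (cong starP e) (starP-invol (shape (tab p)))) (Content-star (shape (tab p')) p' (shape-content p' L')))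

      shape-eq : p ↭ map invL p' → shape (tab p') ≡ starP (shape (tab p))
      shape-eq s = trans (sym (starP-invol _)) (cong starP (content-ext p (starP-part (shape-part p' L')) (shape-part p L)
        (λ b i → trans (cnt-↭ s (b , i)) (Content-star (shape (tab p')) p' (shape-content p' L') b i)) (shape-content p L)))

      -- `Q` of α prescribes its position path, `Q` of α* its value path up to the involution on
      -- colours. Two paths belong to a word exactly when their contents agree, and then to a single
      -- one.
      pairing-fibre : (d : Dec (shape (tab p') ≡ starP (shape (tab p)))) → ∑ (fibre n (tab p)) hit ≈ χ (does d)
      pairing-fibre (no ne) = ∑-zero (fibre n (tab p)) (λ {α} i → CT.χ-no (λ e →
        let vp = fibre⁻ {n} {p} {α} (refl , L) i in ne (shape-eq (subst₂ _↭_ (proj₂ vp) (matches (proj₁ vp) e) (paths-↭ (proj₁ vp))))))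
      pairing-fibre (yes e) = found (paths-exist {n} {p} {map invL p'} (refl , L) (Lat-inv p' L') (content-eq e))
        where
        found : (∃ λ α → Valid n α × positionPath α ≡ p × valuePath α ≡ map invL p') → ∑ (fibre n (tab p)) hit ≈ 1#
        found (α , v , ep , ev) = ≈-trans (∑-single hit (fibre-unique n (tab p)) (fibre⁺ {n} {p} {α} v ep) (λ {β} i ne → CT.χ-no (λ e' → ne (same β i e'))))
            (≈-trans (reflexive (cong (λ T → χ (does (btab≟ (tab p') T))) (trans (Q-star v) (cong tab (trans (cong (map invL) ev) (invL-invL p')))))) (CT.χ-yes (tab p')))
          where
          same : ∀ β → β ∈ fibre n (tab p) → tab p' ≡ Q (starW β) → β ≡ α
          same β i e' = let vp = fibre⁻ {n} {p} {β} (refl , L) i in paths-determine {α = β} {β = α} (proj₁ vp) v (trans (proj₂ vp) (sym ep)) (trans (matches (proj₁ vp) e') (sym ev))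

    pairing-tab : ∑ (fibre (boxes (tab p)) (tab p)) hit ≈ χ (does (bpart≟ (shape (tab p')) (starP (shape (tab p)))))
    pairing-tab = ≈-trans (reflexive (cong (λ k → ∑ (fibre k (tab p)) hit) (tab-boxes p L))) (pairing-fibre (bpart≟ (shape (tab p')) (starP (shape (tab p)))))

  pairing-std : ∀ T T' → IsStdBT T → IsStdBT T' →
    ∑ (fibre (boxes T) T) (λ α → χ (does (btab≟ T' (Q (starW α))))) ≈ χ (does (bpart≟ (shape T') (starP (shape T))))
  pairing-std T T' s s' = go (std-path T s) (std-path T' s')
    where
    Goal : BTab → BTab → Set ℓ
    Goal T T' = ∑ (fibre (boxes T) T) (λ α → χ (does (btab≟ T' (Q (starW α))))) ≈ χ (does (bpart≟ (shape T') (starP (shape T))))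
    go : (∃ λ p → Path (boxes T) p × tab p ≡ T) → (∃ λ p → Path (boxes T') p × tab p ≡ T') → Goal T T'
    go (p , (_ , L) , e) (p' , (_ , L') , e') = subst₂ Goal e e' (pairing-tab L L')

  pairing-sum : ∀ {A B : Set} (M : A → B → Bool) (x : Comb A) (y : Comb B) →
    sumK (concatMap (λ p → map (λ q → if M (proj₂ p) (proj₂ q) then proj₁ p * proj₁ q else 0#) y) x)
      ≈ ∑ x (λ p → proj₁ p * ∑ y (λ q → if M (proj₂ p) (proj₂ q) then proj₁ q else 0#))
  pairing-sum M x y = ≈-trans (reflexive (cong sumK (sym (map-id (concatMap row x))))) (≈-trans (∑-concatMap row x id)
    (∑-cong x (λ {p} _ → ≈-trans (reflexive (cong sumK (map-id (row p)))) (≈-trans (∑-cong y (λ {q} _ → pull (M (proj₂ p) (proj₂ q)) (proj₁ p) (proj₁ q)))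
      (≈-sym (∑-*ˡ y (proj₁ p) (λ q → if M (proj₂ p) (proj₂ q) then proj₁ q else 0#)))))))
    where
    row : Carrier × _ → List Carrier
    row p = map (λ q → if M (proj₂ p) (proj₂ q) then proj₁ p * proj₁ q else 0#) y
    pull : ∀ t k l → (if t then k * l else 0#) ≈ k * (if t then l else 0#)
    pull true k l = ≈-refl
    pull false k l = ≈-sym (zeroʳ k)

  ϖ-ext : ∀ x y → ϖ x y ≈ ext (λ α → coefF y (starW α)) x
  ϖ-ext = pairing-sum (λ α β → does (word≟ β (starW α)))

  ϖ-resp : ∀ x x' y y' → x ≈F x' → y ≈F y' → ϖ x y ≈ ϖ x' y'
  ϖ-resp x x' y y' h h' = ≈-trans (ϖ-ext x y) (≈-trans (CW.ext-resp _ x x' h) (≈-trans (∑-cong x' (λ {p} _ → *-congˡ (h' (starW (proj₂ p))))) (≈-sym (ϖ-ext x' y'))))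

  pairS-ext : ∀ p q → pairS p q ≈ ext (λ λ' → CB.coef q (starP λ')) p
  pairS-ext = pairing-sum (λ λ' μ → does (bpart≟ μ (starP λ')))

  pairS-resp : ∀ p p' q q' → (∀ μ → CB.coef p μ ≈ CB.coef p' μ) → (∀ μ → CB.coef q μ ≈ CB.coef q' μ) → pairS p q ≈ pairS p' q'
  pairS-resp p p' q q' h h' = ≈-trans (pairS-ext p q) (≈-trans (CB.ext-resp _ p p' h) (≈-trans (∑-cong p' (λ {r} _ → *-congˡ (h' (starP (proj₂ r))))) (≈-sym (pairS-ext p' q'))))

  ϖ-Θs : ∀ u v → Std u → Std v → ϖ (ι u) (ι v) ≈ pairS (Θs u) (Θs v)
  ϖ-Θs u v su sv = begin
    ϖ (ι u) (ι v) ≈⟨ ϖ-ext (ι u) (ι v) ⟩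
    ext (λ α → coefF (ι v) (starW α)) (ι u) ≈⟨ ext-ι (λ α → coefF (ι v) (starW α)) u ⟩
    ∑ u (λ p → proj₁ p * ext (λ α → coefF (ι v) (starW α)) (tT (proj₂ p))) ≈⟨ ∑-cong u (λ {p} i → *-congˡ (inner (proj₂ p) (All.lookup su i))) ⟩
    ∑ u (λ p → proj₁ p * CB.coef (Θs v) (starP (shape (proj₂ p)))) ≈⟨ ≈-sym (∑-map (λ p → (proj₁ p , shape (proj₂ p))) u (λ r → proj₁ r * CB.coef (Θs v) (starP (proj₂ r)))) ⟩
    ext (λ λ' → CB.coef (Θs v) (starP λ')) (Θs u) ≈⟨ ≈-sym (pairS-ext (Θs u) (Θs v)) ⟩
    pairS (Θs u) (Θs v) ∎
    where
    open ≈R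
    inner : ∀ T → IsStdBT T → ext (λ α → coefF (ι v) (starW α)) (tT T) ≈ CB.coef (Θs v) (starP (shape T))
    inner T s = begin
      ext (λ α → coefF (ι v) (starW α)) (tT T) ≈⟨ ext-tT (λ α → coefF (ι v) (starW α)) T ⟩
      ∑ (fibre (boxes T) T) (λ α → coefF (ι v) (starW α)) ≈⟨ ∑-cong (fibre (boxes T) T) (λ {α} i → ≈-trans (coef-ι v (star-valid (fibre-valid (boxes T) T {α} i))) (CT.coef-ext v (Q (starW α)))) ⟩
      ∑ (fibre (boxes T) T) (λ α → ∑ v (λ q → proj₁ q * χ (does (btab≟ (proj₂ q) (Q (starW α)))))) ≈⟨ ∑-swap (fibre (boxes T) T) v (λ α q → proj₁ q * χ (does (btab≟ (proj₂ q) (Q (starW α))))) ⟩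
      ∑ v (λ q → ∑ (fibre (boxes T) T) (λ α → proj₁ q * χ (does (btab≟ (proj₂ q) (Q (starW α)))))) ≈⟨ ∑-cong v (λ {q} j → ≈-trans (≈-sym (∑-*ˡ (fibre (boxes T) T) (proj₁ q) (λ α → χ (does (btab≟ (proj₂ q) (Q (starW α))))))) (*-congˡ (pairing-std T (proj₂ q) s (All.lookup sv j)))) ⟩
      ∑ v (λ q → proj₁ q * χ (does (bpart≟ (shape (proj₂ q)) (starP (shape T))))) ≈⟨ ≈-sym (∑-map (λ q → (proj₁ q , shape (proj₂ q))) v (λ r → proj₁ r * χ (does (bpart≟ (proj₂ r) (starP (shape T)))))) ⟩
      ext (λ λ' → χ (does (bpart≟ λ' (starP (shape T))))) (Θs v) ≈⟨ ≈-sym (CB.coef-ext (Θs v) (starP (shape T))) ⟩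
      CB.coef (Θs v) (starP (shape T)) ∎

  Θs-part : ∀ u → Std u → AllPartV (Θs u)
  Θs-part u s = AllP.map⁺ (All.map (λ {p} → std-part (proj₂ p)) s)

  -- The expansions `p` and `q` are arbitrary; by independence they have the same coefficients as
  -- the expansions obtained from `u` and `v`.
  ϖ-pairS : ∀ u v p q → Std u → Std v → AllPart p → AllPart q → evalS p ≈Λ Θ u → evalS q ≈Λ Θ v → ϖ (ι u) (ι v) ≈ pairS p q
  ϖ-pairS u v p q su sv Pp Pq h h' = ≈-trans (ϖ-Θs u v su sv) (pairS-resp (Θs u) p (Θs v) q
    (schur-independent (Θs u) p (Θs-part u su) (AllPart⇒ Pp) (λ a → ≈-sym (h a)))
    (schur-independent (Θs v) q (Θs-part v sv) (AllPart⇒ Pq) (λ a → ≈-sym (h' a))))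

  ϖ-cong-Θ : ∀ u v v' → Std u → Std v → Std v' → Θ v ≈Λ Θ v' → ϖ (ι u) (ι v) ≈ ϖ (ι u) (ι v')
  ϖ-cong-Θ u v v' su sv sv' h = ≈-trans (ϖ-Θs u v su sv) (≈-trans (pairS-resp (Θs u) (Θs u) (Θs v) (Θs v') (λ _ → ≈-refl) (schur-independent (Θs v) (Θs v') (Θs-part v sv) (Θs-part v' sv') h)) (≈-sym (ϖ-Θs u v' su sv')))

  kernel⇒ : ∀ u → Std u → Θ u ≈Λ 0Λ → ∀ v → Std v → ϖ (ι u) (ι v) ≈ 0#
  kernel⇒ u su h v sv = ≈-trans (ϖ-Θs u v su sv) (pairS-resp (Θs u) [] (Θs v) (Θs v) (schur-independent (Θs u) [] (Θs-part u su) [] h) (λ _ → ≈-refl))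

  kernel⇐ : ∀ u → Std u → (∀ v → Std v → ϖ (ι u) (ι v) ≈ 0#) → Θ u ≈Λ 0Λ
  kernel⇐ u su h a = CB.ext-resp (λ λ' → schurB λ' a) (Θs u) [] (λ μ → cases μ (DecMem._∈?_ bpart≟ μ (map proj₂ (Θs u))))
    where
    star-iff : ∀ λ' μ → does (bpart≟ (starP μ) (starP λ')) ≡ does (bpart≟ λ' μ)
    star-iff λ' μ = does-⇔ (mk⇔ (λ e → trans (sym (starP-invol λ')) (trans (cong starP (sym e)) (starP-invol μ))) (λ e → cong starP (sym e))) (bpart≟ (starP μ) (starP λ')) (bpart≟ λ' μ)
    coef-0 : ∀ μ → PartV μ → CB.coef (Θs u) μ ≈ 0#
    coef-0 μ P = ≈-trans (CB.coef-ext (Θs u) μ) (≈-trans (∑-cong (Θs u) (λ {r} _ → *-congˡ (≈-sym (≈-trans (+-identityʳ _) (≈-trans (if-χ (does (bpart≟ (shape (canTab (starP μ))) (starP (proj₂ r)))) 1#) (≈-trans (*-identityʳ _)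
        (reflexive (cong χ (trans (cong (λ z → does (bpart≟ z (starP (proj₂ r)))) (shape-canTab (starP-part {μ} P))) (star-iff (proj₂ r) μ))))))))))
      (≈-trans (≈-sym (pairS-ext (Θs u) (Θs v))) (≈-trans (≈-sym (ϖ-Θs u v su sv)) (h v sv))))
      where
      -- A tableau whose shape is the star of `μ`: pairing with it extracts the coefficient of the
      -- Schur function of `μ`.
      v : QRep
      v = (1# , canTab (starP μ)) ∷ []
      sv : Std v
      sv = canTab-std {starP μ} (starP-part {μ} P) ∷ []
    cases : ∀ μ → Dec (μ ∈ map proj₂ (Θs u)) → CB.coef (Θs u) μ ≈ 0#
    cases μ (yes i) = coef-0 μ (All.lookup (support-part (Θs u) (Θs-part u su)) i)
    cases μ (no ni) = CB.coef-∉ (Θs u) μ (All.tabulate (λ i e → ni (subst (_∈ map proj₂ (Θs u)) e (∈-map⁺ proj₂ i))))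

  -- Symmetry in the variables.

  Pads : ∀ {n} → Vec (List ℕ) n → Vec (List ℕ) n → Set
  Pads a a' = ∀ b → PadPerm (lookup a b) (lookup a' b)

  Sym : ΛB → Set ℓ
  Sym f = ∀ a a' → Pads a a' → f a ≈ f a'

  pad-refl : ∀ e → PadPerm e e
  pad-refl e = 0 , 0 , ↭-refl

  pad-↭ : ∀ {e e'} → e ↭ e' → PadPerm e e'
  pad-↭ s = 0 , 0 , ++⁺ʳ [] s

  pad-zeros : ∀ e k → PadPerm e (e ++ replicate k 0)
  pad-zeros e k = k , 0 , ↭-reflexive (sym (++-identityʳ _))

  pads-∷ : ∀ {n e e'} {es es' : Vec (List ℕ) n} → PadPerm e e' → Pads es es' → Pads (e V.∷ es) (e' V.∷ es')
  pads-∷ h hs zero = h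
  pads-∷ h hs (suc b) = hs b

  pads-refl : ∀ {n} (es : Vec (List ℕ) n) → Pads es es
  pads-refl es b = pad-refl (lookup es b)

  LS : List ℕ → (List ℕ → List ℕ → Carrier) → Carrier
  LS e H = ∑ (splitsL e) (λ p → H (proj₁ p) (proj₂ p))

  LS-∷ : ∀ x xs H → LS (x ∷ xs) H ≈ S x (λ i k → LS xs (λ p q → H (i ∷ p) (k ∷ q)))
  LS-∷ x xs H = ≈-trans (∑-concatMap (λ i → map (cut i) (splitsL xs)) (upTo (suc x)) G) (∑-cong (upTo (suc x)) (λ {i} _ → ∑-map (cut i) (splitsL xs) G))
    where
    cut : ℕ → List ℕ × List ℕ → List ℕ × List ℕ
    cut i p = i ∷ proj₁ p , (x ∸ i) ∷ proj₂ p
    G : List ℕ × List ℕ → Carrier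
    G r = H (proj₁ r) (proj₂ r)

  LS-cong : ∀ e {H H'} → (∀ p q → H p q ≈ H' p q) → LS e H ≈ LS e H'
  LS-cong e h = ∑-cong (splitsL e) (λ _ → h _ _)

  -- A permutation of the exponents permutes both halves of every splitting in the same way, so
  -- invariance of `H` in its two arguments is what the sum requires.
  LS-↭ : ∀ {e e'} → e ↭ e' → ∀ H → (∀ p p' q q' → p ↭ p' → q ↭ q' → H p q ≈ H p' q') → LS e H ≈ LS e' H
  LS-↭ refl H h = ≈-refl
  LS-↭ (prep {xs} {ys} x s) H h = ≈-trans (LS-∷ x xs H) (≈-trans (S-cong x (λ i k → LS-↭ s (λ p q → H (i ∷ p) (k ∷ q)) (λ p p' q q' s t → h _ _ _ _ (prep i s) (prep k t)))) (≈-sym (LS-∷ x ys H)))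
  LS-↭ (swap {xs} {ys} x y s) H h = begin
    LS (x ∷ y ∷ xs) H ≈⟨ ≈-trans (LS-∷ x (y ∷ xs) H) (S-cong x (λ i k → LS-∷ y xs (λ p q → H (i ∷ p) (k ∷ q)))) ⟩
    S x (λ i k → S y (λ j l → LS xs (λ p q → H (i ∷ j ∷ p) (k ∷ l ∷ q)))) ≈⟨ S-cong x (λ i k → S-cong y (λ j l → ≈-trans (LS-↭ s (λ p q → H (i ∷ j ∷ p) (k ∷ l ∷ q)) (λ p p' q q' s t → h _ _ _ _ (prep i (prep j s)) (prep k (prep l t))))
        (LS-cong ys (λ p q → h _ _ _ _ (swap i j ↭-refl) (swap k l ↭-refl))))) ⟩
    S x (λ i k → S y (λ j l → LS ys (λ p q → H (j ∷ i ∷ p) (l ∷ k ∷ q)))) ≈⟨ ∑-swap (upTo (suc x)) (upTo (suc y)) (λ i j → LS ys (λ p q → H (j ∷ i ∷ p) ((y ∸ j) ∷ (x ∸ i) ∷ q))) ⟩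
    S y (λ j l → S x (λ i k → LS ys (λ p q → H (j ∷ i ∷ p) (l ∷ k ∷ q)))) ≈⟨ ≈-sym (≈-trans (LS-∷ y (x ∷ ys) H) (S-cong y (λ j l → LS-∷ x ys (λ p q → H (j ∷ p) (l ∷ q))))) ⟩
    LS (y ∷ x ∷ ys) H ∎
    where open ≈R
  LS-↭ (↭-tr s t) H h = ≈-trans (LS-↭ s H h) (LS-↭ t H h)

  LS-zeros : ∀ e k H → LS (e ++ replicate k 0) H ≈ LS e (λ p q → H (p ++ replicate k 0) (q ++ replicate k 0))
  LS-zeros [] zero H = ≈-refl
  LS-zeros [] (suc k) H = ≈-trans (LS-∷ 0 (replicate k 0) H) (≈-trans (+-identityʳ _) (LS-zeros [] k (λ p q → H (0 ∷ p) (0 ∷ q))))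
  LS-zeros (x ∷ e) k H = ≈-trans (LS-∷ x (e ++ replicate k 0) H) (≈-trans (S-cong x (λ i l → LS-zeros e k (λ p q → H (i ∷ p) (l ∷ q)))) (≈-sym (LS-∷ x e (λ p q → H (p ++ replicate k 0) (q ++ replicate k 0)))))

  LS-pad : ∀ e e' → PadPerm e e' → ∀ H → (∀ p p' q q' → PadPerm p p' → PadPerm q q' → H p q ≈ H p' q') → LS e H ≈ LS e' H
  LS-pad e e' (k , k' , s) H h = ≈-trans (pad e k) (≈-trans (LS-↭ s H (λ p p' q q' s t → h p p' q q' (pad-↭ s) (pad-↭ t))) (≈-sym (pad e' k')))
    where
    pad : ∀ e k → LS e H ≈ LS (e ++ replicate k 0) H
    pad e k = ≈-trans (LS-cong e (λ p q → h p _ q _ (pad-zeros p k) (pad-zeros q k))) (≈-sym (LS-zeros e k H))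

  VS : ∀ {n} → Vec (List ℕ) n → (Vec (List ℕ) n → Vec (List ℕ) n → Carrier) → Carrier
  VS es H = ∑ (splitsV es) (λ p → H (proj₁ p) (proj₂ p))

  VS-∷ : ∀ {n} e (es : Vec (List ℕ) n) H → VS (e V.∷ es) H ≈ LS e (λ p q → VS es (λ P Q → H (p V.∷ P) (q V.∷ Q)))
  VS-∷ {n} e es H = ≈-trans (∑-concatMap (λ p → map (cut p) (splitsV es)) (splitsL e) G) (∑-cong (splitsL e) (λ {p} _ → ∑-map (cut p) (splitsV es) G))
    where
    cut : List ℕ × List ℕ → Vec (List ℕ) n × Vec (List ℕ) n → Vec (List ℕ) (suc n) × Vec (List ℕ) (suc n)
    cut p q = proj₁ p V.∷ proj₁ q , proj₂ p V.∷ proj₂ q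
    G : Vec (List ℕ) (suc n) × Vec (List ℕ) (suc n) → Carrier
    G r = H (proj₁ r) (proj₂ r)

  VS-cong : ∀ {n} (es : Vec (List ℕ) n) {H H'} → (∀ P Q → H P Q ≈ H' P Q) → VS es H ≈ VS es H'
  VS-cong es h = ∑-cong (splitsV es) (λ _ → h _ _)

  VS-pad : ∀ {n} (es es' : Vec (List ℕ) n) → Pads es es' → ∀ H → (∀ P P' Q Q' → Pads P P' → Pads Q Q' → H P Q ≈ H P' Q') → VS es H ≈ VS es' H
  VS-pad V.[] V.[] _ H h = ≈-refl
  VS-pad (e V.∷ es) (e' V.∷ es') hs H h = ≈-trans (VS-∷ e es H) (≈-trans
    (LS-pad e e' (hs zero) (λ p q → VS es (λ P Q → H (p V.∷ P) (q V.∷ Q))) (λ p p' q q' s t → VS-cong es (λ P Q → h _ _ _ _ (pads-∷ {es = P} {es' = P} s (pads-refl P)) (pads-∷ {es = Q} {es' = Q} t (pads-refl Q)))))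
    (≈-trans (LS-cong e' (λ p q → VS-pad es es' (hs ∘ suc) (λ P Q → H (p V.∷ P) (q V.∷ Q)) (λ P P' Q Q' s t → h _ _ _ _ (pads-∷ {es = P} {es' = P'} (pad-refl p) s) (pads-∷ {es = Q} {es' = Q'} (pad-refl q) t))))
      (≈-sym (VS-∷ e' es' H))))

  Sym-·Λ : ∀ f g → Sym f → Sym g → Sym (f ·Λ g)
  Sym-·Λ f g sf sg a a' h = VS-pad a a' h (λ P Q → f P * g Q) (λ P P' Q Q' s t → *-cong (sf P P' s) (sg Q Q' t))

  sum-zeros : ∀ e k → sum (e ++ replicate k 0) ≡ sum e
  sum-zeros [] zero = refl
  sum-zeros [] (suc k) = sum-zeros [] k
  sum-zeros (x ∷ e) k = cong (x ℕ.+_) (sum-zeros e k)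

  sum-pad : ∀ {e e'} → PadPerm e e' → sum e ≡ sum e'
  sum-pad {e} {e'} (k , k' , s) = trans (sym (sum-zeros e k)) (trans (sum-↭ s) (sum-zeros e' k'))

  allZero-sum : ∀ e → allZero e ≡ (sum e ≡ᵇ 0)
  allZero-sum [] = refl
  allZero-sum (zero ∷ e) = allZero-sum e
  allZero-sum (suc x ∷ e) = refl

  allZeroV-pads : ∀ {n} (es es' : Vec (List ℕ) n) → Pads es es' → allZeroV es ≡ allZeroV es'
  allZeroV-pads V.[] V.[] _ = refl
  allZeroV-pads (e V.∷ es) (e' V.∷ es') h = cong₂ _∧_ (trans (allZero-sum e) (trans (cong (_≡ᵇ 0) (sum-pad (h zero))) (sym (allZero-sum e')))) (allZeroV-pads es es' (h ∘ suc))

  Sym-1Λ : Sym 1Λ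
  Sym-1Λ a a' h = reflexive (cong (if_then 1# else 0#) (allZeroV-pads a a' h))

  Sym-hΛ : ∀ n b → Sym (hΛ n b)
  Sym-hΛ n b a a' h = reflexive (cong₂ (λ x y → if (x ≡ᵇ n) ∧ y then 1# else 0#) (sum-pad (h b)) (allZeroV-pads (a [ b ]≔ []) (a' [ b ]≔ []) cleared))
    where
    cleared : Pads (a [ b ]≔ []) (a' [ b ]≔ [])
    cleared d = go (d ≟ᶠ b)
      where
      go : Dec (d ≡ b) → PadPerm (lookup (a [ b ]≔ []) d) (lookup (a' [ b ]≔ []) d)
      go (yes refl) = subst₂ PadPerm (sym (VP.lookup∘updateAt b a)) (sym (VP.lookup∘updateAt b a')) (pad-refl [])
      go (no ne) = subst₂ PadPerm (sym (VP.lookup∘updateAt′ d b ne a)) (sym (VP.lookup∘updateAt′ d b ne a')) (h d)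

  Sym-hWord : ∀ w → Sym (hWord w)
  Sym-hWord [] = Sym-1Λ
  Sym-hWord ((n , b) ∷ w) = Sym-·Λ (hΛ (suc n) b) (hWord w) (Sym-hΛ (suc n) b) (Sym-hWord w)

  Sym-φ : ∀ p → Sym (φ p)
  Sym-φ p a a' h = ∑-cong p (λ {q} _ → *-congˡ (Sym-hWord (proj₂ q) a a' h))

  -- Schur functions in the span of products of complete functions.

  -- The generator (n , b) stands for the element of degree n + 1, hence the predecessor. Parts of a
  -- partition are positive, so nothing is lost.
  gensOf : BPart → List (ℕ × Fin m)
  gensOf μ = map (map₁ ℕ.pred) (wOf μ)

  gens-gensOf : ∀ {μ} → PartV μ → gens (gensOf μ) ≡ wOf μ
  gens-gensOf {μ} P = trans (sym (map-∘ (wOf μ))) (trans (map-cong-∈ (wOf μ) (λ {r} i → cong (_, proj₂ r) (suc-pred (All.lookup (positive id μ (λ b → proj₂ (PartV.part P b))) i)))) (map-id (wOf μ)))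
    where
    suc-pred : ∀ {n} → 1 ≤ n → suc (ℕ.pred n) ≡ n
    suc-pred (s≤s _) = refl
    positive : ∀ {k} (f : Fin k → Fin m) (es : Vec (List ℕ) k) → (∀ b → All (1 ≤_) (lookup es b)) → All (λ r → 1 ≤ proj₁ r) (wOf′ f es)
    positive f V.[] _ = []
    positive f (e V.∷ es) h = AllP.++⁺ (AllP.map⁺ (h zero)) (positive (f ∘ suc) es (h ∘ suc))

  Span : BPart → Set (c Level.⊔ ℓ)
  Span μ = ∃ λ p → φ p ≈Λ schurB μ

  φ-++ : ∀ p q a → φ (p ++ q) a ≈ φ p a + φ q a
  φ-++ p q a = ∑-++ p q (λ r → proj₁ r * hWord (proj₂ r) a)

  sumSpan : ∀ L → All (λ T → Span (shape T)) L → ∃ λ p → ∀ a → φ p a ≈ ∑ L (λ T → schurB (shape T) a)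
  sumSpan [] [] = [] , λ a → ≈-refl
  sumSpan (T ∷ L) ((p , h) ∷ hs) = let (q , k) = sumSpan L hs in p ++ q , λ a → ≈-trans (φ-++ p q a) (+-cong (h a) (k a))

  -- The iterated Pieri rule: the product of generators is a sum of distinct `tT`, and Θ sends each
  -- of them to the Schur function of its shape.
  h-expansion : ∀ w a → φ ((1# , w) ∷ []) a ≈ ∑ (tabs w) (λ T → schurB (shape T) a)
  h-expansion w a = ≈-trans (≈-sym (Θ-φ p (toQ p) (toQ-std p) (evalD-toQ p) a)) (≈-trans (Θ-∑ (toQ p) a) (≈-trans (reflexive (cong (λ u → ∑ u (λ r → proj₁ r * schurB (shape (proj₂ r)) a)) (++-identityʳ (tabRep 1# w))))
    (≈-trans (∑-map (1# ,_) (tabs w) (λ r → proj₁ r * schurB (shape (proj₂ r)) a)) (∑-cong (tabs w) (λ _ → *-identityˡ _)))))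
    where
    p : DRep
    p = (1# , w) ∷ []

  ∑-remove : ∀ {D T₀} (f : BTab → Carrier) → Unique D → T₀ ∈ D → ∑ D f ≈ f T₀ + ∑ (filter (λ T → ¬? (btab≟ T T₀)) D) f
  ∑-remove {D} {T₀} f u i = begin
    ∑ D f ≈⟨ ∑-cong D (λ {T} _ → decompose T (btab≟ T T₀)) ⟩
    ∑ D (λ T → χ (does (btab≟ T T₀)) * f T + χ (does (¬? (btab≟ T T₀))) * f T) ≈⟨ ∑-+ D (λ T → χ (does (btab≟ T T₀)) * f T) (λ T → χ (does (¬? (btab≟ T T₀))) * f T) ⟩
    ∑ D (λ T → χ (does (btab≟ T T₀)) * f T) + ∑ D (λ T → χ (does (¬? (btab≟ T T₀))) * f T) ≈⟨ +-cong
        (≈-trans (∑-single (λ T → χ (does (btab≟ T T₀)) * f T) u i (λ _ ne → ≈-trans (*-congʳ (CT.χ-no ne)) (zeroˡ _))) (≈-trans (*-congʳ (CT.χ-yes T₀)) (*-identityˡ _)))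
        (≈-sym (∑-filter (λ T → ¬? (btab≟ T T₀)) D f)) ⟩
    f T₀ + ∑ (filter (λ T → ¬? (btab≟ T T₀)) D) f ∎
    where
    open ≈R
    decompose : ∀ T (d : Dec (T ≡ T₀)) → f T ≈ χ (does d) * f T + χ (does (¬? d)) * f T
    decompose T (yes _) = ≈-sym (≈-trans (+-cong (*-identityˡ _) (zeroˡ _)) (+-identityʳ _))
    decompose T (no _) = ≈-sym (≈-trans (+-cong (zeroˡ _) (*-identityˡ _)) (+-identityˡ _))

  canTab-word : ∀ {μ} → PartV μ → ∃ λ α → Valid (length (canP μ)) α × Q α ≡ canTab μ × comp 0 (wOf μ) (positionWord α) ≡ true
  canTab-word {μ} P = go (paths-exist {length (canP μ)} {canP μ} {canP μ} (refl , canP-lat P) (canP-lat P) ↭-refl)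
    where
    go : (∃ λ α → Valid (length (canP μ)) α × positionPath α ≡ canP μ × valuePath α ≡ canP μ) → ∃ λ α → Valid (length (canP μ)) α × Q α ≡ canTab μ × comp 0 (wOf μ) (positionWord α) ≡ true
    go (α , v , e , _) = α , v , trans (Q-tab v) (cong tab e) ,
      proj₂ (comp⇔path (wOf μ) (positionWord α) (distinct-position v)) (subst (Blocks _≤ₗ_ (reverse (wOf μ))) (sym e) (can-blocks (reverse (wOf μ))))

  canTab-∈ : ∀ {μ} → PartV μ → canTab μ ∈ tabs (gensOf μ)
  canTab-∈ {μ} P = go (canTab-word P)
    where
    go : (∃ λ α → Valid (length (canP μ)) α × Q α ≡ canTab μ × comp 0 (wOf μ) (positionWord α) ≡ true) → canTab μ ∈ tabs (gensOf μ)
    go (α , v , e , h) = subst (_∈ tabs (gensOf μ)) e (tabs⁺ (gensOf μ) v (subst (λ w → comp 0 w (positionWord α) ≡ true) (sym (gens-gensOf P)) h))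

  -- A tableau of the list is given by a path with the block type of `μ`, and the row sum of the
  -- path is the `stat` of its shape. By `path-bound` only the superstandard path attains `stat μ`.
  tabs-stat : ∀ {μ T} → PartV μ → T ∈ tabs (gensOf μ) → PartV (shape T) × (T ≢ canTab μ → stat (shape T) < stat μ)
  tabs-stat {μ} {T} P i = go (tabs⁻ (gensOf μ) i)
    where
    go : (∃ λ β → Valid (wsize (gens (gensOf μ))) β × comp 0 (gens (gensOf μ)) (positionWord β) ≡ true × T ≡ Q β) → PartV (shape T) × (T ≢ canTab μ → stat (shape T) < stat μ)
    go (β , v , h , e) = subst (PartV ∘ shape) (sym T≡) (shape-part q L) ,
        λ ne → ℕP.≤∧≢⇒< (subst (_≤ stat μ) rs≡ (proj₁ (proj₂ pb))) (λ s≡ → ne (trans T≡ (cong tab (proj₂ (proj₂ pb) (trans rs≡ s≡)))))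
      where
      q : List Cell
      q = positionPath β
      L : Lat q
      L = positionPath-lat v
      T≡ : T ≡ tab q
      T≡ = trans e (Q-tab v)
      B : Blocks _≤ₗ_ (reverse (wOf μ)) q
      B = proj₁ (comp⇔path (wOf μ) (positionWord β) (distinct-position v)) (subst (λ w → comp 0 w (positionWord β) ≡ true) (gens-gensOf P) h)
      pb = path-bound (reverse (wOf μ)) q B L
      rs≡ : rowsum q ≡ stat (shape T)
      rs≡ = trans (rowsum-content (shape (tab q)) q (shape-content q L)) (cong (stat ∘ shape) (sym T≡))

  -- h_μ = s_μ + terms of smaller stat.
  span : ∀ s μ → PartV μ → stat μ < s → Span μ
  span (suc s) μ P (s≤s le) = ((1# , gensOf μ) ∷ []) ++ ((- 1#) •D proj₁ rest′) , λ a → begin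
      φ (((1# , gensOf μ) ∷ []) ++ ((- 1#) •D proj₁ rest′)) a ≈⟨ φ-++ ((1# , gensOf μ) ∷ []) ((- 1#) •D proj₁ rest′) a ⟩
      φ ((1# , gensOf μ) ∷ []) a + φ ((- 1#) •D proj₁ rest′) a ≈⟨ +-cong (≈-trans (h-expansion (gensOf μ) a) (∑-remove (λ T → schurB (shape T) a) (tabs-unique (gensOf μ)) (canTab-∈ P))) (≈-trans (φ-• (- 1#) (proj₁ rest′) a) (*-congˡ (proj₂ rest′ a))) ⟩
      (schurB (shape (canTab μ)) a + R a) + (- 1#) * R a ≈⟨ ≈-trans (+-assoc _ _ _) (+-congˡ (≈-trans (+-congʳ (≈-sym (*-identityˡ _))) (≈-trans (≈-sym (distribʳ _ _ _)) (≈-trans (*-congʳ (-‿inverseʳ 1#)) (zeroˡ _))))) ⟩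
      schurB (shape (canTab μ)) a + 0# ≈⟨ +-identityʳ _ ⟩
      schurB (shape (canTab μ)) a ≡⟨ cong (λ λ' → schurB λ' a) (shape-canTab P) ⟩
      schurB μ a ∎
    where
    open ≈R
    other? : ∀ T → Dec (T ≢ canTab μ)
    other? T = ¬? (btab≟ T (canTab μ))
    D' : List BTab
    D' = filter other? (tabs (gensOf μ))
    R : BMon → Carrier
    R a = ∑ D' (λ T → schurB (shape T) a)
    spans : All (λ T → Span (shape T)) D'
    spans = All.tabulate (λ {T} i → let j = ∈-filter⁻ other? {v = T} {xs = tabs (gensOf μ)} i ; st = tabs-stat P (proj₁ j) in
      span s (shape T) (proj₁ st) (ℕP.<-≤-trans (proj₂ st (proj₂ j)) le))
    rest′ : ∃ λ p → ∀ a → φ p a ≈ R a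
    rest′ = sumSpan D' spans

  -- Symmetry is inherited from the products of complete functions, in whose span the Schur function
  -- lies.
  Sym-schurB : ∀ {μ} → PartV μ → Sym (schurB μ)
  Sym-schurB {μ} P a a' h = let (p , e) = span (suc (stat μ)) μ P ℕP.≤-refl in ≈-trans (≈-sym (e a)) (≈-trans (Sym-φ p a a' h) (e a'))

  schurB-degree : ∀ T → IsStdBT T → ∀ a → totdeg a ≢ boxes T → schurB (shape T) a ≈ 0#
  schurB-degree T s a ne = ≈-trans (schurB-kostkaB (shape T) (wOf a) a (wOf-has a)) (≈-trans (≈-sym (Φ-std T s (wOf a))) (Φ-degree T (wOf a) (λ e → ne (trans (sym (wsize-wOf a)) e))))

  ∈⇒≤sum : ∀ {k} {X : Set k} (f : X → ℕ) {x xs} → x ∈ xs → f x ≤ sum (map f xs)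
  ∈⇒≤sum f {xs = x ∷ xs} (here refl) = ℕP.m≤m+n (f x) _
  ∈⇒≤sum f {xs = y ∷ xs} (there i) = ℕP.≤-trans (∈⇒≤sum f i) (ℕP.m≤n+m _ (f y))

  Θ-symmetric : ∀ u → Std u → IsΛB (Θ u)
  Θ-symmetric u s = (λ a a' h → ≈-trans (Θ-∑ u a) (≈-trans (∑-cong u (λ {p} i → *-congˡ (Sym-schurB (std-part (proj₂ p) (All.lookup s i)) a a' h))) (≈-sym (Θ-∑ u a')))) ,
    sum (map (boxes ∘ proj₂) u) , λ a lt → ≈-trans (Θ-∑ u a) (∑-zero u (λ {p} i → ≈-trans (*-congˡ (schurB-degree (proj₂ p) (All.lookup s i) a
      (λ e → ℕP.<-irrefl refl (ℕP.<-≤-trans lt (subst (_≤ _) (sym e) (∈⇒≤sum (boxes ∘ proj₂) i)))))) (zeroʳ _)))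

  -- Schur functions span Λ(B); surjectivity.

  insertPart : ∀ x l → AllPairs _≥_ l → ∃ λ l' → AllPairs _≥_ l' × l' ↭ x ∷ l
  insertPart x [] _ = x ∷ [] , [] ∷ [] , ↭-refl
  insertPart x (y ∷ l) (a ∷ s) with y ℕP.≤? x
  ... | yes le = x ∷ y ∷ l , (le ∷ All.map (λ q → ℕP.≤-trans q le) a) ∷ a ∷ s , ↭-refl
  ... | no nle = let (l' , s' , p) = insertPart x l s in y ∷ l' , Perm.All-resp-↭ (↭-sym p) (ℕP.<⇒≤ (ℕP.≰⇒> nle) ∷ a) ∷ s' , ↭-trans (prep y p) (swap y x ↭-refl)

  sortPart : ∀ e → ∃ λ l → AllPairs _≥_ l × All (1 ≤_) l × PadPerm e l
  sortPart [] = [] , [] , [] , pad-refl []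
  sortPart (zero ∷ e) = let (l , s , p , (k , k' , t)) = sortPart e in l , s , p , k , suc k' , ↭-trans (prep 0 t) (↭-sym (shift 0 l (replicate k' 0)))
  sortPart (suc x ∷ e) = let (l , s , p , (k , k' , t)) = sortPart e ; (l' , s' , q) = insertPart (suc x) l s in
    l' , s' , Perm.All-resp-↭ (↭-sym q) (s≤s z≤n ∷ p) , k , k' , ↭-trans (prep (suc x) t) (++⁺ʳ (replicate k' 0) (↭-sym q))

  normal : BMon → BPart
  normal a = V.tabulate (λ b → proj₁ (sortPart (lookup a b)))

  normal-part : ∀ a → PartV (normal a)
  normal-part a = partV λ b → subst IsPartition (sym (VP.lookup∘tabulate _ b)) (let (l , s , p , _) = sortPart (lookup a b) in AllPairs⇒Linked s , p)

  normal-pads : ∀ a → Pads a (normal a)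
  normal-pads a b = subst (PadPerm (lookup a b)) (sym (VP.lookup∘tabulate _ b)) (proj₂ (proj₂ (proj₂ (sortPart (lookup a b)))))

  -- All B-partitions of size at most `D`, obtained as shapes of the tableaux of all words of these
  -- lengths; none is missed, as `canTab-word` provides a word for each.
  parts : ℕ → List BPart
  parts D = deduplicate bpart≟ (concatMap (λ N → map (shape ∘ Q) (allBasis N)) (upTo (suc D)))

  parts⁺ : ∀ {D μ} → PartV μ → totdeg μ ≤ D → μ ∈ parts D
  parts⁺ {D} {μ} P le = go (canTab-word P)
    where
    go : (∃ λ α → Valid (length (canP μ)) α × Q α ≡ canTab μ × comp 0 (wOf μ) (positionWord α) ≡ true) → μ ∈ parts D
    go (α , v , e , h) = ∈-deduplicate⁺ bpart≟ (∈-concatMap-join (λ N → map (shape ∘ Q) (allBasis N)) (∈-upTo⁺ (s≤s (ℕP.≤-trans (ℕP.≤-reflexive (trans (comp-size (wOf μ) v h) (wsize-wOf μ))) le)))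
      (subst (_∈ map (shape ∘ Q) (allBasis (length (canP μ)))) (trans (cong shape e) (shape-canTab P)) (∈-map⁺ (shape ∘ Q) {x = α} (allBasis⁺ v))))

  parts⁻ : ∀ {D μ} → μ ∈ parts D → PartV μ × (∀ a → D < totdeg a → schurB μ a ≈ 0#)
  parts⁻ {D} {μ} i = go (∈-concatMap-split (λ N → map (shape ∘ Q) (allBasis N)) (upTo (suc D)) (∈-deduplicate⁻ bpart≟ _ i))
    where
    go : (∃ λ N → N ∈ upTo (suc D) × μ ∈ map (shape ∘ Q) (allBasis N)) → PartV μ × (∀ a → D < totdeg a → schurB μ a ≈ 0#)
    go (N , j , k) = go′ (∈-map⁻ (shape ∘ Q) k)
      where
      go′ : (∃ λ α → α ∈ allBasis N × μ ≡ shape (Q α)) → PartV μ × (∀ a → D < totdeg a → schurB μ a ≈ 0#)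
      go′ (α , l , e) = subst PartV (sym e) (std-part (Q α) (Q-std v)) , λ a lt → subst (λ μ → schurB μ a ≈ 0#) (sym e)
          (schurB-degree (Q α) (Q-std v) a (λ q → ℕP.<-irrefl refl (ℕP.<-≤-trans lt (ℕP.≤-trans (ℕP.≤-reflexive (trans q (boxes-Q v))) (ℕP.≤-pred (∈-upTo⁻ j))))))
        where
        v : Valid N α
        v = allBasis⁻ N l

  evalS-++ : ∀ p q a → evalS (p ++ q) a ≈ evalS p a + evalS q a
  evalS-++ p q a = ∑-++ p q (λ r → proj₁ r * schurB (proj₂ r) a)

  module _ (D K : ℕ) (K-bound : ∀ {μ} → μ ∈ parts D → stat μ < K) where

    -- The coefficients of f are eliminated in increasing order of stat.
    expand : ∀ k f → Sym f → (∀ a → D < totdeg a → f a ≈ 0#) → (∀ μ → PartV μ → stat μ < K ∸ k → f μ ≈ 0#) → ∃ λ p → AllPartV p × evalS p ≈Λ f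
    -- Every exponent vector can be sorted and freed of zeros, so by symmetry the values at
    -- partitions decide; there `f` vanishes, by `vf` up to degree `D` and by `bf` beyond.
    expand zero f sf bf vf = [] , [] , λ a → ≈-sym (≈-trans (sf a (normal a) (normal-pads a)) (vanish (normal a) (normal-part a) (totdeg (normal a) ℕP.≤? D)))
      where
      vanish : ∀ μ → PartV μ → Dec (totdeg μ ≤ D) → f μ ≈ 0#
      vanish μ P (yes le) = vf μ P (K-bound (parts⁺ P le))
      vanish μ P (no nle) = bf μ (ℕP.≰⇒> nle)
    expand (suc k) f sf bf vf = let (p , Pp , e) = expand k g sg bg vg in
        p ++ map (λ μ → (f μ , μ)) L , AllP.++⁺ Pp (AllP.map⁺ (All.tabulate (λ i → proj₁ (parts⁻ {D} (proj₁ (L⁻ i)))))) ,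
        λ a → ≈-trans (evalS-++ p (map (λ μ → (f μ , μ)) L) a) (≈-trans (+-cong (e a) (∑-map (λ μ → (f μ , μ)) L (λ r → proj₁ r * schurB (proj₂ r) a)))
          (≈-trans (+-assoc _ _ _) (≈-trans (+-congˡ (-‿inverseˡ _)) (+-identityʳ _))))
      where
      s : ℕ
      s = K ∸ suc k
      level? : ∀ μ → Dec (stat μ ≡ s)
      level? μ = stat μ ℕP.≟ s
      L : List BPart
      L = filter level? (parts D)
      L⁻ : ∀ {μ} → μ ∈ L → μ ∈ parts D × stat μ ≡ s
      L⁻ i = ∈-filter⁻ level? {xs = parts D} i
      R : ΛB
      R a = ∑ L (λ μ → f μ * schurB μ a)
      g : ΛB
      g a = f a + - R a
      -‿cong′ : ∀ {x y} → x ≈ y → - x ≈ - y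
      -‿cong′ = CommutativeRing.-‿cong 𝕂
      sg : Sym g
      sg a a' h = +-cong (sf a a' h) (-‿cong′ (∑-cong L (λ i → *-congˡ (Sym-schurB (proj₁ (parts⁻ {D} (proj₁ (L⁻ i)))) a a' h))))
      bg : ∀ a → D < totdeg a → g a ≈ 0#
      bg a lt = ≈-trans (+-cong (bf a lt) (-‿cong′ (∑-zero L (λ i → ≈-trans (*-congˡ (proj₂ (parts⁻ {D} (proj₁ (L⁻ i))) a lt)) (zeroʳ _))))) (-‿inverseʳ 0#)
      uL : Unique L
      uL = Uniq.filter⁺ level? (UniqD.deduplicate-! bpart≟ (concatMap (λ N → map (shape ∘ Q) (allBasis N)) (upTo (suc D))))
      vg : ∀ ν → PartV ν → stat ν < K ∸ k → g ν ≈ 0#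
      vg ν P lt = cases (totdeg ν ℕP.≤? D) (stat ν ℕP.≟ s)
        where
        le : stat ν ≤ s
        le = ℕP.≤-pred (ℕP.≤-trans lt (step K k))
          where
          step : ∀ K k → K ∸ k ≤ suc (K ∸ suc k)
          step zero k = ℕP.≤-trans (ℕP.≤-reflexive (ℕP.0∸n≡0 k)) z≤n
          step (suc K) zero = ℕP.≤-refl
          step (suc K) (suc k) = step K k
        off : ∀ {μ} → μ ∈ L → μ ≢ ν → f μ * schurB μ ν ≈ 0#
        off i ne = ≈-trans (*-congˡ (schurB-≢ (proj₁ (parts⁻ {D} (proj₁ (L⁻ i)))) P ne (ℕP.≤-trans le (ℕP.≤-reflexive (sym (proj₂ (L⁻ i))))))) (zeroʳ _)
        cases : Dec (totdeg ν ≤ D) → Dec (stat ν ≡ s) → g ν ≈ 0#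
        cases (no nle) _ = bg ν (ℕP.≰⇒> nle)
        -- At `ν` the other Schur functions of this level vanish and that of `ν` takes the value 1,
        -- so `R` has the value `f ν` there.
        cases (yes q) (yes e) = ≈-trans (+-congˡ (-‿cong′ (≈-trans (∑-single (λ μ → f μ * schurB μ ν) uL (∈-filter⁺ level? (parts⁺ P q) e) off) (≈-trans (*-congˡ (schurB-≡ P)) (*-identityʳ _))))) (-‿inverseʳ (f ν))
        cases (yes q) (no ne) = ≈-trans (+-cong (vf ν P (ℕP.≤∧≢⇒< le ne)) (-‿cong′ (∑-zero L (λ i → off i (λ { refl → ne (proj₂ (L⁻ i)) }))))) (-‿inverseʳ 0#)

  schur-spanning : ∀ f → IsΛB f → ∃ λ p → AllPartV p × evalS p ≈Λ f
  schur-spanning f (sf , D , bf) = expand D K (λ i → s≤s (∈⇒≤sum stat i)) K f sf bf (λ μ _ lt → ⊥-elim (ℕP.n≮0 (subst (stat μ <_) (ℕP.n∸n≡0 K) lt)))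
    where
    K : ℕ
    -- Larger than the `stat` of every listed partition, since a sum bounds its terms. The
    -- elimination starts at `K ∸ K`, where the vanishing hypothesis is empty.
    K = suc (sum (map stat (parts D)))

  canRep : SRep → QRep
  canRep = map (map₂ canTab)

  canRep-std : ∀ p → AllPartV p → Std (canRep p)
  canRep-std p P = AllP.map⁺ (All.map canTab-std P)

  Θ-canRep : ∀ p → AllPartV p → Θ (canRep p) ≈Λ evalS p
  Θ-canRep p P a = ≈-trans (Θ-∑ (canRep p) a) (≈-trans (∑-map (map₂ canTab) p (λ r → proj₁ r * schurB (shape (proj₂ r)) a)) (∑-cong p (λ i → *-congˡ (reflexive (cong (λ λ' → schurB λ' a) (shape-canTab (All.lookup P i)))))))

  Θ-surjective : ∀ f → IsΛB f → ∃ λ u → Std u × Θ u ≈Λ f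
  Θ-surjective f h = let (p , P , e) = schur-spanning f h in canRep p , canRep-std p P , λ a → ≈-trans (Θ-canRep p P a) (e a)

  -- The restriction to 𝒟(B).

  φ-schur : ∀ p → AllPartV p → ∃ λ d → φ d ≈Λ evalS p
  φ-schur [] [] = [] , λ a → ≈-refl
  φ-schur ((k , μ) ∷ p) (P ∷ Ps) = let (d , e) = span (suc (stat μ)) μ P ℕP.≤-refl ; (d' , e') = φ-schur p Ps in
    (k •D d) ++ d' , λ a → ≈-trans (φ-++ (k •D d) d' a) (+-cong (≈-trans (φ-• k d a) (*-congˡ (e a))) (e' a))

  φ-surjective : ∀ f → IsΛB f → ∃ λ p → φ p ≈Λ f
  φ-surjective f h = let (p , P , e) = schur-spanning f h ; (d , e') = φ-schur p P in d , λ a → ≈-trans (e' a) (e a)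

  Θ-toQ : ∀ p → Θ (toQ p) ≈Λ φ p
  Θ-toQ p = Θ-φ p (toQ p) (toQ-std p) (evalD-toQ p)

  ϖ-toQ : ∀ p q → ϖ (evalD p) (evalD q) ≈ ϖ (ι (toQ p)) (ι (toQ q))
  ϖ-toQ p q = ϖ-resp (evalD p) (ι (toQ p)) (evalD q) (ι (toQ q)) (evalD-toQ p) (evalD-toQ q)

  φ-kernel⇒ : ∀ p → φ p ≈Λ 0Λ → ∀ q → ϖ (evalD p) (evalD q) ≈ 0#
  φ-kernel⇒ p h q = ≈-trans (ϖ-toQ p q) (kernel⇒ (toQ p) (toQ-std p) (λ a → ≈-trans (Θ-toQ p a) (h a)) (toQ q) (toQ-std q))

  -- Orthogonality is given against 𝒟(B) only. On 𝒬(B) the pairing depends on its second argument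
  -- through the image under Θ, and φ reaches every such image, so a test element of 𝒬(B) can be
  -- traded for one of 𝒟(B).
  φ-kernel⇐ : ∀ p → (∀ q → ϖ (evalD p) (evalD q) ≈ 0#) → φ p ≈Λ 0Λ
  φ-kernel⇐ p h a = ≈-trans (≈-sym (Θ-toQ p a)) (kernel⇐ (toQ p) (toQ-std p) orthogonal a)
    where
    orthogonal : ∀ v → Std v → ϖ (ι (toQ p)) (ι v) ≈ 0#
    orthogonal v sv = let (q , e) = φ-surjective (Θ v) (Θ-symmetric v sv) in
      ≈-trans (ϖ-cong-Θ (toQ p) v (toQ q) (toQ-std p) sv (toQ-std q) (λ a → ≈-sym (≈-trans (Θ-toQ q a) (e a)))) (≈-trans (≈-sym (ϖ-toQ p q)) (h q))

theorem5p9 : ∀ {c ℓ} (𝕂 : CommutativeRing c ℓ) (m : ℕ) (inv : Fin m → Fin m)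
  → (∀ b → inv (inv b) ≡ b)
  → let open CommutativeRing 𝕂
        open Setup 𝕂 m inv
    in
    -- Θ_B is well defined on 𝒬(B) and takes values in Λ(B)
    (∀ u v → Std u → Std v → ι u ≈F ι v → Θ u ≈Λ Θ v)
    × (∀ u → Std u → IsΛB (Θ u))
    -- Θ_B is graded
    × (∀ u n → Std u → All (λ p → boxes (proj₂ p) ≡ n) u → ∀ a → totdeg a ≢ n → Θ u a ≈ 0#)
    -- Θ_B is an algebra morphism
    × (∀ u v w → Std u → Std v → Std w → ι w ≈F (ι u *F ι v) → Θ w ≈Λ (Θ u ·Λ Θ v))
    × (∀ u → Std u → ι u ≈F oneF → Θ u ≈Λ 1Λ)
    -- Θ_B is a coalgebra morphism
    × (∀ u r → Std u → Std2 r → ΔF (ι u) ≈F2 ι2 r → ΔΛ (Θ u) ≈Λ2 Θ2 r)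
    × (∀ u → Std u → εΛ (Θ u) ≈ εF (ι u))
    -- Θ_B is surjective
    × (∀ f → IsΛB f → ∃ λ u → Std u × Θ u ≈Λ f)
    -- ker Θ_B = 𝒬(B) ∩ 𝒬(B)°
    × (∀ u → Std u → (Θ u ≈Λ 0Λ → ∀ v → Std v → ϖ (ι u) (ι v) ≈ 0#)
                    × ((∀ v → Std v → ϖ (ι u) (ι v) ≈ 0#) → Θ u ≈Λ 0Λ))
    -- ϖ_tot(x, y) = ⟨Θ_B x, Θ_B y⟩
    × (∀ u v p q → Std u → Std v → AllPart p → AllPart q
         → evalS p ≈Λ Θ u → evalS q ≈Λ Θ v → ϖ (ι u) (ι v) ≈ pairS p q)
    -- 𝒟(B) ⊆ 𝒬(B), and Θ_B restricted to 𝒟(B) is φ : y_{n,b} ↦ h_n(b)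
    × (∀ p → ∃ λ u → Std u × evalD p ≈F ι u)
    × (∀ p u → Std u → evalD p ≈F ι u → Θ u ≈Λ φ p)
    -- φ is an algebra homomorphism 𝒟(B) → Λ(B) with y_{n,b} ↦ h_n(b), and the unique one
    × IsAlgHomD φ
    × (∀ ψ → IsAlgHomD ψ → ∀ p → ψ p ≈Λ φ p)
    -- the restriction is surjective, with kernel 𝒟(B) ∩ 𝒟(B)°
    × (∀ f → IsΛB f → ∃ λ p → φ p ≈Λ f)
    × (∀ p → (φ p ≈Λ 0Λ → ∀ q → ϖ (evalD p) (evalD q) ≈ 0#)
             × ((∀ q → ϖ (evalD p) (evalD q) ≈ 0#) → φ p ≈Λ 0Λ))
theorem5p9 𝕂 m inv inv-inv =
    Θ-well-defined , Θ-symmetric , Θ-graded , Θ-multiplicative , Θ-unit , Θ-comultiplicative , Θ-counit , Θ-surjective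
  , (λ u su → kernel⇒ u su , kernel⇐ u su)
  , ϖ-pairS
  , (λ p → toQ p , toQ-std p , evalD-toQ p)
  , Θ-φ , φ-hom , φ-unique , φ-surjective
  , (λ p → φ-kernel⇒ p , φ-kernel⇐ p)
  where open CharacterMap 𝕂 m inv inv-inv
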